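{- Let $0\le k\le n$ and $f\in\operatorname{Bound}(k,n)$. For a vertex $g$ of the bounded affine Lascoux–Schützenberger tree of $f$, let $\pi_g$ be the unique path from the root to $g$ and $\operatorname{sgn}(\pi_g)$ the product of its edge labels ($\pm1$). Then in $\Lambda^{n-k}(k)$, \[ G_f=\sum_{g}\operatorname{sgn}(\pi_g)\,\overline{s}_{\lambda(g)}, \] where $g$ runs over the leaves of the tree (counted as vertices, possibly with repeated labels).
   Context: Affine permutations $\widetilde S_n$: bijections $f:\mathbb{Z}\to\mathbb{Z}$ with $f(i+n)=f(i)+n$. $\tau(i)=i+1$; $s_i$ swaps $i+pn,i+1+pn$ for all $p$; $\widetilde S_n^0=\langle s_0,\dots,s_{n-1}\rangle$; $f=\tau^{\operatorname{av}(f)}g$ uniquely with $g\in\widetilde S^0_n$. $\ell(f)=\#\{(i,j):1\le i\le n,\ i<j,\ f(i)>f(j)\}$. For $i<j$ with $i\not\equiv j\pmod n$, $t_{ij}$ swaps $i+pn$ and $j+pn$ for all $p$. Bruhat cover: $f\lessdot ft_{ij}$ iff $\ell(ft_{ij})=\ell(f)+1$. $\operatorname{Bound}(k,n)$: $f$ with $i\le f(i)\le i+n$ for all $i$ and exactly $k$ of $f(1),\dots,f(n)$ exceeding $n$. For $r\in\mathbb{Z}$: $\Phi^+(f,r)=\{ft_{rj}: r<j,\ f\lessdot ft_{rj}\}$, $\Phi^-(f,r)=\{ft_{ir}: i<r,\ f\lessdot ft_{ir}\}$, and $B\Phi^\pm(f,r)=\Phi^\pm(f,r)\cap\operatorname{Bound}(k,n)$.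 The maximal inversion of $g\in\operatorname{Bound}(k,n)$ is the lexicographically largest $(r,s)$ with $1\le r<s\le n$ and $g(r)>g(s)$; if none exists $g$ is $0$-Grassmannian. The bounded affine L-S tree of $f$ is the rooted tree with vertices labeled by elements of $\operatorname{Bound}(k,n)$ and edges labeled $+$ or $-$: the root is $f$; a $0$-Grassmannian vertex $g$ has no children; otherwise, with $(r,s)$ the maximal inversion of $g$, $g$ has as children the elements of $B\Phi^-(gt_{rs},r)$ (edges labeled $+$) and of $B\Phi^+(gt_{rs},r)\setminus\{g\}$ (edges labeled $-$). For $0$-Grassmannian $g\in\operatorname{Bound}(k,n)$, $w=g\tau^{ -k}$ restricts to a permutation of $[n]$, and $\lambda(g)$ is the partition obtained by sorting $(c_1(w),\dots,c_n(w))$ decreasingly, where $c_i(w)=\#\{i'>i: w(i)>w(i')\}$. Symmetric functions: a sequence $i_1,\dots,i_m$ in $\mathbb{Z}/n\mathbb{Z}$ is cyclically decreasing if entries are distinct and whenever $j,j+1$ both appear, $j+1$ comes first; $g\in\widetilde S^0_n$ is cyclically decreasing if it is the product $s_{i_1}\cdots s_{i_m}$ of such a sequence. $\widetilde F_f=\sum x_1^{\ell(f_1)}x_2^{\ell(f_2)}\cdots$ over factorizations $\tau^{ -\operatorname{av}(f)}f=f_1f_2\cdots$ with $\sum\ell(f_i)=\ell(f)$ and each $f_i$ cyclically decreasing. $\Lambda^{n-k}(k)$ is $\mathbb{Z}[x_1,\dots,x_k]^{S_k}$ modulo the ideal generated by $h_d(x_1,\dots,x_k)$, $d>n-k$; $\overline{F}$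 denotes the image of $F(x_1,\dots,x_k)$; $G_f=\overline{\widetilde F_f}$; $\overline{s}_\lambda$ is the image of the Schur polynomial. -}

module Defs where

open import Data.Nat as ℕ using (ℕ; zero; suc; NonZero)
import Data.Nat.Properties as ℕP
open import Data.Nat.DivMod using (_%_; m%n<n)
open import Data.Integer as ℤ using (ℤ; +_; _◃_; 0ℤ; 1ℤ)
open import Data.Integer.DivMod using (_/ℕ_; _%ℕ_; n%ℕd<d)
open import Data.Fin as Fin using (Fin; toℕ; fromℕ<)
import Data.Fin.Properties as FinP
open import Data.Fin.Permutation using (Permutation′; _⟨$⟩ʳ_)
open import Data.Vec as Vec using (Vec; lookup; tabulate; toList)
import Data.Vec.Properties as VecP
open import Data.List as List using (List; []; _∷_; [_]; length; filter; map; concat; concatMap; zipWith; upTo; allFin; foldr)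
open import Data.List.Membership.Propositional using (_∈_)
open import Data.List.Relation.Unary.Unique.Propositional using (Unique)
open import Data.List.Relation.Unary.Linked using (Linked)
open import Data.List.Relation.Binary.Pointwise using (Pointwise)
open import Data.Maybe using (Maybe; just; nothing; _>>=_)
open import Data.Sign as Sign using (Sign)
open import Data.Product using (Σ; _×_; _,_; proj₁; proj₂)
open import Data.Sum using (_⊎_)
open import Function.Definitions using (Bijective)
open import Relation.Nullary using (¬_; yes; no)
open import Relation.Nullary.Decidable using (_×-dec_)
open import Relation.Binary.PropositionalEquality using (_≡_)

HasCard : {A : Set} → (A → Set) → ℕ → Set
HasCard {A} P m =
  Σ (List A) λ xs → Unique xs × (∀ x → (x ∈ xs → P x) × (P x → x ∈ xs)) × length xs ≡ m

-- Affine permutations, represented by their window [f(1),…,f(n)].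
-- Periodicity f(i+n) = f(i)+n is built into `eval`.

module _ (n : ℕ) {{nz : NonZero n}} where

  Perm : Set
  Perm = Vec ℤ n

  pos : Fin n → ℤ
  pos j = + suc (toℕ j)

  -- f(x) for x ∈ ℤ : write x - 1 = q n + r with 0 ≤ r < n, then f(x) = f(r+1) + q n
  eval : Perm → ℤ → ℤ
  eval w x = lookup w (fromℕ< (n%ℕd<d (x ℤ.- 1ℤ) n)) ℤ.+ ((x ℤ.- 1ℤ) /ℕ n) ℤ.* + n

  fromFun : (ℤ → ℤ) → Perm
  fromFun F = tabulate (λ j → F (pos j))

  IsAffPerm : Perm → Set
  IsAffPerm w = Bijective _≡_ _≡_ (eval w)

  idP : Perm
  idP = fromFun (λ x → x)

  compose : Perm → Perm → Perm
  compose f g = fromFun (λ x → eval f (eval g x))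

  -- the map t_{ij} : ℤ → ℤ swapping i+pn and j+pn (identity if i ≡ j mod n)
  tr : ℤ → ℤ → ℤ → ℤ
  tr i j x with i %ℕ n ℕ.≟ j %ℕ n
  ... | yes _ = x
  ... | no _ with x %ℕ n ℕ.≟ i %ℕ n
  ...   | yes _ = x ℤ.- i ℤ.+ j
  ...   | no _ with x %ℕ n ℕ.≟ j %ℕ n
  ...     | yes _ = x ℤ.- j ℤ.+ i
  ...     | no _ = x

  mulT : Perm → ℤ → ℤ → Perm
  mulT f i j = fromFun (λ x → eval f (tr i j x))

  sgen : Fin n → Perm
  sgen i = fromFun (tr (+ toℕ i) (+ toℕ i ℤ.+ 1ℤ))

  wordProd : List (Fin n) → Perm
  wordProd = foldr (λ i p → compose (sgen i) p) idP

  shift : ℤ → Perm → Perm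
  shift a f = Vec.map (λ v → v ℤ.- a) f

  InS0 : Perm → Set
  InS0 g = Σ (List (Fin n)) λ w → wordProd w ≡ g

  -- av(f) = a  iff  τ^{-a} f ∈ S̃⁰ₙ   (f = τ^a g with g ∈ S̃⁰ₙ)
  IsAv : Perm → ℤ → Set
  IsAv f a = InS0 (shift a f)

  InvPair : Perm → ℤ × ℤ → Set
  InvPair f (i , j) = 1ℤ ℤ.≤ i × i ℤ.≤ + n × i ℤ.< j × eval f j ℤ.< eval f i

  Len : Perm → ℕ → Set
  Len f m = HasCard (InvPair f) m

  -- Bruhat cover f ⋖ g  (used with g = f t_{ij}):  ℓ(g) = ℓ(f) + 1
  Cover : Perm → Perm → Set
  Cover f g = Σ ℕ λ m → Len f m × Len g (suc m)

  IsBound : ℕ → Perm → Set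
  IsBound k f = IsAffPerm f
              × (∀ x → x ℤ.≤ eval f x × eval f x ℤ.≤ x ℤ.+ + n)
              × length (filter (λ j → + n ℤ.<? lookup f j) (allFin n)) ≡ k

  Inv1 : Perm → ℤ → ℤ → Set
  Inv1 g r s = 1ℤ ℤ.≤ r × r ℤ.< s × s ℤ.≤ + n × eval g s ℤ.< eval g r

  ZeroGrass : Perm → Set
  ZeroGrass g = ∀ r s → ¬ Inv1 g r s

  MaxInv : Perm → ℤ → ℤ → Set
  MaxInv g r s = Inv1 g r s × (∀ r' s' → Inv1 g r' s' → r' ℤ.< r ⊎ (r' ≡ r × s' ℤ.≤ s))

  -- children of g (maximal inversion (r,s)), with their edge labels
  -- +  : elements of BΦ⁻(g t_{rs}, r);   - : elements of BΦ⁺(g t_{rs}, r) ∖ {g}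
  Child : ℕ → Perm → ℤ → ℤ → Sign → Perm → Set
  Child k g r s Sign.+ c =
    IsBound k c × Σ ℤ λ i → i ℤ.< r × ¬ (i %ℕ n ≡ r %ℕ n)
                × c ≡ mulT (mulT g r s) i r × Cover (mulT g r s) c
  Child k g r s Sign.- c =
    IsBound k c × Σ ℤ λ j → r ℤ.< j × ¬ (r %ℕ n ≡ j %ℕ n)
                × c ≡ mulT (mulT g r s) r j × Cover (mulT g r s) c × ¬ (c ≡ g)

  -- signed leaves below a vertex g with listed children cs and their signed leaf lists;
  -- a vertex with no children is itself a leaf
  nodeLeaves : Perm → List (Sign × Perm) → List (List (Sign × Perm)) → List (Sign × Perm)
  nodeLeaves g [] _ = [ (Sign.+ , g) ]
  nodeLeaves g (c ∷ cs) ls =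
    concat (zipWith (λ sc L → map (λ th → (proj₁ sc Sign.* proj₁ th , proj₂ th)) L) (c ∷ cs) ls)

  -- LSTree k g L : the bounded affine L-S tree rooted at g is finite and L lists its leaves
  -- (as vertices, with repetitions) together with sgn(π) of the path from g.
  data LSTree (k : ℕ) : Perm → List (Sign × Perm) → Set where
    leaf : ∀ {g} → ZeroGrass g → LSTree k g [ (Sign.+ , g) ]
    node : ∀ {g r s L} → MaxInv g r s
         → (cs : List (Sign × Perm)) → Unique cs
         → (∀ σ c → ((σ , c) ∈ cs → Child k g r s σ c) × (Child k g r s σ c → (σ , c) ∈ cs))
         → (ls : List (List (Sign × Perm)))
         → Pointwise (λ sc L' → LSTree k (proj₂ sc) L') cs ls
         → L ≡ nodeLeaves g cs ls
         → LSTree k g L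

  nextFin : Fin n → Fin n
  nextFin j = fromℕ< (m%n<n (suc (toℕ j)) n)

  CycDec : List (Fin n) → Set
  CycDec w = Unique w × (∀ p q → List.lookup w p ≡ nextFin (List.lookup w q) → toℕ p ℕ.< toℕ q)

  CycDecElem : Perm → Set
  CycDecElem g = Σ (List (Fin n)) λ w → CycDec w × wordProd w ≡ g

  -- factorizations τ^{-av(f)} f = f₁ ⋯ f_k (f_{k+1} = ⋯ = id) with ℓ(fᵢ) = aᵢ, Σ aᵢ = ℓ(f)
  Fact : (k : ℕ) → Perm → Vec ℕ k → Vec Perm k → Set
  Fact k f a fs = (∀ i → CycDecElem (lookup fs i) × Len (lookup fs i) (lookup a i))
                × Σ ℤ (λ m → IsAv f m × foldr compose idP (toList fs) ≡ shift m f)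
                × Len f (Vec.sum a)

  -- coefficient of x^a in F̃_f(x₁,…,x_k,0,0,…)
  GCoeff : (k : ℕ) → Perm → Vec ℕ k → ℕ → Set
  GCoeff k f a m = HasCard (Fact k f a) m

  insertDesc : ℕ → List ℕ → List ℕ
  insertDesc x [] = [ x ]
  insertDesc x (y ∷ ys) with y ℕ.≤? x
  ... | yes _ = x ∷ y ∷ ys
  ... | no _ = y ∷ insertDesc x ys

  sortDesc : List ℕ → List ℕ
  sortDesc = foldr insertDesc []

  lam : ℕ → Perm → List ℕ
  lam k g = sortDesc (map code oneToN)
    where
      oneToN : List ℕ
      oneToN = map suc (upTo n)
      w : ℕ → ℤ
      w i = eval g (+ i ℤ.- + k)
      code : ℕ → ℕ
      code i = length (filter (λ i' → (i ℕ.<? i') ×-dec (w i' ℤ.<? w i)) oneToN)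

-- Schur polynomials in k variables via semistandard tableaux (entries in Fin k ≅ {1..k})

_!!_ : {A : Set} → List A → ℕ → Maybe A
[] !! _ = nothing
(x ∷ xs) !! zero = just x
(x ∷ xs) !! suc i = xs !! i

entry : {k : ℕ} → List (List (Fin k)) → ℕ → ℕ → Maybe (Fin k)
entry T r c = (T !! r) >>= (λ row → row !! c)

SSYT : (k : ℕ) → List ℕ → List (List (Fin k)) → Set
SSYT k μ T = map length T ≡ μ
           × Data.List.Relation.Unary.All.All (Linked Fin._≤_) T
           × (∀ r c x y → entry T r c ≡ just x → entry T (suc r) c ≡ just y → x Fin.< y)
  where import Data.List.Relation.Unary.All

Content : (k : ℕ) → List (List (Fin k)) → Vec ℕ k → Set
Content k T a = ∀ m → length (filter (λ x → x Fin.≟ m) (concat T)) ≡ lookup a m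

-- Kostka number: coefficient of x^a in s_μ(x₁,…,x_k)
Kostka : (k : ℕ) → List ℕ → Vec ℕ k → ℕ → Set
Kostka k μ a m = HasCard (λ T → SSYT k μ T × Content k T a) m

Poly : ℕ → Set
Poly k = List (ℤ × Vec ℕ k)

coeff : {k : ℕ} → Poly k → Vec ℕ k → ℤ
coeff P a = foldr ℤ._+_ 0ℤ (map proj₁ (filter (λ t → VecP.≡-dec ℕ._≟_ (proj₂ t) a) P))

mulPoly : {k : ℕ} → Poly k → Poly k → Poly k
mulPoly P Q = concatMap (λ t → map (λ u → (proj₁ t ℤ.* proj₁ u , Vec.zipWith ℕ._+_ (proj₂ t) (proj₂ u))) Q) P

comps : (k d : ℕ) → List (Vec ℕ k)
comps zero zero = [ Vec.[] ]
comps zero (suc d) = []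
comps (suc k) d = concatMap (λ i → map (i Vec.∷_) (comps k (d ℕ.∸ i))) (upTo (suc d))

hPoly : (k d : ℕ) → Poly k
hPoly k d = map (λ e → (1ℤ , e)) (comps k d)

Symmetric : {k : ℕ} → Poly k → Set
Symmetric {k} P = ∀ (σ : Permutation′ k) a → coeff P (tabulate (λ i → lookup a (σ ⟨$⟩ʳ i))) ≡ coeff P a

idealSum : {k : ℕ} → List (ℕ × Poly k) → Poly k
idealSum {k} W = concatMap (λ dc → mulPoly (proj₂ dc) (hPoly k (proj₁ dc))) W

-- Σ_{(σ,g) ∈ L} σ · K(λ(g), a) : coefficient of x^a in Σ sgn · s_{λ(g)}
signedKostkaSum : {k : ℕ} → (n : ℕ) → {{nz : NonZero n}} → (List ℕ → Vec ℕ k → ℕ) → List (Sign × Perm n) → Vec ℕ k → ℤ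
signedKostkaSum {k} n {{nz}} K L a = foldr ℤ._+_ 0ℤ (map (λ sg → proj₁ sg ◃ K (lam n k (proj₂ sg)) a) L)

{-# OPTIONS --safe #-}
module Submission where

-- The coefficients of the affine Stanley function of v come from operators H_a
-- (sums over cyclically decreasing words) iterated on functions of v. The signed
-- sum over the Bruhat covers v t_{rj} is a derivation killing every H_a, so at
-- v = g t_{rs} it writes G_g through the children of g and unbounded covers c.
-- If c(x) < x for some x, the function of c vanishes in k variables; if
-- c(x) > x + n, it is in the ideal. At a 0-Grassmannian g the inverse is a
-- boundary path on which H_a acts by removing horizontal strips, which gives
-- the Schur polynomial.

open import Defs
import Data.Nat as N
open import Data.Nat as ℕ using (ℕ; zero; suc; NonZero; z≤n; s≤s)
import Data.Nat.Properties as M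
open import Data.Integer as ℤ using (ℤ; +_; -[1+_]; _+_; _*_; _-_; -_; _≤_; _<_; _≤?_; _<?_; _≟_; _◃_) renaming (0ℤ to 0z; 1ℤ to 1z)
import Data.Integer.Properties as Z
open import Data.Integer.DivMod using (_/ℕ_; _%ℕ_; n%ℕd<d; a≡a%ℕn+[a/ℕn]*n)
open import Data.Fin as Fin using (Fin; toℕ; fromℕ<)
import Data.Fin.Properties as FinP
open import Data.Bool as Bool using (Bool; true; false; _∧_; if_then_else_)
open import Data.Unit using (⊤; tt)
open import Data.Empty using (⊥) renaming (⊥-elim to absurd)
open import Data.Vec as Vec using (Vec; []; _∷_; lookup; tabulate; toList)
import Data.Vec.Properties as VecP
open import Data.List as List using (List; []; _∷_; [_]; _++_; length; filter; map; concat; concatMap; zipWith; upTo; allFin; foldr; reverse; replicate)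
import Data.List.Properties as L
open import Data.List.Membership.Propositional using (_∈_)
open import Data.List.Membership.Propositional.Properties using (∈-map⁺; ∈-map⁻; ∈-++⁺ˡ; ∈-++⁺ʳ; ∈-++⁻; ∈-filter⁺; ∈-filter⁻; ∈-allFin; ∈-∃++; ∈-upTo⁺; ∈-upTo⁻; ∈-applyUpTo⁻; ∈-concat⁺′; ∈-concat⁻′; ∈-downFrom⁺; ∈-downFrom⁻)
open import Data.List.Relation.Unary.Any as Any using (Any; here; there)
open import Data.List.Relation.Unary.All as All using (All; []; _∷_)
import Data.List.Relation.Unary.All.Properties as AllP
open import Data.List.Relation.Unary.AllPairs using ([]; _∷_)
open import Data.List.Relation.Unary.Unique.Propositional using (Unique)
import Data.List.Relation.Unary.Unique.Propositional.Properties as UP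
open import Data.Product using (Σ; _×_; _,_; proj₁; proj₂)
open import Data.Product using () renaming (proj₁ to fst; proj₂ to snd)
import Data.Product.Properties as ΣP
open import Data.Sum using (_⊎_) renaming (inj₁ to inl; inj₂ to inr)
open import Data.Sign as Sign using (Sign)
open import Function using (_∘_; id)
open import Relation.Nullary using (¬_; Dec; yes; no)
open import Relation.Nullary.Decidable using (_×-dec_; ¬?; ⌊_⌋)
open import Relation.Binary.PropositionalEquality using (_≡_; _≢_; refl; sym; trans; cong; cong-app; subst; module ≡-Reasoning) renaming (cong₂ to cong2; subst₂ to subst2)
open import Data.Integer.Tactic.RingSolver using () renaming (solve-∀ to ring)
open import Data.List.Relation.Binary.Permutation.Propositional as Perm using (_↭_)
import Data.List.Relation.Binary.Permutation.Propositional.Properties as PermP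
open import Data.List.Relation.Binary.BagAndSetEquality using (∼bag⇒↭)
open import Data.List.Membership.Propositional.Properties.WithK using (unique∧set⇒bag)
open import Function.Bundles using (mk⇔)
open import Data.Nat.Tactic.RingSolver using () renaming (solve-∀ to ringN)
open import Relation.Binary.Definitions using (module Tri)
import Data.List.Relation.Unary.Any.Properties as AnyP
import Data.Nat.DivMod as ℕD
open import Algebra.Bundles using (CommutativeRing)
open import Level using (0ℓ)
open import Data.Fin.Permutation using (Permutation′; _⟨$⟩ʳ_; _⟨$⟩ˡ_; inverseˡ; inverseʳ) renaming (flip to flipP)
open import Data.List.Relation.Unary.Linked as Linked using (Linked)
import Data.List.Relation.Unary.Linked.Properties as LinkedP
open import Data.Maybe using (just)
import Relation.Binary.Construct.Flip.EqAndOrd as Flip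
open import Data.List.Relation.Unary.Sorted.TotalOrder.Properties using (↗↭↗⇒≋)
open import Data.List.Relation.Binary.Pointwise using (Pointwise; Pointwise-≡⇒≡; []; _∷_)

-- The hard point is a cover with c(x) > x + n. Beside `H a`, which strips increasing cyclic words,
-- stands `E a`, which strips decreasing ones. The two kinds commute, and the alternating sum of
-- `H (m - j)` after `E j` vanishes for 1 ≤ m < n; the bound comes from pairs of subsets that
-- together cover every residue. In k variables the series of c is a sum of q(a) times a product of
-- complete homogeneous polynomials of degrees a_i - (k - i), where q is the coefficient function
-- acted on by the Vandermonde product: a Cauchy identity in Jacobi-Trudi form. If some a_i ≥ n, one
-- factor is h_d with d > n - k. If all a_i < n, repeated use of the alternating relation (a dual
-- Jacobi-Trudi expansion) writes q(a) through products of n - k operators `E`. Each moves a point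
-- by at most one, and after translation by -k the excess of c at x is more than n - k, so q(a) = 0.
-- Commutation of the `H a` among themselves is not proved directly; it follows from the alternating
-- relation and commutation with `E`.

infixr 5 _&_
_&_ : {A : Set} {x y z : A} → x ≡ y → y ≡ z → x ≡ z
_&_ = trans


-- Linear arithmetic over the integers by reflection.

infixl 6 _:+_ _:-_
infix 4 _=<_ _:<_ _:=_
infixr 3 _=>_

data Ex (n : ℕ) : Set where
 var : Fin n -> Ex n
 # : ℤ -> Ex n
 _:+_ _:-_ : Ex n -> Ex n -> Ex n

Env : ℕ -> Set
Env n = Vec ℤ n

⟦_⟧ : ∀ {n} -> Ex n -> Env n -> ℤ
⟦ var i ⟧ ρ = lookup ρ i
⟦ # c ⟧ ρ = c
⟦ a :+ b ⟧ ρ = ⟦ a ⟧ ρ + ⟦ b ⟧ ρ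
⟦ a :- b ⟧ ρ = ⟦ a ⟧ ρ - ⟦ b ⟧ ρ

Row : ℕ -> Set
Row n = ℤ × Vec ℤ n

dot : ∀ {n} -> Vec ℤ n -> Env n -> ℤ
dot [] [] = 0z
dot (a ∷ as) (x ∷ ρ) = a * x + dot as ρ

val : ∀ {n} -> Row n -> Env n -> ℤ
val (c , as) ρ = c + dot as ρ

unit : ∀ {n} -> Fin n -> Vec ℤ n
unit Fin.zero = 1z ∷ Vec.replicate _ 0z
unit (Fin.suc i) = 0z ∷ unit i

lc : ∀ {n} -> ℤ -> Row n -> ℤ -> Row n -> Row n
lc p (c , as) q (d , bs) = p * c + q * d , Vec.zipWith (\a b -> p * a + q * b) as bs

norm : ∀ {n} -> Ex n -> Row n
norm (var i) = 0z , unit i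
norm (# c) = c , Vec.replicate _ 0z
norm (a :+ b) = lc 1z (norm a) 1z (norm b)
norm (a :- b) = lc 1z (norm a) -[1+ 0 ] (norm b)

dot-0 : ∀ {n} (ρ : Env n) -> dot (Vec.replicate _ 0z) ρ ≡ 0z
dot-0 [] = refl
dot-0 (x ∷ ρ) = cong (\y -> 0z * x + y) (dot-0 ρ) & l x
 where
  l : ∀ x -> 0z * x + 0z ≡ 0z
  l = ring

dot-unit : ∀ {n} (i : Fin n) ρ -> dot (unit i) ρ ≡ lookup ρ i
dot-unit Fin.zero (x ∷ ρ) rewrite dot-0 ρ = l x
 where
  l : ∀ x -> 1z * x + 0z ≡ x
  l = ring
dot-unit (Fin.suc i) (x ∷ ρ) rewrite dot-unit i ρ = l x (lookup ρ i)
 where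
  l : ∀ x y -> 0z * x + y ≡ y
  l = ring

dot-lc : ∀ {n} p q (as bs : Vec ℤ n) ρ -> dot (Vec.zipWith (\a b -> p * a + q * b) as bs) ρ ≡ p * dot as ρ + q * dot bs ρ
dot-lc p q [] [] [] = l p q
 where
  l : ∀ p q -> 0z ≡ p * 0z + q * 0z
  l = ring
dot-lc p q (a ∷ as) (b ∷ bs) (x ∷ ρ) rewrite dot-lc p q as bs ρ = l p q a b x (dot as ρ) (dot bs ρ)
 where
  l : ∀ p q a b x s t -> (p * a + q * b) * x + (p * s + q * t) ≡ p * (a * x + s) + q * (b * x + t)
  l = ring

val-lc : ∀ {n} p (r : Row n) q s ρ -> val (lc p r q s) ρ ≡ p * val r ρ + q * val s ρ
val-lc p (c , as) q (d , bs) ρ rewrite dot-lc p q as bs ρ = l p q c d (dot as ρ) (dot bs ρ)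
 where
  l : ∀ p q c d s t -> (p * c + q * d) + (p * s + q * t) ≡ p * (c + s) + q * (d + t)
  l = ring

norm-ok : ∀ {n} (e : Ex n) ρ -> val (norm e) ρ ≡ ⟦ e ⟧ ρ
norm-ok (var i) ρ = (Z.+-identityˡ _) & dot-unit i ρ
norm-ok (# c) ρ = cong (_+_ c) (dot-0 ρ) & Z.+-identityʳ c
norm-ok (a :+ b) ρ = val-lc 1z (norm a) 1z (norm b) ρ & cong2 (\x y -> 1z * x + 1z * y) (norm-ok a ρ) (norm-ok b ρ) & l (⟦ a ⟧ ρ) (⟦ b ⟧ ρ)
 where
  l : ∀ x y -> 1z * x + 1z * y ≡ x + y
  l = ring
norm-ok (a :- b) ρ = (val-lc 1z (norm a) -[1+ 0 ] (norm b) ρ) & cong2 (\x y -> 1z * x + -[1+ 0 ] * y) (norm-ok a ρ) (norm-ok b ρ) & l (⟦ a ⟧ ρ) (⟦ b ⟧ ρ)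
 where
  l : ∀ x y -> 1z * x + -[1+ 0 ] * y ≡ x - y
  l = ring

NN : ∀ {n} -> Env n -> Row n -> Set
NN ρ r = 0z ≤ val r ρ

nn-lc : ∀ {n} (ρ : Env n) a b r s -> NN ρ r -> NN ρ s -> NN ρ (lc (+ a) r (+ b) s)
nn-lc ρ a b r s p q rewrite val-lc (+ a) r (+ b) s ρ = Z.+-mono-≤ (mul a p) (mul b q)
 where
  mul : ∀ a {x} -> 0z ≤ x -> 0z ≤ + a * x
  mul a {+ x} _ = subst (0z ≤_) (Z.pos-* a x) (ℤ.+≤+ z≤n)
  mul a { -[1+ x ] } ()

-- Fourier–Motzkin elimination of the first variable.
split : ∀ {n} -> List (Row (suc n)) -> List (ℕ × Row (suc n)) × List (ℕ × Row (suc n)) × List (Row n)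
split [] = [] , [] , []
split ((c , a ∷ as) ∷ rs) with split rs
... | p , q , z = go a
 where
  go : ℤ -> _
  go (+ zero) = p , q , (c , as) ∷ z
  go (+ suc m) = (suc m , (c , a ∷ as)) ∷ p , q , z
  go -[1+ m ] = p , (suc m , (c , a ∷ as)) ∷ q , z

isZ : ℤ -> Bool
isZ (+ zero) = true
isZ _ = false

-- The multipliers in `comb` make the leading coefficient zero. Dropping a row is always sound, so
-- this is tested and not proved.
drop0 : ∀ {n} -> Row (suc n) -> List (Row n)
drop0 (c , d ∷ ds) = if isZ d then (c , ds) ∷ [] else []

comb : ∀ {n} -> ℕ × Row (suc n) -> ℕ × Row (suc n) -> List (Row n)
comb (a , r) (b , s) = drop0 (lc (+ b) r (+ a) s)

neg? : ℤ -> Bool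
neg? (+ _) = false
neg? -[1+ _ ] = true

-- Sound but not complete: elimination works over the rationals. Integrality enters only where a
-- strict inequality is sharpened by one, in `hyp` and in the negated goal of `check`.
refute : ∀ n -> List (Row n) -> Bool
refute zero [] = false
refute zero (r ∷ rs) = if neg? (fst r) then true else refute zero rs
refute (suc n) rs with split rs
... | p , q , z = refute n (z ++ concatMap (\x -> concatMap (comb x) q) p)

nn-drop0 : ∀ {n} x (ρ : Env n) r -> NN (x ∷ ρ) r -> All (NN ρ) (drop0 r)
nn-drop0 x ρ (c , + zero ∷ ds) h = subst (0z ≤_) (cong (_+_ c) (Z.+-identityˡ _)) h ∷ []
nn-drop0 x ρ (c , + suc _ ∷ ds) h = []
nn-drop0 x ρ (c , -[1+ _ ] ∷ ds) h = []

nn-comb : ∀ {n} x (ρ : Env n) (r s : ℕ × Row (suc n)) -> NN (x ∷ ρ) (snd r) -> NN (x ∷ ρ) (snd s) -> All (NN ρ) (comb r s)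
nn-comb x ρ (a , r) (b , s) p q = nn-drop0 x ρ (lc (+ b) r (+ a) s) (nn-lc (x ∷ ρ) b a r s p q)

nn-split : ∀ {n} x (ρ : Env n) rs -> All (NN (x ∷ ρ)) rs ->
 All (NN (x ∷ ρ) ∘ snd) (fst (split rs)) × All (NN (x ∷ ρ) ∘ snd) (fst (snd (split rs))) × All (NN ρ) (snd (snd (split rs)))
nn-split x ρ [] [] = [] , [] , []
nn-split x ρ ((c , + zero ∷ as) ∷ rs) (h ∷ hs) with nn-split x ρ rs hs
... | p , q , z = p , q , subst (0z ≤_) (cong (_+_ c) (Z.+-identityˡ _)) h ∷ z
nn-split x ρ ((c , + suc m ∷ as) ∷ rs) (h ∷ hs) with nn-split x ρ rs hs
... | p , q , z = h ∷ p , q , z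
nn-split x ρ ((c , -[1+ m ] ∷ as) ∷ rs) (h ∷ hs) with nn-split x ρ rs hs
... | p , q , z = p , h ∷ q , z

all-concatMap : {A B : Set} {P : A -> Set} {Q : B -> Set} (f : A -> List B) -> (∀ a -> P a -> All Q (f a)) -> ∀ {xs} -> All P xs -> All Q (concatMap f xs)
all-concatMap f h [] = []
all-concatMap f h (p ∷ ps) = AllP.++⁺ (h _ p) (all-concatMap f h ps)

refute-ok : ∀ n (rs : List (Row n)) -> refute n rs ≡ true -> ∀ ρ -> All (NN ρ) rs -> ⊥
refute-ok zero ((+ c , []) ∷ rs) e [] (_ ∷ hs) = refute-ok zero rs e [] hs
refute-ok zero ((-[1+ c ] , []) ∷ rs) e [] (() ∷ hs)
refute-ok (suc n) rs e (x ∷ ρ) hs with split rs | nn-split x ρ rs hs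
... | p , q , z | hp , hq , hz = refute-ok n (z ++ concatMap (\x -> concatMap (comb x) q) p) e ρ
 (AllP.++⁺ hz (all-concatMap _ (\r hr -> all-concatMap _ (\s hs' -> nn-comb x ρ r s hr hs') hq) hp))

#0 #1 : ∀ {n} -> Ex n
#0 = # 0z
#1 = # 1z

data At (n : ℕ) : Set where
 _=<_ _:<_ _:=_ : Ex n -> Ex n -> At n
 ff : At n

data Fm (n : ℕ) : Set where
 |-_ : At n -> Fm n
 _=>_ : At n -> Fm n -> Fm n

infixr 3 |-_

⟪_⟫ : ∀ {n} -> At n -> Env n -> Set
⟪ a =< b ⟫ ρ = ⟦ a ⟧ ρ ≤ ⟦ b ⟧ ρ
⟪ a :< b ⟫ ρ = ⟦ a ⟧ ρ < ⟦ b ⟧ ρ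
⟪ a := b ⟫ ρ = ⟦ a ⟧ ρ ≡ ⟦ b ⟧ ρ
⟪ ff ⟫ ρ = ⊥

Sem : ∀ {n} -> Fm n -> Env n -> Set
Sem (|- a) ρ = ⟪ a ⟫ ρ
Sem (a => f) ρ = ⟪ a ⟫ ρ -> Sem f ρ

hyp : ∀ {n} -> At n -> List (Row n)
hyp (a =< b) = norm (b :- a) ∷ []
hyp (a :< b) = norm (b :- a :- #1) ∷ []
hyp (a := b) = norm (b :- a) ∷ norm (a :- b) ∷ []
hyp ff = []

check : ∀ {n} -> List (Row n) -> Fm n -> Bool
check rs (a => f) = check (hyp a ++ rs) f
check {n} rs (|- (a =< b)) = refute n (norm (a :- b :- #1) ∷ rs)
check {n} rs (|- (a :< b)) = refute n (norm (a :- b) ∷ rs)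
check {n} rs (|- (a := b)) = refute n (norm (a :- b :- #1) ∷ rs) ∧ refute n (norm (b :- a :- #1) ∷ rs)
check {n} rs (|- ff) = refute n rs

≤→nn : ∀ {a b} -> a ≤ b -> 0z ≤ b - a
≤→nn = Z.i≤j⇒0≤j-i

<→nn : ∀ {a b} -> a < b -> 0z ≤ b - a - 1z
<→nn {a} {b} h = subst (0z ≤_) (l a b) (≤→nn (Z.i<j⇒suc[i]≤j h))
 where
  l : ∀ a b -> b - ℤ.suc a ≡ b - a - 1z
  l a b = m a b
   where
    m : ∀ a b -> b - (1z + a) ≡ b - a - 1z
    m = ring

nn : ∀ {n} (e : Ex n) ρ -> 0z ≤ ⟦ e ⟧ ρ -> NN ρ (norm e)
nn e ρ = subst (0z ≤_) (sym (norm-ok e ρ))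

hyp-ok : ∀ {n} (a : At n) ρ -> ⟪ a ⟫ ρ -> All (NN ρ) (hyp a)
hyp-ok (a =< b) ρ h = nn (b :- a) ρ (≤→nn h) ∷ []
hyp-ok (a :< b) ρ h = nn (b :- a :- #1) ρ (<→nn h) ∷ []
hyp-ok (a := b) ρ h = nn (b :- a) ρ (≤→nn (Z.≤-reflexive h)) ∷ nn (a :- b) ρ (≤→nn (Z.≤-reflexive (sym h))) ∷ []
hyp-ok ff ρ ()

∧-l : ∀ a {b} -> a ∧ b ≡ true -> a ≡ true × b ≡ true
∧-l true e = refl , e

check-ok : ∀ {n} rs (f : Fm n) -> check rs f ≡ true -> ∀ ρ -> All (NN ρ) rs -> Sem f ρ
check-ok rs (a => f) e ρ hs h = check-ok (hyp a ++ rs) f e ρ (AllP.++⁺ (hyp-ok a ρ h) hs)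
check-ok rs (|- ff) e ρ hs = refute-ok _ rs e ρ hs
check-ok rs (|- (a =< b)) e ρ hs = Z.≮⇒≥ \h -> refute-ok _ _ e ρ (nn (a :- b :- #1) ρ (<→nn h) ∷ hs)
check-ok rs (|- (a :< b)) e ρ hs = Z.≰⇒> \h -> refute-ok _ _ e ρ (nn (a :- b) ρ (≤→nn h) ∷ hs)
check-ok rs (|- (a := b)) e ρ hs with ∧-l (refute _ (norm (a :- b :- #1) ∷ rs)) e
... | e1 , e2 = Z.≤-antisym (check-ok rs (|- (a =< b)) e1 ρ hs) (check-ok rs (|- (b =< a)) e2 ρ hs)

Fun : ℕ -> Set -> Set -> Set
Fun zero A B = B
Fun (suc n) A B = A -> Fun n A B

app : ∀ {A B : Set} n -> Fun n A B -> Vec A n -> B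
app zero f [] = f
app (suc n) f (x ∷ xs) = app n (f x) xs

All' : ∀ n -> (Env n -> Set) -> Set
All' zero P = P []
All' (suc n) P = ∀ x -> All' n (\ρ -> P (x ∷ ρ))

intro : ∀ n {P : Env n -> Set} -> (∀ ρ -> P ρ) -> All' n P
intro zero h = h []
intro (suc n) h x = intro n (\ρ -> h (x ∷ ρ))

form : ∀ n -> Fun n (Ex n) (Fm n) -> Fm n
form n f = app n f (Vec.map var (Vec.allFin n))

-- Products are invisible to the procedure: call sites pass a term such as `m * N` as a variable and
-- the facts about it as hypotheses. Negation is not in the syntax, so `- N` enters as `#0 :- N` or
-- as a variable with a defining equation.
lia : ∀ n (f : Fun n (Ex n) (Fm n)) {_ : Bool.T (check [] (form n f))} -> All' n (Sem (form n f))
lia n f {e} = intro n (\ρ -> check-ok [] (form n f) (true! e) ρ [])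
 where
  true! : ∀ {b} -> Bool.T b -> b ≡ true
  true! {true} _ = refl

-- Finite sums and cardinalities

+0 : ∀ x -> x + 0z ≡ x
+0 = Z.+-identityʳ

0+ : ∀ x -> 0z + x ≡ x
0+ = Z.+-identityˡ

interchange : ∀ a b c d -> (a + b) + (c + d) ≡ (a + c) + (b + d)
interchange = ring

+-cancelʳ : ∀ a b c -> a + c ≡ b + c -> a ≡ b
+-cancelʳ = lia 3 (\a b c -> a :+ c := b :+ c => |- a := b)

ΣL : {A : Set} -> List A -> (A -> ℤ) -> ℤ
ΣL [] f = 0z
ΣL (x ∷ xs) f = f x + ΣL xs f

on : {P : Set} -> Dec P -> ℤ -> ℤ
on (yes _) x = x
on (no _) x = 0z

on-yes : {P : Set} (d : Dec P) -> P -> ∀ x -> on d x ≡ x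
on-yes (yes _) p x = refl
on-yes (no ¬p) p x = absurd (¬p p)

on-no : {P : Set} (d : Dec P) -> ¬ P -> ∀ x -> on d x ≡ 0z
on-no (yes p) ¬p x = absurd (¬p p)
on-no (no _) ¬p x = refl

on-cong : {P Q : Set} (d : Dec P) (e : Dec Q) -> (P -> Q) -> (Q -> P) -> ∀ {x y} -> (P -> x ≡ y) -> on d x ≡ on e y
on-cong (yes p) (yes q) f g h = h p
on-cong (yes p) (no ¬q) f g h = absurd (¬q (f p))
on-cong (no ¬p) (yes q) f g h = absurd (¬p (g q))
on-cong (no ¬p) (no ¬q) f g h = refl

on-+ : {P : Set} (d : Dec P) -> ∀ x y -> on d (x + y) ≡ on d x + on d y
on-+ (yes _) x y = refl
on-+ (no _) x y = refl

on-0 : {P : Set} (d : Dec P) -> on d 0z ≡ 0z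
on-0 (yes _) = refl
on-0 (no _) = refl

on-on : {P Q : Set} (d : Dec P) (e : Dec Q) -> ∀ x -> on d (on e x) ≡ on (d ×-dec e) x
on-on (yes _) (yes _) x = refl
on-on (yes _) (no _) x = refl
on-on (no _) e x = refl

module _ {A : Set} where

 Σ-cong∈ : (xs : List A) {f g : A -> ℤ} -> (∀ x -> x ∈ xs -> f x ≡ g x) -> ΣL xs f ≡ ΣL xs g
 Σ-cong∈ [] h = refl
 Σ-cong∈ (x ∷ xs) h = cong2 _+_ (h x (here refl)) (Σ-cong∈ xs (\y m -> h y (there m)))

 Σ-cong : (xs : List A) {f g : A -> ℤ} -> (∀ x -> f x ≡ g x) -> ΣL xs f ≡ ΣL xs g
 Σ-cong xs h = Σ-cong∈ xs (\x _ -> h x)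

 Σ-0 : (xs : List A) {f : A -> ℤ} -> (∀ x -> x ∈ xs -> f x ≡ 0z) -> ΣL xs f ≡ 0z
 Σ-0 [] h = refl
 Σ-0 (x ∷ xs) h = cong2 _+_ (h x (here refl)) (Σ-0 xs (\y m -> h y (there m)))

 Σ-++ : (xs ys : List A) (f : A -> ℤ) -> ΣL (xs ++ ys) f ≡ ΣL xs f + ΣL ys f
 Σ-++ [] ys f = sym (0+ (ΣL ys f))
 Σ-++ (x ∷ xs) ys f = cong (_+_ (f x)) (Σ-++ xs ys f) & sym (Z.+-assoc (f x) (ΣL xs f) (ΣL ys f))

 Σ-+ : (xs : List A) (f g : A -> ℤ) -> ΣL xs (\x -> f x + g x) ≡ ΣL xs f + ΣL xs g
 Σ-+ [] f g = refl
 Σ-+ (x ∷ xs) f g = cong (_+_ (f x + g x)) (Σ-+ xs f g) & interchange (f x) (g x) (ΣL xs f) (ΣL xs g)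

 Σ-* : (c : ℤ) (xs : List A) (f : A -> ℤ) -> ΣL xs (\x -> c * f x) ≡ c * ΣL xs f
 Σ-* c [] f = sym (Z.*-zeroʳ c)
 Σ-* c (x ∷ xs) f = cong (_+_ (c * f x)) (Σ-* c xs f) & sym (Z.*-distribˡ-+ c (f x) (ΣL xs f))

 Σ-neg : (xs : List A) (f : A -> ℤ) -> ΣL xs (\x -> - f x) ≡ - ΣL xs f
 Σ-neg [] f = refl
 Σ-neg (x ∷ xs) f = cong (_+_ (- f x)) (Σ-neg xs f) & sym (Z.neg-distrib-+ (f x) (ΣL xs f))

 Σ-↭ : ∀ {xs ys : List A} (f : A -> ℤ) -> xs ↭ ys -> ΣL xs f ≡ ΣL ys f
 Σ-↭ f Perm.refl = refl
 Σ-↭ f (Perm.prep x p) = cong (_+_ (f x)) (Σ-↭ f p)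
 Σ-↭ {x ∷ y ∷ xs} {_ ∷ _ ∷ ys} f (Perm.swap _ _ p) = cong (\z -> f x + (f y + z)) (Σ-↭ f p) & l (f x) (f y) (ΣL ys f)
  where
   l : ∀ a b c -> a + (b + c) ≡ b + (a + c)
   l = ring
 Σ-↭ f (Perm.trans p q) = (Σ-↭ f p) & (Σ-↭ f q)

 uniq-↭ : ∀ {xs ys : List A} -> Unique xs -> Unique ys -> (∀ x -> x ∈ xs -> x ∈ ys) -> (∀ x -> x ∈ ys -> x ∈ xs) -> xs ↭ ys
 uniq-↭ u v f g = ∼bag⇒↭ (unique∧set⇒bag u v (mk⇔ (f _) (g _)))

 Σ-one : ∀ {xs : List A} (f : A -> ℤ) -> Unique xs -> ∀ {x} -> x ∈ xs -> (∀ y -> y ∈ xs -> y ≢ x -> f y ≡ 0z) -> ΣL xs f ≡ f x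
 Σ-one {x ∷ xs} f (a ∷ u) (here refl) h = cong (_+_ (f x)) (Σ-0 xs (\y m -> h y (there m) (\e -> All.lookup a m (sym e)))) & +0 (f x)
 Σ-one {x ∷ xs} f (a ∷ u) (there m) h = (cong2 _+_ (h x (here refl) (\ { refl -> All.lookup a m refl })) (Σ-one f u m (\y m' -> h y (there m')))) & (0+ _)

 Σ-filter : {P : A -> Set} (P? : ∀ x -> Dec (P x)) (xs : List A) (f : A -> ℤ) -> ΣL (filter P? xs) f ≡ ΣL xs (\x -> on (P? x) (f x))
 Σ-filter P? [] f = refl
 Σ-filter P? (x ∷ xs) f with P? x
 ... | yes _ = cong (_+_ (f x)) (Σ-filter P? xs f)
 ... | no _ = Σ-filter P? xs f & sym (0+ _)

 Σ-1 : (xs : List A) -> ΣL xs (\_ -> 1z) ≡ + length xs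
 Σ-1 [] = refl
 Σ-1 (x ∷ xs) = cong (_+_ 1z) (Σ-1 xs)

module _ {A B : Set} where

 Σ-map : (g : A -> B) (xs : List A) (f : B -> ℤ) -> ΣL (map g xs) f ≡ ΣL xs (\x -> f (g x))
 Σ-map g [] f = refl
 Σ-map g (x ∷ xs) f = cong (_+_ (f (g x))) (Σ-map g xs f)

 Σ-concatMap : (g : A -> List B) (xs : List A) (f : B -> ℤ) -> ΣL (concatMap g xs) f ≡ ΣL xs (\x -> ΣL (g x) f)
 Σ-concatMap g [] f = refl
 Σ-concatMap g (x ∷ xs) f = (Σ-++ (g x) (concatMap g xs) f) & cong (_+_ (ΣL (g x) f)) (Σ-concatMap g xs f)

 Σ-swap : (xs : List A) (ys : List B) (f : A -> B -> ℤ) -> ΣL xs (\x -> ΣL ys (f x)) ≡ ΣL ys (\y -> ΣL xs (\x -> f x y))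
 Σ-swap [] ys f = sym (Σ-0 ys (\_ _ -> refl))
 Σ-swap (x ∷ xs) ys f = cong (_+_ (ΣL ys (f x))) (Σ-swap xs ys f) & sym (Σ-+ ys (f x) (\y -> ΣL xs (\x -> f x y)))

 uniq-map∈ : (f : A -> B) {xs : List A} -> Unique xs -> (∀ x y -> x ∈ xs -> y ∈ xs -> f x ≡ f y -> x ≡ y) -> Unique (map f xs)
 uniq-map∈ f [] h = []
 uniq-map∈ f {x ∷ xs} (a ∷ u) h =
  All.tabulate (\m e -> let (y , m' , e') = ∈-map⁻ f m in All.lookup a m' (h x y (here refl) (there m') (e & e')))
  ∷ uniq-map∈ f u (\x y m m' -> h x y (there m) (there m'))

 map-↭ : {xs : List A} {ys : List B} -> Unique xs -> Unique ys -> (f : A -> B) (g : B -> A) ->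
  (∀ x -> x ∈ xs -> f x ∈ ys × g (f x) ≡ x) -> (∀ y -> y ∈ ys -> g y ∈ xs × f (g y) ≡ y) -> map f xs ↭ ys
 map-↭ {xs} {ys} u v f g p q = uniq-↭ (uniq-map∈ f u (\x y m m' e -> sym (snd (p x m)) & cong g e & snd (p y m'))) v
  (\y m -> let (x , m' , e) = ∈-map⁻ f m in subst (_∈ ys) (sym e) (fst (p x m')))
  (\y m -> subst (_∈ map f xs) (snd (q y m)) (∈-map⁺ f (fst (q y m))))

 Σ-bij : {xs : List A} {ys : List B} -> Unique xs -> Unique ys -> (f : A -> B) (g : B -> A) ->
  (∀ x -> x ∈ xs -> f x ∈ ys × g (f x) ≡ x) -> (∀ y -> y ∈ ys -> g y ∈ xs × f (g y) ≡ y) ->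
  (F : A -> ℤ) (G : B -> ℤ) -> (∀ x -> x ∈ xs -> F x ≡ G (f x)) -> ΣL xs F ≡ ΣL ys G
 Σ-bij {xs} u v f g p q F G h = Σ-cong∈ xs h & sym (Σ-map f xs G) & (Σ-↭ G (map-↭ u v f g p q))

 hc-bij : {P : A -> Set} {Q : B -> Set} {m : ℕ} (f : A -> B) (g : B -> A) ->
  (∀ x -> P x -> Q (f x) × g (f x) ≡ x) -> (∀ y -> Q y -> P (g y) × f (g y) ≡ y) -> HasCard P m -> HasCard Q m
 hc-bij {P} {Q} f g p q (xs , u , h , l) = map f xs ,
  uniq-map∈ f u (\x y m m' e -> sym (snd (p x (fst (h x) m))) & cong g e & snd (p y (fst (h y) m'))) ,
  (\y -> (\m -> let (x , m' , e) = ∈-map⁻ f m in subst Q (sym e) (fst (p x (fst (h x) m'))))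
   , \r -> subst (_∈ map f xs) (snd (q y r)) (∈-map⁺ f (snd (h (g y)) (fst (q y r))))) ,
  trans (L.length-map f xs) l

module _ {A : Set} where

 hc-unique : {P : A -> Set} {m m' : ℕ} -> HasCard P m -> HasCard P m' -> m ≡ m'
 hc-unique (xs , u , h , l) (ys , v , k , l') = sym l & PermP.↭-length
  (uniq-↭ u v (\x m -> snd (k x) (fst (h x) m)) (\x m -> snd (h x) (fst (k x) m))) & l'

 hc-iff : {P Q : A -> Set} {m : ℕ} -> (∀ x -> P x -> Q x) -> (∀ x -> Q x -> P x) -> HasCard P m -> HasCard Q m
 hc-iff f g (xs , u , h , l) = xs , u , (\x -> (\m -> f x (fst (h x) m)) , \q -> snd (h x) (g x q)) , l

 hc-insert : {P Q : A -> Set} {m : ℕ} (x : A) -> ¬ P x -> Q x -> (∀ y -> P y -> Q y) -> (∀ y -> Q y -> y ≡ x ⊎ P y) -> HasCard P m -> HasCard Q (suc m)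
 hc-insert {P} {Q} x ¬p q f g (xs , u , h , l) = x ∷ xs , All.tabulate (\m e -> ¬p (fst (h x) (subst (_∈ xs) (sym e) m))) ∷ u ,
  (\y -> (\ { (here refl) -> q ; (there m) -> f y (fst (h y) m) })
   , \r -> k y (g y r)) , cong suc l
  where
   k : ∀ y -> y ≡ x ⊎ P y -> y ∈ x ∷ xs
   k y (inl refl) = here refl
   k y (inr p) = there (snd (h y) p)

 hc-filter : {P : A -> Set} (P? : ∀ x -> Dec (P x)) (xs : List A) -> Unique xs -> (∀ x -> P x -> x ∈ xs) -> HasCard P (length (filter P? xs))
 hc-filter P? xs u c = filter P? xs , UP.filter⁺ P? u , (\x -> (\m -> snd (∈-filter⁻ P? {xs = xs} m)) , \p -> ∈-filter⁺ P? (c x p) p) , refl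

range : ℤ -> ℕ -> List ℤ
range a zero = []
range a (suc m) = a ∷ range (a + 1z) m

∈-range⁻ : ∀ a m x -> x ∈ range a m -> a ≤ x × x < a + + m
∈-range⁻ a (suc m) x (here refl) = Z.≤-refl , lia 2 (\a m -> #0 =< m => |- a :< a :+ (#1 :+ m)) a (+ m) (ℤ.+≤+ z≤n)
∈-range⁻ a (suc m) x (there h) with ∈-range⁻ (a + 1z) m x h
... | p , q = lia 2 (\a x -> a :+ #1 =< x => |- a =< x) a x p , lia 3 (\a m x -> x :< a :+ #1 :+ m => |- x :< a :+ (#1 :+ m)) a (+ m) x q

∈-range⁺ : ∀ a m x -> a ≤ x -> x < a + + m -> x ∈ range a m
∈-range⁺ a zero x p q = absurd (lia 2 (\a x -> a =< x => x :< a :+ #0 => |- ff) a x p q)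
∈-range⁺ a (suc m) x p q with x ≟ a
... | yes e = here e
... | no ne = there (∈-range⁺ (a + 1z) m x (lia 2 (\a x -> a :< x => |- a :+ #1 =< x) a x (Z.≤∧≢⇒< p (ne ∘ sym)))
 (lia 3 (\a m x -> x :< a :+ (#1 :+ m) => |- x :< a :+ #1 :+ m) a (+ m) x q))

range-unique : ∀ a m -> Unique (range a m)
range-unique a zero = []
range-unique a (suc m) = All.tabulate (\ {x} h e -> lia 2 (\a x -> a :+ #1 =< x => a := x => |- ff) a x (fst (∈-range⁻ (a + 1z) m x h)) e) ∷ range-unique (a + 1z) m

_×L_ : {A B : Set} -> List A -> List B -> List (A × B)
xs ×L ys = concatMap (\x -> map (x ,_) ys) xs

∈-×L⁺ : {A B : Set} {xs : List A} {ys : List B} -> ∀ x y -> x ∈ xs -> y ∈ ys -> (x , y) ∈ xs ×L ys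
∈-×L⁺ {ys = ys} x y (here refl) q = ∈-++⁺ˡ (∈-map⁺ (x ,_) q)
∈-×L⁺ {xs = z ∷ zs} {ys} x y (there p) q = ∈-++⁺ʳ (map (z ,_) ys) (∈-×L⁺ x y p q)

∈-×L⁻ : {A B : Set} (xs : List A) {ys : List B} {p : A × B} -> p ∈ xs ×L ys -> fst p ∈ xs × snd p ∈ ys
∈-×L⁻ (x ∷ xs) {ys} m with ∈-++⁻ (map (x ,_) ys) m
... | inl h with ∈-map⁻ (x ,_) h
...   | y , q , refl = here refl , q
∈-×L⁻ (x ∷ xs) {ys} m | inr h with ∈-×L⁻ xs h
... | p , q = there p , q

×L-unique : {A B : Set} {xs : List A} {ys : List B} -> Unique xs -> Unique ys -> Unique (xs ×L ys)
×L-unique [] v = []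
×L-unique {xs = x ∷ xs} {ys} (a ∷ u) v = UP.++⁺ (UP.map⁺ (\ { refl -> refl }) v) (×L-unique u v)
 (\ { (p , q) -> let (y , _ , e) = ∈-map⁻ (x ,_) p in All.lookup a (fst (∈-×L⁻ xs q)) (sym (cong fst e)) })

-- Periodic functions and reflections

module Aff (n : ℕ) {{nz : NonZero n}} where

 N : ℤ
 N = + n

 opaque
  -- Sealed copies of `eval` and `tr`, so that goals do not unfold into quotients and remainders.
  -- They are handled through equations such as `ev-pos`, `t-a`, `t-b` and `t-o`.
  ev : Perm n -> ℤ -> ℤ
  ev = eval n

  ev≡eval : ∀ v x -> ev v x ≡ eval n v x
  ev≡eval v x = refl

  t : ℤ -> ℤ -> ℤ -> ℤ
  t = tr n

  t≡tr : ∀ a b x -> t a b x ≡ tr n a b x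
  t≡tr a b x = refl

 0<N : 0z < N
 0<N = ℤ.+<+ (N.>-nonZero⁻¹ n)

 -- A nonzero multiple of n is at least n in absolute value. After this case split `m * N` can be
 -- treated as a variable in linear arithmetic.
 data MC (m : ℤ) : Set where
  neg : m < 0z -> m * N ≤ - N -> MC m
  nul : m ≡ 0z -> MC m
  pos' : 0z < m -> N ≤ m * N -> MC m

 mcase : ∀ m -> MC m
 mcase (+ zero) = nul refl
 mcase (+ suc m) = pos' (ℤ.+<+ (s≤s z≤n)) (subst (N ≤_) (Z.pos-* (suc m) n) (ℤ.+≤+ (M.m≤m+n n (m N.* n))))
 mcase -[1+ m ] = neg ℤ.-<+ (subst (_≤ - N) e (Z.neg-mono-≤ (ℤ.+≤+ (M.m≤m+n n (m N.* n)))))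
  where
   e : - + (suc m N.* n) ≡ -[1+ m ] * N
   e = (cong -_ (Z.pos-* (suc m) n)) & Z.neg-distribˡ-* (+ suc m) N

 divmod-unique : ∀ r r' q q' -> r N.< n -> r' N.< n -> + r + q * N ≡ + r' + q' * N -> r ≡ r' × q ≡ q'
 divmod-unique r r' q q' h h' e = go (mcase (q - q'))
  where
   d : (q - q') * N ≡ q * N - q' * N
   d = l q q' N
    where
     l : ∀ q q' N -> (q - q') * N ≡ q * N - q' * N
     l = ring
   fin : q ≡ q' -> r ≡ r' × q ≡ q'
   fin e' = Z.+-injective (lia 4 (\r r' a b -> r :+ a := r' :+ b => a := b => |- r := r') (+ r) (+ r') (q * N) (q' * N) e (cong (_* N) e')) , e'
   go : MC (q - q') -> _
   go (neg _ x) = absurd (lia 6 (\r r' a b c N -> #0 =< r => r' :< N => r :< N => #0 =< r' => r :+ a := r' :+ b => c := a :- b => c =< #0 :- N => |- ff) (+ r) (+ r') (q * N) (q' * N) ((q - q') * N) N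
    (ℤ.+≤+ z≤n) (ℤ.+<+ h') (ℤ.+<+ h) (ℤ.+≤+ z≤n) e d (subst ((q - q') * N ≤_) (sym (0+ (- N))) x))
   go (pos' _ x) = absurd (lia 6 (\r r' a b c N -> #0 =< r => r' :< N => r :< N => #0 =< r' => r :+ a := r' :+ b => c := a :- b => N =< c => |- ff) (+ r) (+ r') (q * N) (q' * N) ((q - q') * N) N
    (ℤ.+≤+ z≤n) (ℤ.+<+ h') (ℤ.+<+ h) (ℤ.+≤+ z≤n) e d x)
   go (nul x) = fin (lia 2 (\q q' -> q :- q' := #0 => |- q := q') q q' x)

 divmod : ∀ x r q -> r N.< n -> x ≡ + r + q * N -> x %ℕ n ≡ r × x /ℕ n ≡ q
 divmod x r q h e = divmod-unique (x %ℕ n) r (x /ℕ n) q (n%ℕd<d x n) h (sym (a≡a%ℕn+[a/ℕn]*n x n) & e)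

 infix 4 _~_
 _~_ : ℤ -> ℤ -> Set
 x ~ y = x %ℕ n ≡ y %ℕ n

 _~?_ : ∀ x y -> Dec (x ~ y)
 x ~? y = x %ℕ n N.≟ y %ℕ n

 ~→ : ∀ x y -> x ~ y -> Σ ℤ \m -> y ≡ x + m * N
 ~→ x y h = y /ℕ n - x /ℕ n , a≡a%ℕn+[a/ℕn]*n y n & cong (\r -> + r + y /ℕ n * N) (sym h) &
  l (+ (x %ℕ n)) (x /ℕ n) (y /ℕ n) N & cong (_+ (y /ℕ n - x /ℕ n) * N) (sym (a≡a%ℕn+[a/ℕn]*n x n))
  where
   l : ∀ r p q N -> r + q * N ≡ (r + p * N) + (q - p) * N
   l = ring

 →~ : ∀ x y m -> y ≡ x + m * N -> x ~ y
 →~ x y m e = sym (fst (divmod y (x %ℕ n) (x /ℕ n + m) (n%ℕd<d x n)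
  (e & cong (_+ m * N) (a≡a%ℕn+[a/ℕn]*n x n) & l (+ (x %ℕ n)) (x /ℕ n) m N)))
  where
   l : ∀ r p q N -> (r + p * N) + q * N ≡ r + (p + q) * N
   l = ring

 near : ∀ x y -> x < y -> y < x + N -> ¬ x ~ y
 near x y a b h with ~→ x y h
 ... | m , refl = go (mcase m)
  where
   go : MC m -> ⊥
   go (neg _ z) = lia 3 (\x k N -> x :< x :+ k => #0 :< N => k :+ N =< #0 => |- ff) x (m * N) N a 0<N (subst (m * N + N ≤_) (Z.+-inverseˡ N) (Z.+-monoˡ-≤ N z))
   go (nul refl) = Z.<-irrefl (sym (+0 x)) a
   go (pos' _ z) = lia 3 (\x k N -> x :+ k :< x :+ N => N =< k => |- ff) x (m * N) N b z

 data Win (x : ℤ) : Set where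
  win : ∀ (j : Fin n) q -> x ≡ pos n j + q * N -> Win x

 toWin : ∀ x -> Win x
 toWin x = win (fromℕ< (n%ℕd<d (x - 1z) n)) ((x - 1z) /ℕ n)
  ((l x & cong (_+_ 1z) (a≡a%ℕn+[a/ℕn]*n (x - 1z) n)) &
   sym (Z.+-assoc 1z (+ ((x - 1z) %ℕ n)) ((x - 1z) /ℕ n * N)) & cong (\r -> (1z + + r) + (x - 1z) /ℕ n * N) (sym (FinP.toℕ-fromℕ< (n%ℕd<d (x - 1z) n))))
  where
   l : ∀ x -> x ≡ 1z + (x - 1z)
   l = ring

 opaque
  unfolding ev

  ev-pos : ∀ v j q -> ev v (pos n j + q * N) ≡ lookup v j + q * N
  ev-pos v j q with divmod (pos n j + q * N - 1z) (toℕ j) q (FinP.toℕ<n j) (l (+ toℕ j) (q * N))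
   where
    l : ∀ a b -> (1z + a) + b - 1z ≡ a + b
    l = ring
  ... | e , e' = cong2 (\i p -> lookup v i + p * N) (FinP.toℕ-injective ((FinP.toℕ-fromℕ< _) & e)) e'

 Per : (ℤ -> ℤ) -> Set
 Per F = ∀ x m -> F (x + m * N) ≡ F x + m * N

 ev-per : ∀ v -> Per (ev v)
 ev-per v x m with toWin x
 ... | win j q refl = cong (ev v) (l (pos n j) q m N) & ev-pos v j (q + m) & sym (l (lookup v j) q m N) & cong (_+ m * N) (sym (ev-pos v j q))
  where
   l : ∀ a q m N -> (a + q * N) + m * N ≡ a + (q + m) * N
   l = ring

 ev-lookup : ∀ v j -> ev v (pos n j) ≡ lookup v j
 ev-lookup v j = cong (ev v) (sym (+0 (pos n j))) & ev-pos v j 0z & +0 (lookup v j)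

 ev-fromFun : ∀ {F} -> Per F -> ∀ x -> ev (fromFun n F) x ≡ F x
 ev-fromFun {F} p x with toWin x
 ... | win j q refl = (ev-pos _ j q) & cong (_+ q * N) (VecP.lookup∘tabulate _ j) & sym (p (pos n j) q)

 ext : ∀ v w -> (∀ x -> ev v x ≡ ev w x) -> v ≡ w
 ext v w h = sym (VecP.tabulate∘lookup v) & VecP.tabulate-cong (\j -> sym (ev-lookup v j) & h (pos n j) & ev-lookup w j) & VecP.tabulate∘lookup w

 per-~ : ∀ {F} -> Per F -> ∀ x y -> x ~ y -> F x ~ F y
 per-~ {F} p x y h with ~→ x y h
 ... | m , refl = →~ (F x) _ m (p x m)

 data TV (a b x : ℤ) : Set where
  isA : ∀ m -> x ≡ a + m * N -> TV a b x
  isB : ∀ m -> x ≡ b + m * N -> TV a b x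
  off : ¬ x ~ a -> ¬ x ~ b -> TV a b x

 tv : ∀ a b x -> TV a b x
 tv a b x with x ~? a | x ~? b
 ... | yes p | _ = let (m , e) = ~→ a x (sym p) in isA m e
 ... | no _ | yes p = let (m , e) = ~→ b x (sym p) in isB m e
 ... | no p | no q = off p q

 opaque
  unfolding t

  t-a : ∀ {a b} -> ¬ a ~ b -> ∀ m -> t a b (a + m * N) ≡ b + m * N
  t-a {a} {b} h m with a %ℕ n N.≟ b %ℕ n
  ... | yes p = absurd (h p)
  ... | no _ with (a + m * N) %ℕ n N.≟ a %ℕ n
  ...   | yes _ = lia 3 (\a b k -> |- a :+ k :- a :+ b := b :+ k) a b (m * N)
  ...   | no q = absurd (q (sym (→~ a _ m refl)))

  t-b : ∀ {a b} -> ¬ a ~ b -> ∀ m -> t a b (b + m * N) ≡ a + m * N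
  t-b {a} {b} h m with a %ℕ n N.≟ b %ℕ n
  ... | yes p = absurd (h p)
  ... | no _ with (b + m * N) %ℕ n N.≟ a %ℕ n
  ...   | yes p = absurd (h (sym p & sym (→~ b _ m refl)))
  ...   | no _ with (b + m * N) %ℕ n N.≟ b %ℕ n
  ...     | yes _ = lia 3 (\a b k -> |- b :+ k :- b :+ a := a :+ k) a b (m * N)
  ...     | no q = absurd (q (sym (→~ b _ m refl)))

  t-o : ∀ {a b x} -> ¬ x ~ a -> ¬ x ~ b -> t a b x ≡ x
  t-o {a} {b} {x} h h' with a %ℕ n N.≟ b %ℕ n
  ... | yes p = refl
  ... | no _ with x %ℕ n N.≟ a %ℕ n
  ...   | yes p = absurd (h p)
  ...   | no _ with x %ℕ n N.≟ b %ℕ n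
  ...     | yes p = absurd (h' p)
  ...     | no _ = refl

  t-id : ∀ {a b} -> a ~ b -> ∀ x -> t a b x ≡ x
  t-id {a} {b} h x with a %ℕ n N.≟ b %ℕ n
  ... | yes _ = refl
  ... | no q = absurd (q h)

 +0N : ∀ a -> a + 0z * N ≡ a
 +0N a = +0 a

 t-a0 : ∀ {a b} -> ¬ a ~ b -> t a b a ≡ b
 t-a0 {a} {b} h = cong (t a b) (sym (+0N a)) & t-a h 0z & +0N b

 t-b0 : ∀ {a b} -> ¬ a ~ b -> t a b b ≡ a
 t-b0 {a} {b} h = cong (t a b) (sym (+0N b)) & t-b h 0z & +0N a

 +N+N : ∀ a q m -> (a + q * N) + m * N ≡ a + (q + m) * N
 +N+N a q m = l a q m N
  where
   l : ∀ a q m N -> (a + q * N) + m * N ≡ a + (q + m) * N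
   l = ring

 t-per : ∀ a b -> Per (t a b)
 t-per a b x m with a ~? b
 ... | yes h = (t-id h _) & cong (_+ m * N) (sym (t-id h x))
 ... | no h with tv a b x
 ...   | isA q refl = cong (t a b) (+N+N a q m) & t-a h (q + m) & sym (+N+N b q m) & cong (_+ m * N) (sym (t-a h q))
 ...   | isB q refl = cong (t a b) (+N+N b q m) & t-b h (q + m) & sym (+N+N a q m) & cong (_+ m * N) (sym (t-b h q))
 ...   | off p q = t-o (p ∘ trans (→~ x _ m refl)) (q ∘ trans (→~ x _ m refl)) & cong (_+ m * N) (sym (t-o p q))

 t-inv : ∀ a b x -> t a b (t a b x) ≡ x
 t-inv a b x with a ~? b
 ... | yes h = (t-id h _) & t-id h x
 ... | no h with tv a b x
 ...   | isA q refl = cong (t a b) (t-a h q) & t-b h q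
 ...   | isB q refl = cong (t a b) (t-b h q) & t-a h q
 ...   | off p q = cong (t a b) (t-o p q) & t-o p q

 t-~ : ∀ a b x y -> t a b x ~ t a b y -> x ~ y
 t-~ a b x y h = subst2 _~_ (t-inv a b x) (t-inv a b y) (per-~ {t a b} (t-per a b) (t a b x) (t a b y) h)

 -- Conjugation of a reflection, for any periodic σ that is injective on residues. With σ a
 -- reflection it gives `mulT-conj`, through which two reflections are moved past each other below.
 conj : ∀ {σ} -> Per σ -> (∀ x y -> σ x ~ σ y -> x ~ y) -> ∀ {a b} -> ¬ a ~ b -> ∀ x -> σ (t a b x) ≡ t (σ a) (σ b) (σ x)
 conj {σ} p r {a} {b} h x = go (tv a b x)
  where
   h' : ¬ σ a ~ σ b
   h' = h ∘ r a b
   go : TV a b x -> _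
   go (isA m refl) = cong σ (t-a h m) & p b m & sym (t-a h' m) & cong (t (σ a) (σ b)) (sym (p a m))
   go (isB m refl) = cong σ (t-b h m) & p a m & sym (t-b h' m) & cong (t (σ a) (σ b)) (sym (p b m))
   go (off u w) = cong σ (t-o u w) & sym (t-o (u ∘ r x a) (w ∘ r x b))

 t-sym : ∀ a b x -> t a b x ≡ t b a x
 t-sym a b x with a ~? b
 ... | yes h = t-id h x & sym (t-id (sym h) x)
 ... | no h with tv a b x
 ...   | isA m refl = t-a h m & sym (t-b (h ∘ sym) m)
 ...   | isB m refl = t-b h m & sym (t-a (h ∘ sym) m)
 ...   | off p q = t-o p q & sym (t-o q p)

 t-shift : ∀ a b m x -> t (a + m * N) (b + m * N) x ≡ t a b x
 t-shift a b m x with a ~? b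
 ... | yes h = t-id (sym (→~ a _ m refl) & h & (→~ b _ m refl)) x & sym (t-id h x)
 ... | no h with tv a b x
 ...   | isA q refl = cong (t (a + m * N) (b + m * N)) (k a) & t-a h' (q - m) & sym (k b) & sym (t-a h q)
  where
   k : ∀ a -> a + q * N ≡ a + m * N + (q - m) * N
   k a = l a q m N
    where
     l : ∀ a q m N -> a + q * N ≡ a + m * N + (q - m) * N
     l = ring
   h' : ¬ a + m * N ~ b + m * N
   h' z = h ((→~ a _ m refl) & z & sym (→~ b _ m refl))
 ...   | isB q refl = cong (t (a + m * N) (b + m * N)) (k b) & t-b h' (q - m) & sym (k a) & sym (t-b h q)
  where
   k : ∀ a -> a + q * N ≡ a + m * N + (q - m) * N
   k a = l a q m N
    where
     l : ∀ a q m N -> a + q * N ≡ a + m * N + (q - m) * N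
     l = ring
   h' : ¬ a + m * N ~ b + m * N
   h' z = h ((→~ a _ m refl) & z & sym (→~ b _ m refl))
 ...   | off p q = t-o (\z -> p (z & sym (→~ a _ m refl))) (\z -> q (z & sym (→~ b _ m refl))) & sym (t-o p q)

 ev-t : ∀ v a b x -> ev (mulT n v a b) x ≡ ev v (t a b x)
 ev-t v a b x = cong (\w -> ev w x) (VecP.tabulate-cong \j -> sym (ev≡eval v _) & cong (ev v) (sym (t≡tr a b _))) &
  ev-fromFun {\y -> ev v (t a b y)} (\y m -> cong (ev v) (t-per a b y m) & ev-per v (t a b y) m) x

 record IsAff (v : Perm n) : Set where
  field
   inj : ∀ x y -> ev v x ≡ ev v y -> x ≡ y
   at : ℤ -> ℤ
   ev-at : ∀ y -> ev v (at y) ≡ y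

  inj~ : ∀ x y -> ev v x ~ ev v y -> x ~ y
  inj~ x y h with ~→ (ev v x) (ev v y) h
  ... | m , e = →~ x y m (inj y (x + m * N) (e & sym (ev-per v x m)))

  at-ev : ∀ x -> at (ev v x) ≡ x
  at-ev x = inj _ _ (ev-at (ev v x))

  at-per : Per at
  at-per x m = inj _ _ ((ev-at _) & sym (ev-per v (at x) m & cong (_+ m * N) (ev-at x)))

 open IsAff public

 opaque
  unfolding ev

  toAff : ∀ {v} -> IsAffPerm n v -> IsAff v
  toAff (i , s) = record { inj = \x y -> i ; at = \y -> fst (s y) ; ev-at = \y -> snd (s y) refl }

  fromAff : ∀ {v} -> IsAff v -> IsAffPerm n v
  fromAff A = (\ {x} {y} -> inj A x y) , \y -> at A y , \ { refl -> ev-at A y }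

 t-Aff : ∀ {v} -> IsAff v -> ∀ a b -> IsAff (mulT n v a b)
 t-Aff {v} A a b = record
  { inj = \x y e -> trans (sym (t-inv a b x)) (cong (t a b) (inj A _ _ (sym (ev-t v a b x) & e & ev-t v a b y)) & t-inv a b y)
  ; at = \y -> t a b (at A y)
  ; ev-at = \y -> trans (ev-t v a b _) (cong (ev v) (t-inv a b (at A y)) & ev-at A y) }

 mulT-inv : ∀ v a b -> mulT n (mulT n v a b) a b ≡ v
 mulT-inv v a b = ext _ _ \x -> (ev-t _ a b x) & (ev-t v a b _) & cong (ev v) (t-inv a b x)

 mulT-conj : ∀ v c d {a b} -> ¬ a ~ b -> mulT n (mulT n v a b) c d ≡ mulT n (mulT n v c d) (t c d a) (t c d b)
 mulT-conj v c d {a} {b} h = ext _ _ \x -> begin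
  ev (mulT n (mulT n v a b) c d) x ≡⟨ trans (ev-t _ c d x) (ev-t v a b _) ⟩
  ev v (t a b (t c d x)) ≡⟨ cong (ev v) (sym (t-inv c d _) & cong (t c d) (conj {t c d} (t-per c d) (t-~ c d) {a} {b} h (t c d x) & cong (t (t c d a) (t c d b)) (t-inv c d x))) ⟩
  ev v (t c d (t (t c d a) (t c d b) x)) ≡⟨ sym ((ev-t _ (t c d a) (t c d b) x) & (ev-t v c d _)) ⟩
  ev (mulT n (mulT n v c d) (t c d a) (t c d b)) x ∎
  where
   open ≡-Reasoning

-- Length

module Length (n : ℕ) {{nz : NonZero n}} where
 open Aff n public

 -- The number of periods that brings a into the window 1, ..., n.
 κ : ℤ -> ℤ
 κ a = - ((a - 1z) /ℕ n)

 κ-shift : ∀ a m -> κ (a + m * N) ≡ κ a - m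
 κ-shift a m = (cong -_ (snd (divmod (a + m * N - 1z) ((a - 1z) %ℕ n) ((a - 1z) /ℕ n + m) (n%ℕd<d (a - 1z) n)
  (l a (m * N) & cong (_+ m * N) (a≡a%ℕn+[a/ℕn]*n (a - 1z) n) & +N+N (+ ((a - 1z) %ℕ n)) ((a - 1z) /ℕ n) m)))) &
  Z.neg-distrib-+ ((a - 1z) /ℕ n) m
  where
   l : ∀ a k -> a + k - 1z ≡ a - 1z + k
   l = ring

 nrm : ℤ × ℤ -> ℤ × ℤ
 nrm (a , b) = a + κ a * N , b + κ a * N

 nrm-shift : ∀ a b m -> nrm (a + m * N , b + m * N) ≡ nrm (a , b)
 nrm-shift a b m = cong2 _,_ (e a) (e b)
  where
   l : ∀ c m k N -> c + m * N + (k - m) * N ≡ c + k * N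
   l = ring
   e : ∀ c -> c + m * N + κ (a + m * N) * N ≡ c + κ a * N
   e c = cong (\k -> c + m * N + k * N) (κ-shift a m) & l c m (κ a) N

 nrm-range : ∀ a -> 1z ≤ a + κ a * N × a + κ a * N ≤ N
 nrm-range a = subst (\z -> 1z ≤ z × z ≤ N) (sym e) (ℤ.+≤+ (s≤s z≤n) , ℤ.+≤+ (n%ℕd<d (a - 1z) n))
  where
   l : ∀ a r q N -> a - 1z ≡ r + q * N -> a + (- q) * N ≡ 1z + r
   l a r q N h = m a q N & cong (\z -> 1z + (z - q * N)) h & m' r q N
    where
     m : ∀ a q N -> a + (- q) * N ≡ 1z + ((a - 1z) - q * N)
     m = ring
     m' : ∀ r q N -> 1z + ((r + q * N) - q * N) ≡ 1z + r
     m' = ring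
   e : a + κ a * N ≡ + suc ((a - 1z) %ℕ n)
   e = l a (+ ((a - 1z) %ℕ n)) ((a - 1z) /ℕ n) N (a≡a%ℕn+[a/ℕn]*n (a - 1z) n)

 nrm-id : ∀ a b -> 1z ≤ a -> a ≤ N -> nrm (a , b) ≡ (a , b)
 nrm-id a b h h' = go (mcase (κ a))
  where
   go : MC (κ a) -> nrm (a , b) ≡ (a , b)
   go (neg _ x) = absurd (lia 4 (\a k N -N -> a =< N => #1 =< a :+ k => k =< -N => -N := #0 :- N => |- ff) a (κ a * N) N (- N) h' (fst (nrm-range a)) x (sym (0+ (- N))))
   go (nul x) = cong2 _,_ (cong (\k -> a + k * N) x & +0N a) (cong (\k -> b + k * N) x & +0N b)
   go (pos' _ x) = absurd (lia 3 (\a k N -> #1 =< a => a :+ k =< N => N =< k => |- ff) a (κ a * N) N h (snd (nrm-range a)) x)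

 Inv : Perm n -> ℤ × ℤ -> Set
 Inv v (a , b) = a < b × ev v b < ev v a

 NInv : Perm n -> ℤ × ℤ -> Set
 NInv v (a , b) = (1z ≤ a × a ≤ N) × Inv v (a , b)

 inv-shift : ∀ v a b m -> Inv v (a , b) -> Inv v (a + m * N , b + m * N)
 inv-shift v a b m (p , q) = Z.+-monoˡ-< (m * N) p , subst2 _<_ (sym (ev-per v b m)) (sym (ev-per v a m)) (Z.+-monoˡ-< (m * N) q)

 NInv-nrm : ∀ v a b -> Inv v (a , b) -> NInv v (nrm (a , b))
 NInv-nrm v a b h = nrm-range a , inv-shift v a b (κ a) h

 Σ-mem≤ : {A : Set} (f : A -> ℤ) -> (∀ x -> 0z ≤ f x) -> (xs : List A) -> 0z ≤ ΣL xs f × (∀ x -> x ∈ xs -> f x ≤ ΣL xs f)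
 Σ-mem≤ f h [] = Z.≤-refl , \x ()
 Σ-mem≤ f h (y ∷ ys) with Σ-mem≤ f h ys
 ... | p , q = Z.+-mono-≤ (h y) p , \ { x (here refl) -> lia 2 (\a b -> #0 =< b => |- a =< a :+ b) (f y) (ΣL ys f) p
  ; x (there m) -> lia 3 (\x a b -> #0 =< a => x =< b => |- x =< a :+ b) (f x) (f y) (ΣL ys f) (h y) (q x m) }

 disp : Perm n -> Fin n -> ℤ
 disp v j = + ℤ.∣ lookup v j - pos n j ∣

 -- The total displacement of the window. By periodicity it bounds the displacement of every point,
 -- which turns the search for inversions and for covers into a finite one.
 B : Perm n -> ℕ
 B v = ℤ.∣ ΣL (allFin n) (disp v) ∣

 abs≤ : ∀ x c -> + ℤ.∣ x ∣ ≤ c -> - c ≤ x × x ≤ c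
 abs≤ (+ x) (+ c) h = Z.≤-trans (Z.neg-mono-≤ (ℤ.+≤+ (z≤n {c}))) (ℤ.+≤+ z≤n) , h
 abs≤ -[1+ x ] (+ suc c) (ℤ.+≤+ (s≤s h)) = ℤ.-≤- h , ℤ.-≤+

 B-bound : ∀ v x -> x - + B v ≤ ev v x × ev v x ≤ x + + B v
 B-bound v x with toWin x
 ... | win j q refl = subst (\z -> pos n j + q * N - + B v ≤ z × z ≤ pos n j + q * N + + B v) (sym (ev-pos v j q))
  (lia 5 (\p k b l c -> c =< l :- p => c := #0 :- b => |- p :+ k :- b =< l :+ k) (pos n j) (q * N) (+ B v) (lookup v j) (- + B v) (fst h) (sym (0+ _))
  , lia 4 (\p k b l -> l :- p =< b => |- l :+ k =< p :+ k :+ b) (pos n j) (q * N) (+ B v) (lookup v j) (snd h))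
  where
   σ = Σ-mem≤ (disp v) (\_ -> ℤ.+≤+ z≤n) (allFin n)
   h : - + B v ≤ lookup v j - pos n j × lookup v j - pos n j ≤ + B v
   h = abs≤ (lookup v j - pos n j) (+ B v) (subst (disp v j ≤_) (sym (Z.0≤i⇒+∣i∣≡i (fst σ))) (snd σ j (∈-allFin j)))

 NInv? : ∀ v p -> Dec (NInv v p)
 NInv? v (a , b) = ((1z ≤? a) ×-dec (a ≤? N)) ×-dec ((a <? b) ×-dec (ev v b <? ev v a))

 NInv-fin : ∀ v p -> NInv v p -> p ∈ range 1z n ×L range 1z (n N.+ B v N.+ B v)
 NInv-fin v (a , b) ((h , h') , (l , l')) = ∈-×L⁺ a b (∈-range⁺ 1z n a h (lia 2 (\a N -> a =< N => |- a :< #1 :+ N) a N h'))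
  (∈-range⁺ 1z _ b (lia 2 (\a b -> #1 =< a => a :< b => |- #1 =< b) a b h l)
   (lia 6 (\a b N B x y -> a =< N => b :- B =< y => x =< a :+ B => y :< x => |- b :< #1 :+ (N :+ B :+ B)) a b N (+ B v) (ev v a) (ev v b)
    h' (fst (B-bound v b)) (snd (B-bound v a)) l'))

 opaque
  len : Perm n -> ℕ
  len v = length (filter (NInv? v) (range 1z n ×L range 1z (n N.+ B v N.+ B v)))

  len-card : ∀ v -> HasCard (NInv v) (len v)
  len-card v = hc-filter (NInv? v) _ (×L-unique (range-unique 1z n) (range-unique 1z _)) (NInv-fin v)

 opaque
  unfolding ev

  Len-len : ∀ v -> Len n v (len v)
  Len-len v = hc-iff {P = NInv v} {Q = InvPair n v} (\ { (a , b) ((p , q) , r , s) -> p , q , r , s }) (\ { (a , b) (p , q , r , s) -> (p , q) , r , s }) (len-card v)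

 Len→len : ∀ v {m} -> Len n v m -> m ≡ len v
 Len→len v h = hc-unique h (Len-len v)

 inverse : ∀ {v} -> IsAff v -> Perm n
 inverse A = fromFun n (at A)

 ev-inverse : ∀ {v} (A : IsAff v) x -> ev (inverse A) x ≡ at A x
 ev-inverse A = ev-fromFun (at-per A)

 inverse-Aff : ∀ {v} (A : IsAff v) -> IsAff (inverse A)
 inverse-Aff {v} A = record
  { inj = \x y e -> trans (sym (ev-at A x)) (cong (ev v) (sym (ev-inverse A x) & e & ev-inverse A y) & ev-at A y)
  ; at = ev v
  ; ev-at = \y -> trans (ev-inverse A (ev v y)) (at-ev A y) }

 -- (a, b) is an inversion of v exactly when (v(b), v(a)) is one of the inverse; `nrm` moves the
 -- image pair back into the window.
 len-inverse : ∀ {v} (A : IsAff v) -> len (inverse A) ≡ len v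
 len-inverse {v} A = hc-unique (len-card (inverse A)) (hc-bij f g fP gP (len-card v))
  where
   w = inverse A
   f g : ℤ × ℤ -> ℤ × ℤ
   f (a , b) = nrm (ev v b , ev v a)
   g (a , b) = nrm (ev w b , ev w a)
   wv : ∀ x -> ev w (ev v x) ≡ x
   wv x = ev-inverse A (ev v x) & at-ev A x
   vw : ∀ x -> ev v (ev w x) ≡ x
   vw x = cong (ev v) (ev-inverse A x) & ev-at A x
   fP : ∀ p -> NInv v p -> NInv w (f p) × g (f p) ≡ p
   fP (a , b) ((h , h') , l , l') = NInv-nrm w _ _ (l' , subst2 _<_ (sym (wv a)) (sym (wv b)) l) ,
    trans (cong2 (\x y -> nrm (x , y)) (e a) (e b)) (nrm-shift a b (κ (ev v b)) & nrm-id a b h h')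
    where
     e : ∀ x -> ev w (ev v x + κ (ev v b) * N) ≡ x + κ (ev v b) * N
     e x = ev-per w (ev v x) (κ (ev v b)) & cong (_+ κ (ev v b) * N) (wv x)
   gP : ∀ p -> NInv w p -> NInv v (g p) × f (g p) ≡ p
   gP (a , b) ((h , h') , l , l') = NInv-nrm v _ _ (l' , subst2 _<_ (sym (vw a)) (sym (vw b)) l) ,
    trans (cong2 (\x y -> nrm (x , y)) (e a) (e b)) (nrm-shift a b (κ (ev w b)) & nrm-id a b h h')
    where
     e : ∀ x -> ev v (ev w x + κ (ev w b) * N) ≡ x + κ (ev w b) * N
     e x = ev-per v (ev w x) (κ (ev w b)) & cong (_+ κ (ev w b) * N) (vw x)

-- Simple reflections and the length.

module Simple (n : ℕ) {{nz : NonZero n}} (1<n : 1z < + n) where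
 open Length n public

 s : ℤ -> ℤ -> ℤ
 s i = t i (i + 1z)

 infixl 6 _·s_
 _·s_ : Perm n -> ℤ -> Perm n
 v ·s i = mulT n v i (i + 1z)

 i≁ : ∀ i -> ¬ i ~ i + 1z
 i≁ i = near i (i + 1z) (lia 1 (\i -> |- i :< i :+ #1) i) (Z.+-monoʳ-< i 1<n)

 data SV (i x : ℤ) : Set where
  up : ∀ m -> x ≡ i + m * N -> s i x ≡ x + 1z -> SV i x
  dn : ∀ m -> x ≡ i + 1z + m * N -> s i x ≡ x - 1z -> SV i x
  st : ¬ x ~ i -> ¬ x ~ i + 1z -> s i x ≡ x -> SV i x

 sv : ∀ i x -> SV i x
 sv i x = go (tv i (i + 1z) x)
  where
   go : TV i (i + 1z) x -> SV i x
   go (isA m e) = up m e (cong (s i) e & t-a (i≁ i) m & l i (m * N) & cong (_+ 1z) (sym e))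
    where
     l : ∀ i k -> i + 1z + k ≡ i + k + 1z
     l = ring
   go (isB m e) = dn m e (cong (s i) e & t-b (i≁ i) m & l i (m * N) & cong (_- 1z) (sym e))
    where
     l : ∀ i k -> i + k ≡ i + 1z + k - 1z
     l = ring
   go (off p q) = st p q (t-o p q)

 s-inj : ∀ i x y -> s i x ≡ s i y -> x ≡ y
 s-inj i x y e = sym (t-inv i (i + 1z) x) & cong (s i) e & t-inv i (i + 1z) y

 s-bound : ∀ i x -> x - 1z ≤ s i x × s i x ≤ x + 1z
 s-bound i x = go (sv i x)
  where
   go : SV i x -> _
   go (up m e e') = subst (\z -> x - 1z ≤ z × z ≤ x + 1z) (sym e') (lia 1 (\x -> |- x :- #1 =< x :+ #1) x , Z.≤-refl)
   go (dn m e e') = subst (\z -> x - 1z ≤ z × z ≤ x + 1z) (sym e') (Z.≤-refl , lia 1 (\x -> |- x :- #1 =< x :+ #1) x)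
   go (st _ _ e') = subst (\z -> x - 1z ≤ z × z ≤ x + 1z) (sym e') (lia 1 (\x -> |- x :- #1 =< x) x , lia 1 (\x -> |- x =< x :+ #1) x)

 s-mono : ∀ i a b -> a < b -> ¬ (Σ ℤ \m -> a ≡ i + m * N × b ≡ i + 1z + m * N) -> s i a < s i b
 s-mono i a b l h = Z.≤∧≢⇒< (le (b ≟ a + 1z)) (\e -> Z.<-irrefl (s-inj i a b e) l)
  where
   adj : b ≡ a + 1z -> SV i a -> SV i b -> s i a ≤ s i b
   adj e (up m f _) _ = absurd (h (m , f , e & cong (_+ 1z) f & p i (m * N)))
    where
     p : ∀ i k -> i + k + 1z ≡ i + 1z + k
     p = ring
   adj e _ (dn m f g) = lia 4 (\a b x y -> b := a :+ #1 => y := b :- #1 => x =< a => |- x =< y) a b (s i a) (s i b) e g (le' (sv i a))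
    where
     le' : SV i a -> s i a ≤ a
     le' (up m' f' _) = absurd (h (m' , f' , e & cong (_+ 1z) f' & p i (m' * N)))
      where
       p : ∀ i k -> i + k + 1z ≡ i + 1z + k
       p = ring
     le' (dn _ _ g') = subst (_≤ a) (sym g') (lia 1 (\a -> |- a :- #1 =< a) a)
     le' (st _ _ g') = Z.≤-reflexive g'
   adj e (dn m f g) (st _ _ g') = lia 4 (\a b x y -> b := a :+ #1 => x := a :- #1 => y := b => |- x =< y) a b (s i a) (s i b) e g g'
   adj e (dn m f g) (up _ _ g') = lia 4 (\a b x y -> b := a :+ #1 => x := a :- #1 => y := b :+ #1 => |- x =< y) a b (s i a) (s i b) e g g'
   adj e (st _ _ g) (st _ _ g') = lia 4 (\a b x y -> b := a :+ #1 => x := a => y := b => |- x =< y) a b (s i a) (s i b) e g g'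
   adj e (st _ _ g) (up _ _ g') = lia 4 (\a b x y -> b := a :+ #1 => x := a => y := b :+ #1 => |- x =< y) a b (s i a) (s i b) e g g'
   le : Dec (b ≡ a + 1z) -> s i a ≤ s i b
   le (yes e) = adj e (sv i a) (sv i b)
   le (no ne) = lia 4 (\a b x y -> a :+ #1 :< b => x =< a :+ #1 => b :- #1 =< y => |- x =< y) a b (s i a) (s i b)
    (Z.≤∧≢⇒< (lia 2 (\a b -> a :< b => |- a :+ #1 =< b) a b l) (ne ∘ sym)) (snd (s-bound i a)) (fst (s-bound i b))

 s-Aff : ∀ {v} -> IsAff v -> ∀ i -> IsAff (v ·s i)
 s-Aff A i = t-Aff A i (i + 1z)

 ev-s : ∀ v i x -> ev (v ·s i) x ≡ ev v (s i x)
 ev-s v i = ev-t v i (i + 1z)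

 ev-sl : ∀ v i -> ev (v ·s i) i ≡ ev v (i + 1z)
 ev-sl v i = ev-s v i i & cong (ev v) (t-a0 (i≁ i))

 ev-sr : ∀ v i -> ev (v ·s i) (i + 1z) ≡ ev v i
 ev-sr v i = ev-s v i (i + 1z) & cong (ev v) (t-b0 (i≁ i))

 ss : ∀ v i -> v ·s i ·s i ≡ v
 ss v i = mulT-inv v i (i + 1z)

 -- By `s-mono`, s_i keeps the order of every pair of positions except the translates of (i, i + 1).
 -- So it matches the inversions of v with those of v s_i other than the new class `p0`.
 len-asc : ∀ v i -> ev v i < ev v (i + 1z) -> len (v ·s i) ≡ suc (len v)
 len-asc v i h = hc-unique (len-card w) (hc-insert {P = R} p0 (\r -> snd r refl)
  (NInv-nrm w i (i + 1z) (lia 1 (\i -> |- i :< i :+ #1) i , subst2 _<_ (sym (ev-sr v i)) (sym (ev-sl v i)) h))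
  (\_ -> fst) dec (hc-bij g g fP gP (len-card v)))
  where
   w = v ·s i
   p0 = nrm (i , i + 1z)
   g : ℤ × ℤ -> ℤ × ℤ
   g (a , b) = nrm (s i a , s i b)
   R : ℤ × ℤ -> Set
   R p = NInv w p × p ≢ p0
   dec : ∀ p -> NInv w p -> p ≡ p0 ⊎ R p
   dec p q with ΣP.≡-dec _≟_ _≟_ p p0
   ... | yes e = inl e
   ... | no ne = inr (q , ne)
   ws : ∀ x -> ev w (s i x) ≡ ev v x
   ws x = (ev-s v i _) & cong (ev v) (t-inv i (i + 1z) x)
   gg : ∀ a b -> 1z ≤ a -> a ≤ N -> g (g (a , b)) ≡ (a , b)
   gg a b h h' = cong2 (\x y -> nrm (x , y)) (e a) (e b) & nrm-shift a b (κ (s i a)) & nrm-id a b h h'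
    where
     e : ∀ x -> s i (s i x + κ (s i a) * N) ≡ x + κ (s i a) * N
     e x = t-per i (i + 1z) (s i x) (κ (s i a)) & cong (_+ κ (s i a) * N) (t-inv i (i + 1z) x)
   fP : ∀ p -> NInv v p -> R (g p) × g (g p) ≡ p
   fP (a , b) ((k , k') , l , l') = (NInv-nrm w _ _ (s-mono i a b l bad , subst2 _<_ (sym (ws b)) (sym (ws a)) l') , ne) , gg a b k k'
    where
     bad : ¬ (Σ ℤ \m -> a ≡ i + m * N × b ≡ i + 1z + m * N)
     bad (m , refl , refl) = Z.<-asym l' (subst2 _<_ (sym (ev-per v i m)) (sym (ev-per v (i + 1z) m)) (Z.+-monoˡ-< (m * N) h))
     ne : g (a , b) ≢ p0
     ne e = Z.<-asym l (subst2 _<_ (sym eb) (sym ea) (lia 2 (\i k -> |- i :+ k :< i :+ #1 :+ k) i (m * N)))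
      where
       m = κ i - κ (s i a)
       k2 : ∀ x y -> x + κ (s i a) * N ≡ y + κ i * N -> x ≡ y + m * N
       k2 x y e = l2 x y (κ (s i a)) (κ i) N e
        where
         l1 : ∀ x p N -> x ≡ x + p * N - p * N
         l1 = ring
         l3 : ∀ y p q N -> y + q * N - p * N ≡ y + (q - p) * N
         l3 = ring
         l2 : ∀ x y p q N -> x + p * N ≡ y + q * N -> x ≡ y + (q - p) * N
         l2 x y p q N e = l1 x p N & cong (_- p * N) e & l3 y p q N
       ea : a ≡ i + 1z + m * N
       ea = s-inj i a _ (k2 (s i a) i (cong fst e) & sym (t-b (i≁ i) m))
       eb : b ≡ i + m * N
       eb = s-inj i b _ (k2 (s i b) (i + 1z) (cong snd e) & sym (t-a (i≁ i) m))
   gP : ∀ p -> R p -> NInv v (g p) × g (g p) ≡ p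
   gP (a , b) (((k , k') , l , l') , ne) = NInv-nrm v _ _ (s-mono i a b l bad , subst2 _<_ (ev-s v i b) (ev-s v i a) l') , gg a b k k'
    where
     bad : ¬ (Σ ℤ \m -> a ≡ i + m * N × b ≡ i + 1z + m * N)
     bad (m , refl , refl) = ne (sym (nrm-id (i + m * N) (i + 1z + m * N) k k') & nrm-shift i (i + 1z) m)

 len-desc : ∀ v i -> ev v (i + 1z) < ev v i -> suc (len (v ·s i)) ≡ len v
 len-desc v i h = sym (len-asc (v ·s i) i (subst2 _<_ (sym (ev-sl v i)) (sym (ev-sr v i)) h)) & cong len (ss v i)

-- Reflections and Bruhat covers

module Bruhat (n : ℕ) {{nz : NonZero n}} (1<n : 1z < + n) where
 open Simple n 1<n public

 Free : Perm n -> ℤ -> ℤ -> Set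
 Free v a b = ∀ c -> a < c -> c < b -> ev v a < ev v c -> ev v c < ev v b -> ⊥

 -- The gain in length under a lengthening reflection is odd. Written as 1 + 2m, it lets the
 -- induction in `jump` change m by at most one, and the cover criterion becomes m = 0.
 record Jump (v : Perm n) (a b : ℤ) : Set where
  field
   m : ℕ
   len-t : len (mulT n v a b) ≡ suc (len v N.+ (m N.+ m))
   free : m ≡ 0 -> Free v a b
   free⁻¹ : Free v a b -> m ≡ 0

 -- Conjugating by s_a shortens the reflection t_ab; the length can only change
 -- by more than one when a + 1 lies between a and b in value.
 jump : ∀ k {v} -> IsAff v -> ∀ a b -> b ≤ a + 1z + + k -> a < b -> ¬ a ~ b -> ev v a < ev v b -> Jump v a b
 jump k {v} A a b le l h lv = go (b ≟ a + 1z)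
  where
   base : b ≡ a + 1z -> Jump v a b
   base refl = record { m = 0 ; len-t = trans (len-asc v a lv) (cong suc (sym (M.+-identityʳ (len v)))) ; free = \_ c p q _ _ -> lia 2 (\a c -> a :< c => c :< a :+ #1 => |- ff) a c p q ; free⁻¹ = \_ -> refl }
   u = mulT n v a b
   w = v ·s a
   b' = s a b
   wf : ∀ x -> ev w (s a x) ≡ ev v x
   wf x = (ev-s v a _) & cong (ev v) (t-inv a (a + 1z) x)
   sa : s a a ≡ a + 1z
   sa = t-a0 (i≁ a)
   usw : u ·s a ≡ mulT n w (a + 1z) b'
   usw = mulT-conj v a (a + 1z) h & cong (\x -> mulT n w x b') sa
   ua : ev u a ≡ ev v b
   ua = ev-t v a b a & cong (ev v) (t-a0 h)
   b≤ : b' ≤ b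
   b≤ = f (sv a b)
    where
     f : SV a b -> b' ≤ b
     f (up m e _) = absurd (h (→~ a b m e))
     f (dn m e e') = subst (_≤ b) (sym e') (lia 1 (\b -> |- b :- #1 =< b) b)
     f (st _ _ e') = Z.≤-reflexive e'
   h' : ¬ a + 1z ~ b'
   h' z = h (t-~ a (a + 1z) a b (cong (_%ℕ n) sa & z))
   -- whenever b ≡ a + 1 we have v(a+1) < v(b), and u has a descent at a
   dnlt : ∀ m -> b ≡ a + 1z + m * N -> 0z ≤ m * N
   dnlt m e = lia 3 (\a b k -> a :< b => b := a :+ #1 :+ k => |- #0 =< k) a b (m * N) l e
   step : ∀ k -> b ≤ a + 1z + + suc k -> b ≢ a + 1z -> Jump v a b
   step k le ne = tri (Z.<-cmp (ev v (a + 1z)) (ev v a)) (Z.<-cmp (ev v (a + 1z)) (ev v b))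
    where
     a+1<b : a + 1z < b
     a+1<b = Z.≤∧≢⇒< (lia 2 (\a b -> a :< b => |- a :+ #1 =< b) a b l) (ne ∘ sym)
     l' : a + 1z < b'
     l' = Z.≤∧≢⇒< (lia 3 (\a b b' -> a :+ #1 :< b => b :- #1 =< b' => |- a :+ #1 =< b') a b b' a+1<b (fst (s-bound a b))) (\e -> h' (cong (_%ℕ n) e))
     J : Jump w (a + 1z) b'
     J = jump k (s-Aff A a) (a + 1z) b' (lia 4 (\a b b' k -> b =< a :+ #1 :+ (#1 :+ k) => b' =< b => |- b' =< a :+ #1 :+ #1 :+ k) a b b' (+ k) le b≤)
      l' h' (subst2 _<_ (sym (ev-sr v a)) (sym (wf b)) lv)
     open Jump J
     wl = ev-sr v a
     len-us : len (u ·s a) ≡ suc (len w N.+ (m N.+ m))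
     len-us = cong len usw & len-t
     ua1 : (ev u (a + 1z) ≡ ev v (a + 1z)) ⊎ (ev v (a + 1z) < ev v b × ev u (a + 1z) < ev u a)
     ua1 = f (sv a b)
      where
       f : SV a b -> _
       f (up m e _) = absurd (h (→~ a b m e))
       f (st _ q _) = inl ((ev-t v a b _) & cong (ev v) (t-o (i≁ a ∘ sym) (q ∘ sym)))
       f (dn m e _) = inr (f1 (mcase m) , subst2 _<_ (sym e1) (sym ua) (f2 (mcase m)))
        where
         e0 : a + 1z ≡ b + (- m) * N
         e0 = l1 a m N & cong (_+ (- m) * N) (sym e)
          where
           l1 : ∀ a m N -> a + 1z ≡ a + 1z + m * N + (- m) * N
           l1 = ring
         e1 : ev u (a + 1z) ≡ ev v a + (- m) * N
         e1 = (ev-t v a b _) & cong (ev v) (cong (t a b) e0 & t-b h (- m)) & ev-per v a (- m)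
         e2 : ev v b ≡ ev v (a + 1z) + m * N
         e2 = cong (ev v) e & ev-per v (a + 1z) m
         e3 : (- m) * N ≡ 0z - m * N
         e3 = l1 m N
          where
           l1 : ∀ m N -> (- m) * N ≡ 0z - m * N
           l1 = ring
         f1 : MC m -> ev v (a + 1z) < ev v b
         f1 (pos' _ x) = lia 4 (\p q k N -> q := p :+ k => N =< k => #0 :< N => |- p :< q) (ev v (a + 1z)) (ev v b) (m * N) N e2 x 0<N
         f1 (nul x) = absurd (ne (e & cong (\k -> a + 1z + k * N) x & (+0N _)))
         f1 (neg _ x) = absurd (lia 3 (\k N -N -> #0 =< k => k =< -N => -N :+ N := #0 => #0 :< N => |- ff) (m * N) N (- N) (dnlt m e) x (Z.+-inverseˡ N) 0<N)
         f2 : MC m -> ev v a + (- m) * N < ev v b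
         f2 _ = lia 4 (\p q k k' -> p :< q => k' := #0 :- k => #0 =< k => |- p :+ k' :< q) (ev v a) (ev v b) (m * N) ((- m) * N) lv e3 (dnlt m e)
     u-desc : ev v (a + 1z) < ev v b -> ev u (a + 1z) < ev u a
     u-desc z = f ua1
      where
       f : _ -> _
       f (inl e) = subst2 _<_ (sym e) (sym ua) z
       f (inr (_ , r)) = r
     Free→ : Free v a b -> Free w (a + 1z) b'
     Free→ F c p q r r' = F (s a c) (lia 3 (\a c x -> a :+ #1 :< c => c :- #1 =< x => |- a :< x) a c (s a c) p (fst (s-bound a c)))
      (Z.≤∧≢⇒< (lia 4 (\b b' c x -> c :< b' => b' =< b => x =< c :+ #1 => |- x =< b) b b' c (s a c) q b≤ (snd (s-bound a c)))
       (\e -> Z.<-irrefl (cong (ev v) e) r2)) (subst2 _<_ wl (ev-s v a c) r) r2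
      where
       r2 : ev v (s a c) < ev v b
       r2 = subst2 _<_ (ev-s v a c) (wf b) r'
     Free← : (ev v a < ev v (a + 1z) -> ev v (a + 1z) < ev v b -> ⊥) -> Free w (a + 1z) b' -> Free v a b
     Free← nb F c p q r r' = F (s a c) (subst (_< s a c) sa (s-mono a a c p bad)) (s-mono a c b q bad')
      (subst2 _<_ (sym wl) (sym (wf c)) r) (subst2 _<_ (sym (wf c)) (sym (wf b)) r')
      where
       bad : ¬ (Σ ℤ \m -> a ≡ a + m * N × c ≡ a + 1z + m * N)
       bad (m , e , e') = nb (subst (\z -> ev v a < ev v z) c≡ r) (subst (\z -> ev v z < ev v b) c≡ r')
        where
         c≡ : c ≡ a + 1z
         c≡ = lia 3 (\a c k -> a := a :+ k => c := a :+ #1 :+ k => |- c := a :+ #1) a c (m * N) e e'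
       bad' : ¬ (Σ ℤ \m -> c ≡ a + m * N × b ≡ a + 1z + m * N)
       bad' (m , e , e') = nb
        (lia 5 (\x y z u k -> z := x :+ k => u := y :+ k => z :< u => |- x :< y) (ev v a) (ev v (a + 1z)) (ev v c) (ev v b) (m * N)
         (cong (ev v) e & ev-per v a m) e2 r')
        (ua2 ua1)
        where
         e2 = cong (ev v) e' & ev-per v (a + 1z) m
         ua2 : _ -> ev v (a + 1z) < ev v b
         ua2 (inr (x , _)) = x
         ua2 (inl _) = Z.≤∧≢⇒< (lia 3 (\y u k -> u := y :+ k => #0 =< k => |- y =< u) (ev v (a + 1z)) (ev v b) (m * N) e2 (dnlt m e')) (\z -> ne (sym (inj A _ _ z)))
     tri : _ -> _ -> Jump v a b
     -- v(a+1) < v(a)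
     tri (Tri.tri< x _ _) _ = record
      { m = m
      ; len-t = sym (len-desc u a (u-desc (Z.<-trans x lv))) & cong suc len-us & cong (\z -> suc (z N.+ (m N.+ m))) (len-desc v a x)
      ; free = \z -> Free← (\y _ -> Z.<-asym x y) (free z)
      ; free⁻¹ = \F -> free⁻¹ (Free→ F) }
     tri (Tri.tri≈ _ x _) _ = absurd (Z.<-irrefl (sym (inj A _ _ x)) (lia 1 (\a -> |- a :< a :+ #1) a))
     tri _ (Tri.tri≈ _ x _) = absurd (ne (sym (inj A _ _ x)))
     -- Here s_a lengthens v but shortens u, so the difference of lengths grows by two: m becomes
     -- `suc m`, and a + 1 is the position that refutes `Free`.
     tri (Tri.tri> _ _ x) (Tri.tri< y _ _) = record
      { m = suc m
      ; len-t = sym (len-desc u a (u-desc y)) & cong suc len-us & cong (\z -> suc (suc (z N.+ (m N.+ m)))) (len-asc v a x) & cong suc (ar (len v) m)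
      ; free = \()
      ; free⁻¹ = \F -> absurd (F (a + 1z) (lia 1 (\a -> |- a :< a :+ #1) a) a+1<b x y) }
      where
       ar : ∀ l m -> suc (suc l N.+ (m N.+ m)) ≡ l N.+ (suc m N.+ suc m)
       ar = ringN
     tri (Tri.tri> _ _ x) (Tri.tri> _ _ y) = record
      { m = m
      ; len-t = M.suc-injective (sym (len-asc u a u-asc) & len-us & cong (\z -> suc (z N.+ (m N.+ m))) (len-asc v a x))
      ; free = \z -> Free← (\_ y' -> Z.<-asym y y') (free z)
      ; free⁻¹ = \F -> free⁻¹ (Free→ F) }
      where
       u-asc : ev u a < ev u (a + 1z)
       u-asc = f ua1
        where
         f : _ -> _
         f (inl e) = subst2 _<_ (sym ua) (sym e) y
         f (inr (z , _)) = absurd (Z.<-asym y z)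
   k-case : ∀ k -> b ≤ a + 1z + + k -> b ≢ a + 1z -> Jump v a b
   go : Dec (b ≡ a + 1z) -> Jump v a b
   go (yes e) = base e
   go (no ne) = k-case k le ne
   k-case zero le ne = absurd (ne (lia 2 (\a b -> a :< b => b =< a :+ #1 :+ #0 => |- b := a :+ #1) a b l le))
   k-case (suc k) le ne = step k le ne

 Jump' : ∀ {v} -> IsAff v -> ∀ a b -> a < b -> ¬ a ~ b -> ev v a < ev v b -> Jump v a b
 Jump' A a b l = jump ℤ.∣ b - a ∣ A a b (subst (\z -> b ≤ a + 1z + z) (sym (Z.0≤i⇒+∣i∣≡i (Z.i≤j⇒0≤j-i (Z.<⇒≤ l)))) (lia 2 (\a b -> |- b =< a :+ #1 :+ (b :- a)) a b)) l

 len-up : ∀ {v} -> IsAff v -> ∀ a b -> a < b -> ¬ a ~ b -> ev v a < ev v b -> len v N.< len (mulT n v a b)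
 len-up {v} A a b l h lv = subst (len v N.<_) (sym (Jump.len-t J)) (s≤s (M.m≤m+n _ _))
  where
   J = Jump' A a b l h lv

 len-up⁻¹ : ∀ {v} -> IsAff v -> ∀ a b -> a < b -> ¬ a ~ b -> len v N.< len (mulT n v a b) -> ev v a < ev v b
 len-up⁻¹ {v} A a b l h lt = f (Z.<-cmp (ev v a) (ev v b))
  where
   w = mulT n v a b
   f : _ -> ev v a < ev v b
   f (Tri.tri< x _ _) = x
   f (Tri.tri≈ _ x _) = absurd (Z.<-irrefl (inj A _ _ x) l)
   f (Tri.tri> _ _ x) = absurd (M.<-asym lt (subst (\z -> len w N.< len z) (mulT-inv v a b)
    (len-up (t-Aff A a b) a b l h (subst2 _<_ (sym (ev-t v a b a & cong (ev v) (t-a0 h))) (sym (ev-t v a b b & cong (ev v) (t-b0 h))) x))))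

 Cov : Perm n -> ℤ -> ℤ -> Set
 Cov v a b = len (mulT n v a b) ≡ suc (len v)

 cov⁺ : ∀ {v} -> IsAff v -> ∀ a b -> a < b -> ¬ a ~ b -> ev v a < ev v b -> Free v a b -> Cov v a b
 cov⁺ {v} A a b l h lv F = Jump.len-t J & cong suc (cong (\m -> len v N.+ (m N.+ m)) (Jump.free⁻¹ J F) & (M.+-identityʳ _))
  where
   J = Jump' A a b l h lv

 cov⁻ : ∀ {v} -> IsAff v -> ∀ a b -> a < b -> ¬ a ~ b -> Cov v a b -> ev v a < ev v b × Free v a b
 cov⁻ {v} A a b l h c = lv , Jump.free J (m0 (Jump.m J) (M.+-cancelˡ-≡ (len v) _ _ (M.suc-injective (sym (Jump.len-t J) & c) & sym (M.+-identityʳ _))))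
  where
   lv = len-up⁻¹ A a b l h (M.≤-reflexive (sym c))
   J = Jump' A a b l h lv
   m0 : ∀ m -> m N.+ m ≡ 0 -> m ≡ 0
   m0 zero _ = refl

 mulT-sym : ∀ v a b -> mulT n v a b ≡ mulT n v b a
 mulT-sym v a b = ext _ _ \x -> ev-t v a b x & cong (ev v) (t-sym a b x) & sym (ev-t v b a x)

 bd : Perm n -> ℕ
 bd v = n N.+ B v N.+ B v

 -- If b lies more than n beyond a, then b - n is a position strictly between them whose value is
 -- below v(b). The cover condition forces v(b) - n ≤ v(a), and the displacement bound `B` then
 -- limits b - a.
 cov-bound : ∀ {v} -> IsAff v -> ∀ a b -> a < b -> ¬ a ~ b -> Cov v a b -> b ≤ a + + bd v
 cov-bound {v} A a b l h c = f (a + N <? b)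
  where
   B0 : 0z ≤ + B v
   B0 = ℤ.+≤+ z≤n
   f : Dec (a + N < b) -> b ≤ a + + bd v
   f (no p) = lia 4 (\a b N B -> b =< a :+ N => #0 =< B => |- b =< a :+ (N :+ B :+ B)) a b N (+ B v) (Z.≮⇒≥ p) B0
   f (yes p) = g (ev v a <? ev v (b - 1z * N))
    where
     e : ev v (b - 1z * N) ≡ ev v b - N
     e = cong (ev v) (l1 b N) & ev-per v b (- 1z) & sym (l1' (ev v b) N)
      where
       l1 : ∀ b N -> b - 1z * N ≡ b + (- 1z) * N
       l1 = ring
       l1' : ∀ b N -> b - N ≡ b + (- 1z) * N
       l1' = ring
     e1 : 1z * N ≡ N
     e1 = Z.*-identityˡ N
     g : Dec (ev v a < ev v (b - 1z * N)) -> b ≤ a + + bd v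
     g (yes q) = absurd (snd (cov⁻ A a b l h c) (b - 1z * N) (lia 4 (\a b N M -> a :+ N :< b => M := N => |- a :< b :- M) a b N (1z * N) p e1)
      (lia 3 (\b N M -> M := N => #0 :< N => |- b :- M :< b) b N (1z * N) e1 0<N)
      q (lia 3 (\x y N -> x := y :- N => #0 :< N => |- x :< y) (ev v (b - 1z * N)) (ev v b) N e 0<N))
     g (no q) = lia 7 (\a b N B x y z -> z =< x => z := y :- N => b :- B =< y => x =< a :+ B => |- b =< a :+ (N :+ B :+ B)) a b N (+ B v) (ev v a) (ev v b) (ev v (b - 1z * N))
      (Z.≮⇒≥ q) e (fst (B-bound v b)) (snd (B-bound v a))

 Cov? : ∀ v r j -> Dec ((¬ r ~ j) × Cov v r j)
 Cov? v r j = ¬? (r ~? j) ×-dec (len (mulT n v r j) N.≟ suc (len v))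

 covs : Perm n -> ℤ -> List ℤ
 covs v r = filter (Cov? v r) (range (r - + bd v) (suc (bd v N.+ bd v)))

 covs-unique : ∀ v r -> Unique (covs v r)
 covs-unique v r = UP.filter⁺ (Cov? v r) (range-unique _ _)

 covs⁻ : ∀ v r j -> j ∈ covs v r -> (¬ r ~ j) × Cov v r j
 covs⁻ v r j m = snd (∈-filter⁻ (Cov? v r) {xs = range (r - + bd v) (suc (bd v N.+ bd v))} m)

 covs⁺ : ∀ {v} -> IsAff v -> ∀ r j -> ¬ r ~ j -> Cov v r j -> j ∈ covs v r
 covs⁺ {v} A r j h c = ∈-filter⁺ (Cov? v r) (f (Z.<-cmp r j)) (h , c)
  where
   D0 : 0z ≤ + bd v
   D0 = ℤ.+≤+ z≤n
   f : _ -> j ∈ range (r - + bd v) (suc (bd v N.+ bd v))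
   f (Tri.tri≈ _ x _) = absurd (h (cong (_%ℕ n) x))
   f (Tri.tri< x _ _) = ∈-range⁺ _ _ j (lia 3 (\r j d -> r :< j => #0 =< d => |- r :- d =< j) r j (+ bd v) x D0)
    (lia 3 (\r j d -> j =< r :+ d => |- j :< r :- d :+ (#1 :+ (d :+ d))) r j (+ bd v) (cov-bound A r j x h c))
   f (Tri.tri> _ _ x) = ∈-range⁺ _ _ j (lia 3 (\r j d -> r =< j :+ d => |- r :- d =< j) r j (+ bd v) (cov-bound A j r x (h ∘ sym) (cong len (mulT-sym v j r) & c)))
    (lia 3 (\r j d -> j :< r => #0 =< d => |- j :< r :- d :+ (#1 :+ (d :+ d))) r j (+ bd v) x D0)

-- Operators indexed by words

module Fun' {V : Set} (Ok : V -> Set) where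

 Fn : Set
 Fn = V -> ℤ

 infix 4 _≈_
 -- Comparison only at `Ok` arguments, later the windows of genuine affine permutations: lengths,
 -- and with them the sums over covers, are controlled only for bijections.
 _≈_ : Fn -> Fn -> Set
 φ ≈ ψ = ∀ v -> Ok v -> φ v ≡ ψ v

 ≈r : ∀ {φ} -> φ ≈ φ
 ≈r v _ = refl

 ≈s : ∀ {φ ψ} -> φ ≈ ψ -> ψ ≈ φ
 ≈s p v o = sym (p v o)

 infixr 2 _⟫_
 _⟫_ : ∀ {φ ψ χ} -> φ ≈ ψ -> ψ ≈ χ -> φ ≈ χ
 (p ⟫ q) v o = p v o & q v o

 O : Fn
 O _ = 0z

 infixl 6 _⊹_
 _⊹_ : Fn -> Fn -> Fn
 (φ ⊹ ψ) v = φ v + ψ v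

 infixr 7 _⋆_
 _⋆_ : ℤ -> Fn -> Fn
 (c ⋆ φ) v = c * φ v

 ⊹-cong : ∀ {φ φ' ψ ψ'} -> φ ≈ φ' -> ψ ≈ ψ' -> φ ⊹ ψ ≈ φ' ⊹ ψ'
 ⊹-cong p q v o = cong2 _+_ (p v o) (q v o)

 ⋆-cong : ∀ c {φ ψ} -> φ ≈ ψ -> c ⋆ φ ≈ c ⋆ ψ
 ⋆-cong c p v o = cong (c *_) (p v o)

 ΣF : {A : Set} -> List A -> (A -> Fn) -> Fn
 ΣF xs f v = ΣL xs (\x -> f x v)

 ΣF-cong : {A : Set} (xs : List A) {f g : A -> Fn} -> (∀ x -> f x ≈ g x) -> ΣF xs f ≈ ΣF xs g
 ΣF-cong xs h v o = Σ-cong xs (\x -> h x v o)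

 record Lin (L : Fn -> Fn) : Set where
  field
   lcong : ∀ {φ ψ} -> φ ≈ ψ -> L φ ≈ L ψ
   ladd : ∀ φ ψ -> L (φ ⊹ ψ) ≈ L φ ⊹ L ψ
   lscl : ∀ c φ -> L (c ⋆ φ) ≈ c ⋆ L φ

  lzero : L O ≈ O
  lzero v o = lcong {O} {0z ⋆ O} (\_ _ -> refl) v o & lscl 0z O v o & Z.*-zeroˡ (L O v)

  lO : ∀ {φ} -> φ ≈ O -> L φ ≈ O
  lO p = lcong p ⟫ lzero

  lΣ : {A : Set} (xs : List A) (f : A -> Fn) -> L (ΣF xs f) ≈ ΣF xs (\x -> L (f x))
  lΣ [] f = lzero
  lΣ (x ∷ xs) f = ladd (f x) (ΣF xs f) ⟫ ⊹-cong {L (f x)} {L (f x)} ≈r (lΣ xs f)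

 open Lin public

 Lin-∘ : ∀ {K L} -> Lin K -> Lin L -> Lin (\φ -> K (L φ))
 Lin-∘ k l = record
  { lcong = \p -> lcong k (lcong l p)
  ; ladd = \φ ψ -> lcong k (ladd l φ ψ) ⟫ ladd k _ _
  ; lscl = \c φ -> lcong k (lscl l c φ) ⟫ lscl k c _ }

 Lin-id : Lin id
 Lin-id = record { lcong = id ; ladd = \_ _ _ _ -> refl ; lscl = \_ _ _ _ -> refl }

 Lin-ΣF : {A : Set} (xs : List A) {K : A -> Fn -> Fn} -> (∀ x -> Lin (K x)) -> Lin (\φ -> ΣF xs (\x -> K x φ))
 Lin-ΣF xs {K} k = record
  { lcong = \p -> ΣF-cong xs (\x -> lcong (k x) p)
  ; ladd = \φ ψ v o -> Σ-cong xs (\x -> ladd (k x) φ ψ v o) & (Σ-+ xs (\x -> K x φ v) (\x -> K x ψ v))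
  ; lscl = \c φ v o -> trans (Σ-cong xs (\x -> lscl (k x) c φ v o)) (Σ-* c xs (\x -> K x φ v)) }

 Lin-⋆ : ∀ c {K} -> Lin K -> Lin (\φ -> c ⋆ K φ)
 Lin-⋆ c {K} k = record
  { lcong = \p -> ⋆-cong c (lcong k p)
  ; ladd = \φ ψ v o -> cong (c *_) (ladd k φ ψ v o) & Z.*-distribˡ-+ c (K φ v) (K ψ v)
  ; lscl = \d φ v o -> trans (cong (c *_) (lscl k d φ v o)) (l c d (K φ v)) }
  where
   l : ∀ c d x -> c * (d * x) ≡ d * (c * x)
   l = ring

 -- A sum over words whose i-th letter is drawn from the i-th list. The nesting splits off the first
 -- letter by definition and the last one by `sumQ-rot`, which is what rotation of cyclic words
 -- needs.
 sumQ : {A : Set} -> List (List A) -> (List A -> Fn) -> Fn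
 sumQ [] f = f []
 sumQ (Q ∷ Qs) f = ΣF Q (\q -> sumQ Qs (\w -> f (q ∷ w)))

 module _ {A : Set} where

  sumQ-cong : (Qs : List (List A)) {f g : List A -> Fn} -> (∀ w -> length w ≡ length Qs -> f w ≈ g w) -> sumQ Qs f ≈ sumQ Qs g
  sumQ-cong [] h = h [] refl
  sumQ-cong (Q ∷ Qs) h = ΣF-cong Q (\q -> sumQ-cong Qs (\w e -> h (q ∷ w) (cong suc e)))

  sumQ-+ : (Qs : List (List A)) (f g : List A -> Fn) -> sumQ Qs (\w -> f w ⊹ g w) ≈ sumQ Qs f ⊹ sumQ Qs g
  sumQ-+ [] f g = ≈r
  sumQ-+ (Q ∷ Qs) f g v o = Σ-cong Q (\q -> sumQ-+ Qs _ _ v o) & (Σ-+ Q (\q -> sumQ Qs (\w -> f (q ∷ w)) v) (\q -> sumQ Qs (\w -> g (q ∷ w)) v))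

  sumQ-lin : ∀ {L} -> Lin L -> (Qs : List (List A)) (f : List A -> Fn) -> L (sumQ Qs f) ≈ sumQ Qs (\w -> L (f w))
  sumQ-lin l [] f = ≈r
  sumQ-lin l (Q ∷ Qs) f = lΣ l Q _ ⟫ ΣF-cong Q (\q -> sumQ-lin l Qs (\w -> f (q ∷ w)))

  sumQ-O : (Qs : List (List A)) {f : List A -> Fn} -> (∀ w -> length w ≡ length Qs -> f w ≈ O) -> sumQ Qs f ≈ O
  sumQ-O [] h = h [] refl
  sumQ-O (Q ∷ Qs) h v o = Σ-0 Q (\q _ -> sumQ-O Qs (\w e -> h (q ∷ w) (cong suc e)) v o)

  sumQ-++ : (Ps Qs : List (List A)) (f : List A -> Fn) -> sumQ (Ps ++ Qs) f ≈ sumQ Ps (\p -> sumQ Qs (\q -> f (p ++ q)))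
  sumQ-++ [] Qs f = ≈r
  sumQ-++ (P ∷ Ps) Qs f = ΣF-cong P (\x -> sumQ-++ Ps Qs (\w -> f (x ∷ w)))

  sumQ-ΣF : {B : Set} (Qs : List (List A)) (ys : List B) (f : List A -> B -> Fn) -> sumQ Qs (\w -> ΣF ys (f w)) ≈ ΣF ys (\y -> sumQ Qs (\w -> f w y))
  sumQ-ΣF [] ys f = ≈r
  sumQ-ΣF (Q ∷ Qs) ys f v o = Σ-cong Q (\q -> sumQ-ΣF Qs ys (\w -> f (q ∷ w)) v o) & Σ-swap Q ys (\q y -> sumQ Qs (\w -> f (q ∷ w) y) v)

  sumQ-swap : {B : Set} (Ps : List (List A)) (Qs : List (List B)) (f : List A -> List B -> Fn) -> sumQ Ps (\p -> sumQ Qs (f p)) ≈ sumQ Qs (\q -> sumQ Ps (\p -> f p q))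
  sumQ-swap Ps [] f = ≈r
  sumQ-swap Ps (Q ∷ Qs) f = sumQ-ΣF Ps Q (\p q -> sumQ Qs (\w -> f p (q ∷ w))) ⟫ ΣF-cong Q (\q -> sumQ-swap Ps Qs (\p w -> f p (q ∷ w)))

  sumQ-rot : ∀ m (Q : List A) (f : List A -> Fn) -> sumQ (replicate (suc m) Q) f ≈ sumQ (replicate m Q) (\w -> ΣF Q (\q -> f (w ++ [ q ])))
  sumQ-rot zero Q f = ≈r
  sumQ-rot (suc m) Q f = ΣF-cong Q (\q -> sumQ-rot m Q (\w -> f (q ∷ w)))

-- The affine nil-Coxeter relations and words of cyclic subsets.

module Words (n : ℕ) {{nz : NonZero n}} {V : Set} (Ok : V -> Set) (U : ℤ -> (V -> ℤ) -> V -> ℤ) where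
 open Fun' Ok public

 private
  N = + n

 -- The affine nil-Coxeter relations. The braid relation is guarded because for n = 2 the two
 -- generators satisfy none.
 record Nil : Set where
  field
   U-lin : ∀ i -> Lin (U i)
   U-per : ∀ i m φ -> U (i + m * N) φ ≈ U i φ
   U-nil : ∀ i φ -> U i (U i φ) ≈ O
   U-far : ∀ i j φ -> i + 1z < j -> j + 1z < i + N -> U i (U j φ) ≈ U j (U i φ)
   U-braid : + 2 < N -> ∀ i φ -> U i (U (i + 1z) (U i φ)) ≈ U (i + 1z) (U i (U (i + 1z) φ))

 UW : List ℤ -> Fn -> Fn
 UW [] φ = φ
 UW (i ∷ w) φ = U i (UW w φ)

 UM : List ℤ ⊎ ⊤ -> Fn -> Fn
 UM (inl w) φ = UW w φ
 UM (inr _) φ = O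

 I : ℤ -> List Bool -> List ℤ
 I a [] = []
 I a (true ∷ S) = a ∷ I (a + 1z) S
 I a (false ∷ S) = I (a + 1z) S

 -- `k` holds the letters met before the first gap. In the cyclic order that starts at the gap they
 -- come last, so they are placed after all later letters. Reaching the end without a gap yields no
 -- word.
 go : ℤ -> List Bool -> List ℤ -> List ℤ ⊎ ⊤
 go a [] k = inr tt
 go a (true ∷ S) k = go (a + 1z) S (k ++ [ a ])
 go a (false ∷ S) k = inl (I (a + 1z) S ++ k)

 -- The increasing word of the cyclic subset S read from a gap; S lists the
 -- letters r, r+1, …, r+n-1, and the full subset has no word.
 cw : ℤ -> List Bool -> List ℤ ⊎ ⊤
 cw r S = go r S []

 rev : List ℤ ⊎ ⊤ -> List ℤ ⊎ ⊤
 rev (inl w) = inl (reverse w)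
 rev (inr x) = inr x

 ∥_∥ : List Bool -> ℕ
 ∥ [] ∥ = 0
 ∥ true ∷ S ∥ = suc ∥ S ∥
 ∥ false ∷ S ∥ = ∥ S ∥

 bools : ℕ -> List (List Bool)
 bools m = replicate m (true ∷ false ∷ [])

 module Laws (nil : Nil) where
  open Nil nil

  UW-lin : ∀ w -> Lin (UW w)
  UW-lin [] = Lin-id
  UW-lin (i ∷ w) = Lin-∘ (U-lin i) (UW-lin w)

  UW-++ : ∀ x y φ -> UW (x ++ y) φ ≈ UW x (UW y φ)
  UW-++ [] y φ = ≈r
  UW-++ (i ∷ x) y φ = lcong (U-lin i) (UW-++ x y φ)

  UM-lin : ∀ w -> Lin (UM w)
  UM-lin (inl w) = UW-lin w
  UM-lin (inr _) = record { lcong = \_ -> ≈r ; ladd = \_ _ -> ≈r ; lscl = \c _ _ _ -> sym (Z.*-zeroʳ c) }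

  Far : ℤ -> ℤ -> Set
  Far i j = ∀ φ -> U i (U j φ) ≈ U j (U i φ)

  far1 : ∀ {i x} -> All (Far i) x -> ∀ φ -> U i (UW x φ) ≈ UW x (U i φ)
  far1 [] φ = ≈r
  far1 {i} (_∷_ {j} p ps) φ = p _ ⟫ lcong (U-lin j) (far1 ps φ)

  FarW : List ℤ -> List ℤ -> Set
  FarW x y = All (\i -> All (Far i) y) x

  farW : ∀ {x y} -> FarW x y -> ∀ φ -> UW x (UW y φ) ≈ UW y (UW x φ)
  farW [] φ = ≈r
  farW {i ∷ x} (p ∷ ps) φ = lcong (U-lin i) (farW ps φ) ⟫ far1 p (UW x φ)

  All-reverse : {A : Set} {P : A -> Set} {x : List A} -> All P x -> All P (reverse x)
  All-reverse {x = x} p = All.tabulate (\m -> All.lookup p (AnyP.reverse⁻ m))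

  farW-rev : ∀ {x y} -> FarW x y -> FarW (reverse x) (reverse y)
  farW-rev p = All-reverse (All.map All-reverse p)

  -- Equality of words together with their reverses, so that statements about
  -- decreasing words follow from those about increasing ones.
  infix 4 _≅_
  record _≅_ (x y : List ℤ ⊎ ⊤) : Set where
   constructor _,_
   field
    fw : ∀ φ -> UM x φ ≈ UM y φ
    bw : ∀ φ -> UM (rev x) φ ≈ UM (rev y) φ
  open _≅_ public

  ≅r : ∀ {x} -> x ≅ x
  ≅r = (\_ -> ≈r) , (\_ -> ≈r)

  ≅s : ∀ {x y} -> x ≅ y -> y ≅ x
  ≅s (p , q) = (\φ -> ≈s (p φ)) , (\φ -> ≈s (q φ))

  ≅t : ∀ {x y z} -> x ≅ y -> y ≅ z -> x ≅ z
  ≅t (p , q) (p' , q') = (\φ -> p φ ⟫ p' φ) , (\φ -> q φ ⟫ q' φ)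

  ≅≡ : ∀ {x y} -> x ≡ y -> x ≅ y
  ≅≡ refl = ≅r

  UW-rev++ : ∀ x y φ -> UW (reverse (x ++ y)) φ ≈ UW (reverse y) (UW (reverse x) φ)
  UW-rev++ x y φ rewrite L.reverse-++ x y = UW-++ (reverse y) (reverse x) φ

  ≅-++ : ∀ {x x' y y'} -> inl x ≅ inl x' -> inl y ≅ inl y' -> inl (x ++ y) ≅ inl (x' ++ y')
  ≅-++ {x} {x'} {y} {y'} (p , q) (p' , q') =
   (\φ -> UW-++ x y φ ⟫ lcong (UW-lin x) (p' φ) ⟫ p _ ⟫ ≈s (UW-++ x' y' φ)) ,
   (\φ -> UW-rev++ x y φ ⟫ lcong (UW-lin (reverse y)) (q φ) ⟫ q' _ ⟫ ≈s (UW-rev++ x' y' φ))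

  ≅-far : ∀ {x y} -> FarW x y -> inl (x ++ y) ≅ inl (y ++ x)
  ≅-far {x} {y} f = (\φ -> UW-++ x y φ ⟫ farW f φ ⟫ ≈s (UW-++ y x φ)) ,
   (\φ -> UW-rev++ x y φ ⟫ ≈s (farW (farW-rev f) φ) ⟫ ≈s (UW-rev++ y x φ))

  ≅-per : ∀ a m -> inl [ a + m * N ] ≅ inl [ a ]
  ≅-per a m = (\φ -> U-per a m φ) , (\φ -> U-per a m φ)

  +1s : ∀ a k -> a + 1z + + k ≡ a + + suc k
  +1s a k = Z.+-assoc a 1z (+ k)

  I-++ : ∀ a S T -> I a (S ++ T) ≡ I a S ++ I (a + + length S) T
  I-++ a [] T = cong (\z -> I z T) (sym (+0 a))
  I-++ a (true ∷ S) T = cong (a ∷_) (I-++ (a + 1z) S T & cong (\z -> I (a + 1z) S ++ I z T) (+1s a (length S)))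
  I-++ a (false ∷ S) T = I-++ (a + 1z) S T & cong (\z -> I (a + 1z) S ++ I z T) (+1s a (length S))

  I-range : ∀ a S -> All (\j -> a ≤ j × j < a + + length S) (I a S)
  I-range a [] = []
  I-range a (true ∷ S) = (Z.≤-refl , lia 2 (\a k -> #0 =< k => |- a :< a :+ (#1 :+ k)) a (+ length S) (ℤ.+≤+ z≤n)) ∷ All.map (\ {j} -> f j) (I-range (a + 1z) S)
   where
    f : ∀ j -> _ -> _
    f j (p , q) = lia 2 (\a j -> a :+ #1 =< j => |- a =< j) a j p , subst (j <_) (+1s a (length S)) q
  I-range a (false ∷ S) = All.map (\ {j} -> f j) (I-range (a + 1z) S)
   where
    f : ∀ j -> _ -> _
    f j (p , q) = lia 2 (\a j -> a :+ #1 =< j => |- a =< j) a j p , subst (j <_) (+1s a (length S)) q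

  -- I a S and I b T are far apart when a gap separates them on either side.
  I-far : ∀ a S b T -> a + + length S < b -> b + + length T < a + N -> FarW (I a S) (I b T)
  I-far a S b T h h' = All.map (\ {i} (p , q) -> All.map (\ {j} (p' , q') φ -> U-far i j φ
   (lia 5 (\a s b i j -> a :+ s :< b => i :< a :+ s => b =< j => |- i :+ #1 :< j) a (+ length S) b i j h q p')
   (lia 6 (\a b t i j N -> b :+ t :< a :+ N => a =< i => j :< b :+ t => |- j :+ #1 :< i :+ N) a b (+ length T) i j N h' p q'))
   (I-range b T)) (I-range a S)

-- Increasing and decreasing cyclic words commute

module Commute (n : ℕ) {{nz : NonZero n}} {V : Set} (Ok : V -> Set) (U : ℤ -> (V -> ℤ) -> V -> ℤ) (nil : Words.Nil n Ok U) where
 open Words n Ok U public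
 open Nil nil public
 open Laws nil public

 private
  N = + n

 go-cong : ∀ a S {k k'} -> inl k ≅ inl k' -> go a S k ≅ go a S k'
 go-cong a [] p = ≅r
 go-cong a (true ∷ S) p = go-cong (a + 1z) S (≅-++ p (≅r {inl [ a ]}))
 go-cong a (false ∷ S) p = ≅-++ (≅r {inl (I (a + 1z) S)}) p

 go-true : ∀ a S k -> go a (S ++ [ true ]) k ≡ go a S (a + + length S ∷ k)
 go-true a [] k = refl
 go-true a (true ∷ S) k = go-true (a + 1z) S (k ++ [ a ]) & cong (\z -> go (a + 1z) S (z ∷ k ++ [ a ])) (+1s a (length S))
 go-true a (false ∷ S) k = cong inl (cong (_++ k) (I-++ (a + 1z) S [ true ]) &
  (L.++-assoc (I (a + 1z) S) _ k) & cong (\z -> I (a + 1z) S ++ z ∷ k) (+1s a (length S)))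

 -- A word may be broken at its last gap instead of its first: the blocks on the two sides contain
 -- no neighbouring letters, in either direction around the circle, and therefore commute. `T` is
 -- the block already read.
 go-false : ∀ a S b T -> b + + length T ≡ a -> a + + length S < b + N -> go a (S ++ [ false ]) (I b T) ≅ inl (I b T ++ I a S)
 go-false a [] b T e h = ≅≡ (cong inl (sym (L.++-identityʳ (I b T))))
 go-false a (true ∷ S) b T e h = subst (\z -> go (a + 1z) (S ++ [ false ]) z ≅ inl (I b T ++ a ∷ I (a + 1z) S)) k≡
  (≅t (go-false (a + 1z) S b (T ++ [ true ]) e' (subst (_< b + N) (sym (+1s a (length S))) h))
   (≅≡ (cong inl (cong (_++ I (a + 1z) S) k≡ & (L.++-assoc (I b T) [ a ] _)))))
  where
   k≡ : I b (T ++ [ true ]) ≡ I b T ++ [ a ]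
   k≡ = (I-++ b T [ true ]) & cong (\z -> I b T ++ [ z ]) e
   e' : b + + length (T ++ [ true ]) ≡ a + 1z
   e' = cong (\z -> b + + z) (L.length-++ T) & sym (Z.+-assoc b (+ length T) 1z) & cong (_+ 1z) e
 go-false a (false ∷ S) b T e h = ≅t (≅≡ (cong (\z -> inl (z ++ I b T)) ((I-++ (a + 1z) S [ false ]) & (L.++-identityʳ _))))
  (≅s (≅-far (I-far b T (a + 1z) S (subst (_< a + 1z) (sym e) (lia 1 (\a -> |- a :< a :+ #1) a)) (subst (_< b + N) (sym (+1s a (length S))) h))))

 len-n : ∀ r {S : List Bool} {b} -> length (b ∷ S) ≡ n -> r + 1z + + length S ≡ r + N
 len-n r {S} e = +1s r (length S) & cong (\z -> r + + z) e

 cw-gap : ∀ r S -> length S N.< n -> cw r (S ++ [ false ]) ≅ inl (I r S)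
 cw-gap r S h = go-false r S r [] (+0 r) (Z.+-monoʳ-< r (ℤ.+<+ h))

 -- Moving the first bit to the end changes where the circle is cut and not the operator: the letter
 -- r reappears as r + n, and the generators are periodic.
 cw-rot : ∀ r b S -> length (b ∷ S) ≡ n -> cw r (b ∷ S) ≅ cw (r + 1z) (S ++ [ b ])
 cw-rot r true S e = ≅s (≅t (≅≡ (go-true (r + 1z) S [])) (go-cong (r + 1z) S
  (≅t (≅≡ (cong (\z -> inl [ z ]) (len-n r {S} {true} e & cong (_+_ r) (sym (Z.*-identityˡ N))))) (≅-per r 1z))))
 cw-rot r false S e = ≅s (≅t (cw-gap (r + 1z) S (M.≤-reflexive e)) (≅≡ (cong inl (sym (L.++-identityʳ _)))))

 cw-rotN : ∀ r X Y -> length (X ++ Y) ≡ n -> cw r (X ++ Y) ≅ cw (r + + length X) (Y ++ X)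
 cw-rotN r [] Y e = ≅≡ (cong2 cw (sym (+0 r)) (sym (L.++-identityʳ Y)))
 cw-rotN r (x ∷ X) Y e = ≅t (cw-rot r x (X ++ Y) e) (≅t (≅≡ (cong (cw (r + 1z)) (L.++-assoc X Y [ x ])))
  (≅t (cw-rotN (r + 1z) X (Y ++ [ x ]) e') (≅≡ (cong2 cw (+1s r (length X)) (L.++-assoc Y [ x ] X)))))
  where
   e' : length (X ++ Y ++ [ x ]) ≡ n
   e' = cong length (sym (L.++-assoc X Y [ x ])) & L.length-++ (X ++ Y) & (M.+-comm _ 1) & e

 I-per : ∀ a m S -> inl (I (a + m * N) S) ≅ inl (I a S)
 I-per a m [] = ≅r
 I-per a m (true ∷ S) = ≅-++ {[ a + m * N ]} {[ a ]} (≅-per a m) (≅t (≅≡ (cong (\z -> inl (I z S)) (l a (m * N)))) (I-per (a + 1z) m S))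
  where
   l : ∀ a k -> a + k + 1z ≡ a + 1z + k
   l = ring
 I-per a m (false ∷ S) = ≅t (≅≡ (cong (\z -> inl (I z S)) (l a (m * N)))) (I-per (a + 1z) m S)
  where
   l : ∀ a k -> a + k + 1z ≡ a + 1z + k
   l = ring

 -- One residue of a pair of subsets (S, T): the first bit is membership in S, which is read
 -- increasingly, the second is membership in T, which is read decreasingly. A pair of subsets
 -- becomes a word in four states.
 St : Set
 St = Bool × Bool

 pattern ∅ = (false , false)
 pattern 𝕤 = (true , false)
 pattern 𝕥 = (false , true)
 pattern 𝕓 = (true , true)

 fs ts : List St -> List Bool
 fs = map fst
 ts = map snd

 q3 : List St
 q3 = 𝕤 ∷ 𝕥 ∷ 𝕓 ∷ []

 -- `false` forbids the empty state. Words will be sorted by the position of their first empty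
 -- state, which leaves nonempty states before it and arbitrary ones after it.
 Q : Bool -> List St
 Q true = ∅ ∷ q3
 Q false = q3

 -- Weights that see only the two cardinalities serve both purposes below: Kronecker deltas for the
 -- commutation of `H` with `E`, and alternating signs for the relation between them.
 Wt : Set
 Wt = ℕ -> ℕ -> ℤ

 wt : Wt -> List St -> ℤ
 wt c w = c ∥ fs w ∥ ∥ ts w ∥

 bit : Bool -> ℕ
 bit true = 1
 bit false = 0

 sh : St -> Wt -> Wt
 sh (x , y) c i j = c (bit x N.+ i) (bit y N.+ j)

 wt-∷ : ∀ c q w -> wt c (q ∷ w) ≡ wt (sh q c) w
 wt-∷ c ∅ w = refl
 wt-∷ c 𝕤 w = refl
 wt-∷ c 𝕥 w = refl
 wt-∷ c 𝕓 w = refl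

 UI UR : ℤ -> List Bool -> Fn -> Fn
 UI a S = UW (I a S)
 UR a S = UW (reverse (I a S))

 UI-lin : ∀ a S -> Lin (UI a S)
 UI-lin a S = UW-lin (I a S)

 UR-lin : ∀ a S -> Lin (UR a S)
 UR-lin a S = UW-lin (reverse (I a S))

 u : Bool -> ℤ -> Fn -> Fn
 u true a = U a
 u false a = id

 u-lin : ∀ x a -> Lin (u x a)
 u-lin true a = U-lin a
 u-lin false a = Lin-id

 UI-∷ : ∀ a x S φ -> UI a (x ∷ S) φ ≡ u x a (UI (a + 1z) S φ)
 UI-∷ a true S φ = refl
 UI-∷ a false S φ = refl

 UR-∷ : ∀ a x S φ -> UR a (x ∷ S) φ ≈ UR (a + 1z) S (u x a φ)
 UR-∷ a false S φ = ≈r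
 UR-∷ a true S φ rewrite L.unfold-reverse a (I (a + 1z) S) = UW-++ (reverse (I (a + 1z) S)) [ a ] φ

 farU : ∀ a S -> a + 1z + + length S < a + N -> ∀ b -> a + 1z < b -> b + + length S < a + N -> All (Far a) (I b S)
 farU a S _ b h h' = All.map (\ {j} (p , q) φ -> U-far a j φ (Z.<-≤-trans h p)
  (lia 5 (\a b l j N -> j :< b :+ l => b :+ l :< a :+ N => |- j :+ #1 :< a :+ N) a b (+ length S) j N q h')) (I-range b S)

 u-UI : ∀ a x S -> a + 1z + 1z + + length S < a + N -> ∀ φ -> u x a (UI (a + 1z + 1z) S φ) ≈ UI (a + 1z + 1z) S (u x a φ)
 u-UI a false S h φ = ≈r
 u-UI a true S h φ = far1 (farU a S (lia 3 (\a l N -> a :+ #1 :+ #1 :+ l :< a :+ N => |- a :+ #1 :+ l :< a :+ N) a (+ length S) N h) (a + 1z + 1z) (lia 1 (\a -> |- a :+ #1 :< a :+ #1 :+ #1) a) h) φ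

 u-UR : ∀ a x S -> a + 1z + 1z + + length S < a + N -> ∀ φ -> u x a (UR (a + 1z + 1z) S φ) ≈ UR (a + 1z + 1z) S (u x a φ)
 u-UR a false S h φ = ≈r
 u-UR a true S h φ = far1 (All-reverse (farU a S (lia 3 (\a l N -> a :+ #1 :+ #1 :+ l :< a :+ N => |- a :+ #1 :+ l :< a :+ N) a (+ length S) N h) (a + 1z + 1z) (lia 1 (\a -> |- a :+ #1 :< a :+ #1 :+ #1) a) h)) φ

 2<N : ∀ a m -> a + 1z + 1z + + m < a + N -> + 2 < N
 2<N a m h = lia 3 (\a m N -> a :+ #1 :+ #1 :+ m :< a :+ N => #0 =< m => |- # (+ 2) :< N) a (+ m) N h (ℤ.+≤+ z≤n)

 -- X is the nested product at the letters a, a+1 with the state at a outermost,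
 -- X' the one with the state at a+1 outermost.
 X X' : ℤ -> St -> St -> Fn -> Fn
 X a (x , y) (x' , y') ψ = u x a (u y' (a + 1z) (u x' (a + 1z) (u y a ψ)))
 X' a (x , y) (x' , y') ψ = u y' (a + 1z) (u y a (u x a (u x' (a + 1z) ψ)))

 X-∅ˡ : ∀ a q ψ -> X a ∅ q ψ ≈ X' a ∅ q ψ
 X-∅ˡ a q ψ = ≈r

 X-∅ʳ : ∀ a q ψ -> X a q ∅ ψ ≈ X' a q ∅ ψ
 X-∅ʳ a ∅ ψ = ≈r
 X-∅ʳ a 𝕤 ψ = ≈r
 X-∅ʳ a 𝕥 ψ = ≈r
 X-∅ʳ a 𝕓 ψ = ≈r

 -- The point is to exchange the states of a and a + 1. With this exchange each of the nine cases is
 -- an identity, a vanishing square on both sides, or the braid relation; without it the summands do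
 -- not match.
 X-swap : + 2 < N -> ∀ a p q -> p ∈ q3 -> q ∈ q3 -> ∀ ψ -> X a p q ψ ≈ X' a q p ψ
 X-swap h a _ _ (here refl) (here refl) ψ = ≈r
 X-swap h a _ _ (here refl) (there (here refl)) ψ = ≈r
 X-swap h a _ _ (here refl) (there (there (here refl))) ψ = lO (U-lin a) (U-nil (a + 1z) ψ) ⟫ ≈s (U-nil a _)
 X-swap h a _ _ (there (here refl)) (here refl) ψ = ≈r
 X-swap h a _ _ (there (here refl)) (there (here refl)) ψ = ≈r
 X-swap h a _ _ (there (here refl)) (there (there (here refl))) ψ = U-nil (a + 1z) _ ⟫ ≈s (lO (U-lin (a + 1z)) (U-nil a ψ))
 X-swap h a _ _ (there (there (here refl))) (here refl) ψ = U-braid h a ψ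
 X-swap h a _ _ (there (there (here refl))) (there (here refl)) ψ = U-braid h a ψ
 X-swap h a _ _ (there (there (here refl))) (there (there (here refl))) ψ = lO (U-lin a) (U-nil (a + 1z) _) ⟫ ≈s (lO (U-lin (a + 1z)) (U-nil a _))

 sh-swap : ∀ c p q i j -> sh p (sh q c) i j ≡ sh q (sh p c) i j
 sh-swap c (x , y) (x' , y') i j = cong2 c (l (bit x) (bit x') i) (l (bit y) (bit y') j)
  where
   l : ∀ a b c -> b N.+ (a N.+ c) ≡ a N.+ (b N.+ c)
   l = ringN

 -- Terms with an empty state agree one by one. The nonempty pairs agree after the two summation
 -- variables are exchanged, which the weights permit by `sh-swap`; `q3` is contained in `Q e` and
 -- `Q e'` alike, so the exchange is always available.
 local : + 2 < N -> ∀ a e e' c i j ψ -> ΣF (Q e) (\p -> ΣF (Q e') (\q -> sh q (sh p c) i j ⋆ X a p q ψ)) ≈ ΣF (Q e) (\p -> ΣF (Q e') (\q -> sh q (sh p c) i j ⋆ X' a p q ψ))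
 local h a e e' c i j ψ v o = outer e
  where
   Y Y' : St -> St -> ℤ
   Y p q = sh q (sh p c) i j * X a p q ψ v
   Y' p q = sh q (sh p c) i j * X' a p q ψ v
   core : ΣL q3 (\p -> ΣL q3 (Y p)) ≡ ΣL q3 (\p -> ΣL q3 (Y' p))
   core = Σ-cong∈ q3 (\p m -> Σ-cong∈ q3 (\q m' -> cong2 _*_ (sh-swap c q p i j) (X-swap h a p q m m' ψ v o))) & Σ-swap q3 q3 (\p q -> Y' q p)
   row : ∀ e' p -> Y p ∅ ≡ Y' p ∅ -> ΣL (Q e') (Y p) - ΣL q3 (Y p) ≡ ΣL (Q e') (Y' p) - ΣL q3 (Y' p)
   row false p z = Z.+-inverseʳ (ΣL q3 (Y p)) & sym (Z.+-inverseʳ (ΣL q3 (Y' p)))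
   row true p z = l (Y p ∅) (ΣL q3 (Y p)) & z & sym (l (Y' p ∅) (ΣL q3 (Y' p)))
    where
     l : ∀ x y -> x + y - y ≡ x
     l = ring
   mid : ΣL q3 (\p -> ΣL (Q e') (Y p)) ≡ ΣL q3 (\p -> ΣL (Q e') (Y' p))
   mid = sp Y & (cong2 _+_ core (Σ-cong q3 (\p -> row e' p (cong (sh ∅ (sh p c) i j *_) (X-∅ʳ a p ψ v o))))) & sym (sp Y')
    where
     l : ∀ x y -> x ≡ y + (x - y)
     l = ring
     sp : ∀ Y -> ΣL q3 (\p -> ΣL (Q e') (Y p)) ≡ ΣL q3 (\p -> ΣL q3 (Y p)) + ΣL q3 (\p -> ΣL (Q e') (Y p) - ΣL q3 (Y p))
     sp Y = Σ-cong q3 (\p -> l (ΣL (Q e') (Y p)) (ΣL q3 (Y p))) & (Σ-+ q3 (\p -> ΣL q3 (Y p)) (\p -> ΣL (Q e') (Y p) - ΣL q3 (Y p)))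
   outer : ∀ e -> ΣL (Q e) (\p -> ΣL (Q e') (Y p)) ≡ ΣL (Q e) (\p -> ΣL (Q e') (Y' p))
   outer false = mid
   outer true = cong2 _+_ (Σ-cong (Q e') (\q -> cong (sh q (sh ∅ c) i j *_) (X-∅ˡ a q ψ v o))) mid

 Qs : List Bool -> List (List St)
 Qs = map Q

 NN' : ℤ -> List St -> Fn -> Fn
 NN' a w φ = UI a (fs w) (UR a (ts w) φ)

 MM : ℤ -> List St -> Fn -> Fn
 MM a w φ = UR a (ts w) (UI a (fs w) φ)

 sumQ-⋆ : (Ps : List (List St)) (f : List St -> ℤ) {L : Fn -> Fn} -> Lin L -> (g : List St -> Fn) -> sumQ Ps (\w -> f w ⋆ L (g w)) ≈ L (sumQ Ps (\w -> f w ⋆ g w))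
 sumQ-⋆ Ps f l g = sumQ-cong Ps (\w _ -> ≈s (lscl l (f w) (g w))) ⟫ ≈s (sumQ-lin l Ps _)

 -- The letter a of S is outermost and that of T innermost, so the induction hypothesis first
 -- commutes everything above a. Letters from a + 2 on commute with a, so it remains to rearrange
 -- the letters at a and a + 1, which is `local`.
 nest : ∀ a fl c φ -> a + + length fl < a + N -> sumQ (Qs fl) (\w -> wt c w ⋆ NN' a w φ) ≈ sumQ (Qs fl) (\w -> wt c w ⋆ MM a w φ)
 nest a [] c φ h = ≈r
 nest a (e ∷ fl) c φ h = ΣF-cong (Q e) (\q -> step q) ⟫ rest fl h
  where
   h1 : a + 1z + + length fl < a + N
   h1 = subst (_< a + N) (sym (+1s a (length fl))) h
   step : ∀ q -> sumQ (Qs fl) (\w -> wt c (q ∷ w) ⋆ NN' a (q ∷ w) φ) ≈ sumQ (Qs fl) (\w -> wt (sh q c) w ⋆ u (fst q) a (MM (a + 1z) w (u (snd q) a φ)))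
   step q = sumQ-cong (Qs fl) (\w _ v o -> cong2 _*_ (wt-∷ c q w) (cong-app (UI-∷ a (fst q) (fs w) _) v & lcong (Lin-∘ (u-lin (fst q) a) (UI-lin (a + 1z) (fs w))) (UR-∷ a (snd q) (ts w) φ) v o))
    ⟫ sumQ-⋆ (Qs fl) (wt (sh q c)) (u-lin (fst q) a) (\w -> NN' (a + 1z) w (u (snd q) a φ))
    ⟫ lcong (u-lin (fst q) a) (nest (a + 1z) fl (sh q c) (u (snd q) a φ) (lia 3 (\a l N -> a :+ #1 :+ l :< a :+ N => |- a :+ #1 :+ l :< a :+ #1 :+ N) a (+ length fl) N h1))
    ⟫ ≈s (sumQ-⋆ (Qs fl) (wt (sh q c)) (u-lin (fst q) a) (\w -> MM (a + 1z) w (u (snd q) a φ)))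
   MM-∷ : ∀ b q w φ -> MM b (q ∷ w) φ ≈ UR (b + 1z) (ts w) (u (snd q) b (u (fst q) b (UI (b + 1z) (fs w) φ)))
   MM-∷ b q w φ = UR-∷ b (snd q) (ts w) _ ⟫ lcong (Lin-∘ (UR-lin (b + 1z) (ts w)) (u-lin (snd q) b)) (\v o -> cong-app (UI-∷ b (fst q) (fs w) φ) v)
   rest : ∀ fl -> a + + length (e ∷ fl) < a + N -> ΣF (Q e) (\q -> sumQ (Qs fl) (\w -> wt (sh q c) w ⋆ u (fst q) a (MM (a + 1z) w (u (snd q) a φ))))
    ≈ ΣF (Q e) (\q -> sumQ (Qs fl) (\w -> wt c (q ∷ w) ⋆ MM a (q ∷ w) φ))
   rest [] h = ΣF-cong (Q e) (\q v o -> cong2 _*_ (sym (wt-∷ c q [])) (r q v o))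
    where
     r : ∀ q -> u (fst q) a (u (snd q) a φ) ≈ MM a (q ∷ []) φ
     r ∅ = ≈r
     r 𝕤 = ≈r
     r 𝕥 = ≈r
     r 𝕓 = ≈r
   rest (e' ∷ fl) h = ≈s (flip (\p q w -> wt (sh q (sh p c)) w ⋆ u (fst p) a (MM (a + 1z) (q ∷ w) (u (snd p) a φ))) (\p q w v _ -> cong (_* u (fst p) a (MM (a + 1z) (q ∷ w) (u (snd p) a φ)) v) (sym (wt-∷ (sh p c) q w))))
    ⟫ sumQ-cong (Qs fl) (\w ew -> loc w (bd w (ew & L.length-map Q fl)))
    ⟫ flip (\p q w -> wt (sh q (sh p c)) w ⋆ MM a (p ∷ q ∷ w) φ) (\p q w v _ -> cong (_* MM a (p ∷ q ∷ w) φ v) (sym (wt-∷ c p (q ∷ w) & wt-∷ (sh p c) q w)))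
    where
     bd : ∀ w -> length w ≡ length fl -> a + 1z + 1z + + length w < a + N
     bd w ew rewrite ew = lia 3 (\a l N -> a :+ (#1 :+ (#1 :+ l)) :< a :+ N => |- a :+ #1 :+ #1 :+ l :< a :+ N) a (+ length fl) N h
     flip : (T : St -> St -> List St -> Fn) {T' : St -> St -> List St -> Fn} -> (∀ p q w -> T p q w ≈ T' p q w) ->
      sumQ (Qs fl) (\w -> ΣF (Q e) (\p -> ΣF (Q e') (\q -> T p q w))) ≈ ΣF (Q e) (\p -> ΣF (Q e') (\q -> sumQ (Qs fl) (\w -> T' p q w)))
     flip T z = sumQ-ΣF (Qs fl) (Q e) _ ⟫ ΣF-cong (Q e) (\p -> sumQ-ΣF (Qs fl) (Q e') _ ⟫ ΣF-cong (Q e') (\q -> sumQ-cong (Qs fl) (\w _ -> z p q w)))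
     loc : ∀ w -> a + 1z + 1z + + length w < a + N ->
      ΣF (Q e) (\p -> ΣF (Q e') (\q -> wt (sh q (sh p c)) w ⋆ u (fst p) a (MM (a + 1z) (q ∷ w) (u (snd p) a φ))))
      ≈ ΣF (Q e) (\p -> ΣF (Q e') (\q -> wt (sh q (sh p c)) w ⋆ MM a (p ∷ q ∷ w) φ))
     loc w hw = ΣF-cong (Q e) (\p -> ΣF-cong (Q e') (\q -> ⋆-cong (wt (sh q (sh p c)) w) (in1 p q) ⟫ ≈s (lscl Rl (wt (sh q (sh p c)) w) _)) ⟫ ≈s (lΣ Rl (Q e') _)) ⟫ ≈s (lΣ Rl (Q e) _)
      ⟫ lcong Rl (local (2<N a (length w) hw) a e e' c ∥ fs w ∥ ∥ ts w ∥ ψ)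
      ⟫ lΣ Rl (Q e) _ ⟫ ΣF-cong (Q e) (\p -> lΣ Rl (Q e') _ ⟫ ΣF-cong (Q e') (\q -> lscl Rl (wt (sh q (sh p c)) w) _ ⟫ ⋆-cong (wt (sh q (sh p c)) w) (≈s (in2 p q))))
      where
       b = a + 1z + 1z
       Rl = UR-lin b (ts w)
       ψ = UI b (fs w) φ
       hf : a + 1z + 1z + + length (fs w) < a + N
       hf rewrite L.length-map fst w = hw
       ht : a + 1z + 1z + + length (ts w) < a + N
       ht rewrite L.length-map snd w = hw
       in1 : ∀ p q -> u (fst p) a (MM (a + 1z) (q ∷ w) (u (snd p) a φ)) ≈ UR b (ts w) (X a p q ψ)
       in1 p q = lcong (u-lin (fst p) a) (MM-∷ (a + 1z) q w _ ⟫ lcong (Lin-∘ Rl (Lin-∘ (u-lin (snd q) (a + 1z)) (u-lin (fst q) (a + 1z)))) (≈s (u-UI a (snd p) (fs w) hf φ)))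
        ⟫ u-UR a (fst p) (ts w) ht _
       in2 : ∀ p q -> MM a (p ∷ q ∷ w) φ ≈ UR b (ts w) (X' a p q ψ)
       in2 p q = MM-∷ a p (q ∷ w) φ ⟫ UR-∷ (a + 1z) (snd q) (ts w) _ ⟫ lcong (Lin-∘ Rl (Lin-∘ (u-lin (snd q) (a + 1z)) (Lin-∘ (u-lin (snd p) a) (u-lin (fst p) a)))) (\v o -> cong-app (UI-∷ (a + 1z) (fst q) (fs w) φ) v)

 -- Without empty states, an extra letter at the upper end of the interval travels down to a: at
 -- each position an identity or a braid move pushes it one step, and both words shift by one. This
 -- is the origin of the shifted base point in `main`.
 nestA : ∀ a w φ -> All (_∈ q3) w -> a + 1z + + length w < a + N ->
  UI a (fs w) (U (a + + length w) (UR a (ts w) φ)) ≈ UR (a + 1z) (ts w) (U a (UI (a + 1z) (fs w) φ))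
 nestA a [] φ _ h rewrite +0 a = ≈r
 nestA a ((x , y) ∷ w) φ (m ∷ ms) h =
  (\v o -> cong-app (UI-∷ a x (fs w) _) v)
  ⟫ lcong (Lin-∘ (u-lin x a) (Lin-∘ (UI-lin (a + 1z) (fs w)) (U-lin (a + + suc (length w))))) (UR-∷ a y (ts w) φ)
  ⟫ lcong (u-lin x a) ((\v o -> cong (\z -> UI (a + 1z) (fs w) (U z (UR (a + 1z) (ts w) (u y a φ))) v) (sym (+1s a (length w))))
   ⟫ nestA (a + 1z) w (u y a φ) ms (lia 3 (\a l N -> a :+ #1 :+ (#1 :+ l) :< a :+ N => |- a :+ #1 :+ #1 :+ l :< a :+ #1 :+ N) a (+ length w) N h)
   ⟫ lcong (Lin-∘ (UR-lin (a + 1z + 1z) (ts w)) (U-lin (a + 1z))) (≈s (u-UI a y (fs w) (subst (\z -> a + 1z + 1z + + z < a + N) (sym (L.length-map fst w)) hw) φ)))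
  ⟫ u-UR a x (ts w) (subst (\z -> a + 1z + 1z + + z < a + N) (sym (L.length-map snd w)) hw) _
  ⟫ lcong (UR-lin (a + 1z + 1z) (ts w)) (loc x y m (UI (a + 1z + 1z) (fs w) φ))
  ⟫ lcong (Lin-∘ (UR-lin (a + 1z + 1z) (ts w)) (Lin-∘ (u-lin y (a + 1z)) (U-lin a))) (\v o -> cong-app (sym (UI-∷ (a + 1z) x (fs w) φ)) v)
  ⟫ ≈s (UR-∷ (a + 1z) y (ts w) _)
  where
   hw : a + 1z + 1z + + length w < a + N
   hw = lia 3 (\a l N -> a :+ #1 :+ (#1 :+ l) :< a :+ N => |- a :+ #1 :+ #1 :+ l :< a :+ N) a (+ length w) N h
   loc : ∀ x y -> (x , y) ∈ q3 -> ∀ ψ -> u x a (U (a + 1z) (u y a ψ)) ≈ u y (a + 1z) (U a (u x (a + 1z) ψ))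
   loc _ _ (here refl) ψ = ≈r
   loc _ _ (there (here refl)) ψ = ≈r
   loc _ _ (there (there (here refl))) ψ = U-braid (2<N a (length w) hw) a ψ

-- Pairs of cyclic subsets: from intervals to the circle.

module Cyclic (n : ℕ) {{nz : NonZero n}} {V : Set} (Ok : V -> Set) (U : ℤ -> (V -> ℤ) -> V -> ℤ) (nil : Words.Nil n Ok U) where
 open Commute n Ok U nil public

 private
  N = + n

 ff' gg : ℤ -> List St -> Fn -> Fn
 ff' r w φ = UM (cw r (fs w)) (UM (rev (cw r (ts w))) φ)
 gg r w φ = UM (rev (cw r (ts w))) (UM (cw r (fs w)) φ)

 ff-≅ : ∀ {x x' y y'} -> x ≅ x' -> y ≅ y' -> ∀ φ -> UM x (UM (rev y) φ) ≈ UM x' (UM (rev y') φ)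
 ff-≅ {x} p q φ = lcong (UM-lin x) (bw q φ) ⟫ fw p _

 gg-≅ : ∀ {x x' y y'} -> x ≅ x' -> y ≅ y' -> ∀ φ -> UM (rev y) (UM x φ) ≈ UM (rev y') (UM x' φ)
 gg-≅ {y = y} p q φ = lcong (UM-lin (rev y)) (fw p φ) ⟫ bw q _

 cw-map : ∀ (pr : St -> Bool) r X Y -> length (X ++ Y) ≡ n -> cw r (map pr (X ++ Y)) ≅ cw (r + + length X) (map pr (Y ++ X))
 cw-map pr r X Y e rewrite L.map-++ pr X Y | L.map-++ pr Y X =
  subst (\z -> cw r (map pr X ++ map pr Y) ≅ cw (r + + z) (map pr Y ++ map pr X)) (L.length-map pr X)
   (cw-rotN r (map pr X) (map pr Y) ((cong length (sym (L.map-++ pr X Y)) & L.length-map pr (X ++ Y)) & e))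

 ff-rot : ∀ r X Y -> length (X ++ Y) ≡ n -> ∀ φ -> ff' r (X ++ Y) φ ≈ ff' (r + + length X) (Y ++ X) φ
 ff-rot r X Y e = ff-≅ (cw-map fst r X Y e) (cw-map snd r X Y e)

 gg-rot : ∀ r X Y -> length (X ++ Y) ≡ n -> ∀ φ -> gg r (X ++ Y) φ ≈ gg (r + + length X) (Y ++ X) φ
 gg-rot r X Y e = gg-≅ (cw-map fst r X Y e) (cw-map snd r X Y e)

 ff-∅ : ∀ r w φ -> ff' r (∅ ∷ w) φ ≡ NN' (r + 1z) w φ
 ff-∅ r w φ rewrite L.++-identityʳ (I (r + 1z) (fs w)) | L.++-identityʳ (I (r + 1z) (ts w)) = refl

 gg-∅ : ∀ r w φ -> gg r (∅ ∷ w) φ ≡ MM (r + 1z) w φ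
 gg-∅ r w φ rewrite L.++-identityʳ (I (r + 1z) (fs w)) | L.++-identityʳ (I (r + 1z) (ts w)) = refl

 ∥++∥ : ∀ S T -> ∥ S ++ T ∥ ≡ ∥ S ∥ N.+ ∥ T ∥
 ∥++∥ [] T = refl
 ∥++∥ (true ∷ S) T = cong suc (∥++∥ S T)
 ∥++∥ (false ∷ S) T = ∥++∥ S T

 wt-rot : ∀ c p q -> wt c (p ++ q) ≡ wt c (q ++ p)
 wt-rot c p q = cong2 c (e fst) (e snd)
  where
   e : ∀ (pr : St -> Bool) -> ∥ map pr (p ++ q) ∥ ≡ ∥ map pr (q ++ p) ∥
   e pr rewrite L.map-++ pr p q | L.map-++ pr q p | ∥++∥ (map pr p) (map pr q) | ∥++∥ (map pr q) (map pr p) = M.+-comm ∥ map pr p ∥ _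

 q4 : List St
 q4 = Q true

 rp : {A : Set} -> ℕ -> A -> List A
 rp = replicate

 Qs-fl : ∀ m o -> Qs (rp m true ++ rp o false) ≡ rp m q4 ++ rp o q3
 Qs-fl m o = L.map-++ Q (rp m true) (rp o false) & (cong2 _++_ (L.map-replicate Q m true) (L.map-replicate Q o false))

 module _ (c : Wt) (r : ℤ) (φ : Fn) where

  F G : List St -> Fn
  F w = wt c w ⋆ ff' r w φ
  G w = wt c w ⋆ gg r w φ

  -- Rotating the first empty state to the front cuts the circle there. The sum becomes one over an
  -- interval with m free positions followed by o nonempty ones, the setting of `nest`.
  gap-term : ∀ o m -> o N.+ suc m ≡ n -> (T : ℤ -> List St -> Fn -> Fn) (T' : ℤ -> List St -> Fn -> Fn) ->
   (∀ r X Y -> length (X ++ Y) ≡ n -> T r (X ++ Y) φ ≈ T (r + + length X) (Y ++ X) φ) -> (∀ r w -> T r (∅ ∷ w) φ ≡ T' (r + 1z) w φ) ->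
   sumQ (rp o q3) (\p -> sumQ (rp m q4) (\q -> wt c (p ++ ∅ ∷ q) ⋆ T r (p ++ ∅ ∷ q) φ)) ≈ sumQ (Qs (rp m true ++ rp o false)) (\w -> wt c w ⋆ T' (r + + o + 1z) w φ)
  gap-term o m e T T' rot' at∅ rewrite Qs-fl m o =
   sumQ-cong (rp o q3) (\p ep -> sumQ-cong (rp m q4) (\q eq v ok -> cong2 _*_ (wt-rot c p (∅ ∷ q) & (wt-∷ c ∅ (q ++ p)))
    (rot' r p (∅ ∷ q) (L.length-++ p & cong2 (\x y -> x N.+ suc y) (ep & L.length-replicate o) (eq & L.length-replicate m) & e) v ok &
     cong-app (at∅ (r + + length p) (q ++ p)) v & cong (\z -> T' (r + + z + 1z) (q ++ p) φ v) (ep & L.length-replicate o))))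
   ⟫ sumQ-swap (rp o q3) (rp m q4) _ ⟫ ≈s (sumQ-++ (rp m q4) (rp o q3) _)

  gap-eq : ∀ o m -> o N.+ suc m ≡ n -> sumQ (rp o q3) (\p -> sumQ (rp m q4) (\q -> F (p ++ ∅ ∷ q))) ≈ sumQ (rp o q3) (\p -> sumQ (rp m q4) (\q -> G (p ++ ∅ ∷ q)))
  gap-eq o m e = gap-term o m e ff' NN' (\r X Y e -> ff-rot r X Y e φ) (\r w -> ff-∅ r w φ)
   ⟫ nest (r + + o + 1z) (rp m true ++ rp o false) c φ (Z.+-monoʳ-< (r + + o + 1z) (ℤ.+<+ (M.≤-reflexive e')))
   ⟫ ≈s (gap-term o m e gg MM (\r X Y e -> gg-rot r X Y e φ) (\r w -> gg-∅ r w φ))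
   where
    e' : suc (length (rp m true ++ rp o false)) ≡ n
    e' = cong suc (L.length-++ (rp m true) & (cong2 N._+_ (L.length-replicate m) (L.length-replicate o))) & M.+-comm (suc m) o & e

 -- A word has a first empty state, and these terms are assumed to agree for each of its positions,
 -- or it has none. The sums over words of the second kind are added crosswise, so that nothing has
 -- to be subtracted.
 total : (F G : List St -> Fn) -> (∀ o m -> o N.+ suc m ≡ n -> sumQ (rp o q3) (\p -> sumQ (rp m q4) (\q -> F (p ++ ∅ ∷ q))) ≈ sumQ (rp o q3) (\p -> sumQ (rp m q4) (\q -> G (p ++ ∅ ∷ q)))) ->
  ∀ o m -> o N.+ m ≡ n -> sumQ (rp o q3) (\p -> sumQ (rp m q4) (\w -> F (p ++ w))) ⊹ sumQ (rp n q3) G ≈ sumQ (rp o q3) (\p -> sumQ (rp m q4) (\w -> G (p ++ w))) ⊹ sumQ (rp n q3) F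
 total F G h o zero e with trans (sym (M.+-identityʳ o)) e
 ... | refl = \v ok -> cong (_+ sumQ (rp n q3) G v) (i F v ok) & Z.+-comm (sumQ (rp n q3) F v) (sumQ (rp n q3) G v) & cong (_+ sumQ (rp n q3) F v) (sym (i G v ok))
  where
   i : ∀ F -> sumQ (rp n q3) (\p -> F (p ++ [])) ≈ sumQ (rp n q3) F
   i F = sumQ-cong (rp n q3) (\w _ v _ -> cong (\z -> F z v) (L.++-identityʳ w))
 total F G h o (suc m) e v ok = cong (_+ S G) (sp F) & lem (A F) (R F) (S G) (S F) (A G) (R G) (h o m e v ok) (total F G h (suc o) m (sym (M.+-suc o m) & e) v ok) & cong (_+ S F) (sym (sp G))
  where
   S A R : (List St -> Fn) -> ℤ
   S F = sumQ (rp n q3) F v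
   A F = sumQ (rp o q3) (\p -> sumQ (rp m q4) (\q -> F (p ++ ∅ ∷ q))) v
   R F = sumQ (rp (suc o) q3) (\p -> sumQ (rp m q4) (\w -> F (p ++ w))) v
   lem : ∀ a b c d a' b' -> a ≡ a' -> b + c ≡ b' + d -> (a + b) + c ≡ (a' + b') + d
   lem a b c d a' b' p q = Z.+-assoc a b c & (cong2 _+_ p q) & sym (Z.+-assoc a' b' d)
   sp : ∀ F -> sumQ (rp o q3) (\p -> sumQ (rp (suc m) q4) (\w -> F (p ++ w))) v ≡ A F + R F
   sp F = sumQ-+ (rp o q3) (\p -> sumQ (rp m q4) (\q -> F (p ++ ∅ ∷ q))) (\p -> ΣF q3 (\q -> sumQ (rp m q4) (\w -> F (p ++ q ∷ w)))) v ok &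
    cong (_+_ (A F)) (sym ((sumQ-rot o q3 (\p -> sumQ (rp m q4) (\w -> F (p ++ w))) ⟫ sumQ-cong (rp o q3) (\p _ -> ΣF-cong q3 (\q -> sumQ-cong (rp m q4) (\w _ v _ -> cong (\z -> F z v) (L.++-assoc p [ q ] w))))) v ok))

 AllT : List Bool -> Set
 AllT = All (_≡ true)

 go-AllT : ∀ a S k -> AllT S -> go a S k ≡ inr tt
 go-AllT a [] k _ = refl
 go-AllT a (true ∷ S) k (_ ∷ p) = go-AllT (a + 1z) S _ p

 find𝕥 : ∀ w -> All (_∈ q3) w -> AllT (fs w) ⊎ 𝕥 ∈ w
 find𝕥 [] _ = inl []
 find𝕥 (_ ∷ w) (there (here refl) ∷ ms) = inr (here refl)
 find𝕥 (_ ∷ w) (here refl ∷ ms) with find𝕥 w ms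
 ... | inl p = inl (refl ∷ p)
 ... | inr p = inr (there p)
 find𝕥 (_ ∷ w) (there (there (here refl)) ∷ ms) with find𝕥 w ms
 ... | inl p = inl (refl ∷ p)
 ... | inr p = inr (there p)

 find𝕤 : ∀ w -> All (_∈ q3) w -> AllT (ts w) ⊎ 𝕤 ∈ w
 find𝕤 [] _ = inl []
 find𝕤 (_ ∷ w) (here refl ∷ ms) = inr (here refl)
 find𝕤 (_ ∷ w) (there (here refl) ∷ ms) with find𝕤 w ms
 ... | inl p = inl (refl ∷ p)
 ... | inr p = inr (there p)
 find𝕤 (_ ∷ w) (there (there (here refl)) ∷ ms) with find𝕤 w ms
 ... | inl p = inl (refl ∷ p)
 ... | inr p = inr (there p)

 module _ (A B : List St) (e : suc (suc (length A N.+ length B)) ≡ n) where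

  ww : List St
  ww = (A ++ 𝕤 ∷ B) ++ [ 𝕥 ]

  lA lB : ℤ
  lA = + length A
  lB = + length B

  eN : N ≡ 1z + (1z + (lA + lB))
  eN = cong +_ (sym e)

  cwS : ∀ r -> cw r (fs ww) ≅ inl (I r (fs A) ++ (r + lA ∷ I (r + lA + 1z) (fs B)))
  cwS r = ≅t (≅≡ (cong (cw r) ((L.map-++ fst (A ++ 𝕤 ∷ B) [ 𝕥 ]) & cong (_++ [ false ]) (L.map-++ fst A (𝕤 ∷ B)))))
   (≅t (cw-gap r (fs A ++ true ∷ fs B) (M.≤-reflexive (cong suc (L.length-++ (fs A) & cong2 (\x y -> x N.+ suc y) (L.length-map fst A) (L.length-map fst B)) & cong suc (M.+-suc _ _) & e)))
    (≅≡ (cong inl (I-++ r (fs A) (true ∷ fs B) & cong (\z -> I r (fs A) ++ (r + + z ∷ I (r + + z + 1z) (fs B))) (L.length-map fst A)))))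

  cwT : ∀ r -> cw r (ts ww) ≅ inl (I (r + lA + 1z) (ts B) ++ (r + lA + 1z + lB ∷ I r (ts A)))
  cwT r = ≅t (≅≡ (cong (\z -> cw r (ts z)) (L.++-assoc A (𝕤 ∷ B) [ 𝕥 ])))
   (≅t (cw-map snd r A (𝕤 ∷ B ++ [ 𝕥 ]) (L.length-++ A & cong (\z -> length A N.+ suc z) (L.length-++ B & (M.+-comm _ 1)) & (M.+-suc _ _) & cong suc (M.+-suc _ _) & e))
   (≅t (≅≡ (cong inl ((L.++-identityʳ _) & cong (I (r + lA + 1z)) (L.map-++ snd (B ++ [ 𝕥 ]) A & cong (_++ ts A) (L.map-++ snd B [ 𝕥 ]) & (L.++-assoc (ts B) [ true ] (ts A))) &
    I-++ (r + lA + 1z) (ts B) (true ∷ ts A) & cong (\z -> I (r + lA + 1z) (ts B) ++ (r + lA + 1z + + z ∷ I (r + lA + 1z + + z + 1z) (ts A))) (L.length-map snd B))))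
    (≅-++ {I (r + lA + 1z) (ts B)} ≅r (≅-++ {[ r + lA + 1z + lB ]} ≅r (≅t (≅≡ (cong (\z -> inl (I z (ts A))) (l r lA lB & cong (_+_ r) (sym eN & sym (Z.*-identityˡ N))))) (I-per r 1z (ts A)))))))
   where
    l : ∀ r a b -> r + a + 1z + b + 1z ≡ r + (1z + (1z + (a + b)))
    l = ring

  -- In the word A, `𝕤`, B, `𝕥` the set S has a gap at the `𝕥` and T has one at the `𝕤`, so both
  -- have words broken at these places. `nestA` is applied first to B and then to A, and periodicity
  -- closes the circle.
  main : ∀ r φ -> All (_∈ q3) A -> All (_∈ q3) B -> ff' r ww φ ≈ gg (r + 1z) ww φ
  main r φ mA mB = ff-≅ (cwS r) (cwT r) φ
   ⟫ UW-++ (I r (fs A)) _ _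
   ⟫ lcong (UI-lin r (fs A)) (lcong (U-lin q) (lcong (UI-lin (q + 1z) (fs B)) (UW-rev++ (I (q + 1z) (ts B)) _ φ ⟫ UR-∷' p (I r (ts A)) _)
    ⟫ farW (All-revʳ (I-swap (ts A) (fs B) tA fB)) _))
   ⟫ lcong (UI-lin r (fs A)) (lcong (U-lin q) (lcong (UR-lin r (ts A)) (nestA (q + 1z) B φ mB hB)))
   ⟫ nestA r A _ mA hA
   ⟫ lcong (UR-lin (r + 1z) (ts A)) (lcong (U-lin r) (farW (All-revʳ (I-far (r + 1z) (fs A) (q + 1z + 1z) (ts B) far1' far2')) _) ⟫ ≈s (U-per r 1z _) ⟫ (\v o -> cong (\z -> U z (UR (q + 1z + 1z) (ts B) (UI (r + 1z) (fs A) (U (q + 1z) (UI (q + 1z + 1z) (fs B) φ)))) v) (sym p'≡)))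
   ⟫ ≈s (UR-∷' (r + 1z + lA + 1z + lB) (I (r + 1z) (ts A)) _)
   ⟫ lcong (UW-lin (reverse (r + 1z + lA + 1z + lB ∷ I (r + 1z) (ts A)))) (\v o -> cong2 (\z z' -> UR z (ts B) (UI (r + 1z) (fs A) (U z' (UI z (fs B) φ))) v) (sym (cong (_+ 1z) q≡)) (sym q≡))
   ⟫ ≈s (UW-rev++ (I (r + 1z + lA + 1z) (ts B)) (r + 1z + lA + 1z + lB ∷ I (r + 1z) (ts A)) _ ⟫ lcong (Lin-∘ (UW-lin (reverse (r + 1z + lA + 1z + lB ∷ I (r + 1z) (ts A)))) (UR-lin (r + 1z + lA + 1z) (ts B))) (UW-++ (I (r + 1z) (fs A)) _ φ))
   ⟫ ≈s (gg-≅ (cwS (r + 1z)) (cwT (r + 1z)) φ)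
   where
    q = r + lA
    p = r + lA + 1z + lB
    q≡ : r + 1z + lA ≡ q + 1z
    q≡ = lia 2 (\r a -> |- r :+ #1 :+ a := r :+ a :+ #1) r lA
    p'≡ : r + 1z + lA + 1z + lB ≡ r + 1z * N
    p'≡ = l r lA lB & cong (_+_ r) (sym eN & sym (Z.*-identityˡ N))
     where
      l : ∀ r a b -> r + 1z + a + 1z + b ≡ r + (1z + (1z + (a + b)))
      l = ring
    UR-∷' : ∀ a x ψ -> UW (reverse (a ∷ x)) ψ ≈ UW (reverse x) (U a ψ)
    UR-∷' a x ψ rewrite L.unfold-reverse a x = UW-++ (reverse x) [ a ] ψ
    All-revʳ : ∀ {x y} -> FarW x y -> FarW x (reverse y)
    All-revʳ = All.map All-reverse
    0≤ : ∀ {k} -> 0z ≤ + k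
    0≤ = ℤ.+≤+ z≤n
    hB : q + 1z + 1z + + length B < q + 1z + N
    hB = lia 4 (\q a b N -> N := #1 :+ (#1 :+ (a :+ b)) => #0 =< a => |- q :+ #1 :+ #1 :+ b :< q :+ #1 :+ N) q lA lB N eN 0≤
    hA : r + 1z + + length A < r + N
    hA = lia 4 (\r a b N -> N := #1 :+ (#1 :+ (a :+ b)) => #0 =< b => |- r :+ #1 :+ a :< r :+ N) r lA lB N eN 0≤
    tA : + length (ts A) ≡ lA
    tA = cong +_ (L.length-map snd A)
    fB : + length (fs B) ≡ lB
    fB = cong +_ (L.length-map fst B)
    I-swap : ∀ S T -> + length S ≡ lA -> + length T ≡ lB -> FarW (I (q + 1z) T) (I r S)
    I-swap S T es et = All.map (\ {i} (h , h') -> All.map (\ {j} (k , k') ψ -> ≈s (U-far j i ψ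
     (lia 4 (\i j r a -> j :< r :+ a => r :+ a :+ #1 =< i => |- j :+ #1 :< i) i j r lA (subst (\z -> j < r + z) es k') h)
     (lia 6 (\i j r a b N -> r =< j => i :< r :+ a :+ #1 :+ b => N := #1 :+ (#1 :+ (a :+ b)) => |- i :+ #1 :< j :+ N) i j r lA lB N k (subst (\z -> i < q + 1z + z) et h') eN)))
     (I-range r S)) (I-range (q + 1z) T)
    far1' : r + 1z + + length (fs A) < q + 1z + 1z
    far1' rewrite L.length-map fst A = lia 2 (\r a -> |- r :+ #1 :+ a :< r :+ a :+ #1 :+ #1) r lA
    far2' : q + 1z + 1z + + length (ts B) < r + 1z + N
    far2' rewrite L.length-map snd B = lia 4 (\r a b N -> N := #1 :+ (#1 :+ (a :+ b)) => |- r :+ a :+ #1 :+ #1 :+ b :< r :+ #1 :+ N) r lA lB N eN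

 -- If S or T is full, both sides are zero because there is no word. Otherwise some residue lies in
 -- T alone and some in S alone, and a rotation brings the word into the form of `main`.
 ff≈gg : ∀ r w φ -> All (_∈ q3) w -> length w ≡ n -> ff' r w φ ≈ gg (r + 1z) w φ
 ff≈gg r w φ ms e with find𝕥 w ms | find𝕤 w ms
 ... | inl p | _ rewrite go-AllT r (fs w) [] p | go-AllT (r + 1z) (fs w) [] p = ≈s (lzero (UM-lin (rev (cw (r + 1z) (ts w)))))
 ... | _ | inl p rewrite go-AllT r (ts w) [] p | go-AllT (r + 1z) (ts w) [] p = lzero (UM-lin (cw r (fs w)))
 ... | inr p | inr q with ∈-∃++ p
 ...   | X , Y , refl with ∈-∃++ {v = 𝕤} {xs = Y ++ X} (sw (∈-++⁻ X q))
  where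
   sw : 𝕤 ∈ X ⊎ 𝕤 ∈ 𝕥 ∷ Y -> 𝕤 ∈ Y ++ X
   sw (inl m) = ∈-++⁺ʳ Y m
   sw (inr (there m)) = ∈-++⁺ˡ m
 ...     | A , B , e' = (\v o -> cong (\z -> ff' r z φ v) (sym (L.++-assoc X [ 𝕥 ] Y))) ⟫ ff-rot r (X ++ [ 𝕥 ]) Y e1 φ
  ⟫ (\v o -> cong (\z -> ff' r' z φ v) w≡) ⟫ main A B e2 r' φ (fst mAB) (All.tail (snd mAB))
  ⟫ (\v o -> cong2 (\z y -> gg z y φ v) (l r (+ length (X ++ [ 𝕥 ]))) (sym w≡)) ⟫ ≈s (gg-rot (r + 1z) (X ++ [ 𝕥 ]) Y e1 φ) ⟫ (\v o -> cong (\z -> gg (r + 1z) z φ v) (L.++-assoc X [ 𝕥 ] Y))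
  where
   r' = r + + length (X ++ [ 𝕥 ])
   l : ∀ r k -> r + k + 1z ≡ r + 1z + k
   l = ring
   e1 : length ((X ++ [ 𝕥 ]) ++ Y) ≡ n
   e1 = cong length (L.++-assoc X [ 𝕥 ] Y) & e
   mAB : All (_∈ q3) A × All (_∈ q3) (𝕤 ∷ B)
   mAB = AllP.++⁻ A (subst (All (_∈ q3)) e' (AllP.++⁺ (All.tail (AllP.++⁻ʳ X ms)) (AllP.++⁻ˡ X ms)))
   e2 : suc (suc (length A N.+ length B)) ≡ n
   e2 = cong suc (sym (M.+-suc (length A) (length B)) & sym (L.length-++ A) & cong length (sym e')) &
    cong suc (L.length-++ Y & M.+-comm (length Y) (length X)) & sym (M.+-suc (length X) (length Y)) & sym (L.length-++ X) & e
   w≡ : Y ++ (X ++ [ 𝕥 ]) ≡ ww A B e2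
   w≡ = sym (L.++-assoc Y X [ 𝕥 ]) & cong (_++ [ 𝕥 ]) e'

 sumQ-cong∈ : {A : Set} (m : ℕ) (P : List A) {f g : List A -> Fn} -> (∀ w -> All (_∈ P) w -> length w ≡ m -> f w ≈ g w) -> sumQ (rp m P) f ≈ sumQ (rp m P) g
 sumQ-cong∈ zero P h = h [] [] refl
 sumQ-cong∈ (suc m) P h v o = Σ-cong∈ P (\q q∈ -> sumQ-cong∈ m P (\w ms e -> h (q ∷ w) (q∈ ∷ ms) (cong suc e)) v o)

 -- The shift of base point in `ff≈gg` is absorbed by rotating all words of the sum by one place.
 all-eq : ∀ c r φ -> sumQ (rp n q3) (F c r φ) ≈ sumQ (rp n q3) (G c r φ)
 all-eq c r φ = sumQ-cong∈ n q3 (\w ms e -> ⋆-cong (wt c w) (ff≈gg r w φ ms e)) ⟫ h n refl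
  where
   h : ∀ k -> k ≡ n -> sumQ (rp k q3) (\w -> wt c w ⋆ gg (r + 1z) w φ) ≈ sumQ (rp k q3) (G c r φ)
   h zero e = absurd (N.≢-nonZero⁻¹ n (sym e))
   h (suc m) e = sumQ-rot m q3 (\w -> wt c w ⋆ gg (r + 1z) w φ)
    ⟫ sumQ-cong (rp m q3) (\w ew -> ΣF-cong q3 (\q v o -> cong2 _*_ (wt-rot c w [ q ]) (sym (gg-rot r [ q ] w (cong suc (ew & L.length-replicate m) & e) φ v o))))
    ⟫ sumQ-ΣF (rp m q3) q3 (\w q -> G c r φ (q ∷ w))

 ff-gg : ∀ c r φ -> sumQ (rp n q4) (F c r φ) ≈ sumQ (rp n q4) (G c r φ)
 ff-gg c r φ v o = +-cancelʳ (sumQ (rp n q4) (F c r φ) v) (sumQ (rp n q4) (G c r φ) v) (sumQ (rp n q3) (G c r φ) v) (total (F c r φ) (G c r φ) (gap-eq c r φ) 0 n refl v o & cong (_+_ (sumQ (rp n q4) (G c r φ) v)) (all-eq c r φ v o))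

 -- Under this condition the terms with an innermost letter taken by S alone and by T alone cancel.
 Alt : Wt -> Set
 Alt c = ∀ i j -> c (suc i) j + c i (suc j) ≡ 0z

 Alt-sh : ∀ {c} q -> Alt c -> Alt (sh q c)
 Alt-sh {c} (x , y) h i j = cong2 (\p q -> c p (bit y N.+ j) + c (bit x N.+ i) q) (M.+-suc (bit x) i) (M.+-suc (bit y) j) & h (bit x N.+ i) (bit y N.+ j)

 -- the innermost letter is chosen from the first or the second word with opposite weights
 alt-inner : ∀ e c a φ -> Alt c -> ΣF (Q e) (\q -> sh q c 0 0 ⋆ u (fst q) a (u (snd q) a φ)) ≈ (if e then c 0 0 ⋆ φ else O)
 alt-inner false c a φ h v o = cong2 (\x y -> c 1 0 * U a φ v + (c 0 1 * U a φ v + (c 1 1 * x + y))) (U-nil a φ v o) refl & l (c 1 0) (c 0 1) (c 1 1) (U a φ v) & cong (_* U a φ v) (h 0 0)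
  where
   l : ∀ x y z u -> x * u + (y * u + (z * 0z + 0z)) ≡ (x + y) * u
   l = ring
 alt-inner true c a φ h v o = cong (_+_ (c 0 0 * φ v)) (alt-inner false c a φ h v o) & (+0 _)

 nest-∷ : ∀ a e fl c φ -> sumQ (Qs (e ∷ fl)) (\w -> wt c w ⋆ NN' a w φ) ≈ ΣF (Q e) (\q -> u (fst q) a (sumQ (Qs fl) (\w -> wt (sh q c) w ⋆ NN' (a + 1z) w (u (snd q) a φ))))
 nest-∷ a e fl c φ = ΣF-cong (Q e) (\q -> sumQ-cong (Qs fl) (\w _ v o -> cong2 _*_ (wt-∷ c q w) (cong-app (UI-∷ a (fst q) (fs w) _) v & lcong (Lin-∘ (u-lin (fst q) a) (UI-lin (a + 1z) (fs w))) (UR-∷ a (snd q) (ts w) φ) v o))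
  ⟫ sumQ-⋆ (Qs fl) (wt (sh q c)) (u-lin (fst q) a) (\w -> NN' (a + 1z) w (u (snd q) a φ)))

 -- At the last position of an interval the letters of S and T are adjacent, in the middle of the
 -- product. If that position must be nonempty, `alt-inner` leaves nothing.
 nest-forced : ∀ fl a c φ -> Alt c -> sumQ (Qs (fl ++ [ false ])) (\w -> wt c w ⋆ NN' a w φ) ≈ O
 nest-forced [] a c φ h = nest-∷ a false [] c φ ⟫ ΣF-cong q3 (\q -> lscl (u-lin (fst q) a) (sh q c 0 0) (u (snd q) a φ)) ⟫ alt-inner false c a φ h
 nest-forced (e ∷ fl) a c φ h = nest-∷ a e (fl ++ [ false ]) c φ ⟫ (\v o -> Σ-0 (Q e) (\q _ -> lO (u-lin (fst q) a) (nest-forced fl (a + 1z) (sh q c) (u (snd q) a φ) (Alt-sh {c} q h)) v o))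

 nest-free : ∀ m a c φ -> Alt c -> sumQ (Qs (rp m true)) (\w -> wt c w ⋆ NN' a w φ) ≈ c 0 0 ⋆ φ
 nest-free zero a c φ h = ≈r
 nest-free (suc m) a c φ h = nest-∷ a true (rp m true) c φ
  ⟫ ΣF-cong q4 (\q -> lcong (u-lin (fst q) a) (nest-free m (a + 1z) (sh q c) (u (snd q) a φ) (Alt-sh {c} q h)) ⟫ lscl (u-lin (fst q) a) (sh q c 0 0) (u (snd q) a φ))
  ⟫ alt-inner true c a φ h

 q3-count : ∀ w -> All (_∈ q3) w -> length w N.≤ ∥ fs w ∥ N.+ ∥ ts w ∥
 q3-count [] _ = z≤n
 q3-count (_ ∷ w) (here refl ∷ ms) = s≤s (q3-count w ms)
 q3-count (_ ∷ w) (there (here refl) ∷ ms) = M.≤-trans (s≤s (q3-count w ms)) (M.≤-reflexive (sym (M.+-suc ∥ fs w ∥ ∥ ts w ∥)))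
 q3-count (_ ∷ w) (there (there (here refl)) ∷ ms) = s≤s (M.≤-trans (q3-count w ms) (M.≤-trans (M.n≤1+n _) (M.≤-reflexive (sym (M.+-suc ∥ fs w ∥ ∥ ts w ∥)))))

 -- Sort words by their first empty state. A nonempty prefix gives a forced last position after
 -- rotation and kills the term; a prefix of length zero leaves c(0, 0). Words without empty state
 -- have i + j ≥ n, and this is where the bound n enters.
 ff-alt : ∀ c r φ -> Alt c -> c 0 0 ≡ 0z -> (∀ i j -> n N.≤ i N.+ j -> c i j ≡ 0z) -> sumQ (rp n q4) (F c r φ) ≈ O
 ff-alt c r φ h c0 big v o = sym (+0 _) & cong (_+_ (sumQ (rp n q4) (F c r φ) v)) (sym (sumQ-O (rp n q3) {\_ -> O} (\_ _ -> ≈r) v o)) &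
  total (F c r φ) (\_ -> O) (\o m e -> gap o m e ⟫ ≈s (sumQ-O (rp o q3) (\_ _ -> sumQ-O (rp m q4) (\_ _ -> ≈r)))) 0 n refl v o &
   (cong2 _+_ (sumQ-O (rp n q4) {\_ -> O} (\_ _ -> ≈r) v o) (sumQ-cong∈ n q3 {g = \_ -> O} (\w ms e v _ -> cong (_* ff' r w φ v) (big _ _ (subst (N._≤ ∥ fs w ∥ N.+ ∥ ts w ∥) e (q3-count w ms))) & Z.*-zeroˡ (ff' r w φ v)) v o & sumQ-O (rp n q3) {\_ -> O} (\_ _ -> ≈r) v o)) & refl
  where
   gap : ∀ o m -> o N.+ suc m ≡ n -> sumQ (rp o q3) (\p -> sumQ (rp m q4) (\q -> F c r φ (p ++ ∅ ∷ q))) ≈ O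
   gap o m e = gap-term c r φ o m e ff' NN' (\r X Y e -> ff-rot r X Y e φ) (\r w -> ff-∅ r w φ) ⟫ z o
    where
     z : ∀ o -> sumQ (Qs (rp m true ++ rp o false)) (\w -> wt c w ⋆ NN' (r + + o + 1z) w φ) ≈ O
     z zero rewrite L.++-identityʳ (rp m true) = nest-free m _ c φ h ⟫ \v _ -> cong (_* φ v) c0 & Z.*-zeroˡ (φ v)
     z (suc o) = subst (\z -> sumQ (Qs z) (\w -> wt c w ⋆ NN' (r + + suc o + 1z) w φ) ≈ O) ((L.++-assoc (rp m true) (rp o false) [ false ]) & cong (rp m true ++_) (rs o)) (nest-forced (rp m true ++ rp o false) _ c φ h)
      where
       rs : ∀ o -> rp o false ++ [ false ] ≡ false ∷ rp o false
       rs zero = refl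
       rs (suc o) = cong (false ∷_) (rs o)

-- The operators `H` and `E`, their relations, and derivations.

sg : ℕ -> ℤ
sg zero = 1z
sg (suc j) = - sg j

δ : ℕ -> ℕ -> ℤ
δ a i = on (a N.≟ i) 1z

module HE (n : ℕ) {{nz : NonZero n}} {V : Set} (Ok : V -> Set) (U : ℤ -> (V -> ℤ) -> V -> ℤ) (nil : Words.Nil n Ok U) where
 open Cyclic n Ok U nil public

 private
  N = + n

 Hc Ec : (ℕ -> ℤ) -> ℤ -> Fn -> Fn
 Hc c r φ = sumQ (bools n) (\S -> c ∥ S ∥ ⋆ UM (cw r S) φ)
 Ec c r φ = sumQ (bools n) (\S -> c ∥ S ∥ ⋆ UM (rev (cw r S)) φ)

 Lin-sumQ : {A : Set} (Ps : List (List A)) {K : List A -> Fn -> Fn} -> (∀ w -> Lin (K w)) -> Lin (\φ -> sumQ Ps (\w -> K w φ))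
 Lin-sumQ [] k = k []
 Lin-sumQ (P ∷ Ps) k = Lin-ΣF P (\q -> Lin-sumQ Ps (\w -> k (q ∷ w)))

 Hc-lin : ∀ c r -> Lin (Hc c r)
 Hc-lin c r = Lin-sumQ (bools n) (\S -> Lin-⋆ (c ∥ S ∥) (UM-lin (cw r S)))

 Ec-lin : ∀ c r -> Lin (Ec c r)
 Ec-lin c r = Lin-sumQ (bools n) (\S -> Lin-⋆ (c ∥ S ∥) (UM-lin (rev (cw r S))))

 sum-rot : ∀ c (T : ℤ -> List Bool -> Fn) -> (∀ r b S -> length (b ∷ S) ≡ n -> T r (b ∷ S) ≈ T (r + 1z) (S ++ [ b ])) ->
  ∀ r -> sumQ (bools n) (\S -> c ∥ S ∥ ⋆ T r S) ≈ sumQ (bools n) (\S -> c ∥ S ∥ ⋆ T (r + 1z) S)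
 sum-rot c T h r = k n refl
  where
   k : ∀ m -> m ≡ n -> sumQ (bools m) (\S -> c ∥ S ∥ ⋆ T r S) ≈ sumQ (bools m) (\S -> c ∥ S ∥ ⋆ T (r + 1z) S)
   k zero e = absurd (N.≢-nonZero⁻¹ n (sym e))
   k (suc m) e = ≈s (sumQ-rot m (true ∷ false ∷ []) (\S -> c ∥ S ∥ ⋆ T (r + 1z) S)
    ⟫ sumQ-cong (bools m) (\S eS -> ΣF-cong (true ∷ false ∷ []) (\b v o -> cong2 _*_ (cong c ((∥++∥ S [ b ]) & (M.+-comm ∥ S ∥ ∥ [ b ] ∥) & sym (∥++∥ [ b ] S)))
     (sym (h r b S (cong suc (eS & L.length-replicate m) & e) v o))))
    ⟫ sumQ-ΣF (bools m) (true ∷ false ∷ []) (\S b -> c ∥ b ∷ S ∥ ⋆ T r (b ∷ S)))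

 all-base : (T : ℤ -> Fn) -> (∀ r -> T r ≈ T (r + 1z)) -> ∀ r -> T r ≈ T 0z
 all-base T h (+ zero) = ≈r
 all-base T h (+ suc k) = ≈s (\v o -> h (+ k) v o & cong (\z -> T z v) (Z.+-comm (+ k) 1z)) ⟫ all-base T h (+ k)
 all-base T h -[1+ zero ] = h -[1+ zero ]
 all-base T h -[1+ suc k ] = h -[1+ suc k ] ⟫ all-base T h -[1+ k ]

 Hc-base : ∀ c φ r -> Hc c r φ ≈ Hc c 0z φ
 Hc-base c φ = all-base (\r -> Hc c r φ) (sum-rot c (\r S -> UM (cw r S) φ) (\r b S e -> fw (cw-rot r b S e) φ))

 Ec-base : ∀ c φ r -> Ec c r φ ≈ Ec c 0z φ
 Ec-base c φ = all-base (\r -> Ec c r φ) (sum-rot c (\r S -> UM (rev (cw r S)) φ) (\r b S e -> bw (cw-rot r b S e) φ))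

 H E : ℕ -> Fn -> Fn
 H a = Hc (δ a) 0z
 E a = Ec (δ a) 0z

 H-lin : ∀ a -> Lin (H a)
 H-lin a = Hc-lin (δ a) 0z

 E-lin : ∀ a -> Lin (E a)
 E-lin a = Ec-lin (δ a) 0z

 sumQ-zip : ∀ m (T : List Bool -> List Bool -> Fn) -> sumQ (bools m) (\S -> sumQ (bools m) (T S)) ≈ sumQ (rp m q4) (\w -> T (fs w) (ts w))
 sumQ-zip zero T = ≈r
 sumQ-zip (suc m) T v o = Σ-cong bs (\x -> sumQ-ΣF (bools m) bs (\S y -> sumQ (bools m) (\T' -> T (x ∷ S) (y ∷ T'))) v o &
  Σ-cong bs (\y -> sumQ-zip m (\S T' -> T (x ∷ S) (y ∷ T')) v o)) &
  l (A (true , true)) (A (true , false)) (A (false , true)) (A (false , false))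
  where
   bs = true ∷ false ∷ []
   A : St -> ℤ
   A (x , y) = sumQ (rp m q4) (\w -> T (x ∷ fs w) (y ∷ ts w)) v
   l : ∀ a b c d -> (a + (b + 0z)) + ((c + (d + 0z)) + 0z) ≡ d + (b + (c + (a + 0z)))
   l = ring

 HcEc : ∀ c d φ -> Hc c 0z (Ec d 0z φ) ≈ sumQ (rp n q4) (F (\i j -> c i * d j) 0z φ)
 HcEc c d φ = sumQ-cong (bools n) (\S _ -> sumQ-lin (Lin-⋆ (c ∥ S ∥) (UM-lin (cw 0z S))) (bools n) _
  ⟫ sumQ-cong (bools n) (\T _ v o -> cong (c ∥ S ∥ *_) (lscl (UM-lin (cw 0z S)) (d ∥ T ∥) (UM (rev (cw 0z T)) φ) v o) & sym (Z.*-assoc (c ∥ S ∥) (d ∥ T ∥) _)))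
  ⟫ sumQ-zip n (\S T -> (c ∥ S ∥ * d ∥ T ∥) ⋆ UM (cw 0z S) (UM (rev (cw 0z T)) φ))

 EcHc : ∀ c d φ -> Ec d 0z (Hc c 0z φ) ≈ sumQ (rp n q4) (G (\i j -> c i * d j) 0z φ)
 EcHc c d φ = sumQ-cong (bools n) (\T _ -> sumQ-lin (Lin-⋆ (d ∥ T ∥) (UM-lin (rev (cw 0z T)))) (bools n) _
  ⟫ sumQ-cong (bools n) (\S _ v o -> cong (d ∥ T ∥ *_) (lscl (UM-lin (rev (cw 0z T))) (c ∥ S ∥) (UM (cw 0z S) φ) v o) & l (d ∥ T ∥) (c ∥ S ∥) (UM (rev (cw 0z T)) (UM (cw 0z S) φ) v)))
  ⟫ sumQ-swap (bools n) (bools n) _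
  ⟫ sumQ-zip n (\S T -> (c ∥ S ∥ * d ∥ T ∥) ⋆ UM (rev (cw 0z T)) (UM (cw 0z S) φ))
  where
   l : ∀ a b x -> a * (b * x) ≡ (b * a) * x
   l = ring

 HE-comm : ∀ a b φ -> H a (E b φ) ≈ E b (H a φ)
 HE-comm a b φ = HcEc (δ a) (δ b) φ ⟫ ff-gg (\i j -> δ a i * δ b j) 0z φ ⟫ ≈s (EcHc (δ a) (δ b) φ)

 δ-same : ∀ a -> δ a a ≡ 1z
 δ-same a = on-yes (a N.≟ a) refl 1z

 δ-diff : ∀ {a i} -> a ≢ i -> δ a i ≡ 0z
 δ-diff {a} {i} ne = on-no (a N.≟ i) ne 1z

 sum-δ0 : ∀ m (T : List Bool -> Fn) -> sumQ (bools m) (\S -> δ 0 ∥ S ∥ ⋆ T S) ≈ T (rp m false)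
 sum-δ0 zero T v o = Z.*-identityˡ (T [] v)
 sum-δ0 (suc m) T v o = cong2 (\x y -> x + (y + 0z)) (sumQ-O (bools m) {\S -> 0z ⋆ T (true ∷ S)} (\S _ v _ -> Z.*-zeroˡ (T (true ∷ S) v)) v o) (sum-δ0 m (\S -> T (false ∷ S)) v o) & l (T (false ∷ rp m false) v)
  where
   l : ∀ x -> 0z + (x + 0z) ≡ x
   l = ring

 I-false : ∀ a m -> I a (rp m false) ≡ []
 I-false a zero = refl
 I-false a (suc m) = I-false (a + 1z) m

 cw-false : ∀ r -> cw r (rp n false) ≡ inl []
 cw-false r = k n refl
  where
   k : ∀ m -> m ≡ n -> cw r (rp m false) ≡ inl []
   k zero e = absurd (N.≢-nonZero⁻¹ n (sym e))
   k (suc m) e = cong (\z -> inl (z ++ [])) (I-false (r + 1z) m)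

 H0 : ∀ φ -> H 0 φ ≈ φ
 H0 φ = sum-δ0 n (\S -> UM (cw 0z S) φ) ⟫ \v o -> cong (\z -> UM z φ v) (cw-false 0z)

 E0 : ∀ φ -> E 0 φ ≈ φ
 E0 φ = sum-δ0 n (\S -> UM (rev (cw 0z S)) φ) ⟫ \v o -> cong (\z -> UM (rev z) φ v) (cw-false 0z)

 ∥∥≤ : ∀ S -> ∥ S ∥ N.≤ length S
 ∥∥≤ [] = z≤n
 ∥∥≤ (true ∷ S) = s≤s (∥∥≤ S)
 ∥∥≤ (false ∷ S) = M.m≤n⇒m≤1+n (∥∥≤ S)

 ∥∥-AllT : ∀ S -> length S N.≤ ∥ S ∥ -> AllT S
 ∥∥-AllT [] _ = []
 ∥∥-AllT (true ∷ S) (s≤s h) = refl ∷ ∥∥-AllT S h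
 ∥∥-AllT (false ∷ S) h = absurd (M.<-irrefl refl (M.≤-trans h (∥∥≤ S)))

 H-big : ∀ a -> n N.≤ a -> ∀ φ -> H a φ ≈ O
 H-big a h φ = sumQ-O (bools n) (\S e v o -> k S (e & L.length-replicate n) (a N.≟ ∥ S ∥) v)
  where
   k : ∀ S -> length S ≡ n -> (d : Dec (a ≡ ∥ S ∥)) -> ∀ v -> on d 1z * UM (cw 0z S) φ v ≡ 0z
   k S e (no _) v = Z.*-zeroˡ (UM (cw 0z S) φ v)
   k S e (yes refl) v rewrite go-AllT 0z S [] (∥∥-AllT S (subst (N._≤ ∥ S ∥) (sym e) h)) = refl

 altW : ℕ -> Wt
 altW m i j = on (i N.+ j N.≟ m) (sg j)

 altW-Σ : ∀ m i j -> ΣL (upTo (suc m)) (\b -> sg b * (δ (m N.∸ b) i * δ b j)) ≡ altW m i j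
 altW-Σ m i j = k (i N.+ j N.≟ m)
  where
   k : (d : Dec (i N.+ j ≡ m)) -> ΣL (upTo (suc m)) (\b -> sg b * (δ (m N.∸ b) i * δ b j)) ≡ on d (sg j)
   k (yes refl) = Σ-one (\b -> sg b * (δ (m N.∸ b) i * δ b j)) (UP.upTo⁺ (suc m)) {j} (∈-upTo⁺ (s≤s (M.m≤n+m j i)))
    (\b _ ne -> cong (\z -> sg b * (δ (m N.∸ b) i * z)) (δ-diff ne) & cong (sg b *_) (Z.*-zeroʳ (δ (m N.∸ b) i)) & Z.*-zeroʳ (sg b)) &
    cong2 (\x y -> sg j * (x * y)) (cong (\z -> δ z i) (M.m+n∸n≡m i j) & δ-same i) (δ-same j) & Z.*-identityʳ (sg j)
   k (no ne) = Σ-0 (upTo (suc m)) (\b b∈ -> z b b∈ ((m N.∸ b) N.≟ i) (b N.≟ j))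
    where
     z : ∀ b -> b ∈ upTo (suc m) -> (d : Dec (m N.∸ b ≡ i)) (e : Dec (b ≡ j)) -> sg b * (on d 1z * on e 1z) ≡ 0z
     z b b∈ (yes refl) (yes refl) = absurd (ne (M.m∸n+n≡m (M.≤-pred (∈-upTo⁻ b∈))))
     z b b∈ (yes _) (no _) = Z.*-zeroʳ (sg b)
     z b b∈ (no _) e = Z.*-zeroʳ (sg b)

 -- The signs (-1)^j on pairs with i + j = m satisfy `Alt`. They vanish at (0, 0) because m ≥ 1, and
 -- where i + j ≥ n because m < n, so `ff-alt` applies.
 alternating : ∀ m -> 1 N.≤ m -> m N.< n -> ∀ φ -> ΣF (upTo (suc m)) (\j -> sg j ⋆ H (m N.∸ j) (E j φ)) ≈ O
 alternating m m≥1 m<n φ = ΣF-cong (upTo (suc m)) (\j -> ⋆-cong (sg j) (HcEc (δ (m N.∸ j)) (δ j) φ) ⟫ sumQ-lin (Lin-⋆ (sg j) Lin-id) (rp n q4) _)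
  ⟫ ≈s (sumQ-ΣF (rp n q4) (upTo (suc m)) (\w j -> sg j ⋆ F (\i k -> δ (m N.∸ j) i * δ j k) 0z φ w))
  ⟫ sumQ-cong (rp n q4) (\w _ v o -> Σ-cong (upTo (suc m)) (\j -> l (sg j) (δ (m N.∸ j) ∥ fs w ∥ * δ j ∥ ts w ∥) (ff' 0z w φ v)) &
   (Σ-* (ff' 0z w φ v) (upTo (suc m)) _) & (Z.*-comm (ff' 0z w φ v) _) & cong (_* ff' 0z w φ v) (altW-Σ m ∥ fs w ∥ ∥ ts w ∥))
  ⟫ ff-alt (altW m) 0z φ (\i j -> cong (_+ altW m i (suc j)) (e i j) & Z.+-inverseˡ (altW m i (suc j)))
   (on-no (0 N.≟ m) (\ { refl -> M.<-irrefl refl m≥1 }) 1z)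
   (\i j h -> on-no (i N.+ j N.≟ m) (\ { refl -> M.<-irrefl refl (M.<-≤-trans m<n h) }) (sg j))
  where
   l : ∀ a b c -> a * (b * c) ≡ c * (a * b)
   l = ring
   e : ∀ i j -> altW m (suc i) j ≡ - altW m i (suc j)
   e i j = k (suc i N.+ j N.≟ m) (i N.+ suc j N.≟ m)
    where
     k : (d : Dec (suc i N.+ j ≡ m)) (d' : Dec (i N.+ suc j ≡ m)) -> on d (sg j) ≡ - on d' (- sg j)
     k (yes _) (yes _) = sym (Z.neg-involutive (sg j))
     k (no _) (no _) = refl
     k (yes p) (no q) = absurd (q (M.+-suc i j & p))
     k (no p) (yes q) = absurd (p (sym (M.+-suc i j) & q))

 H-expand : ∀ m -> suc m N.< n -> ∀ φ -> H (suc m) φ ≈ ΣF (upTo (suc m)) (\j -> sg j ⋆ H (m N.∸ j) (E (suc j) φ))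
 H-expand m h φ v o = sym (lcong (H-lin (suc m)) (E0 φ) v o) & lem (H (suc m) (E 0 φ) v) (R (suc m) suc) (cong (_+ R (suc m) suc) (sym (Z.*-identityˡ (H (suc m) (E 0 φ) v))) & cong (_+_ (1z * H (suc m) (E 0 φ) v)) (sym (tab (upTo (suc m)))) & cong (\z -> ΣL z (\j -> sg j * H (suc m N.∸ j) (E j φ) v)) (cong (0 ∷_) (L.map-upTo suc (suc m))) & alternating (suc m) (s≤s z≤n) h φ v o) &
  (cong -_ (Σ-cong (upTo (suc m)) (\j -> sym (Z.neg-distribˡ-* (sg j) (H (m N.∸ j) (E (suc j) φ) v))))) & (cong -_ (Σ-neg (upTo (suc m)) (\j -> sg j * H (m N.∸ j) (E (suc j) φ) v))) & Z.neg-involutive (ΣL (upTo (suc m)) (\j -> sg j * H (m N.∸ j) (E (suc j) φ) v))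
  where
   R : ℕ -> (ℕ -> ℕ) -> ℤ
   R k f = ΣL (upTo k) (\j -> sg (f j) * H (suc m N.∸ f j) (E (f j) φ) v)
   lem : ∀ x y -> x + y ≡ 0z -> x ≡ - y
   lem x y e = sym (+0 x) & cong (_+_ x) (sym (Z.+-inverseʳ y)) & sym (Z.+-assoc x y (- y)) & cong (_+ (- y)) e & 0+ (- y)
   tab : ∀ xs -> ΣL (map suc xs) (\j -> sg j * H (suc m N.∸ j) (E j φ) v) ≡ ΣL xs (\j -> sg (suc j) * H (suc m N.∸ suc j) (E (suc j) φ) v)
   tab xs = Σ-map suc xs _

 -- Strong induction on the first index: `H-expand` writes the operator through smaller `H` and some
 -- `E`, and each `E` commutes with `H b`. From index n on the operator is zero.
 HH-comm : ∀ a b φ -> H a (H b φ) ≈ H b (H a φ)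
 HH-comm a b φ = go' a a M.≤-refl φ
  where
   go' : ∀ k a -> a N.≤ k -> ∀ φ -> H a (H b φ) ≈ H b (H a φ)
   go' k zero h φ = H0 (H b φ) ⟫ ≈s (lcong (H-lin b) (H0 φ))
   go' (suc k) (suc a) (s≤s h) φ = f (suc a N.<? n)
    where
     f : Dec (suc a N.< n) -> H (suc a) (H b φ) ≈ H b (H (suc a) φ)
     f (no p) = H-big (suc a) (M.≮⇒≥ p) (H b φ) ⟫ ≈s (lO (H-lin b) (H-big (suc a) (M.≮⇒≥ p) φ))
     f (yes p) = H-expand a p (H b φ)
      ⟫ ΣF-cong (upTo (suc a)) (\j -> ⋆-cong (sg j) (lcong (H-lin (a N.∸ j)) (≈s (HE-comm b (suc j) φ)) ⟫ go' k (a N.∸ j) (M.≤-trans (M.m∸n≤m a j) h) (E (suc j) φ)) ⟫ ≈s (lscl (H-lin b) (sg j) _))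
      ⟫ ≈s (lΣ (H-lin b) (upTo (suc a)) _) ⟫ ≈s (lcong (H-lin b) (H-expand a p φ))

 -- A twisted commutation rule: passing `U r` exchanges r and r + 1 and leaves a defect, plus the
 -- identity in one direction and minus it in the other. The second rule has φ on the left so that
 -- no subtraction appears.
 record Deriv (D : ℤ -> Fn -> Fn) : Set where
  field
   D-lin : ∀ r -> Lin (D r)
   D-U : ∀ r φ -> D r (U r φ) ≈ U r (D (r + 1z) φ) ⊹ φ
   D-U' : ∀ r φ -> D (r + 1z) (U r φ) ⊹ φ ≈ U r (D r φ)
   D-far : ∀ r i φ -> r < i -> i + 1z < r + N -> D r (U i φ) ≈ U i (D r φ)

 module _ {D : ℤ -> Fn -> Fn} (der : Deriv D) (φ : Fn) (Dφ : ∀ r -> D r φ ≈ O) where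
  open Deriv der

  D-UW : ∀ r w ψ -> All (\i -> r < i × i + 1z < r + N) w -> D r (UW w ψ) ≈ UW w (D r ψ)
  D-UW r [] ψ _ = ≈r
  D-UW r (i ∷ w) ψ ((p , q) ∷ ps) = D-far r i _ p q ⟫ lcong (U-lin i) (D-UW r w ψ ps)

  D-UI : ∀ r a S ψ -> r < a -> a + + length S < r + N -> D r (UI a S ψ) ≈ UI a S (D r ψ)
  D-UI r a S ψ h h' = D-UW r (I a S) ψ (All.map (\ {i} (p , q) -> Z.<-≤-trans h p , lia 3 (\i x y -> i :< x => x :< y => |- i :+ #1 :< y) i (a + + length S) (r + N) q h') (I-range a S))

  -- The weight of the set obtained from S by filling its first gap, or 0 if there is none. Moving D
  -- through an initial run of letters drops one of them, and that letter is the first gap of the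
  -- set that remains.
  gapc : (ℕ -> ℤ) -> List Bool -> ℤ
  gapc c [] = 0z
  gapc c (true ∷ S) = gapc (\i -> c (suc i)) S
  gapc c (false ∷ S) = c (suc ∥ S ∥)

  part1 : ∀ m a c -> a + + m < a + N -> sumQ (bools m) (\S -> c ∥ S ∥ ⋆ D a (UI a S φ)) ≈ sumQ (bools m) (\S -> gapc c S ⋆ UI a S φ)
  part1 zero a c h v o = cong (c 0 *_) (Dφ a v o) & Z.*-zeroʳ (c 0) & sym (Z.*-zeroˡ (φ v))
  part1 (suc m) a c h v o = cong2 (\x y -> x + (y + 0z)) (tt' v o) (sumQ-O (bools m) ff'' v o) & l (sumQ (bools m) (\S -> gapc c' S ⋆ U a (UI (a + 1z) S φ)) v) (sumQ (bools m) (\S -> c' ∥ S ∥ ⋆ UI (a + 1z) S φ) v)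
   where
    c' : ℕ -> ℤ
    c' i = c (suc i)
    l : ∀ x y -> (x + y) + (0z + 0z) ≡ x + (y + 0z)
    l = ring
    len-S : ∀ (S : List Bool) -> length S ≡ length (bools m) -> a + 1z + + length S < a + N
    len-S S e = subst (_< a + N) (sym (+1s a (length S) & cong (\z -> a + + suc z) (e & L.length-replicate m))) h
    ff'' : ∀ S -> length S ≡ length (bools m) -> c ∥ S ∥ ⋆ D a (UI (a + 1z) S φ) ≈ O
    ff'' S e v o = cong (c ∥ S ∥ *_) ((D-UI a (a + 1z) S φ (lia 1 (\a -> |- a :< a :+ #1) a) (len-S S e) ⟫ lO (UI-lin (a + 1z) S) (Dφ a)) v o) & Z.*-zeroʳ (c ∥ S ∥)
    tt' : sumQ (bools m) (\S -> c' ∥ S ∥ ⋆ D a (U a (UI (a + 1z) S φ))) ≈ sumQ (bools m) (\S -> gapc c' S ⋆ U a (UI (a + 1z) S φ)) ⊹ sumQ (bools m) (\S -> c' ∥ S ∥ ⋆ UI (a + 1z) S φ)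
    tt' = sumQ-cong (bools m) (\S _ v o -> cong (c' ∥ S ∥ *_) (D-U a (UI (a + 1z) S φ) v o) & Z.*-distribˡ-+ (c' ∥ S ∥) (U a (D (a + 1z) (UI (a + 1z) S φ)) v) (UI (a + 1z) S φ v))
     ⟫ sumQ-+ (bools m) (\S -> c' ∥ S ∥ ⋆ U a (D (a + 1z) (UI (a + 1z) S φ))) (\S -> c' ∥ S ∥ ⋆ UI (a + 1z) S φ)
     ⟫ ⊹-cong {ψ = sumQ (bools m) (\S -> c' ∥ S ∥ ⋆ UI (a + 1z) S φ)} (sumQ-cong (bools m) (\S _ -> ≈s (lscl (U-lin a) (c' ∥ S ∥) _)) ⟫ ≈s (sumQ-lin (U-lin a) (bools m) _)
      ⟫ lcong (U-lin a) (part1 m (a + 1z) c' (lia 3 (\a m N -> a :+ (#1 :+ m) :< a :+ N => |- a :+ #1 :+ m :< a :+ #1 :+ N) a (+ m) N h))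
      ⟫ sumQ-lin (U-lin a) (bools m) _ ⟫ sumQ-cong (bools m) (\S _ -> lscl (U-lin a) (gapc c' S) _)) ≈r

  -- Sets containing the letter r - 1 cancel the terms of `part1`. D at r passes the block after the
  -- gap, meets `U (r - 1)` and removes it with a minus sign; the rest is the word of T0 ++ T, up to
  -- commuting blocks. `T0` is the initial run read so far.
  part2 : ∀ r T T0 (c : ℕ -> ℤ) -> suc (length T0 N.+ length T) ≡ n ->
   c (∥ T0 ∥ N.+ suc ∥ T ∥) ⋆ D r (UM (go (r + + length T0) T (r + -[1+ 0 ] ∷ I r T0)) φ) ⊹ gapc (\i -> c (∥ T0 ∥ N.+ i)) T ⋆ UI r (T0 ++ T) φ ≈ O
  part2 r [] T0 c e v o = (cong2 _+_ (cong (c (∥ T0 ∥ N.+ 1) *_) (lzero (D-lin r) v o) & Z.*-zeroʳ (c (∥ T0 ∥ N.+ 1))) (Z.*-zeroˡ (UI r (T0 ++ []) φ v))) & refl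
  part2 r (true ∷ T) T0 c e v o = (cong2 _+_
   (cong2 (\x y -> c x * D r (UM y φ) v) ((M.+-suc ∥ T0 ∥ (suc ∥ T ∥)) & cong (N._+ suc ∥ T ∥) (sym cnt))
    (cong2 (\x y -> go x T (r + -[1+ 0 ] ∷ y)) (Z.+-assoc r (+ length T0) 1z & cong (\z -> r + + z) (sym (L.length-++ T0 {[ true ]}))) (sym (I-++ r T0 [ true ]))))
   (cong2 (\x y -> x * UI r y φ v) (gapc-cong T (\i -> cong c ((M.+-suc ∥ T0 ∥ i) & cong (N._+ i) (sym cnt)))) (sym (L.++-assoc T0 [ true ] T)))) &
   part2 r T (T0 ++ [ true ]) c (cong suc (cong (N._+ length T) (L.length-++ T0 & M.+-comm (length T0) 1) & sym (M.+-suc (length T0) (length T))) & e) v o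
   where
    cnt : ∥ T0 ++ [ true ] ∥ ≡ suc ∥ T0 ∥
    cnt = (∥++∥ T0 [ true ]) & (M.+-comm ∥ T0 ∥ 1)
    gapc-cong : ∀ S {c c' : ℕ -> ℤ} -> (∀ i -> c i ≡ c' i) -> gapc c S ≡ gapc c' S
    gapc-cong [] h = refl
    gapc-cong (true ∷ S) h = gapc-cong S (\i -> h (suc i))
    gapc-cong (false ∷ S) h = h _
  part2 r (false ∷ T) T0 c e v o = cong (\z -> z + C * UI r (T0 ++ false ∷ T) φ v) (sym (neg* C (UI r (T0 ++ false ∷ T) φ v) (D r (UM (go (r + + length T0) (false ∷ T) (r + -[1+ 0 ] ∷ I r T0)) φ) v) key)) &
   Z.+-inverseˡ (C * UI r (T0 ++ false ∷ T) φ v)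
   where
    C = c (∥ T0 ∥ N.+ suc ∥ T ∥)
    a = r + + length T0 + 1z
    z = r + -[1+ 0 ]
    neg* : ∀ C x y -> y + x ≡ 0z -> - (C * x) ≡ C * y
    neg* C x y e = l C x & cong (C *_) (lia 2 (\x y -> y :+ x := #0 => |- #0 :- x := y) x y e)
     where
      l : ∀ C x -> - (C * x) ≡ C * (0z - x)
      l = ring
    eN' : N ≡ 1z + (+ length T0 + (1z + + length T))
    eN' = cong +_ (sym e)
    0≤ : ∀ {k} -> 0z ≤ + k
    0≤ = ℤ.+≤+ z≤n
    z+1 : z + 1z ≡ r
    z+1 = lia 1 (\r -> |- r :+ # -[1+ 0 ] :+ #1 := r) r
    ψ = UI r T0 φ
    inner : D r (U z ψ) ⊹ ψ ≈ O
    inner = (\v o -> cong (\y -> D y (U z ψ) v + ψ v) (sym z+1)) ⟫ D-U' z ψ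
     ⟫ lO (U-lin z) (D-UI z r T0 φ (lia 1 (\r -> |- r :+ # -[1+ 0 ] :< r) r) (lia 4 (\r t s N -> N := #1 :+ (t :+ (#1 :+ s)) => #0 =< s => |- r :+ t :< r :+ # -[1+ 0 ] :+ N) r (+ length T0) (+ length T) N eN' 0≤) ⟫ lO (UI-lin r T0) (Dφ z))
    UIeq : UI r (T0 ++ false ∷ T) φ ≈ UI a T ψ
    UIeq = (\v o -> cong (\w -> UW w φ v) (I-++ r T0 (false ∷ T))) ⟫ UW-++ (I r T0) (I a T) φ
     ⟫ farW (I-far r T0 a T (lia 2 (\r t -> |- r :+ t :< r :+ t :+ #1) r (+ length T0)) (lia 4 (\r t s N -> N := #1 :+ (t :+ (#1 :+ s)) => |- r :+ t :+ #1 :+ s :< r :+ N) r (+ length T0) (+ length T) N eN')) φ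
    key : D r (UM (go (r + + length T0) (false ∷ T) (z ∷ I r T0)) φ) v + UI r (T0 ++ false ∷ T) φ v ≡ 0z
    key = (⊹-cong {ψ = UI r (T0 ++ false ∷ T) φ} (lcong (D-lin r) (UW-++ (I a T) (z ∷ I r T0) φ)
     ⟫ D-UI r a T (U z ψ) (lia 2 (\r t -> #0 =< t => |- r :< r :+ t :+ #1) r (+ length T0) 0≤) (lia 4 (\r t s N -> N := #1 :+ (t :+ (#1 :+ s)) => |- r :+ t :+ #1 :+ s :< r :+ N) r (+ length T0) (+ length T) N eN')) UIeq
     ⟫ ≈s (ladd (UI-lin a T) (D r (U z ψ)) ψ) ⟫ lO (UI-lin a T) inner) v o

  -- Split the sets by membership of r - 1. Without it the word is linear and `part1` applies; with
  -- it `part2` yields the opposite terms.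
  D-Hc : ∀ c r -> D r (Hc c r φ) ≈ O
  D-Hc c r = k n refl
   where
    bs = true ∷ false ∷ []
    k : ∀ m -> m ≡ n -> D r (sumQ (bools m) (\S -> c ∥ S ∥ ⋆ UM (cw r S) φ)) ≈ O
    k zero e = absurd (N.≢-nonZero⁻¹ n (sym e))
    k (suc m) e = lcong (D-lin r) (sumQ-rot m bs (\S -> c ∥ S ∥ ⋆ UM (cw r S) φ)
     ⟫ sumQ-cong (bools m) (\T eT v o -> cong2 (\x y -> x + (y + 0z))
      (cong2 (\x y -> c x * y) ((∥++∥ T [ true ]) & (M.+-comm ∥ T ∥ 1)) (last T (eT & L.length-replicate m) v o))
      (cong2 (\x y -> c x * y) ((∥++∥ T [ false ]) & (M.+-identityʳ ∥ T ∥)) (fw (cw-gap r T (subst2 N._<_ (sym (eT & L.length-replicate m)) e (M.n<1+n m))) φ v o)))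
     ⟫ sumQ-+ (bools m) (\T -> c (suc ∥ T ∥) ⋆ UM (go r T [ z ]) φ) (\T -> c ∥ T ∥ ⋆ UI r T φ ⊹ O))
     ⟫ ladd (D-lin r) _ _
     ⟫ ⊹-cong (sumQ-lin (D-lin r) (bools m) _ ⟫ sumQ-cong (bools m) (\T _ -> lscl (D-lin r) (c (suc ∥ T ∥)) (UM (go r T [ z ]) φ)))
      (lcong (D-lin r) (sumQ-cong (bools m) (\T _ v _ -> +0 _)) ⟫ sumQ-lin (D-lin r) (bools m) _ ⟫ sumQ-cong (bools m) (\T _ -> lscl (D-lin r) (c ∥ T ∥) (UI r T φ))
       ⟫ part1 m r c (Z.+-monoʳ-< r (subst (\y -> + m < + y) e (ℤ.+<+ (M.n<1+n m)))))
     ⟫ ≈s (sumQ-+ (bools m) (\T -> c (suc ∥ T ∥) ⋆ D r (UM (go r T [ z ]) φ)) (\T -> gapc c T ⋆ UI r T φ))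
     ⟫ sumQ-O (bools m) (\T eT -> subst (\y -> c (suc ∥ T ∥) ⋆ D r (UM (go y T [ z ]) φ) ⊹ gapc c T ⋆ UI r T φ ≈ O) (+0 r) (part2 r T [] c (cong suc (eT & L.length-replicate m) & e)))
     where
      z = r + -[1+ 0 ]
      last : ∀ T -> length T ≡ m -> UM (cw r (T ++ [ true ])) φ ≈ UM (go r T [ z ]) φ
      last T eT = fw (≅t (≅≡ (go-true r T [])) (go-cong r T (≅t (≅≡ (cong (\y -> inl [ y ]) ez)) (≅-per z 1z)))) φ
       where
        ez : r + + length T ≡ z + 1z * N
        ez = lia 4 (\r t N M -> N := #1 :+ t => M := N => |- r :+ t := r :+ # -[1+ 0 ] :+ M) r (+ length T) N (1z * N) ((cong +_ (sym e)) & cong (\y -> + suc y) (sym eT)) (Z.*-identityˡ N)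

  D-H : ∀ a r -> D r (H a φ) ≈ O
  D-H a r = lcong (D-lin r) (≈s (Hc-base (δ a) φ r)) ⟫ D-Hc (δ a) r

-- The nil-Coxeter operators on functions of affine permutations

module Ops (n : ℕ) {{nz : NonZero n}} (1<n : 1z < + n) where
 open Bruhat n 1<n public

 U : ℤ -> (Perm n -> ℤ) -> Perm n -> ℤ
 U i φ v = on (ev v (i + 1z) <? ev v i) (φ (v ·s i))

 i<i+1 : ∀ i -> i < i + 1z
 i<i+1 = lia 1 (\i -> |- i :< i :+ #1)

 on-* : {P : Set} (d : Dec P) -> ∀ c x -> on d (c * x) ≡ c * on d x
 on-* (yes _) c x = refl
 on-* (no _) c x = sym (Z.*-zeroʳ c)

 ev-s-o : ∀ v i x -> ¬ x ~ i -> ¬ x ~ i + 1z -> ev (v ·s i) x ≡ ev v x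
 ev-s-o v i x p q = ev-s v i x & cong (ev v) (t-o p q)

 ·s-per : ∀ v i m -> v ·s (i + m * N) ≡ v ·s i
 ·s-per v i m = ext _ _ \x -> ev-s v (i + m * N) x & cong (ev v) (cong (\z -> t (i + m * N) z x) (l i (m * N)) & t-shift i (i + 1z) m x) & sym (ev-s v i x)
  where
   l : ∀ i k -> i + k + 1z ≡ i + 1z + k
   l = ring

 U-nilp : Words.Nil n IsAff U
 U-nilp = record
  { U-lin = \i -> record
   { lcong = \p v A -> cong (on (ev v (i + 1z) <? ev v i)) (p (v ·s i) (s-Aff A i))
   ; ladd = \φ ψ v A -> on-+ (ev v (i + 1z) <? ev v i) (φ (v ·s i)) (ψ (v ·s i))
   ; lscl = \c φ v A -> on-* (ev v (i + 1z) <? ev v i) c (φ (v ·s i)) }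
  ; U-per = \i m φ v A -> on-cong (ev v (i + m * N + 1z) <? ev v (i + m * N)) (ev v (i + 1z) <? ev v i)
   (\h -> lia 3 (\x y k -> x :+ k :< y :+ k => |- x :< y) (ev v (i + 1z)) (ev v i) (m * N) (subst2 _<_ (p1 v i m) (ev-per v i m) h))
   (\h -> subst2 _<_ (sym (p1 v i m)) (sym (ev-per v i m)) (Z.+-monoˡ-< (m * N) h)) (\_ -> cong φ (·s-per v i m))
  ; U-nil = \i φ v A -> nil0 i φ v
  ; U-far = \i j φ h h' v A -> far i j φ h h' v
  ; U-braid = \h i φ v A -> braid h i φ v }
  where
   p1 : ∀ v i m -> ev v (i + m * N + 1z) ≡ ev v (i + 1z) + m * N
   p1 v i m = cong (ev v) (l i (m * N)) & ev-per v (i + 1z) m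
    where
     l : ∀ i k -> i + k + 1z ≡ i + 1z + k
     l = ring
   nil0 : ∀ i φ v -> U i (U i φ) v ≡ 0z
   nil0 i φ v = k (ev v (i + 1z) <? ev v i)
    where
     k : (d : Dec (ev v (i + 1z) < ev v i)) -> on d (U i φ (v ·s i)) ≡ 0z
     k (no _) = refl
     k (yes p) = on-no (ev (v ·s i) (i + 1z) <? ev (v ·s i) i) (\q -> Z.<-asym p (subst2 _<_ (ev-sr v i) (ev-sl v i) q)) _
   far : ∀ i j φ -> i + 1z < j -> j + 1z < i + N -> ∀ v -> U i (U j φ) v ≡ U j (U i φ) v
   far i j φ h h' v = (on-on (ev v (i + 1z) <? ev v i) (ev (v ·s i) (j + 1z) <? ev (v ·s i) j) _) &
    on-cong (d1 ×-dec d2) (d3 ×-dec d4)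
     (\ { (p , q) -> subst2 _<_ (o i (j + 1z) j1i j1i1) (o i j ji ji1) q , subst2 _<_ (sym (o j (i + 1z) (ji1 ∘ sym) (j1i1 ∘ sym))) (sym (o j i (ji ∘ sym) (j1i ∘ sym))) p })
     (\ { (p , q) -> subst2 _<_ (o j (i + 1z) (ji1 ∘ sym) (j1i1 ∘ sym)) (o j i (ji ∘ sym) (j1i ∘ sym)) q , subst2 _<_ (sym (o i (j + 1z) j1i j1i1)) (sym (o i j ji ji1)) p })
     (\_ -> cong φ (mulT-conj v j (j + 1z) (i≁ i) & cong2 (mulT n (v ·s j)) (t-o {j} {j + 1z} {i} (ji ∘ sym) (j1i ∘ sym)) (t-o {j} {j + 1z} {i + 1z} (ji1 ∘ sym) (j1i1 ∘ sym)))) &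
    sym (on-on (ev v (j + 1z) <? ev v j) (ev (v ·s j) (i + 1z) <? ev (v ·s j) i) _)
    where
     d1 = ev v (i + 1z) <? ev v i
     d2 = ev (v ·s i) (j + 1z) <? ev (v ·s i) j
     d3 = ev v (j + 1z) <? ev v j
     d4 = ev (v ·s j) (i + 1z) <? ev (v ·s j) i
     o = ev-s-o v
     ij : i < j
     ij = Z.<-trans (i<i+1 i) h
     jN : j < i + N
     jN = Z.<-trans (i<i+1 j) h'
     ji : ¬ j ~ i
     ji = near i j ij jN ∘ sym
     ji1 : ¬ j ~ i + 1z
     ji1 = near (i + 1z) j h (lia 3 (\i j N -> j :< i :+ N => |- j :< i :+ #1 :+ N) i j N jN) ∘ sym
     j1i : ¬ j + 1z ~ i
     j1i = near i (j + 1z) (Z.<-trans ij (i<i+1 j)) h' ∘ sym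
     j1i1 : ¬ j + 1z ~ i + 1z
     j1i1 = near (i + 1z) (j + 1z) (Z.<-trans h (i<i+1 j)) (lia 3 (\i j N -> j :+ #1 :< i :+ N => |- j :+ #1 :< i :+ #1 :+ N) i j N h') ∘ sym
   braid : + 2 < N -> ∀ i φ v -> U i (U (i + 1z) (U i φ)) v ≡ U (i + 1z) (U i (U (i + 1z) φ)) v
   braid h i φ v = (three d1 d2 d3 _) & on-cong (d1 ×-dec (d2 ×-dec d3)) (e1 ×-dec (e2 ×-dec e3))
    (\ { (p , q , r) -> r1 r , r2 q , r3 p }) (\ { (p , q , r) -> l1 r , l2 q , l3 p }) (\_ -> cong φ perm) & sym (three e1 e2 e3 _)
    where
     j = i + 1z
     k = j + 1z
     three : {P Q R : Set} (p : Dec P) (q : Dec Q) (r : Dec R) -> ∀ x -> on p (on q (on r x)) ≡ on (p ×-dec (q ×-dec r)) x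
     three p q r x = cong (on p) (on-on q r x) & on-on p (q ×-dec r) x
     ik : ¬ i ~ k
     ik = near i k (Z.<-trans (i<i+1 i) (i<i+1 j)) (subst (_< i + N) (sym (Z.+-assoc i 1z 1z)) (Z.+-monoʳ-< i h))
     u = v ·s i
     u2 = u ·s j
     w = v ·s j
     w2 = w ·s i
     uk : ev u k ≡ ev v k
     uk = ev-s-o v i k (ik ∘ sym) (i≁ j ∘ sym)
     wi : ev w i ≡ ev v i
     wi = ev-s-o v j i (i≁ i) ik
     u2j : ev u2 j ≡ ev v k
     u2j = ev-sl u j & uk
     u2i : ev u2 i ≡ ev v j
     u2i = ev-s-o u j i (i≁ i) ik & ev-sl v i
     w2j : ev w2 j ≡ ev v i
     w2j = ev-sr w i & wi
     w2k : ev w2 k ≡ ev v j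
     w2k = ev-s-o w i k (ik ∘ sym) (i≁ j ∘ sym) & ev-sr v j
     d1 = ev v j <? ev v i
     d2 = ev u k <? ev u j
     d3 = ev u2 j <? ev u2 i
     e1 = ev v k <? ev v j
     e2 = ev w j <? ev w i
     e3 = ev w2 k <? ev w2 j
     r1 = subst2 _<_ u2j u2i
     l1 : ev w2 k < ev w2 j -> ev v j < ev v i
     l1 = subst2 _<_ w2k w2j
     r2 : ev u k < ev u j -> ev w j < ev w i
     r2 = subst2 _<_ (uk & sym (ev-sl v j)) (ev-sr v i & sym wi)
     l2 : ev w j < ev w i -> ev u k < ev u j
     l2 = subst2 _<_ (ev-sl v j & sym uk) (wi & sym (ev-sr v i))
     r3 : ev v j < ev v i -> ev w2 k < ev w2 j
     r3 = subst2 _<_ (sym w2k) (sym w2j)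
     l3 : ev v k < ev v j -> ev u2 j < ev u2 i
     l3 = subst2 _<_ (sym u2j) (sym u2i)
     perm : u2 ·s i ≡ w2 ·s j
     perm = mulT-conj u i j (i≁ j) & cong2 (\x y -> mulT n (u ·s i) x y) (t-b0 {i} {j} (i≁ i)) (t-o {i} {j} {k} (ik ∘ sym) (i≁ j ∘ sym)) &
      cong (\x -> mulT n x i k) (ss v i & sym (ss v j)) &
       sym (mulT-conj w j k (i≁ i) & cong2 (\x y -> mulT n (w ·s j) x y) (t-o {j} {k} {i} (i≁ i) ik) (t-a0 {j} {k} (i≁ j)))

 open HE n IsAff U U-nilp public

 pick : {P : Set} -> Dec P -> ℤ -> ℤ -> ℤ
 pick (yes _) x y = x
 pick (no _) x y = y

 pick-yes : {P : Set} (d : Dec P) -> P -> ∀ x y -> pick d x y ≡ x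
 pick-yes (yes _) _ x y = refl
 pick-yes (no ¬p) p x y = absurd (¬p p)

 pick-no : {P : Set} (d : Dec P) -> ¬ P -> ∀ x y -> pick d x y ≡ y
 pick-no (yes p) ¬p x y = absurd (¬p p)
 pick-no (no _) _ x y = refl

 ori : ℤ -> ℤ -> ℤ
 ori r j = pick (r <? j) 1z -[1+ 0 ]

 ori-< : ∀ r j -> r < j -> ori r j ≡ 1z
 ori-< r j h = pick-yes (r <? j) h 1z -[1+ 0 ]

 ori-> : ∀ r j -> j < r -> ori r j ≡ -[1+ 0 ]
 ori-> r j h = pick-no (r <? j) (Z.<-asym h) 1z -[1+ 0 ]

 D : ℤ -> Fn -> Fn
 D r φ v = ΣL (covs v r) (\j -> ori r j * φ (mulT n v r j))

 D-linear : ∀ r -> Lin (D r)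
 D-linear r = record
  { lcong = \p v A -> Σ-cong (covs v r) (\j -> cong (ori r j *_) (p _ (t-Aff A r j)))
  ; ladd = \φ ψ v A -> Σ-cong (covs v r) (\j -> Z.*-distribˡ-+ (ori r j) (φ (mulT n v r j)) (ψ (mulT n v r j))) & (Σ-+ (covs v r) _ _)
  ; lscl = \c φ v A -> trans (Σ-cong (covs v r) (\j -> l (ori r j) c (φ (mulT n v r j)))) (Σ-* c (covs v r) _) }
  where
   l : ∀ o c x -> o * (c * x) ≡ c * (o * x)
   l = ring

 Up : Perm n -> ℤ -> ℤ -> Set
 Up v r j = (r < j × ev v r < ev v j) ⊎ (j < r × ev v j < ev v r)

 Up→ : ∀ {v} -> IsAff v -> ∀ r j -> ¬ r ~ j -> Up v r j -> len v N.< len (mulT n v r j)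
 Up→ A r j h (inl (p , q)) = len-up A r j p h q
 Up→ {v} A r j h (inr (p , q)) = subst (\z -> len v N.< len z) (mulT-sym v j r) (len-up A j r p (h ∘ sym) q)

 →Up : ∀ {v} -> IsAff v -> ∀ r j -> ¬ r ~ j -> len v N.< len (mulT n v r j) -> Up v r j
 →Up {v} A r j h lt = k (Z.<-cmp r j)
  where
   k : _ -> Up v r j
   k (Tri.tri< p _ _) = inl (p , len-up⁻¹ A r j p h lt)
   k (Tri.tri≈ _ p _) = absurd (h (cong (_%ℕ n) p))
   k (Tri.tri> _ _ p) = inr (p , len-up⁻¹ A j r p (h ∘ sym) (subst (\z -> len v N.< len z) (mulT-sym v r j) lt))

 Desc : ℤ -> Perm n -> Set
 Desc i v = ev v (i + 1z) < ev v i

 Desc? : ∀ i v -> Dec (Desc i v)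
 Desc? i v = ev v (i + 1z) <? ev v i

 ¬Desc : ∀ {v} -> IsAff v -> ∀ i -> ¬ Desc i v -> ev v i < ev v (i + 1z)
 ¬Desc A i h = Z.≤∧≢⇒< (Z.≮⇒≥ h) (\e -> Z.<-irrefl (inj A _ _ e) (i<i+1 i))

 module _ {v} (A : IsAff v) (i r : ℤ) where
  private
   e = s i r
   w = v ·s i
   Aw = s-Aff A i

  s-order : ∀ j -> j ≢ e -> r < j -> e < s i j
  s-order j ne h = s-mono i r j h (\ { (m , refl , refl) -> ne (sym (t-a (i≁ i) m)) })

  s-order' : ∀ j -> j ≢ e -> j < r -> s i j < e
  s-order' j ne h = s-mono i j r h (\ { (m , refl , refl) -> ne (sym (t-b (i≁ i) m)) })

  Up-s : ∀ j -> j ≢ e -> Up v r j -> Up w e (s i j)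
  Up-s j ne (inl (p , q)) = inl (s-order j ne p , subst2 _<_ (sym (wf r)) (sym (wf j)) q)
   where
    wf : ∀ x -> ev w (s i x) ≡ ev v x
    wf x = (ev-s v i _) & cong (ev v) (t-inv i (i + 1z) x)
  Up-s j ne (inr (p , q)) = inr (s-order' j ne p , subst2 _<_ (sym (wf j)) (sym (wf r)) q)
   where
    wf : ∀ x -> ev w (s i x) ≡ ev v x
    wf x = (ev-s v i _) & cong (ev v) (t-inv i (i + 1z) x)

  s≁ : ∀ j -> ¬ r ~ j -> ¬ e ~ s i j
  s≁ j h z = h (t-~ i (i + 1z) r j z)

  -- Lifting property. If i were an ascent of v, then v s_i would have length len v + 1 and v t_rj
  -- s_i length len v, whereas by `Up-s` the conjugated reflection still lengthens v s_i.
  lift : ∀ j -> j ≢ e -> ¬ r ~ j -> Cov v r j -> Desc i (mulT n v r j) -> Desc i v × Cov w e (s i j)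
  lift j ne h c d = k (Desc? i v)
   where
    cj : mulT n v r j ·s i ≡ mulT n w e (s i j)
    cj = mulT-conj v i (i + 1z) h
    l1 : len (mulT n w e (s i j)) ≡ len v
    l1 = M.suc-injective (cong (suc ∘ len) (sym cj) & (len-desc _ i d) & c)
    l2 : len w N.< len v
    l2 = subst (len w N.<_) l1 (Up→ Aw e (s i j) (s≁ j h) (Up-s j ne (→Up A r j h (M.≤-reflexive (sym c)))))
    k : Dec (Desc i v) -> Desc i v × Cov w e (s i j)
    k (yes p) = p , l1 & sym (len-desc v i p)
    k (no p) = absurd (M.<-asym l2 (M.≤-reflexive (sym (len-asc v i (¬Desc A i p)))))

 lift⁻ : ∀ {v} (A : IsAff v) i r j -> j ≢ s i r -> ¬ r ~ j -> Desc i v -> Cov (v ·s i) (s i r) (s i j) -> Cov v r j × Desc i (mulT n v r j)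
 lift⁻ {v} A i r j ne h d c = k (Desc? i u')
  where
   w = v ·s i
   u' = mulT n v r j
   cj : u' ·s i ≡ mulT n w (s i r) (s i j)
   cj = mulT-conj v i (i + 1z) h
   l1 : len (u' ·s i) ≡ len v
   l1 = cong len cj & c & len-desc v i d
   upr : Up v r j
   upr = subst (\z -> Up z r j) (ss v i) (subst2 (Up (w ·s i)) (t-inv i (i + 1z) r) (t-inv i (i + 1z) j)
    (Up-s (s-Aff A i) i (s i r) (s i j) (\z -> ne (s-inj i _ _ z)) (→Up (s-Aff A i) (s i r) (s i j) (s≁ A i r j h) (M.≤-reflexive (sym c)))))
   k : Dec (Desc i u') -> Cov v r j × Desc i u'
   k (yes p) = sym (len-desc u' i p) & cong suc l1 , p
   k (no p) = absurd (M.<-asym (Up→ A r j h upr) (subst (len u' N.<_) l1 (M.≤-reflexive (sym (len-asc u' i (¬Desc (t-Aff A r j) i p))))))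

 on-split : {B : Set} (d : Dec B) -> ∀ x -> x ≡ on d x + on (¬? d) x
 on-split (yes _) x = sym (+0 x)
 on-split (no _) x = sym (0+ x)

 Σ-split : (xs : List ℤ) -> Unique xs -> (z : ℤ) (f : ℤ -> ℤ) -> ΣL xs f ≡ ΣL xs (\x -> on (x ≟ z) (f x)) + ΣL (filter (\x -> ¬? (x ≟ z)) xs) f
 Σ-split xs u z f = Σ-cong xs (\x -> on-split (x ≟ z) (f x)) & (Σ-+ xs _ _) & cong (_+_ (ΣL xs (\x -> on (x ≟ z) (f x)))) (sym (Σ-filter (\x -> ¬? (x ≟ z)) xs f))

 Σ-at : (xs : List ℤ) -> Unique xs -> ∀ z (f : ℤ -> ℤ) -> z ∈ xs -> ΣL xs (\x -> on (x ≟ z) (f x)) ≡ f z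
 Σ-at xs u z f m = (Σ-one _ u m (\y _ ne -> on-no (y ≟ z) ne (f y))) & on-yes (z ≟ z) refl (f z)

 Σ-at0 : (xs : List ℤ) -> ∀ z (f : ℤ -> ℤ) -> ¬ z ∈ xs -> ΣL xs (\x -> on (x ≟ z) (f x)) ≡ 0z
 Σ-at0 xs z f m = Σ-0 xs (\y y∈ -> on-no (y ≟ z) (\ { refl -> m y∈ }) (f y))

 main-bij : ∀ {v} -> IsAff v -> ∀ i r (φ : Fn) ->
  ΣL (filter (\x -> ¬? (x ≟ s i r)) (covs v r)) (\j -> ori r j * U i φ (mulT n v r j)) ≡ on (Desc? i v) (ΣL (filter (\x -> ¬? (x ≟ r)) (covs (v ·s i) (s i r))) (\j -> ori (s i r) j * φ (mulT n (v ·s i) (s i r) j)))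
 main-bij {v} A i r φ = Σ-cong xs (\j -> sym (on-* (Desc? i (mulT n v r j)) (ori r j) _)) & sym (Σ-filter (\j -> Desc? i (mulT n v r j)) xs _) & k (Desc? i v)
  where
   e = s i r
   w = v ·s i
   xs = filter (\x -> ¬? (x ≟ e)) (covs v r)
   ys = filter (\x -> ¬? (x ≟ r)) (covs w e)
   xs' = filter (\j -> Desc? i (mulT n v r j)) xs
   x⁻ : ∀ j -> j ∈ xs' -> (j ≢ e) × (¬ r ~ j) × Cov v r j × Desc i (mulT n v r j)
   x⁻ j m with ∈-filter⁻ (\j -> Desc? i (mulT n v r j)) {xs = xs} m
   ... | m1 , d with ∈-filter⁻ (\x -> ¬? (x ≟ e)) {xs = covs v r} m1
   ...   | m2 , ne = ne , fst (covs⁻ v r j m2) , snd (covs⁻ v r j m2) , d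
   k : (d : Dec (Desc i v)) -> ΣL xs' (\j -> ori r j * φ (mulT n v r j ·s i)) ≡ on d (ΣL ys (\j -> ori e j * φ (mulT n w e j)))
   k (no nd) = Σ-0 xs' (\j m -> let (ne , h , c , d) = x⁻ j m in absurd (nd (fst (lift A i r j ne h c d))))
   k (yes d) = Σ-bij (UP.filter⁺ _ (UP.filter⁺ _ (covs-unique v r))) (UP.filter⁺ _ (covs-unique w e)) (s i) (s i)
    (\j m -> let (ne , h , c , d) = x⁻ j m in
     ∈-filter⁺ (\x -> ¬? (x ≟ r)) (covs⁺ (s-Aff A i) e (s i j) (s≁ A i r j h) (snd (lift A i r j ne h c d))) (\z -> ne (sym (t-inv i (i + 1z) j) & cong (s i) z)) , t-inv i (i + 1z) j)
    (\j m -> let (m1 , ne) = ∈-filter⁻ (\x -> ¬? (x ≟ r)) {xs = covs w e} m ; (h , c) = covs⁻ w e j m1 ; ne' : s i j ≢ e ; ne' z = ne (s-inj i j r z) ; h' : ¬ r ~ s i j ; h' z = h (subst (e ~_) (t-inv i (i + 1z) j) (per-~ {s i} (t-per i (i + 1z)) r (s i j) z)) ; (c' , d') = lift⁻ A i r (s i j) ne' h' d (subst (Cov w e) (sym (t-inv i (i + 1z) j)) c) in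
     ∈-filter⁺ (\j -> Desc? i (mulT n v r j)) (∈-filter⁺ (\x -> ¬? (x ≟ e)) (covs⁺ A r (s i j) h' c') ne') d' , t-inv i (i + 1z) j)
    (\j -> ori r j * φ (mulT n v r j ·s i)) (\j -> ori e j * φ (mulT n w e j))
    (\j m -> let (ne , h , c , d) = x⁻ j m in cong2 _*_ (o j ne h (Z.<-cmp r j)) (cong φ (mulT-conj v i (i + 1z) h)))
    where
     o : ∀ j -> j ≢ e -> ¬ r ~ j -> _ -> ori r j ≡ ori e (s i j)
     o j ne h (Tri.tri< p _ _) = ori-< r j p & sym (ori-< e (s i j) (s-order A i r j ne p))
     o j ne h (Tri.tri≈ _ p _) = absurd (h (cong (_%ℕ n) p))
     o j ne h (Tri.tri> _ _ p) = ori-> r j p & sym (ori-> e (s i j) (s-order' A i r j ne p))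

 exc : ℤ -> ℤ -> ℤ -> ℤ
 exc r e x = pick (e ≟ r) 0z (ori r e * x)

 -- Covers by reflections other than s_i correspond under conjugation by s_i. The cover by s_i
 -- itself contributes to the left side if i is an ascent and, with opposite orientation, to the
 -- right side if i is a descent; in both cases the difference is `exc`.
 chevalley : ∀ {v} -> IsAff v -> ∀ i r φ -> D r (U i φ) v ≡ U i (D (s i r) φ) v + exc r (s i r) (φ v)
 chevalley {v} A i r φ = (Σ-split (covs v r) (covs-unique v r) e _) & cong (_+_ X1) (main-bij A i r φ) & k (e ≟ r) (Desc? i v) & cong (_+ exc r e (φ v)) (sym (cong (on (Desc? i v)) (Σ-split (covs w e) (covs-unique w e) r _)))
  where
   e = s i r
   w = v ·s i
   T1 = \j -> ori r j * U i φ (mulT n v r j)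
   T2 = \j -> ori e j * φ (mulT n w e j)
   X1 = ΣL (covs v r) (\x -> on (x ≟ e) (T1 x))
   X2 = ΣL (covs w e) (\x -> on (x ≟ r) (T2 x))
   M = ΣL (filter (\x -> ¬? (x ≟ r)) (covs w e)) T2
   l0 : ∀ a b -> a ≡ 0z -> b ≡ 0z -> a + M ≡ (b + M) + 0z
   l0 a b refl refl = sym (+0 (0z + M))
   vt : e ≢ r -> ∀ u -> mulT n u r e ≡ u ·s i
   vt ne u = f (sv i r)
    where
     f : SV i r -> mulT n u r e ≡ u ·s i
     f (up m p q) = cong2 (mulT n u) p (q & cong (_+ 1z) p & l i (m * N)) & cong (mulT n u (i + m * N)) (sym (l i (m * N))) & ·s-per u i m
      where
       l : ∀ i k -> i + k + 1z ≡ i + k + 1z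
       l i k = refl
     f (dn m p q) = mulT-sym u r e & cong2 (mulT n u) (q & cong (_- 1z) p & l i (m * N)) (p & l2 i (m * N)) & ·s-per u i m
      where
       l : ∀ i k -> i + 1z + k - 1z ≡ i + k
       l = ring
       l2 : ∀ i k -> i + 1z + k ≡ i + k + 1z
       l2 = ring
     f (st _ _ q) = absurd (ne q)
   r≁e : e ≢ r -> ¬ r ~ e
   r≁e ne = f (sv i r)
    where
     f : SV i r -> ¬ r ~ e
     f (up m p q) z = i≁ r (subst (r ~_) q z)
     f (dn m p q) z = i≁ (r - 1z) (subst2 _~_ q (l r) (sym z))
      where
       l : ∀ r -> r ≡ r - 1z + 1z
       l = ring
     f (st _ _ q) z = ne q
   k : (q : Dec (e ≡ r)) (d : Dec (Desc i v)) -> X1 + on d M ≡ on d (X2 + M) + pick q 0z (ori r e * φ v)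
   k (yes p) d = cong (_+ on d M) (Σ-at0 (covs v r) e T1 (\m -> fst (covs⁻ v r e m) (cong (_%ℕ n) (sym p)))) & f d
    where
     f : (d : Dec (Desc i v)) -> 0z + on d M ≡ on d (X2 + M) + 0z
     f (yes _) = l0 0z X2 refl (Σ-at0 (covs w e) r T2 (\m -> fst (covs⁻ w e r m) (cong (_%ℕ n) p)))
     f (no _) = refl
   k (no ne) (yes d) = cong (_+ M) (Σ-at0 (covs v r) e T1 (\m -> M.<-asym (M.≤-reflexive (sym (snd (covs⁻ v r e m)))) (subst (\z -> len z N.< len v) (sym (vt ne v)) (M.≤-reflexive (len-desc v i d))))) &
    l (M) (ori r e) (φ v) & cong (\z -> (z + M) + ori r e * φ v) (sym x2)
    where
     l : ∀ M o x -> 0z + M ≡ (- o * x + M) + o * x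
     l = ring
     wv : mulT n w e r ≡ v
     wv = mulT-sym w e r & vt ne w & ss v i
     x2 : X2 ≡ - ori r e * φ v
     x2 = Σ-at (covs w e) (covs-unique w e) r T2 (covs⁺ (s-Aff A i) e r (r≁e ne ∘ sym) (cong len wv & sym (len-desc v i d))) &
      (cong2 _*_ (oo (Z.<-cmp r e)) (cong φ wv))
      where
       oo : _ -> ori e r ≡ - ori r e
       oo (Tri.tri< p _ _) = ori-> e r p & (cong -_ (sym (ori-< r e p)))
       oo (Tri.tri≈ _ p _) = absurd (ne (sym p))
       oo (Tri.tri> _ _ p) = ori-< e r p & (cong -_ (sym (ori-> r e p)))
   k (no ne) (no nd) = +0 X1 & Σ-at (covs v r) (covs-unique v r) e T1 (covs⁺ A r e (r≁e ne) (cong len (vt ne v) & len-asc v i asc)) &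
    cong (ori r e *_) (cong (U i φ) (vt ne v) & (on-yes (Desc? i w) (subst2 _<_ (sym (ev-sr v i)) (sym (ev-sl v i)) asc) _) & cong φ (ss v i)) & sym (0+ _)
    where
     asc = ¬Desc A i nd

 exc-ne : ∀ r e x -> e ≢ r -> exc r e x ≡ ori r e * x
 exc-ne r e x ne = pick-no (e ≟ r) ne 0z (ori r e * x)

 exc-eq : ∀ r e x -> e ≡ r -> exc r e x ≡ 0z
 exc-eq r e x p = pick-yes (e ≟ r) p 0z (ori r e * x)

 D-deriv : Deriv D
 D-deriv = record
  { D-lin = D-linear
  ; D-U = \r φ v A -> chevalley A r r φ & cong2 (\z y -> U r (D z φ) v + y) (t-a0 (i≁ r)) (exc-ne r (s r r) (φ v) (\p -> Z.<-irrefl (sym p & t-a0 (i≁ r)) (i<i+1 r)) &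
   cong (_* φ v) (ori-< r (s r r) (subst (r <_) (sym (t-a0 (i≁ r))) (i<i+1 r))) & Z.*-identityˡ (φ v))
  ; D-U' = \r φ v A -> cong (_+ φ v) (chevalley A r (r + 1z) φ & cong2 (\z y -> U r (D z φ) v + y) (t-b0 (i≁ r)) (exc-ne (r + 1z) (s r (r + 1z)) (φ v) (\p -> Z.<-irrefl (sym (t-b0 (i≁ r)) & p) (i<i+1 r)) &
   cong (_* φ v) (ori-> (r + 1z) (s r (r + 1z)) (subst (_< r + 1z) (sym (t-b0 (i≁ r))) (i<i+1 r))))) & l (U r (D r φ) v) (φ v)
  ; D-far = \r i φ h h' v A -> let e≡ = t-o (near r i h (Z.<-trans (i<i+1 i) h')) (near r (i + 1z) (Z.<-trans h (i<i+1 i)) h') in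
   trans (chevalley A i r φ) (cong2 (\z y -> U i (D z φ) v + y) e≡ (exc-eq r (s i r) (φ v) e≡) & (+0 _)) }
  where
   l : ∀ a b -> a + -[1+ 0 ] * b + b ≡ a
   l = ring

-- Cyclically decreasing words

module CycWords (n : ℕ) {{nz : NonZero n}} (1<n : 1z < + n) where
 open Ops n 1<n public

 act : List ℤ -> ℤ -> ℤ
 act [] x = x
 act (i ∷ w) x = s i (act w x)

 infixl 6 _·w_
 _·w_ : Perm n -> List ℤ -> Perm n
 v ·w [] = v
 v ·w (i ∷ w) = (v ·s i) ·w w

 ev-w : ∀ v w x -> ev (v ·w w) x ≡ ev v (act w x)
 ev-w v [] x = refl
 ev-w v (i ∷ w) x = ev-w (v ·s i) w x & ev-s v i (act w x)

 w-Aff : ∀ {v} -> IsAff v -> ∀ w -> IsAff (v ·w w)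
 w-Aff A [] = A
 w-Aff A (i ∷ w) = w-Aff (s-Aff A i) w

 act-++ : ∀ x y z -> act (x ++ y) z ≡ act x (act y z)
 act-++ [] y z = refl
 act-++ (i ∷ x) y z = cong (s i) (act-++ x y z)

 act-rev : ∀ w x -> act w (act (reverse w) x) ≡ x
 act-rev [] x = refl
 act-rev (i ∷ w) x = cong (\z -> s i (act w z)) (cong (\z -> act z x) (L.unfold-reverse i w) & (act-++ (reverse w) [ i ] x)) &
  cong (s i) (act-rev w (s i x)) & t-inv i (i + 1z) x

 Mem : ℤ -> List ℤ -> Set
 Mem x l = Any (x ~_) l

 Mem-~ : ∀ x y {l} -> x ~ y -> Mem x l -> Mem y l
 Mem-~ x y e = Any.map (\ {z} h -> sym e & h)

 -- `CycDec` for integer letters compared modulo n and stated recursively: after i neither i nor i +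
 -- 1 may occur.
 data CD : List ℤ -> Set where
  [] : CD []
  cons : ∀ {i l} -> ¬ Mem i l -> ¬ Mem (i + 1z) l -> CD l -> CD (i ∷ l)

 +1~ : ∀ x y -> x ~ y -> x + 1z ~ y + 1z
 +1~ x y h with ~→ x y h
 ... | m , refl = →~ (x + 1z) _ m (lia 2 (\x k -> |- x :+ k :+ #1 := x :+ #1 :+ k) x (m * N))

 -1~ : ∀ x y -> x + 1z ~ y + 1z -> x ~ y
 -1~ x y h with ~→ (x + 1z) (y + 1z) h
 ... | m , e = →~ x y m (lia 3 (\x y k -> y :+ #1 := x :+ #1 :+ k => |- y := x :+ k) x y (m * N) e)

 s-up : ∀ i y -> y ~ i -> s i y ≡ y + 1z
 s-up i y h = k (sv i y)
  where
   k : SV i y -> _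
   k (up _ _ e) = e
   k (dn m e _) = absurd (i≁ i (sym h & sym (→~ (i + 1z) y m e)))
   k (st p _ _) = absurd (p h)

 s-dn : ∀ i y -> y ~ i -> s i (y + 1z) ≡ y
 s-dn i y h = cong (s i) (sym (s-up i y h)) & t-inv i (i + 1z) y

 -- The action in closed form: a cyclically decreasing product sends x + 1 to x if x is a letter,
 -- and otherwise to the first non-letter from x + 1 upwards. Hence the product depends only on the
 -- set of its letters, and determines it.
 Spec : List ℤ -> ℤ -> ℤ -> Set
 Spec l x y = x ≤ y × (¬ Mem y l) × (∀ z -> x ≤ z -> z < y -> Mem z l)

 spec-dn : ∀ {l} -> CD l -> ∀ x -> Mem x l -> act l (x + 1z) ≡ x
 spec-up : ∀ {l} -> CD l -> ∀ x -> ¬ Mem x l -> Spec l (x + 1z) (act l (x + 1z))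
 spec-dn {i ∷ l} (cons p q c) x (here h) = cong (s i) y≡ & s-dn i x h
  where
   sp = spec-up c x (\m -> p (Mem-~ x i h m))
   y≡ : act l (x + 1z) ≡ x + 1z
   y≡ = Z.≤-antisym (Z.≮⇒≥ (\lt -> q (Mem-~ (x + 1z) (i + 1z) (+1~ x i h) (snd (snd sp) (x + 1z) Z.≤-refl lt)))) (fst sp)
 spec-dn {i ∷ l} (cons p q c) x (there m) = cong (s i) (spec-dn c x m) & t-o {i} {i + 1z} {x} (\e -> p (Mem-~ x i e m)) (\e -> q (Mem-~ x (i + 1z) e m))
 spec-up {[]} [] x nm = Z.≤-refl , (\()) , \z h h' -> absurd (Z.<-irrefl refl (Z.≤-<-trans h h'))
 spec-up {i ∷ l} (cons p q c) x nm = k (y ~? i) (y ~? (i + 1z))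
  where
   y = act l (x + 1z)
   sp = spec-up c x (nm ∘ there)
   k : Dec (y ~ i) -> Dec (y ~ i + 1z) -> Spec (i ∷ l) (x + 1z) (s i y)
   k (yes e) _ = subst (Spec (i ∷ l) (x + 1z)) (sym (s-up i y e))
    ( Z.≤-trans (fst sp) (Z.<⇒≤ (i<i+1 y))
    , (\ { (here h) -> i≁ y (e & sym h) ; (there m) -> q (Mem-~ (y + 1z) (i + 1z) (+1~ y i e) m) })
    , \z h h' -> f z h h' (z <? y) )
    where
     f : ∀ z -> x + 1z ≤ z -> z < y + 1z -> Dec (z < y) -> Mem z (i ∷ l)
     f z h h' (yes lt) = there (snd (snd sp) z h lt)
     f z h h' (no ge) = here (subst (_~ i) (Z.≤-antisym (Z.≮⇒≥ ge) (lia 2 (\z y -> z :< y :+ #1 => |- z =< y) z y h')) e)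
   k (no ne) (yes e) = absurd (f (x + 1z <? y))
    where
     y1 : y - 1z + 1z ≡ y
     y1 = lia 1 (\y -> |- y :- #1 :+ #1 := y) y
     y-1 : y - 1z ~ i
     y-1 = -1~ (y - 1z) i (cong (_%ℕ n) y1 & e)
     f : Dec (x + 1z < y) -> ⊥
     f (yes lt) = p (Mem-~ (y - 1z) i y-1 (snd (snd sp) (y - 1z) (lia 2 (\x y -> x :+ #1 :< y => |- x :+ #1 =< y :- #1) x y lt) (lia 1 (\y -> |- y :- #1 :< y) y)))
     f (no ge) = nm (here (-1~ x i (cong (_%ℕ n) (Z.≤-antisym (fst sp) (Z.≮⇒≥ ge)) & e)))
   k (no ne) (no ne') = subst (Spec (i ∷ l) (x + 1z)) (sym (t-o {i} {i + 1z} {y} ne ne')) (fst sp , (\ { (here h) -> ne h ; (there m) -> fst (snd sp) m }) , \z h h' -> there (snd (snd sp) z h h'))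

 Mem? : ∀ x l -> Dec (Mem x l)
 Mem? x = Any.any? (x ~?_)

 +1-1 : ∀ x -> x - 1z + 1z ≡ x
 +1-1 = lia 1 (\x -> |- x :- #1 :+ #1 := x)

 act≥ : ∀ {l} -> CD l -> ∀ x -> x - 1z ≤ act l x
 act≥ {l} c x = subst (\z -> x - 1z ≤ act l z) (+1-1 x) (k (Mem? (x - 1z) l))
  where
   k : Dec (Mem (x - 1z) l) -> x - 1z ≤ act l (x - 1z + 1z)
   k (yes m) = Z.≤-reflexive (sym (spec-dn c (x - 1z) m))
   k (no m) = Z.≤-trans (Z.<⇒≤ (i<i+1 (x - 1z))) (fst (spec-up c (x - 1z) m))

 act-unique : ∀ {l l'} -> CD l -> CD l' -> (∀ x -> Mem x l -> Mem x l') -> (∀ x -> Mem x l' -> Mem x l) -> ∀ x -> act l x ≡ act l' x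
 act-unique {l} {l'} c c' f g x = subst (\z -> act l z ≡ act l' z) (+1-1 x) (k (Mem? (x - 1z) l))
  where
   y = x - 1z
   k : Dec (Mem y l) -> act l (y + 1z) ≡ act l' (y + 1z)
   k (yes m) = spec-dn c y m & sym (spec-dn c' y (f y m))
   k (no m) = Z.≤-antisym (Z.≮⇒≥ (\lt -> fst (snd S2) (f (act l' (y + 1z)) (snd (snd S1) (act l' (y + 1z)) (fst S2) lt)))) (Z.≮⇒≥ (\lt -> fst (snd S1) (g (act l (y + 1z)) (snd (snd S2) (act l (y + 1z)) (fst S1) lt))))
    where
     S1 = spec-up c y m
     S2 = spec-up c' y (m ∘ g y)

 act-Mem : ∀ {l} -> CD l -> ∀ x -> act l (x + 1z) ≡ x -> Mem x l
 act-Mem {l} c x e = k (Mem? x l)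
  where
   k : Dec (Mem x l) -> Mem x l
   k (yes m) = m
   k (no m) = absurd (Z.<-irrefl refl (Z.<-≤-trans (i<i+1 x) (subst (x + 1z ≤_) e (fst (spec-up c x m)))))

 CD-snoc : ∀ {l i} -> CD l -> All (\j -> (¬ j ~ i) × (¬ j + 1z ~ i)) l -> CD (l ++ [ i ])
 CD-snoc [] [] = cons (\()) (\()) []
 CD-snoc {j ∷ l} {i} (cons p q c) ((h , h') ∷ hs) = cons (f j p h) (f (j + 1z) q h') (CD-snoc c hs)
  where
   f : ∀ x -> ¬ Mem x l -> ¬ x ~ i -> ¬ Mem x (l ++ [ i ])
   f x nm ne m with AnyP.++⁻ l m
   ... | inl m' = nm m'
   ... | inr (here e) = ne e

 CD-rev : ∀ a S -> length S N.< n -> CD (reverse (I a S))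
 CD-rev a [] h = []
 CD-rev a (false ∷ S) h = CD-rev (a + 1z) S (M.<-trans (M.n<1+n _) h)
 CD-rev a (true ∷ S) h = subst CD (sym (L.unfold-reverse a (I (a + 1z) S))) (CD-snoc (CD-rev (a + 1z) S (M.<-trans (M.n<1+n _) h))
  (All-reverse (All.map (\ {j} (p , q) -> near a j (lia 2 (\a j -> a :+ #1 =< j => |- a :< j) a j p) (lia 4 (\a j l N -> j :< a :+ #1 :+ l => #1 :+ l :< N => |- j :< a :+ N) a j (+ length S) N q (ℤ.+<+ h)) ∘ sym
   , near a (j + 1z) (lia 2 (\a j -> a :+ #1 =< j => |- a :< j :+ #1) a j p) (lia 4 (\a j l N -> j :< a :+ #1 :+ l => #1 :+ l :< N => |- j :+ #1 :< a :+ N) a j (+ length S) N q (ℤ.+<+ h)) ∘ sym) (I-range (a + 1z) S))))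

 Mem-I : ∀ a m S x -> Mem x (I (a + m * N) S) -> Mem x (I a S)
 Mem-I a m (true ∷ S) x (here h) = here (h & sym (→~ a (a + m * N) m refl))
 Mem-I a m (true ∷ S) x (there h) = there (Mem-I (a + 1z) m S x (subst (\z -> Mem x (I z S)) (lia 2 (\a k -> |- a :+ k :+ #1 := a :+ #1 :+ k) a (m * N)) h))
 Mem-I a m (false ∷ S) x h = Mem-I (a + 1z) m S x (subst (\z -> Mem x (I z S)) (lia 2 (\a k -> |- a :+ k :+ #1 := a :+ #1 :+ k) a (m * N)) h)

 Mem-I' : ∀ a m S x -> Mem x (I a S) -> Mem x (I (a + m * N) S)
 Mem-I' a m S x h = Mem-I (a + m * N) (- m) S x (subst (\z -> Mem x (I z S)) (l a m N) h)
  where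
   l : ∀ a m N -> a ≡ a + m * N + (- m) * N
   l = ring

 -- Every proper cyclic subset is read from one of its gaps.
 gap-form : ∀ r S -> length S ≡ n -> AllT S ⊎ (Σ ℤ \b -> Σ (List Bool) \T -> length T N.< n × ∥ T ∥ ≡ ∥ S ∥ × cw r S ≅ inl (I b T) × (∀ x -> (Mem x (I b T) -> Mem x (I r S)) × (Mem x (I r S) -> Mem x (I b T))))
 gap-form r S e with All.all? (\b -> b Bool.≟ true) S
 ... | yes p = inl p
 ... | no ¬p = inr (f (∈-∃++ (g S ¬p)))
  where
   g : ∀ S -> ¬ AllT S -> false ∈ S
   g [] h = absurd (h [])
   g (false ∷ S) h = here refl
   g (true ∷ S) h = there (g S (\p -> h (refl ∷ p)))
   f : (Σ (List Bool) \X -> Σ (List Bool) \Y -> S ≡ X ++ [ false ] ++ Y) -> _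
   f (X , Y , refl) = r + + length X + 1z , Y ++ X , M.≤-reflexive l1 , c1 , ≅t (cw-rotN r X (false ∷ Y) e) (≅≡ (cong inl (L.++-identityʳ _))) , \x -> to x , from x
    where
     l1 : suc (length (Y ++ X)) ≡ n
     l1 = cong suc (L.length-++ Y & M.+-comm (length Y) (length X)) & sym (M.+-suc (length X) (length Y)) & sym (L.length-++ X) & e
     b = r + + length X + 1z
     b≡ : b + + length Y ≡ r + 1z * N
     b≡ = l r (+ length X) (+ length Y) & cong (_+_ r) ((cong +_ (sym (M.+-suc (length X) (length Y)) & sym (L.length-++ X) & e)) & sym (Z.*-identityˡ N))
      where
       l : ∀ r x y -> r + x + 1z + y ≡ r + (1z + (x + y))
       l = ring
     to : ∀ x -> Mem x (I b (Y ++ X)) -> Mem x (I r (X ++ false ∷ Y))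
     to x m = subst (Mem x) (sym (I-++ r X (false ∷ Y))) (k (AnyP.++⁻ (I b Y) (subst (Mem x) (I-++ b Y X) m)))
      where
       k : _ -> Mem x (I r X ++ I b Y)
       k (inl m) = AnyP.++⁺ʳ (I r X) m
       k (inr m) = AnyP.++⁺ˡ (Mem-I r 1z X x (subst (\z -> Mem x (I z X)) b≡ m))
     from : ∀ x -> Mem x (I r (X ++ false ∷ Y)) -> Mem x (I b (Y ++ X))
     from x m = subst (Mem x) (sym (I-++ b Y X)) (k (AnyP.++⁻ (I r X) (subst (Mem x) (I-++ r X (false ∷ Y)) m)))
      where
       k : _ -> Mem x (I b Y ++ I (b + + length Y) X)
       k (inl m) = AnyP.++⁺ʳ (I b Y) (subst (\z -> Mem x (I z X)) (sym b≡) (Mem-I' r 1z X x m))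
       k (inr m) = AnyP.++⁺ˡ m
     c1 : ∥ Y ++ X ∥ ≡ ∥ X ++ false ∷ Y ∥
     c1 = (∥++∥ Y X) & (M.+-comm ∥ Y ∥ ∥ X ∥) & sym (∥++∥ X (false ∷ Y))

 len-w : ∀ {v} -> IsAff v -> ∀ w -> len v N.≤ len (v ·w w) N.+ length w
 len-w A [] = M.≤-reflexive (sym (M.+-identityʳ _))
 len-w {v} A (i ∷ w) = M.≤-trans (k (Desc? i v)) (M.≤-trans (s≤s (len-w (s-Aff A i) w)) (M.≤-reflexive (sym (M.+-suc _ (length w)))))
  where
   k : Dec (Desc i v) -> len v N.≤ suc (len (v ·s i))
   k (yes d) = M.≤-reflexive (sym (len-desc v i d))
   k (no d) = M.m≤n⇒m≤1+n (M.≤-trans (M.n≤1+n _) (M.≤-reflexive (sym (len-asc v i (¬Desc A i d)))))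

 -- A letter changes the length by one, so all descent tests along the word succeed exactly when the
 -- total drop equals the number of letters.
 UW-on : ∀ {v} -> IsAff v -> ∀ w φ -> UW w φ v ≡ on (len (v ·w w) N.+ length w N.≟ len v) (φ (v ·w w))
 UW-on {v} A [] φ = sym (on-yes (len v N.+ 0 N.≟ len v) (M.+-identityʳ _) (φ v))
 UW-on {v} A (i ∷ w) φ = cong (on (Desc? i v)) (UW-on (s-Aff A i) w φ) & k (Desc? i v)
  where
   u' = v ·s i ·w w
   k : (d : Dec (Desc i v)) -> on d (on (len u' N.+ length w N.≟ len (v ·s i)) (φ u')) ≡ on (len u' N.+ suc (length w) N.≟ len v) (φ u')
   k (yes d) = on-cong (len u' N.+ length w N.≟ len (v ·s i)) (len u' N.+ suc (length w) N.≟ len v)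
    (\e -> (M.+-suc _ _) & cong suc e & len-desc v i d) (\e -> M.suc-injective (sym (M.+-suc _ _) & e & sym (len-desc v i d))) (\_ -> refl)
   k (no d) = sym (on-no (len u' N.+ suc (length w) N.≟ len v)
    (\e -> M.<-irrefl refl (M.≤-trans (M.≤-reflexive (sym (len-asc v i (¬Desc A i d)))) (M.≤-trans (len-w (s-Aff A i) w) (M.≤-trans (M.n≤1+n _) (M.≤-reflexive (sym (M.+-suc _ _) & e)))))) (φ u'))

 pw : List ℤ -> Perm n
 pw l = idP n ·w l

 ev-id : ∀ x -> ev (idP n) x ≡ x
 ev-id x = ev-fromFun {\x -> x} (\_ _ -> refl) x

 id-Aff : IsAff (idP n)
 id-Aff = record { inj = \x y e -> trans (sym (ev-id x)) (e & ev-id y) ; at = id ; ev-at = ev-id }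

 ev-pw : ∀ l x -> ev (pw l) x ≡ act l x
 ev-pw l x = ev-w (idP n) l x & ev-id (act l x)

 pw-Aff : ∀ l -> IsAff (pw l)
 pw-Aff l = w-Aff id-Aff l

 ·w-++ : ∀ v x y -> v ·w (x ++ y) ≡ v ·w x ·w y
 ·w-++ v [] y = refl
 ·w-++ v (i ∷ x) y = ·w-++ (v ·s i) x y

 len-id : len (idP n) ≡ 0
 len-id = hc-unique (len-card (idP n)) ([] , [] , (\p -> (\()) , \ { (_ , a , b) -> absurd (Z.<-asym a (subst2 _<_ (ev-id (snd p)) (ev-id (fst p)) b)) }) , refl)

 -- Appending the lowest letter a on the right is an ascent: the other letters fix a, since neither
 -- a - 1 nor a is among them, and they send a + 1 to a + 1 or higher.
 len-rev : ∀ a S -> length S N.< n -> len (pw (reverse (I a S))) ≡ ∥ S ∥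
 len-rev a [] h = len-id
 len-rev a (false ∷ S) h = len-rev (a + 1z) S (M.<-trans (M.n<1+n _) h)
 len-rev a (true ∷ S) h = cong len (cong pw (L.unfold-reverse a w) & (·w-++ (idP n) (reverse w) [ a ])) & len-asc u' a asc & cong suc (len-rev (a + 1z) S h')
  where
   h' = M.<-trans (M.n<1+n _) h
   w = I (a + 1z) S
   u' = pw (reverse w)
   c = CD-rev (a + 1z) S h'
   not : ∀ x -> (∀ j -> a + 1z ≤ j -> j < a + 1z + + length S -> ¬ x ~ j) -> ¬ Mem x (reverse w)
   not x f m with All.lookupAny (All-reverse {x = w} (I-range (a + 1z) S)) m
   ... | (p , q) , e = f _ p q e
   n0 : ¬ Mem a (reverse w)
   n0 = not a (\j p q -> near a j (lia 2 (\a j -> a :+ #1 =< j => |- a :< j) a j p) (lia 4 (\a j l N -> j :< a :+ #1 :+ l => #1 :+ l :< N => |- j :< a :+ N) a j (+ length S) N q (ℤ.+<+ h)))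
   n1 : ¬ Mem (a - 1z) (reverse w)
   n1 = not (a - 1z) (\j p q -> near (a - 1z) j (lia 2 (\a j -> a :+ #1 =< j => |- a :- #1 :< j) a j p) (lia 4 (\a j l N -> j :< a :+ #1 :+ l => #1 :+ l :< N => |- j :< a :- #1 :+ N) a j (+ length S) N q (ℤ.+<+ h)))
   a≡ : act (reverse w) a ≡ a
   a≡ = Z.≤-antisym (Z.≮⇒≥ (\lt -> n0 (snd (snd sp) a (Z.≤-reflexive (+1-1 a)) lt))) (subst (_≤ act (reverse w) a) (+1-1 a) (fst sp))
    where
     sp = subst (\z -> Spec (reverse w) (a - 1z + 1z) (act (reverse w) z)) (+1-1 a) (spec-up c (a - 1z) n1)
   asc : ev u' a < ev u' (a + 1z)
   asc = subst2 _<_ (sym (ev-pw (reverse w) a & a≡)) (sym (ev-pw (reverse w) (a + 1z))) (Z.<-≤-trans (i<i+1 a) (fst (spec-up c a n0)))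

-- Counting factorizations

hc-concat : {A B C : Set} (xs : List A) -> Unique xs -> (P : A -> B -> Set) (m : A -> ℕ) -> (∀ x -> HasCard (P x) (m x)) -> (f : A -> B -> C) ->
 (∀ x x' b b' -> x ∈ xs -> x' ∈ xs -> f x b ≡ f x' b' -> x ≡ x' × b ≡ b') ->
 Σ ℕ \M -> HasCard (\c -> Σ A \x -> Σ B \b -> x ∈ xs × P x b × c ≡ f x b) M × + M ≡ ΣL xs (\x -> + m x)
hc-concat [] u P m h f j = 0 , ([] , [] , (\c -> (\()) , \ { (_ , _ , () , _) }) , refl) , refl
hc-concat {A} {B} {C} (x ∷ xs) (a ∷ u) P m h f j with hc-concat xs u P m h f (\y y' b b' p q -> j y y' b b' (there p) (there q)) | h x
... | M , (cs , uc , hcs , lc) , eM | bs , ub , hb , lb = length bs N.+ length cs ,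
 (map (f x) bs ++ cs , UP.++⁺ (uniq-map∈ (f x) ub (\b b' _ _ e -> snd (j x x b b' (here refl) (here refl) e))) uc disj , mem , L.length-++ (map (f x) bs) & cong (N._+ length cs) (L.length-map (f x) bs)) ,
 cong2 _+_ (cong +_ lb) ((cong +_ lc) & eM)
 where
  disj : ∀ {c} -> ¬ (c ∈ map (f x) bs × c ∈ cs)
  disj {c} (p , q) with ∈-map⁻ (f x) p | fst (hcs c) q
  ... | b , _ , e | y , b' , y∈ , _ , e' = All.lookup a y∈ (fst (j x y b b' (here refl) (there y∈) (sym e & e')))
  mem : ∀ c -> (c ∈ map (f x) bs ++ cs -> Σ A \y -> Σ B \b -> y ∈ x ∷ xs × P y b × c ≡ f y b) × ((Σ A \y -> Σ B \b -> y ∈ x ∷ xs × P y b × c ≡ f y b) -> c ∈ map (f x) bs ++ cs)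
  mem c = (\p -> to (∈-++⁻ (map (f x) bs) p)) , from
   where
    to : c ∈ map (f x) bs ⊎ c ∈ cs -> _
    to (inl p) with ∈-map⁻ (f x) p
    ... | b , b∈ , e = x , b , here refl , fst (hb b) b∈ , e
    to (inr q) with fst (hcs c) q
    ... | y , b , y∈ , r , e = y , b , there y∈ , r , e
    from : _ -> c ∈ map (f x) bs ++ cs
    from (_ , b , here refl , r , e) = ∈-++⁺ˡ (subst (_∈ map (f x) bs) (sym e) (∈-map⁺ (f x) (snd (hb b) r)))
    from (y , b , there y∈ , r , e) = ∈-++⁺ʳ (map (f x) bs) (snd (hcs c) (y , b , y∈ , r , e))

boolsL : ℕ -> List (List Bool)
boolsL zero = [ [] ]
boolsL (suc m) = map (true ∷_) (boolsL m) ++ map (false ∷_) (boolsL m)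

∈-boolsL : ∀ S -> S ∈ boolsL (length S)
∈-boolsL [] = here refl
∈-boolsL (true ∷ S) = ∈-++⁺ˡ (∈-map⁺ (true ∷_) (∈-boolsL S))
∈-boolsL (false ∷ S) = ∈-++⁺ʳ (map (true ∷_) (boolsL (length S))) (∈-map⁺ (false ∷_) (∈-boolsL S))

boolsL-length : ∀ m S -> S ∈ boolsL m -> length S ≡ m
boolsL-length zero S (here refl) = refl
boolsL-length (suc m) S p with ∈-++⁻ (map (true ∷_) (boolsL m)) p
... | inl q = let (T , T∈ , e) = ∈-map⁻ (true ∷_) q in trans (cong length e) (cong suc (boolsL-length m T T∈))
... | inr q = let (T , T∈ , e) = ∈-map⁻ (false ∷_) q in trans (cong length e) (cong suc (boolsL-length m T T∈))

boolsL-unique : ∀ m -> Unique (boolsL m)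
boolsL-unique zero = [] ∷ []
boolsL-unique (suc m) = UP.++⁺ (UP.map⁺ L.∷-injectiveʳ (boolsL-unique m)) (UP.map⁺ L.∷-injectiveʳ (boolsL-unique m))
 (\ { (p , q) -> let (_ , _ , e) = ∈-map⁻ (true ∷_) p ; (_ , _ , e') = ∈-map⁻ (false ∷_) q in case' (L.∷-injectiveˡ (sym e & e')) })
 where
  case' : true ≢ false
  case' ()

module Count (n : ℕ) {{nz : NonZero n}} (1<n : 1z < + n) where
 open CycWords n 1<n public

 sumQ-boolsL : ∀ m (f : List Bool -> Fn) v -> sumQ (bools m) f v ≡ ΣL (boolsL m) (\S -> f S v)
 sumQ-boolsL zero f v = sym (+0 (f [] v))
 sumQ-boolsL (suc m) f v = cong2 (\x y -> x + (y + 0z)) (e true) (e false) & cong (_+_ (ΣL (map (true ∷_) (boolsL m)) (\S -> f S v))) (+0 _) & sym (Σ-++ (map (true ∷_) (boolsL m)) (map (false ∷_) (boolsL m)) (\S -> f S v))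
  where
   e : ∀ b -> sumQ (bools m) (\S -> f (b ∷ S)) v ≡ ΣL (map (b ∷_) (boolsL m)) (\S -> f S v)
   e b = sumQ-boolsL m (\S -> f (b ∷ S)) v & sym (Σ-map (b ∷_) (boolsL m) (\S -> f S v))

 ltr : List (Fin n) -> List ℤ
 ltr = map (\i -> + toℕ i)

 fin~ : ∀ {i j : Fin n} -> + toℕ i ~ + toℕ j -> i ≡ j
 fin~ {i} {j} h = FinP.toℕ-injective (sym (ℕD.m<n⇒m%n≡m (FinP.toℕ<n i)) & h & ℕD.m<n⇒m%n≡m (FinP.toℕ<n j))

 next~ : ∀ j -> + toℕ (nextFin n j) ~ + toℕ j + 1z
 next~ j = cong (N._% n) ((FinP.toℕ-fromℕ< _) & cong (N._% n) (M.+-comm 1 (toℕ j))) & ℕD.m%n%n≡m%n (toℕ j N.+ 1) n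

 Mem-ltr : ∀ x l -> Mem x (ltr l) -> Σ (Fin n) \j -> j ∈ l × x ~ + toℕ j
 Mem-ltr x (i ∷ l) (here h) = i , here refl , h
 Mem-ltr x (i ∷ l) (there m) = let (j , p , q) = Mem-ltr x l m in j , there p , q

 ∈-Mem : ∀ x {j l} -> j ∈ l -> x ~ + toℕ j -> Mem x (ltr l)
 ∈-Mem x (here refl) e = here e
 ∈-Mem x (there m) e = there (∈-Mem x m e)

 CycDec→CD : ∀ l -> CycDec n l -> CD (ltr l)
 CycDec→CD [] _ = []
 CycDec→CD (i ∷ l) (a ∷ u , h) = cons
  (\m -> let (j , j∈ , e) = Mem-ltr (+ toℕ i) l m in All.lookup a j∈ (fin~ e))
  (\m -> let (j , j∈ , e) = Mem-ltr (+ toℕ i + 1z) l m ; (p , e') = idx j∈ in bad (h (Fin.suc p) Fin.zero (e' & sym (fin~ (next~ i & e)))))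
  (CycDec→CD l (u , \p q e -> M.≤-pred (h (Fin.suc p) (Fin.suc q) e)))
  where
   idx : ∀ {j l} -> j ∈ l -> Σ (Fin (length l)) \p -> List.lookup l p ≡ j
   idx (here refl) = Fin.zero , refl
   idx (there m) = let (p , e) = idx m in Fin.suc p , e
   bad : ∀ {m} -> ¬ (suc m N.< 0)
   bad ()

 CD→CycDec : ∀ l -> CD (ltr l) -> CycDec n l
 CD→CycDec [] _ = [] , \()
 CD→CycDec (i ∷ l) (cons p q c) with CD→CycDec l c
 ... | u' , h = All.tabulate (\m e -> p (∈-Mem (+ toℕ i) m (cong (\z -> + toℕ z %ℕ n) e))) ∷ u' , k
  where
   look : ∀ l p -> List.lookup l p ∈ l
   look (x ∷ l) Fin.zero = here refl
   look (x ∷ l) (Fin.suc p) = there (look l p)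
   k : ∀ a b -> List.lookup (i ∷ l) a ≡ nextFin n (List.lookup (i ∷ l) b) -> toℕ a N.< toℕ b
   k Fin.zero Fin.zero e = absurd (i≁ (+ toℕ i) (cong (\z -> + toℕ z %ℕ n) e & next~ i))
   k Fin.zero (Fin.suc b) e = s≤s z≤n
   k (Fin.suc a) Fin.zero e = absurd (q (∈-Mem (+ toℕ i + 1z) (look l a) (sym (next~ i) & cong (\z -> + toℕ z %ℕ n) (sym e))))
   k (Fin.suc a) (Fin.suc b) e = s≤s (h a b e)

 ev-compose : ∀ f g x -> ev (compose n f g) x ≡ ev f (ev g x)
 ev-compose f g x = cong (\w -> ev w x) (VecP.tabulate-cong \j -> sym (ev≡eval f _) & cong (ev f) (sym (ev≡eval g _))) &
  ev-fromFun {\y -> ev f (ev g y)} (\y m -> cong (ev f) (ev-per g y m) & ev-per f (ev g y) m) x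

 ev-sgen : ∀ i x -> ev (sgen n i) x ≡ s (+ toℕ i) x
 ev-sgen i x = cong (\w -> ev w x) (VecP.tabulate-cong \j -> sym (t≡tr _ _ _)) & ev-fromFun {s (+ toℕ i)} (t-per _ _) x

 wordProd-pw : ∀ l -> wordProd n l ≡ pw (ltr l)
 wordProd-pw l = ext _ _ \x -> e l x & sym (ev-pw (ltr l) x)
  where
   e : ∀ l x -> ev (wordProd n l) x ≡ act (ltr l) x
   e [] x = ev-id x
   e (i ∷ l) x = ev-compose (sgen n i) (wordProd n l) x & (ev-sgen i _) & cong (s (+ toℕ i)) (e l x)

 red : List ℤ -> List (Fin n)
 red = map (\z -> fromℕ< (n%ℕd<d z n))

 red~ : ∀ z -> + toℕ (fromℕ< (n%ℕd<d z n)) ~ z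
 red~ z = cong (\m -> m N.% n) (FinP.toℕ-fromℕ< (n%ℕd<d z n)) & ℕD.m<n⇒m%n≡m (n%ℕd<d z n)

 Mem-red : ∀ x l -> (Mem x (ltr (red l)) -> Mem x l) × (Mem x l -> Mem x (ltr (red l)))
 Mem-red x [] = (\()) , \()
 Mem-red x (z ∷ l) = (\ { (here h) -> here (h & red~ z) ; (there m) -> there (fst (Mem-red x l) m) })
  , \ { (here h) -> here (h & sym (red~ z)) ; (there m) -> there (snd (Mem-red x l) m) }

 CD-red : ∀ {l} -> CD l -> CD (ltr (red l))
 CD-red [] = []
 CD-red {i ∷ l} (cons p q c) = cons (\m -> p (Mem-~ z i (red~ i) (fst (Mem-red z l) m))) (\m -> q (Mem-~ (z + 1z) (i + 1z) (+1~ z i (red~ i)) (fst (Mem-red (z + 1z) l) m))) (CD-red c)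
  where
   z = + toℕ (fromℕ< (n%ℕd<d i n))

 pw-unique : ∀ {l l'} -> CD l -> CD l' -> (∀ x -> Mem x l -> Mem x l') -> (∀ x -> Mem x l' -> Mem x l) -> pw l ≡ pw l'
 pw-unique {l} {l'} c c' f g = ext _ _ \x -> ev-pw l x & act-unique c c' f g x & sym (ev-pw l' x)

 CD→Elem : ∀ {l} -> CD l -> CycDecElem n (pw l)
 CD→Elem {l} c = red l , CD→CycDec (red l) (CD-red c) , wordProd-pw (red l) & pw-unique (CD-red c) c (\x -> fst (Mem-red x l)) (\x -> snd (Mem-red x l))

 -- A proper subset of the residues with a linear reading of its cyclic word. The factor `g` is the
 -- product of the reversed word, so that stripping the increasing word from v multiplies v by the
 -- inverse of `g`.
 record Form (S : List Bool) : Set where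
  field
   b : ℤ
   T : List Bool
   T<n : length T N.< n
   ∥T∥ : ∥ T ∥ ≡ ∥ S ∥
   eqv : cw 0z S ≅ inl (I b T)
   mem : ∀ x -> (Mem x (I b T) -> Mem x (I 0z S)) × (Mem x (I 0z S) -> Mem x (I b T))

  word : List ℤ
  word = I b T

  g : Perm n
  g = pw (reverse word)

  cd : CD (reverse word)
  cd = CD-rev b T T<n

  len-g : len g ≡ ∥ S ∥
  len-g = len-rev b T T<n & ∥T∥

  Mem-g : ∀ x -> (Mem x (reverse word) -> Mem x (I 0z S)) × (Mem x (I 0z S) -> Mem x (reverse word))
  Mem-g x = (\m -> fst (mem x) (AnyP.reverse⁻ m)) , \m -> AnyP.reverse⁺ (snd (mem x) m)

  length-word : length word ≡ ∥ S ∥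
  length-word = k b T & ∥T∥
   where
    k : ∀ a T -> length (I a T) ≡ ∥ T ∥
    k a [] = refl
    k a (true ∷ T) = cong suc (k (a + 1z) T)
    k a (false ∷ T) = k (a + 1z) T

 AllT? : ∀ S -> Dec (AllT S)
 AllT? = All.all? (\b -> b Bool.≟ true)

 frm : ∀ S -> length S ≡ n -> ¬ AllT S -> Form S
 frm S e h with gap-form 0z S e
 ... | inl p = absurd (h p)
 ... | inr (b , T , l , c , q , m) = record { b = b ; T = T ; T<n = l ; ∥T∥ = c ; eqv = q ; mem = m }

 Mem-inj : ∀ r S S' -> length S ≡ length S' -> length S N.≤ n -> (∀ x -> Mem x (I r S) -> Mem x (I r S')) -> (∀ x -> Mem x (I r S') -> Mem x (I r S)) -> S ≡ S'
 Mem-inj r [] [] _ _ _ _ = refl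
 Mem-inj r (b ∷ S) (b' ∷ S') e h f g = hd b b' f g
  where
   e' = M.suc-injective e
   no-r : ∀ S -> suc (length S) N.≤ n -> ∀ x -> Mem x (I (r + 1z) S) -> ¬ x ~ r
   no-r S h x m z with All.lookupAny (I-range (r + 1z) S) m
   ... | (p , q) , w = near r _ (lia 2 (\r j -> r :+ #1 =< j => |- r :< j) r _ p) (lia 4 (\r j l N -> j :< r :+ #1 :+ l => #1 :+ l =< N => |- j :< r :+ N) r _ (+ length S) N q (ℤ.+≤+ h)) (sym z & w)
   h' : suc (length S') N.≤ n
   h' = subst (N._≤ n) e h
   hd : ∀ b b' -> (∀ x -> Mem x (I r (b ∷ S)) -> Mem x (I r (b' ∷ S'))) -> (∀ x -> Mem x (I r (b' ∷ S')) -> Mem x (I r (b ∷ S))) -> b ∷ S ≡ b' ∷ S'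
   hd false false f g = cong (false ∷_) (Mem-inj (r + 1z) S S' e' (M.≤-trans (M.n≤1+n _) h) f g)
   hd true false f g = absurd (no-r S' h' r (f r (here refl)) refl)
   hd false true f g = absurd (no-r S h r (g r (here refl)) refl)
   hd true true f g = cong (true ∷_) (Mem-inj (r + 1z) S S' e' (M.≤-trans (M.n≤1+n _) h) (\x m -> tl x (f x (there m)) (no-r S h x m)) (\x m -> tl x (g x (there m)) (no-r S' h' x m)))
    where
     tl : ∀ x {l} -> Mem x (r ∷ l) -> ¬ x ~ r -> Mem x l
     tl x (here z) ne = absurd (ne z)
     tl x (there m) ne = m

 setOf : ℤ -> ℕ -> List ℤ -> List Bool
 setOf r zero l = []
 setOf r (suc m) l = ⌊ Mem? r l ⌋ ∷ setOf (r + 1z) m l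

 length-setOf : ∀ r m l -> length (setOf r m l) ≡ m
 length-setOf r zero l = refl
 length-setOf r (suc m) l = cong suc (length-setOf (r + 1z) m l)

 setOf⁻ : ∀ r m l x -> Mem x (I r (setOf r m l)) -> Mem x l
 setOf⁻ r (suc m) l x h with Mem? r l
 setOf⁻ r (suc m) l x (here e) | yes p = Mem-~ r x (sym e) p
 setOf⁻ r (suc m) l x (there h) | yes p = setOf⁻ (r + 1z) m l x h
 setOf⁻ r (suc m) l x h | no p = setOf⁻ (r + 1z) m l x h

 setOf⁺ : ∀ r m l y -> r ≤ y -> y < r + + m -> Mem y l -> Mem y (I r (setOf r m l))
 setOf⁺ r zero l y p q h = absurd (lia 2 (\r y -> r =< y => y :< r :+ #0 => |- ff) r y p q)
 setOf⁺ r (suc m) l y p q h with Mem? r l | y ≟ r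
 ... | yes _ | yes e = here (cong (_%ℕ n) e)
 ... | no ¬m | yes refl = absurd (¬m h)
 ... | yes _ | no ne = there (setOf⁺ (r + 1z) m l y (lia 2 (\r y -> r :< y => |- r :+ #1 =< y) r y (Z.≤∧≢⇒< p (ne ∘ sym))) (subst (y <_) (sym (+1s r m)) q) h)
 ... | no _ | no ne = setOf⁺ (r + 1z) m l y (lia 2 (\r y -> r :< y => |- r :+ #1 =< y) r y (Z.≤∧≢⇒< p (ne ∘ sym))) (subst (y <_) (sym (+1s r m)) q) h

 setOf-all : ∀ l x -> Mem x l -> Mem x (I 0z (setOf 0z n l))
 setOf-all l x h = Mem-~ y x y~x (setOf⁺ 0z n l y (ℤ.+≤+ z≤n) (subst (y <_) (sym (0+ N)) (ℤ.+<+ (n%ℕd<d x n))) (Mem-~ x y (sym y~x) h))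
  where
   y = + (x %ℕ n)
   y~x : y ~ x
   y~x = ℕD.m<n⇒m%n≡m (n%ℕd<d x n)

 AllT-I : ∀ r S x -> AllT S -> r ≤ x -> x < r + + length S -> Mem x (I r S)
 AllT-I r [] x _ p q = absurd (lia 2 (\r y -> r =< y => y :< r :+ #0 => |- ff) r x p q)
 AllT-I r (true ∷ S) x (_ ∷ a) p q with x ≟ r
 ... | yes e = here (cong (_%ℕ n) e)
 ... | no ne = there (AllT-I (r + 1z) S x a (lia 2 (\r y -> r :< y => |- r :+ #1 =< y) r x (Z.≤∧≢⇒< p (ne ∘ sym))) (subst (x <_) (sym (+1s r (length S))) q))

 CD-gap : ∀ {l} -> CD l -> Σ ℤ \x -> ¬ Mem x l
 CD-gap [] = 0z , \()
 CD-gap {i ∷ l} (cons p q c) = i + 1z , \ { (here h) -> i≁ i (sym h) ; (there m) -> q m }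

 Elem→Form : ∀ {g} -> CycDecElem n g -> Σ (List Bool) \S -> Σ (length S ≡ n) \e -> Σ (¬ AllT S) \h -> Form.g (frm S e h) ≡ g
 Elem→Form {g} (l , cd , e) = S , eS , nT , pw-unique (Form.cd fm) c (\x m -> setOf⁻ 0z n (ltr l) x (fst (Form.Mem-g fm x) m)) (\x m -> snd (Form.Mem-g fm x) (setOf-all (ltr l) x m)) & sym (wordProd-pw l) & e
  where
   c = CycDec→CD l cd
   S = setOf 0z n (ltr l)
   eS = length-setOf 0z n (ltr l)
   nT : ¬ AllT S
   nT a = let (x , nm) = CD-gap c in nm (Mem-~ (+ (x %ℕ n)) x (ℕD.m<n⇒m%n≡m (n%ℕd<d x n)) (setOf⁻ 0z n (ltr l) (+ (x %ℕ n)) (AllT-I 0z S (+ (x %ℕ n)) a (ℤ.+≤+ z≤n) (subst (\m -> + (x %ℕ n) < 0z + + m) (sym eS) (subst (+ (x %ℕ n) <_) (sym (0+ N)) (ℤ.+<+ (n%ℕd<d x n)))))))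
   fm = frm S eS nT

 form-inj : ∀ S S' e e' h h' -> Form.g (frm S e h) ≡ Form.g (frm S' e' h') -> S ≡ S'
 form-inj S S' e e' h h' z = Mem-inj 0z S S' (e & sym e') (M.≤-reflexive e) (\x m -> k S S' e e' h h' z x m) (\x m -> k S' S e' e h' h (sym z) x m)
  where
   k : ∀ S S' e e' h h' -> Form.g (frm S e h) ≡ Form.g (frm S' e' h') -> ∀ x -> Mem x (I 0z S) -> Mem x (I 0z S')
   k S S' e e' h h' z x m = fst (Form.Mem-g F' x) (act-Mem (Form.cd F') x (sym (ev-pw (reverse (Form.word F')) (x + 1z)) & cong (\w -> ev w (x + 1z)) (sym z) & ev-pw (reverse (Form.word F0)) (x + 1z) & spec-dn (Form.cd F0) x (snd (Form.Mem-g F0 x) m)))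
    where
     F0 = frm S e h
     F' = frm S' e' h'

 _≟P_ : (v w : Perm n) -> Dec (v ≡ w)
 _≟P_ = VecP.≡-dec _≟_

 δe : Fn
 δe v = on (v ≟P idP n) 1z

 Fr : List ℕ -> Fn
 Fr [] = δe
 Fr (a ∷ as) = H a (Fr as)

 Fr-↭ : ∀ {as bs} -> as ↭ bs -> Fr as ≈ Fr bs
 Fr-↭ Perm.refl = ≈r
 Fr-↭ (Perm.prep a p) = lcong (H-lin a) (Fr-↭ p)
 Fr-↭ (Perm.swap a b p) = HH-comm a b _ ⟫ lcong (Lin-∘ (H-lin b) (H-lin a)) (Fr-↭ p)
 Fr-↭ (Perm.trans p q) = Fr-↭ p ⟫ Fr-↭ q

 -- The head of the list is the rightmost factor, the one that the outermost `H` strips.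
 prodR : List (Perm n) -> Perm n
 prodR [] = idP n
 prodR (g ∷ gs) = compose n (prodR gs) g

 Good : List ℕ -> List (Perm n) -> Set
 Good [] [] = ⊤
 Good (a ∷ as) (g ∷ gs) = (CycDecElem n g × len g ≡ a) × Good as gs
 Good _ _ = ⊥

 sumN : List ℕ -> ℕ
 sumN [] = 0
 sumN (a ∷ as) = a N.+ sumN as

 compose-w : ∀ u' w -> compose n u' (pw (reverse w)) ·w w ≡ u'
 compose-w u' w = ext _ _ \x -> (ev-w _ w x) & ev-compose u' (pw (reverse w)) (act w x) & cong (ev u') (ev-pw (reverse w) (act w x) & cong (\z -> act (reverse w) (act z x)) (sym (L.reverse-involutive w)) & act-rev (reverse w) x)

 w-compose : ∀ v w -> compose n (v ·w w) (pw (reverse w)) ≡ v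
 w-compose v w = ext _ _ \x -> ev-compose (v ·w w) (pw (reverse w)) x & (ev-w v w _) & cong (ev v) (cong (act w) (ev-pw (reverse w) x) & act-rev w x)

 compose-Aff : ∀ {f g} -> IsAff f -> IsAff g -> IsAff (compose n f g)
 compose-Aff {f} {g} A A' = record
  { inj = \x y e -> inj A' x y (inj A _ _ (sym (ev-compose f g x) & e & ev-compose f g y))
  ; at = \y -> at A' (at A y)
  ; ev-at = \y -> trans (ev-compose f g _) (cong (ev f) (ev-at A' (at A y)) & ev-at A y) }

 Elem-Aff : ∀ {g} -> CycDecElem n g -> IsAff g
 Elem-Aff (l , _ , e) = subst IsAff (sym (wordProd-pw l) & e) (pw-Aff (ltr l))

 Good-Aff : ∀ as gs -> Good as gs -> IsAff (prodR gs)
 Good-Aff [] [] _ = id-Aff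
 Good-Aff (a ∷ as) (g ∷ gs) ((c , _) , G) = compose-Aff (Good-Aff as gs G) (Elem-Aff c)

 len-prodR : ∀ as gs -> Good as gs -> len (prodR gs) N.≤ sumN as
 len-prodR [] [] _ = M.≤-reflexive len-id
 len-prodR (a ∷ as) (g ∷ gs) ((c , refl) , G) with Elem→Form c
 ... | S , e , h , refl = M.≤-trans (len-w {prodR (g ∷ gs)} (compose-Aff (Good-Aff as gs G) (Elem-Aff c)) w)
  (M.≤-trans (M.≤-reflexive ((cong2 N._+_ (cong len (compose-w (prodR gs) w)) (Form.length-word fm & sym (Form.len-g fm))) & (M.+-comm _ (len (Form.g fm))))) (M.+-monoʳ-≤ _ (len-prodR as gs G)))
  where
   fm = frm S e h
   w = Form.word fm

 Tgt : List ℕ -> Perm n -> List (Perm n) -> Set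
 Tgt as v gs = Good as gs × prodR gs ≡ v × len v ≡ sumN as

 cdL : ℕ -> List (List Bool)
 cdL a = filter (\S -> ¬? (AllT? S) ×-dec (a N.≟ ∥ S ∥)) (boolsL n)

 cdL⁻ : ∀ a S -> S ∈ cdL a -> length S ≡ n × (¬ AllT S) × a ≡ ∥ S ∥
 cdL⁻ a S m with ∈-filter⁻ (\S -> ¬? (AllT? S) ×-dec (a N.≟ ∥ S ∥)) {xs = boolsL n} m
 ... | p , q , r = boolsL-length n S p , q , r

 H-cdL : ∀ a φ {v} -> IsAff v -> H a φ v ≡ ΣL (cdL a) (\S -> UM (cw 0z S) φ v)
 H-cdL a φ {v} A = (sumQ-boolsL n _ v) & Σ-cong∈ (boolsL n) (\S m -> k S (boolsL-length n S m) (AllT? S) (a N.≟ ∥ S ∥)) & sym (Σ-filter (\S -> ¬? (AllT? S) ×-dec (a N.≟ ∥ S ∥)) (boolsL n) _)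
  where
   k : ∀ S -> length S ≡ n -> (p : Dec (AllT S)) (q : Dec (a ≡ ∥ S ∥)) -> on q 1z * UM (cw 0z S) φ v ≡ on (¬? p ×-dec q) (UM (cw 0z S) φ v)
   k S e (yes p) q rewrite go-AllT 0z S [] p = Z.*-zeroʳ (on q 1z) & refl
   k S e (no p) (yes q) = Z.*-identityˡ (UM (cw 0z S) φ v)
   k S e (no p) (no q) = Z.*-zeroˡ (UM (cw 0z S) φ v)

 -- A total version of the data of `frm`. The default value is not reached for the sets in `cdL`,
 -- which have length n and a gap.
 facW : ∀ S -> Dec (length S ≡ n) -> Dec (AllT S) -> Perm n × List ℤ
 facW S (yes e) (no h) = Form.g (frm S e h) , Form.word (frm S e h)
 facW S _ _ = idP n , []

 facS : List Bool -> Perm n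
 facS S = fst (facW S (length S N.≟ n) (AllT? S))

 wordS : List Bool -> List ℤ
 wordS S = snd (facW S (length S N.≟ n) (AllT? S))

 facS-form : ∀ S -> length S ≡ n -> ¬ AllT S -> Σ (length S ≡ n) \e -> Σ (¬ AllT S) \h -> facS S ≡ Form.g (frm S e h) × wordS S ≡ Form.word (frm S e h)
 facS-form S e h = k (length S N.≟ n) (AllT? S)
  where
   k : (d : Dec (length S ≡ n)) (d' : Dec (AllT S)) -> Σ (length S ≡ n) \e -> Σ (¬ AllT S) \h -> fst (facW S d d') ≡ Form.g (frm S e h) × snd (facW S d d') ≡ Form.word (frm S e h)
   k (yes e') (no h') = e' , h' , refl , refl
   k (no ne) _ = absurd (ne e)
   k (yes _) (yes p) = absurd (h p)

 -- Induction on the exponents. The rightmost factor is determined by its set of letters;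
 -- `w-compose` and `compose-w` identify cancelling it with stripping its word; and the lengths add
 -- up exactly when the test in `UW-on` succeeds.
 count : ∀ as {v} -> IsAff v -> Σ ℕ \m -> HasCard (Tgt as v) m × + m ≡ Fr as v
 count [] {v} A = k (v ≟P idP n)
  where
   k : (d : Dec (v ≡ idP n)) -> Σ ℕ \m -> HasCard (Tgt [] v) m × + m ≡ on d 1z
   k (yes refl) = 1 , ([ [] ] , [] ∷ [] , (\ { [] -> (\_ -> tt , refl , len-id) , (\_ -> here refl) ; (g ∷ gs) -> (\ { (here ()) ; (there ()) }) , \ { (() , _) } }) , refl) , refl
   k (no ne) = 0 , ([] , [] , (\ { [] -> (\()) , (\ { (_ , e , _) -> absurd (ne (sym e)) }) ; (g ∷ gs) -> (\()) , \ { (() , _) } }) , refl) , refl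
 count (a ∷ as) {v} A = M , hc-iff to from hM , eM & Σ-cong∈ (cdL a) val' & sym (H-cdL a (Fr as) A)
  where
   v' : List Bool -> Perm n
   v' S = v ·w wordS S
   ok : List Bool -> Set
   ok S = len (v' S) N.+ length (wordS S) ≡ len v
   ok? : ∀ S -> Dec (ok S)
   ok? S = len (v' S) N.+ length (wordS S) N.≟ len v
   P : List Bool -> List (Perm n) -> Set
   P S gs = ok S × Tgt as (v' S) gs
   mS : ∀ S -> Σ ℕ \m -> HasCard (P S) m × + m ≡ on (ok? S) (Fr as (v' S))
   mS S = k (ok? S)
    where
     k : (d : Dec (ok S)) -> Σ ℕ \m -> HasCard (P S) m × + m ≡ on d (Fr as (v' S))
     k (yes o) = let (m , h , e) = count as (w-Aff A (wordS S)) in m , hc-iff (\_ t -> o , t) (\_ -> snd) h , e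
     k (no no') = 0 , ([] , [] , (\gs -> (\()) , \ { (o , _) -> absurd (no' o) }) , refl) , refl
   fac : ∀ S -> S ∈ cdL a -> _
   fac S m = let (e , h , _) = cdL⁻ a S m in facS-form S e h
   inj' : ∀ S S' gs gs' -> S ∈ cdL a -> S' ∈ cdL a -> facS S ∷ gs ≡ facS S' ∷ gs' -> S ≡ S' × gs ≡ gs'
   inj' S S' gs gs' p q z with fac S p | fac S' q
   ... | e , h , f , _ | e' , h' , f' , _ = form-inj S S' e e' h h' (sym f & L.∷-injectiveˡ z & f') , L.∷-injectiveʳ z
   R = hc-concat (cdL a) (UP.filter⁺ _ (boolsL-unique n)) P (\S -> fst (mS S)) (\S -> fst (snd (mS S))) (\S gs -> facS S ∷ gs) inj'
   M = fst R
   hM = fst (snd R)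
   eM = snd (snd R)
   val' : ∀ S -> S ∈ cdL a -> + fst (mS S) ≡ UM (cw 0z S) (Fr as) v
   val' S m with fac S m
   ... | e , h , _ , f = snd (snd (mS S)) & sym (UW-on A (wordS S) (Fr as)) & cong (\z -> UW z (Fr as) v) f & sym (fw (Form.eqv (frm S e h)) (Fr as) v A)
   to : ∀ gs -> (Σ (List Bool) \S -> Σ (List (Perm n)) \hs -> S ∈ cdL a × P S hs × gs ≡ facS S ∷ hs) -> Tgt (a ∷ as) v gs
   to _ (S , hs , m , (o , G , pr , le) , refl) with cdL⁻ a S m
   ... | _ , _ , ac with fac S m
   ...   | e , h , f , f' rewrite f | f' = ((CD→Elem (Form.cd (frm S e h)) , Form.len-g (frm S e h) & sym ac) , G)
    , cong (\z -> compose n z (Form.g (frm S e h))) pr & w-compose v (Form.word (frm S e h))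
    , sym o & (cong2 N._+_ le (Form.length-word (frm S e h) & sym ac)) & M.+-comm (sumN as) a
   from : ∀ gs -> Tgt (a ∷ as) v gs -> Σ (List Bool) \S -> Σ (List (Perm n)) \hs -> S ∈ cdL a × P S hs × gs ≡ facS S ∷ hs
   from (g ∷ hs) (((c , lg) , G) , pv , le) = S , hs , S∈ , (o , G , sym v≡ , cong len v≡ & lu) , cong (_∷ hs) (sym gS)
    where
     R' = Elem→Form c
     S = fst R'
     e = fst (snd R')
     h = fst (snd (snd R'))
     g≡ = snd (snd (snd R'))
     F' = facS-form S e h
     fm = frm S (fst F') (fst (snd F'))
     fmg : Form.g fm ≡ g
     fmg = pw-unique (Form.cd fm) (Form.cd (frm S e h)) (\x m -> snd (Form.Mem-g (frm S e h) x) (fst (Form.Mem-g fm x) m)) (\x m -> snd (Form.Mem-g fm x) (fst (Form.Mem-g (frm S e h) x) m)) & g≡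
     gS : facS S ≡ g
     gS = fst (snd (snd F')) & fmg
     wS = snd (snd (snd F'))
     a≡ : a ≡ ∥ S ∥
     a≡ = sym lg & cong len (sym fmg) & Form.len-g fm
     S∈ : S ∈ cdL a
     S∈ = ∈-filter⁺ (\S -> ¬? (AllT? S) ×-dec (a N.≟ ∥ S ∥)) (subst (\m -> S ∈ boolsL m) e (∈-boolsL S)) (h , a≡)
     v≡ : v' S ≡ prodR hs
     v≡ = cong2 _·w_ (sym pv & cong (compose n (prodR hs)) (sym fmg)) wS & compose-w (prodR hs) (Form.word fm)
     lw : length (wordS S) ≡ a
     lw = cong length wS & Form.length-word fm & sym a≡
     lu : len (prodR hs) ≡ sumN as
     lu = M.≤-antisym (len-prodR as hs G) (M.+-cancelˡ-≤ a _ _ (M.≤-trans (M.≤-reflexive (sym le)) (M.≤-trans (len-w A (wordS S)) (M.≤-reflexive ((cong2 N._+_ (cong len v≡) lw) & (M.+-comm _ a))))))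
     o : ok S
     o = (cong2 N._+_ (cong len v≡ & lu) lw) & M.+-comm (sumN as) a & sym le

-- Averages of affine permutations

module Total (n : ℕ) {{nz : NonZero n}} (1<n : 1z < + n) where
 open Count n 1<n public

 Sm : ℤ -> (ℤ -> ℤ) -> ℤ
 Sm a G = ΣL (range a n) G

 range-snoc : ∀ a m -> range a (suc m) ≡ range a m ++ [ a + + m ]
 range-snoc a zero = cong (_∷ []) (sym (+0 a))
 range-snoc a (suc m) = cong (a ∷_) (range-snoc (a + 1z) m & cong (\z -> range (a + 1z) m ++ [ z ]) (+1s a m))

 Sm-shift : ∀ {G} -> Per G -> ∀ a -> Sm (a + 1z) G ≡ Sm a G + N
 Sm-shift {G} p a = k n refl
  where
   k : ∀ m -> m ≡ n -> ΣL (range (a + 1z) m) G ≡ ΣL (range a m) G + N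
   k zero e = absurd (N.≢-nonZero⁻¹ n (sym e))
   k (suc m) e = cong (\z -> ΣL z G) (range-snoc (a + 1z) m) & (Σ-++ (range (a + 1z) m) _ G) & cong (\z -> ΣL (range (a + 1z) m) G + (z + 0z)) gN & l (ΣL (range (a + 1z) m) G) (G a) N
    where
     gN : G (a + 1z + + m) ≡ G a + N
     gN = cong G (+1s a m & cong (_+_ a) ((cong +_ e) & sym (Z.*-identityˡ N))) & p a 1z & cong (_+_ (G a)) (Z.*-identityˡ N)
     l : ∀ s g N -> s + ((g + N) + 0z) ≡ g + s + N
     l = ring

 Sm-any : ∀ {G G'} -> Per G -> Per G' -> ∀ a -> Sm a G ≡ Sm a G' -> ∀ b -> Sm b G ≡ Sm b G'
 Sm-any {G} {G'} p p' a e b = lia 2 (\x y -> x :- y := #0 => |- x := y) (Sm b G) (Sm b G') (c b & sym (c a) & lia 2 (\x y -> x := y => |- x :- y := #0) (Sm a G) (Sm a G') e)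
  where
   d : ℤ -> ℤ
   d x = Sm x G - Sm x G'
   st' : ∀ x -> d (x + 1z) ≡ d x
   st' x = (cong2 _-_ (Sm-shift p x) (Sm-shift p' x)) & l (Sm x G) (Sm x G') N
    where
     l : ∀ a b c -> (a + c) - (b + c) ≡ a - b
     l = ring
   c : ∀ x -> d x ≡ d 0z
   c (+ zero) = refl
   c (+ suc k) = cong d (Z.+-comm 1z (+ k)) & st' (+ k) & c (+ k)
   c -[1+ zero ] = sym (st' -[1+ 0 ])
   c -[1+ suc k ] = sym (st' -[1+ suc k ]) & (c -[1+ k ])

 -- The window sum is unchanged by simple reflections and drops by a n under `shift n a`. It
 -- therefore identifies the average of a permutation without an argument about uniqueness of the
 -- decomposition.
 tot : Perm n -> ℤ
 tot v = Sm 1z (ev v)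

 tot-s : ∀ v i -> tot (v ·s i) ≡ tot v
 tot-s v i = Sm-any (ev-per (v ·s i)) (ev-per v) i (k n refl) 1z
  where
   k : ∀ m -> m ≡ n -> ΣL (range i m) (ev (v ·s i)) ≡ ΣL (range i m) (ev v)
   k zero e = refl
   k (suc zero) e = absurd (Z.<-irrefl (cong +_ e) 1<n)
   k (suc (suc m)) e = cong2 (\x y -> x + (y + ΣL (range (i + 1z + 1z) m) (ev (v ·s i)))) (ev-sl v i) (ev-sr v i) & cong (\z -> ev v (i + 1z) + (ev v i + z)) (Σ-cong∈ (range (i + 1z + 1z) m) fx) & l (ev v (i + 1z)) (ev v i) (ΣL (range (i + 1z + 1z) m) (ev v))
    where
     l : ∀ a b c -> a + (b + c) ≡ b + (a + c)
     l = ring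
     fx : ∀ x -> x ∈ range (i + 1z + 1z) m -> ev (v ·s i) x ≡ ev v x
     fx x x∈ with ∈-range⁻ (i + 1z + 1z) m x x∈
     ... | p , q = ev-s-o v i x (near i x (lia 2 (\i x -> i :+ #1 :+ #1 =< x => |- i :< x) i x p) (lia 4 (\i x m N -> x :< i :+ #1 :+ #1 :+ m => #1 :+ (#1 :+ m) := N => |- x :< i :+ N) i x (+ m) N q (cong +_ e)) ∘ sym)
      (near (i + 1z) x (lia 2 (\i x -> i :+ #1 :+ #1 =< x => |- i :+ #1 :< x) i x p) (lia 4 (\i x m N -> x :< i :+ #1 :+ #1 :+ m => #1 :+ (#1 :+ m) := N => |- x :< i :+ #1 :+ N) i x (+ m) N q (cong +_ e)) ∘ sym)

 tot-w : ∀ v l -> tot (v ·w l) ≡ tot v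
 tot-w v [] = refl
 tot-w v (i ∷ l) = tot-w (v ·s i) l & tot-s v i

 tot-id : ℤ
 tot-id = ΣL (range 1z n) (\x -> x)

 tot-pw : ∀ l -> tot (pw l) ≡ tot-id
 tot-pw l = tot-w (idP n) l & Σ-cong (range 1z n) ev-id

 range-length : ∀ a m -> length (range a m) ≡ m
 range-length a zero = refl
 range-length a (suc m) = cong suc (range-length (a + 1z) m)

 ev-shift : ∀ a f x -> ev (shift n a f) x ≡ ev f x - a
 ev-shift a f x with toWin x
 ... | win j q refl = (ev-pos _ j q) & cong (_+ q * N) (VecP.lookup-map j (\v -> v - a) f) & l (lookup f j) a (q * N) & cong (_- a) (sym (ev-pos f j q))
  where
   l : ∀ x a k -> x - a + k ≡ x + k - a
   l = ring

 Σ-const : {A : Set} (xs : List A) (c : ℤ) -> ΣL xs (\_ -> c) ≡ c * + length xs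
 Σ-const xs c = Σ-cong xs (\_ -> sym (Z.*-identityʳ c)) & (Σ-* c xs (\_ -> 1z)) & cong (c *_) (Σ-1 xs)

 tot-shift : ∀ a f -> tot (shift n a f) ≡ tot f - a * N
 tot-shift a f = Σ-cong (range 1z n) (ev-shift a f) & (Σ-+ (range 1z n) (ev f) (\_ -> - a)) & cong (_+_ (tot f)) (Σ-const (range 1z n) (- a) & cong (\z -> - a * + z) (range-length 1z n) & sym (Z.neg-distribˡ-* a N))

 shift-Aff : ∀ a {f} -> IsAff f -> IsAff (shift n a f)
 shift-Aff a {f} A = record
  { inj = \x y e -> inj A x y (lia 3 (\x y a -> x :- a := y :- a => |- x := y) (ev f x) (ev f y) a (sym (ev-shift a f x) & e & ev-shift a f y))
  ; at = \y -> at A (y + a)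
  ; ev-at = \y -> trans (ev-shift a f _) (cong (_- a) (ev-at A (y + a)) & lia 2 (\y a -> |- y :+ a :- a := y) y a) }

 len-shift : ∀ a f -> len (shift n a f) ≡ len f
 len-shift a f = hc-unique (len-card (shift n a f)) (hc-iff (\ { (x , y) (h , p , q) -> h , p , subst2 _<_ (sym (ev-shift a f y)) (sym (ev-shift a f x)) (Z.+-monoˡ-< (- a) q) })
  (\ { (x , y) (h , p , q) -> h , p , lia 3 (\x y a -> y :- a :< x :- a => |- y :< x) (ev f x) (ev f y) a (subst2 _<_ (ev-shift a f y) (ev-shift a f x) q) }) (len-card f))

 mulT-shift : ∀ a f r j -> shift n a (mulT n f r j) ≡ mulT n (shift n a f) r j
 mulT-shift a f r j = ext _ _ \x -> (ev-shift a _ x) & cong (_- a) (ev-t f r j x) & sym ((ev-t _ r j x) & (ev-shift a f _))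

 exceed : Perm n -> ℕ
 exceed f = length (filter (\j -> N <? lookup f j) (allFin n))

 range-tab : ∀ a m -> range a m ≡ List.tabulate (\(j : Fin m) -> a + + toℕ j)
 range-tab a zero = refl
 range-tab a (suc m) = cong2 _∷_ (sym (+0 a)) (range-tab (a + 1z) m & L.tabulate-cong (\j -> +1s a (toℕ j)))

 Σ-window : ∀ G -> ΣL (range 1z n) G ≡ ΣL (allFin n) (\j -> G (pos n j))
 Σ-window G = cong (\z -> ΣL z G) (range-tab 1z n & sym (L.map-tabulate id (pos n))) & Σ-map (pos n) (allFin n) G

 Bd : Perm n -> Set
 Bd f = ∀ x -> x ≤ ev f x × ev f x ≤ x + N

 -- Subtracting n from the values above n turns the window of a bounded permutation into a
 -- rearrangement of 1, ..., n, with inverse `q`; each exceedance accounts for one n.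
 exceed-tot : ∀ {f} -> IsAff f -> Bd f -> tot f ≡ tot-id + + exceed f * N
 exceed-tot {f} A bd = Σ-cong (range 1z n) sp & (Σ-+ (range 1z n) y _) & (cong2 _+_ perm ((Σ-* N (range 1z n) _) & (Z.*-comm N _) & cong (_* N) cnt))
  where
   e? : ∀ x -> Dec (N < ev f x)
   e? x = N <? ev f x
   y : ℤ -> ℤ
   y x = ev f x - N * on (e? x) 1z
   sp : ∀ x -> ev f x ≡ y x + N * on (e? x) 1z
   sp x = l (ev f x) (N * on (e? x) 1z)
    where
     l : ∀ a b -> a ≡ a - b + b
     l = ring
   cnt : ΣL (range 1z n) (\x -> on (e? x) 1z) ≡ + exceed f
   cnt = (Σ-window _) & Σ-cong (allFin n) (\j -> on-cong (e? (pos n j)) (N <? lookup f j) (subst (N <_) (ev-lookup f j)) (subst (N <_) (sym (ev-lookup f j))) (\_ -> refl)) & sym (Σ-filter (\j -> N <? lookup f j) (allFin n) (\_ -> 1z)) & Σ-1 (filter (\j -> N <? lookup f j) (allFin n))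
   q : ℤ -> ℤ
   q z = pick (1z ≤? at A z) (at A z) (at A z + N)
   N1 : N * 1z ≡ N
   N1 = Z.*-identityʳ N
   N0 : N * 0z ≡ 0z
   N0 = Z.*-zeroʳ N
   at+N : ∀ z -> at A (z + N) ≡ at A z + N
   at+N z = cong (\w -> at A (z + w)) (sym (Z.*-identityˡ N)) & at-per A z 1z & cong (_+_ (at A z)) (Z.*-identityˡ N)
   fN : ∀ x -> ev f (x + N) ≡ ev f x + N
   fN x = cong (\w -> ev f (x + w)) (sym (Z.*-identityˡ N)) & ev-per f x 1z & cong (_+_ (ev f x)) (Z.*-identityˡ N)
   fwd : ∀ x -> x ∈ range 1z n -> y x ∈ range 1z n × q (y x) ≡ x
   fwd x x∈ with ∈-range⁻ 1z n x x∈
   ... | p , p' = k (e? x)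
    where
     k : (d : Dec (N < ev f x)) -> (ev f x - N * on d 1z) ∈ range 1z n × q (ev f x - N * on d 1z) ≡ x
     k (yes g) = ∈-range⁺ 1z n _ (lia 3 (\f N M -> N :< f => M := N => |- #1 =< f :- M) (ev f x) N (N * 1z) g N1) (lia 4 (\x f N M -> f =< x :+ N => x :< #1 :+ N => M := N => |- f :- M :< #1 :+ N) x (ev f x) N (N * 1z) (snd (bd x)) p' N1)
      , (pick-no (1z ≤? at A z) (\h -> lia 4 (\x N a i -> a :+ N := x => x :< i :+ N => i := #1 => i =< a => |- ff) x N (at A z) 1z az p' refl h) _ _) & az
      where
       z = ev f x - N * 1z
       az : at A z + N ≡ x
       az = sym (at+N z) & cong (at A) (lia 3 (\f N M -> M := N => |- f :- M :+ N := f) (ev f x) N (N * 1z) N1) & at-ev A x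
     k (no g) = ∈-range⁺ 1z n _ (lia 3 (\x f M -> #1 =< x => x =< f => M := #0 => |- #1 =< f :- M) x (ev f x) (N * 0z) p (fst (bd x)) N0) (lia 3 (\f N M -> f =< N => M := #0 => |- f :- M :< #1 :+ N) (ev f x) N (N * 0z) (Z.≮⇒≥ g) N0)
      , (pick-yes (1z ≤? at A z) (subst (1z ≤_) (sym az) p) _ _) & az
      where
       z = ev f x - N * 0z
       az : at A z ≡ x
       az = cong (at A) (lia 2 (\f M -> M := #0 => |- f :- M := f) (ev f x) (N * 0z) N0) & at-ev A x
   bwd : ∀ z -> z ∈ range 1z n -> q z ∈ range 1z n × y (q z) ≡ z
   bwd z z∈ with ∈-range⁻ 1z n z z∈
   ... | p , p' = k (1z ≤? a)
    where
     a = at A z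
     fa : ev f a ≡ z
     fa = ev-at A z
     k : (d : Dec (1z ≤ a)) -> pick d a (a + N) ∈ range 1z n × y (pick d a (a + N)) ≡ z
     k (yes g) = ∈-range⁺ 1z n a g (lia 4 (\a f z N -> a =< f => f := z => z :< #1 :+ N => |- a :< #1 :+ N) a (ev f a) z N (fst (bd a)) fa p')
      , cong (\o -> ev f a - N * o) (on-no (e? a) (\h -> lia 3 (\f z N -> N :< f => f := z => z :< #1 :+ N => |- ff) (ev f a) z N h fa p') 1z) & lia 3 (\f z M -> f := z => M := #0 => |- f :- M := z) (ev f a) z (N * 0z) fa N0
     k (no g) = ∈-range⁺ 1z n (a + N) (lia 4 (\a f z N -> f =< a :+ N => f := z => #1 =< z => |- #1 =< a :+ N) a (ev f a) z N (snd (bd a)) fa p) (Z.+-monoˡ-< N (Z.≰⇒> g))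
      , cong (\o -> ev f (a + N) - N * o) (on-yes (e? (a + N)) (lia 4 (\f F z N -> F := f :+ N => f := z => #1 =< z => |- N :< F) (ev f a) (ev f (a + N)) z N (fN a) fa p) 1z) &
       lia 5 (\f F z N M -> F := f :+ N => f := z => M := N => |- F :- M := z) (ev f a) (ev f (a + N)) z N (N * 1z) (fN a) fa N1
   perm : ΣL (range 1z n) y ≡ tot-id
   perm = Σ-bij (range-unique 1z n) (range-unique 1z n) y q fwd bwd y (\z -> z) (\_ _ -> refl)

 *N-cancel : ∀ a b -> a * N ≡ b * N -> a ≡ b
 *N-cancel a b e = Z.*-cancelʳ-≡ a b N {{ℤ.≢-nonZero (\z -> Z.<-irrefl (sym z) 0<N)}} e

 compose-pw : ∀ x y -> compose n (pw x) (pw y) ≡ pw (x ++ y)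
 compose-pw x y = ext _ _ \z -> ev-compose (pw x) (pw y) z & (ev-pw x _) & cong (act x) (ev-pw y z) & sym (act-++ x y z) & sym (ev-pw (x ++ y) z)

 Good-word : ∀ as gs -> Good as gs -> Σ (List (Fin n)) \l -> wordProd n l ≡ prodR gs
 Good-word [] [] _ = [] , refl
 Good-word (a ∷ as) (g ∷ gs) (((l , _ , e) , _) , G) with Good-word as gs G
 ... | l' , e' = l' ++ l , wordProd-pw (l' ++ l) & cong pw (L.map-++ (\i -> + toℕ i) l' l) & sym (compose-pw (ltr l') (ltr l)) & cong2 (compose n) (sym (wordProd-pw l') & e') (sym (wordProd-pw l) & e)

 compose-assoc : ∀ f g h -> compose n f (compose n g h) ≡ compose n (compose n f g) h
 compose-assoc f g h = ext _ _ \x -> (ev-compose f _ x) & cong (ev f) (ev-compose g h x) & sym ((ev-compose _ h x) & (ev-compose f g _))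

 prodR-snoc : ∀ gs x -> prodR (gs ++ [ x ]) ≡ compose n x (prodR gs)
 prodR-snoc [] x = ext _ _ \z -> ev-compose (idP n) x z & (ev-id _) & sym (ev-compose x (idP n) z & cong (ev x) (ev-id z))
 prodR-snoc (g ∷ gs) x = cong (\z -> compose n z g) (prodR-snoc gs x) & sym (compose-assoc x (prodR gs) g)

 prodR-reverse : ∀ fs -> prodR (reverse fs) ≡ foldr (compose n) (idP n) fs
 prodR-reverse [] = refl
 prodR-reverse (f ∷ fs) = cong prodR (L.unfold-reverse f fs) & prodR-snoc (reverse fs) f & cong (compose n f) (prodR-reverse fs)

 Good-snoc : ∀ as gs a g -> Good as gs -> CycDecElem n g × len g ≡ a -> Good (as ++ [ a ]) (gs ++ [ g ])
 Good-snoc [] [] a g _ h = h , tt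
 Good-snoc (_ ∷ as) (_ ∷ gs) a g (p , G) h = p , Good-snoc as gs a g G h

 Good-snoc⁻ : ∀ as gs a g -> Good (as ++ [ a ]) (gs ++ [ g ]) -> Good as gs × CycDecElem n g × len g ≡ a
 Good-snoc⁻ [] [] a g (h , _) = tt , h
 Good-snoc⁻ (_ ∷ as) (_ ∷ gs) a g (p , G) = let (G' , h) = Good-snoc⁻ as gs a g G in (p , G') , h
 Good-snoc⁻ [] (_ ∷ []) a g (_ , ())
 Good-snoc⁻ [] (_ ∷ _ ∷ _) a g (_ , ())
 Good-snoc⁻ (_ ∷ []) [] a g (_ , ())
 Good-snoc⁻ (_ ∷ _ ∷ _) [] a g (_ , ())

 module _ {k : ℕ} where

  GoodV : ∀ {k} -> Vec ℕ k -> Vec (Perm n) k -> Set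
  GoodV a fs = ∀ i -> CycDecElem n (lookup fs i) × Len n (lookup fs i) (lookup a i)

  GoodV→ : ∀ {k} (a : Vec ℕ k) fs -> GoodV a fs -> Good (reverse (toList a)) (reverse (toList fs))
  GoodV→ [] [] h = tt
  GoodV→ (a ∷ as) (f ∷ fs) h rewrite L.unfold-reverse a (toList as) | L.unfold-reverse f (toList fs) =
   Good-snoc (reverse (toList as)) (reverse (toList fs)) a f (GoodV→ as fs (\i -> h (Fin.suc i))) (fst (h Fin.zero) , sym (Len→len f (snd (h Fin.zero))))

  GoodV← : ∀ {k} (a : Vec ℕ k) fs -> Good (reverse (toList a)) (reverse (toList fs)) -> GoodV a fs
  GoodV← (a ∷ as) (f ∷ fs) h i rewrite L.unfold-reverse a (toList as) | L.unfold-reverse f (toList fs) with Good-snoc⁻ (reverse (toList as)) (reverse (toList fs)) a f h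
  GoodV← (a ∷ as) (f ∷ fs) h Fin.zero | G , c , e = c , subst (Len n f) e (Len-len f)
  GoodV← (a ∷ as) (f ∷ fs) h (Fin.suc i) | G , _ = GoodV← as fs G i

  toVec : ∀ k -> List (Perm n) -> Vec (Perm n) k
  toVec zero _ = []
  toVec (suc k) [] = idP n ∷ toVec k []
  toVec (suc k) (x ∷ xs) = x ∷ toVec k xs

  toVec-toList : ∀ {k} (fs : Vec (Perm n) k) -> toVec k (toList fs) ≡ fs
  toVec-toList [] = refl
  toVec-toList (f ∷ fs) = cong (f ∷_) (toVec-toList fs)

  toList-toVec : ∀ k xs -> length xs ≡ k -> toList (toVec k xs) ≡ xs
  toList-toVec zero [] e = refl
  toList-toVec (suc k) (x ∷ xs) e = cong (x ∷_) (toList-toVec k xs (M.suc-injective e))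

 Good-length : ∀ as gs -> Good as gs -> length gs ≡ length as
 Good-length [] [] _ = refl
 Good-length (_ ∷ as) (_ ∷ gs) (_ , G) = cong suc (Good-length as gs G)

 sumN-++ : ∀ xs ys -> sumN (xs ++ ys) ≡ sumN xs N.+ sumN ys
 sumN-++ [] ys = refl
 sumN-++ (x ∷ xs) ys = cong (x N.+_) (sumN-++ xs ys) & sym (M.+-assoc x _ _)

 sumN-rev : ∀ xs -> sumN (reverse xs) ≡ sumN xs
 sumN-rev [] = refl
 sumN-rev (x ∷ xs) = cong sumN (L.unfold-reverse x xs) & (sumN-++ (reverse xs) [ x ]) & (cong2 N._+_ (sumN-rev xs) (M.+-identityʳ x)) & (M.+-comm _ x)

 sumN-vec : ∀ {k} (a : Vec ℕ k) -> Vec.sum a ≡ sumN (toList a)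
 sumN-vec [] = refl
 sumN-vec (x ∷ a) = cong (x N.+_) (sumN-vec a)

 -- `Fact` multiplies from the left while `prodR` starts at the right end, so factors and exponents
 -- are reversed; `Fr-↭` undoes this for the exponents. The window sum shows that the average in
 -- `Fact` must be k.
 GCoeff-Fr : ∀ k {f} -> IsAff f -> tot f ≡ tot-id + + k * N -> ∀ {k'} (a : Vec ℕ k') m -> GCoeff n k' f a m -> + m ≡ Fr (toList a) (shift n (+ k) f)
 GCoeff-Fr k {f} A tf {k'} a m h = (cong +_ (hc-unique {m = m} (hc-bij Φ Ψ to from h) (fst (snd C)))) & snd (snd C) & Fr-↭ (PermP.↭-reverse (toList a)) v Av
  where
   v = shift n (+ k) f
   Av = shift-Aff (+ k) A
   C = count (reverse (toList a)) Av
   Φ : Vec (Perm n) k' -> List (Perm n)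
   Φ fs = reverse (toList fs)
   Ψ : List (Perm n) -> Vec (Perm n) k'
   Ψ gs = toVec {k'} k' (reverse gs)
   sum≡ : Vec.sum a ≡ sumN (reverse (toList a))
   sum≡ = sumN-vec a & sym (sumN-rev (toList a))
   to : ∀ fs -> Fact n k' f a fs -> Tgt (reverse (toList a)) v (Φ fs) × Ψ (Φ fs) ≡ fs
   to fs (gv , (m' , _ , pr) , le) = (G0 , pr' & cong (\z -> shift n z f) (*N-cancel m' (+ k) mk) , len-shift (+ k) f & sym (Len→len f le) & sum≡)
    , cong (toVec {k'} k') (L.reverse-involutive (toList fs)) & toVec-toList {k'} fs
    where
     G0 = GoodV→ {k'} a fs gv
     pr' : prodR (Φ fs) ≡ shift n m' f
     pr' = prodR-reverse (toList fs) & pr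
     W = Good-word _ (Φ fs) G0
     mk : m' * N ≡ + k * N
     mk = lia 4 (\t i x y -> t :- x := i => t := i :+ y => |- x := y) (tot f) tot-id (m' * N) (+ k * N) (sym (tot-shift m' f) & cong tot (sym pr' & sym (snd W) & wordProd-pw (fst W)) & tot-pw (ltr (fst W))) tf
   from : ∀ gs -> Tgt (reverse (toList a)) v gs -> Fact n k' f a (Ψ gs) × Φ (Ψ gs) ≡ gs
   from gs (G , pr , le) = (GoodV← {k'} a (Ψ gs) (subst (Good (reverse (toList a))) (sym ΦΨ) G)
    , (+ k , (fst W , snd W & pr) , sym (prodR-reverse (toList (Ψ gs))) & (cong prodR ΦΨ) & pr)
    , subst (Len n f) (sym (len-shift (+ k) f) & le & sym sum≡) (Len-len f)) , ΦΨ
    where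
     W = Good-word _ gs G
     ΦΨ : Φ (Ψ gs) ≡ gs
     ΦΨ = cong reverse (toList-toVec {k'} k' (reverse gs) (L.length-reverse gs & (Good-length _ gs G) & L.length-reverse (toList a) & VecP.length-toList a)) & L.reverse-involutive gs

 UM-0 : ∀ {x y} -> x ≅ inl y -> ∀ φ {v} -> IsAff v -> φ (v ·w y) ≡ 0z -> UM x φ v ≡ 0z
 UM-0 {x} {y} q φ {v} A h = fw q φ v A & UW-on A y φ & cong (on (len (v ·w y) N.+ length y N.≟ len v)) h & (on-0 _)

 -- Stripping a factor keeps the value v(x) but moves it to a point y ≥ x - 1 (`act≥`). So a deficit
 -- larger than the number of factors survives to the end, where the identity has none.
 Fr-0 : ∀ as {v} -> IsAff v -> ∀ x -> ev v x < x - + length as -> Fr as v ≡ 0z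
 Fr-0 [] {v} A x h = on-no (v ≟P idP n) (\ { refl -> Z.<-irrefl (ev-id x) (subst (ev v x <_) (+0 x) h) }) 1z
 Fr-0 (a ∷ as) {v} A x h = sumQ-0 (bools n) (\S e -> cong (δ a ∥ S ∥ *_) (k S (gap-form 0z S (e & L.length-replicate n))) & Z.*-zeroʳ (δ a ∥ S ∥))
  where
   sumQ-0 : (Ps : List (List Bool)) {f : List Bool -> Fn} -> (∀ w -> length w ≡ length Ps -> f w v ≡ 0z) -> sumQ Ps f v ≡ 0z
   sumQ-0 [] h = h [] refl
   sumQ-0 (P ∷ Ps) h = Σ-0 P (\q _ -> sumQ-0 Ps (\w e -> h (q ∷ w) (cong suc e)))
   k : ∀ S -> _ -> UM (cw 0z S) (Fr as) v ≡ 0z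
   k S (inl p) rewrite go-AllT 0z S [] p = refl
   k S (inr (b , T , l , _ , q , _)) = UM-0 q (Fr as) A (Fr-0 as (w-Aff A w) y
    (lia 4 (\v x y l -> v :< x :- (#1 :+ l) => x :- #1 =< y => |- v :< y :- l) (ev (v ·w w) y) x y (+ length as) (subst (_< x - + suc (length as)) (sym (ev-w v w y & cong (ev v) (act-rev w x))) h) (act≥ (CD-rev b T l) x)))
    where
     w = I b T
     y = act (reverse w) x

 Er : List ℕ -> Fn
 Er [] = δe
 Er (b ∷ bs) = E b (Er bs)

 -- Dual to `Fr-0`: stripping a decreasing word moves the value to a point y ≤ x + 1, so an excess
 -- larger than the number of operators survives.
 Er-0 : ∀ bs {v} -> IsAff v -> ∀ x -> x + + length bs < ev v x -> Er bs v ≡ 0z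
 Er-0 [] {v} A x h = on-no (v ≟P idP n) (\ { refl -> Z.<-irrefl (sym (ev-id x)) (subst (_< ev v x) (+0 x) h) }) 1z
 Er-0 (a ∷ as) {v} A x h = sumQ-0 (bools n) (\S e -> cong (δ a ∥ S ∥ *_) (k S (gap-form 0z S (e & L.length-replicate n))) & Z.*-zeroʳ (δ a ∥ S ∥))
  where
   sumQ-0 : (Ps : List (List Bool)) {f : List Bool -> Fn} -> (∀ w -> length w ≡ length Ps -> f w v ≡ 0z) -> sumQ Ps f v ≡ 0z
   sumQ-0 [] h = h [] refl
   sumQ-0 (P ∷ Ps) h = Σ-0 P (\q _ -> sumQ-0 Ps (\w e -> h (q ∷ w) (cong suc e)))
   k : ∀ S -> _ -> UM (rev (cw 0z S)) (Er as) v ≡ 0z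
   k S (inl p) rewrite go-AllT 0z S [] p = refl
   k S (inr (b , T , l , _ , q , _)) = bw q (Er as) v A & UM-0 (≅r {inl (reverse w)}) (Er as) A (Er-0 as (w-Aff A (reverse w)) y
    (lia 4 (\v x y l -> x :+ (#1 :+ l) :< v => y :- #1 =< x => |- y :+ l :< v) (ev (v ·w reverse w) y) x y (+ length as) (subst (x + + suc (length as) <_) (sym (ev-w v (reverse w) y & cong (ev v) yx)) h) (subst (y - 1z ≤_) yx (act≥ (CD-rev b T l) y))))
    where
     w = I b T
     y = act w x
     yx : act (reverse w) y ≡ x
     yx = cong (\z -> act (reverse w) (act z x)) (sym (L.reverse-involutive w)) & act-rev (reverse w) x

-- Alternants

bump : ∀ {k} -> ℕ -> Vec ℤ k -> Vec ℤ k
bump i [] = []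
bump zero (x ∷ a) = x + 1z ∷ a
bump (suc i) (x ∷ a) = x ∷ bump i a

swp : ∀ {A : Set} {k} -> ℕ -> Vec A k -> Vec A k
swp i [] = []
swp zero (x ∷ []) = x ∷ []
swp zero (x ∷ y ∷ a) = y ∷ x ∷ a
swp (suc i) (x ∷ a) = x ∷ swp i a

-- The transposition of i and i + 1 on indices, as `swp i` is on coordinates.
π : ℕ -> ℕ -> ℕ
π zero zero = 1
π zero (suc zero) = 0
π zero (suc (suc j)) = suc (suc j)
π (suc i) zero = zero
π (suc i) (suc j) = suc (π i j)

π-inv : ∀ i j -> π i (π i j) ≡ j
π-inv zero zero = refl
π-inv zero (suc zero) = refl
π-inv zero (suc (suc j)) = refl
π-inv (suc i) zero = refl
π-inv (suc i) (suc j) = cong suc (π-inv i j)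

π-< : ∀ i j k -> suc i N.< k -> j N.< k -> π i j N.< k
π-< zero zero k h h' = h
π-< zero (suc zero) (suc k) h h' = s≤s z≤n
π-< zero (suc (suc j)) k h h' = h'
π-< (suc i) zero k h h' = h'
π-< (suc i) (suc j) (suc k) (s≤s h) (s≤s h') = s≤s (π-< i j k h h')

bump-comm : ∀ {k} i j (a : Vec ℤ k) -> bump i (bump j a) ≡ bump j (bump i a)
bump-comm i j [] = refl
bump-comm zero zero (x ∷ a) = refl
bump-comm zero (suc j) (x ∷ a) = refl
bump-comm (suc i) zero (x ∷ a) = refl
bump-comm (suc i) (suc j) (x ∷ a) = cong (x ∷_) (bump-comm i j a)

swp-bump : ∀ {k} i j (a : Vec ℤ k) -> suc i N.< k -> bump j (swp i a) ≡ swp i (bump (π i j) a)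
swp-bump zero zero (x ∷ y ∷ a) h = refl
swp-bump zero (suc zero) (x ∷ y ∷ a) h = refl
swp-bump zero (suc (suc j)) (x ∷ y ∷ a) h = refl
swp-bump (suc i) zero (x ∷ a) h = refl
swp-bump (suc i) (suc j) (x ∷ a) (s≤s h) = cong (x ∷_) (swp-bump i j a h)
swp-bump zero j (x ∷ []) (s≤s ())

swp-inv : ∀ {A : Set} {k} i (a : Vec A k) -> swp i (swp i a) ≡ a
swp-inv i [] = refl
swp-inv zero (x ∷ []) = refl
swp-inv zero (x ∷ y ∷ a) = refl
swp-inv (suc i) (x ∷ a) = cong (x ∷_) (swp-inv i a)

pairs : ℕ -> List (ℕ × ℕ)
pairs zero = []
pairs (suc k) = map (\j -> 0 , suc j) (upTo k) ++ map (\(i , j) -> suc i , suc j) (pairs k)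

π2 : ℕ -> ℕ × ℕ -> ℕ × ℕ
π2 i (a , b) = π i a , π i b

up-π : ∀ i k -> suc i N.< k -> map (π i) (upTo k) ↭ upTo k
up-π i k h = map-↭ (UP.upTo⁺ k) (UP.upTo⁺ k) (π i) (π i) (\j m -> ∈-upTo⁺ (π-< i j k h (∈-upTo⁻ m)) , π-inv i j) (\j m -> ∈-upTo⁺ (π-< i j k h (∈-upTo⁻ m)) , π-inv i j)

-- All pairs but (i,i+1) are permuted among themselves by the transposition of i and i+1.
pairs-π : ∀ k i -> suc i N.< k -> Σ (List (ℕ × ℕ)) \rest -> pairs k ↭ (i , suc i) ∷ rest × map (π2 i) rest ↭ rest
pairs-π (suc (suc k)) zero h = rest , Perm.prep _ (Perm.↭-refl) ↭≡ eq0 , subst (_↭ rest) (sym eq) (PermP.shifts B A)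
 where
  _↭≡_ : ∀ {xs ys zs : List (ℕ × ℕ)} -> xs ↭ ys -> zs ≡ xs -> zs ↭ ys
  p ↭≡ refl = p
  A = map (\j -> 0 , suc (suc j)) (upTo k)
  B = map (\j -> 1 , suc (suc j)) (upTo k)
  Z = map (\(i , j) -> suc (suc i) , suc (suc j)) (pairs k)
  rest = A ++ B ++ Z
  s2 : ∀ (f g : ℕ -> ℕ × ℕ) -> (∀ j -> g (suc j) ≡ f j) -> ∀ k -> map g (List.applyUpTo suc k) ≡ map f (upTo k)
  s2 f g h k = cong (map g) (sym (L.map-upTo suc k)) & sym (L.map-∘ (upTo k)) & L.map-cong h (upTo k)
  eq0 : pairs (suc (suc k)) ≡ (0 , 1) ∷ rest
  eq0 = cong ((0 , 1) ∷_) (cong2 _++_ (s2 (\j -> 0 , suc (suc j)) (\j -> 0 , suc j) (\_ -> refl) k)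
   (L.map-++ (\(i , j) -> suc i , suc j) (map (\j -> 0 , suc j) (upTo k)) (map (\(i , j) -> suc i , suc j) (pairs k)) & (cong2 _++_ (sym (L.map-∘ (upTo k))) (sym (L.map-∘ (pairs k))))))
  eq : map (π2 0) rest ≡ B ++ A ++ Z
  eq = L.map-++ (π2 0) A (B ++ Z) & (cong2 _++_ (sym (L.map-∘ (upTo k))) (L.map-++ (π2 0) B Z & (cong2 _++_ (sym (L.map-∘ (upTo k))) (sym (L.map-∘ (pairs k))))))
pairs-π (suc k) (suc i) (s≤s h) with pairs-π k i h
... | rest , p , q = A ++ map ss rest , Perm.↭-trans (PermP.++⁺ˡ A (PermP.map⁺ ss p)) (PermP.shift _ A (map ss rest)) ,
 subst (_↭ A ++ map ss rest) (sym (L.map-++ (π2 (suc i)) A (map ss rest) & (cong2 _++_ (sym (L.map-∘ (upTo k)) & L.map-∘ (upTo k)) (sym (L.map-∘ rest) & L.map-∘ rest))))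
  (PermP.++⁺ (PermP.map⁺ (\j -> 0 , suc j) (up-π i k h)) (PermP.map⁺ ss q))
 where
  ss : ℕ × ℕ -> ℕ × ℕ
  ss (i , j) = suc i , suc j
  A = map (\j -> 0 , suc j) (upTo k)

module Alternant (R : CommutativeRing 0ℓ 0ℓ) where
 open CommutativeRing R public renaming (Carrier to C; _+_ to _+ᵣ_; _*_ to _*ᵣ_; -_ to -ᵣ_; _≈_ to _≈ᵣ_; 0# to 0ᵣ; 1# to 1ᵣ; refl to rr; sym to rs; trans to rt; reflexive to r≡)
  using (+-cong; *-cong; -‿cong; +-assoc; +-comm; +-identityˡ; +-identityʳ; -‿inverseˡ; -‿inverseʳ; *-assoc; *-comm; *-identityˡ; *-identityʳ; distribˡ; distribʳ; zeroˡ; zeroʳ)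
 open import Algebra.Properties.Ring (CommutativeRing.ring R) public using (-‿distribˡ-*; -‿distribʳ-*; -‿involutive; -‿+-comm; -0#≈0#)

 _-ᵣ_ : C -> C -> C
 x -ᵣ y = x +ᵣ (-ᵣ y)

 -- A function of an integer vector a is thought of as the values of a linear form on the monomials
 -- y^a, so that multiplication by y_i is translation by `bump i`.
 Vf : ℕ -> Set
 Vf k = Vec ℤ k -> C

 -- (m , n) stands for the factor y_m - y_n, acting by translation
 Dp : ∀ {k} -> ℕ × ℕ -> Vf k -> Vf k
 Dp (i , j) f a = f (bump i a) -ᵣ f (bump j a)

 DL : ∀ {k} -> List (ℕ × ℕ) -> Vf k -> Vf k
 DL [] f = f
 DL (p ∷ ps) f = Dp p (DL ps f)

 Dp-cong : ∀ {k} p {f g : Vf k} -> (∀ a -> f a ≈ᵣ g a) -> ∀ a -> Dp p f a ≈ᵣ Dp p g a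
 Dp-cong (i , j) h a = +-cong (h _) (-‿cong (h _))

 DL-cong : ∀ {k} ps {f g : Vf k} -> (∀ a -> f a ≈ᵣ g a) -> ∀ a -> DL ps f a ≈ᵣ DL ps g a
 DL-cong [] h = h
 DL-cong (p ∷ ps) h = Dp-cong p (DL-cong ps h)

 inter : ∀ a b c d -> (a +ᵣ b) +ᵣ (c +ᵣ d) ≈ᵣ (a +ᵣ c) +ᵣ (b +ᵣ d)
 inter a b c d = rt (+-assoc a b _) (rt (+-cong rr (rt (rs (+-assoc b c d)) (rt (+-cong (+-comm b c) rr) (+-assoc c b d)))) (rs (+-assoc a c _)))

 DL-+ : ∀ {k} ps (f g : Vf k) a -> DL ps (\b -> f b +ᵣ g b) a ≈ᵣ DL ps f a +ᵣ DL ps g a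
 DL-+ [] f g a = rr
 DL-+ (p@(i , j) ∷ ps) f g a = rt (Dp-cong p (DL-+ ps f g) a) (rt (+-cong rr (rs (-‿+-comm _ _))) (inter _ _ _ _))

 DL-* : ∀ {k} ps r (f : Vf k) a -> DL ps (\b -> r *ᵣ f b) a ≈ᵣ r *ᵣ DL ps f a
 DL-* [] r f a = rr
 DL-* (p@(i , j) ∷ ps) r f a = rt (Dp-cong p (DL-* ps r f) a) (rt (+-cong rr (-‿distribʳ-* r _)) (rs (distribˡ r _ _)))

 Dp-comm : ∀ {k} p q (f : Vf k) a -> Dp p (Dp q f) a ≈ᵣ Dp q (Dp p f) a
 Dp-comm (i , j) (k , l) f a rewrite bump-comm k i a | bump-comm k j a | bump-comm l i a | bump-comm l j a =
  rt (+-cong rr (rs (-‿+-comm _ _))) (rt (inter _ _ _ _) (+-cong rr (-‿+-comm _ _)))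

 DL-↭ : ∀ {k} {ps qs} -> ps ↭ qs -> ∀ (f : Vf k) a -> DL ps f a ≈ᵣ DL qs f a
 DL-↭ Perm.refl f a = rr
 DL-↭ (Perm.prep p h) f = Dp-cong p (DL-↭ h f)
 DL-↭ {ps = _ ∷ _ ∷ xs} (Perm.swap p q h) f a = rt (Dp-comm p q (DL xs f) a) (Dp-cong q (Dp-cong p (DL-↭ h f)) a)
 DL-↭ (Perm.trans h h') f a = rt (DL-↭ h f a) (DL-↭ h' f a)

 DL-swp : ∀ {k} i -> suc i N.< k -> ∀ ps (f : Vf k) a -> DL ps f (swp i a) ≈ᵣ DL (map (π2 i) ps) (\b -> f (swp i b)) a
 DL-swp i h [] f a = rr
 DL-swp i h ((p , q) ∷ ps) f a rewrite swp-bump i p a h | swp-bump i q a h = +-cong (DL-swp i h ps f _) (-‿cong (DL-swp i h ps f _))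

 V⁺ : ∀ k -> Vf k -> Vf k
 V⁺ k = DL (pairs k)

 -- The exchange of i and i + 1 permutes the Vandermonde factors other than y_i - y_{i+1}, which
 -- changes sign.
 V-anti : ∀ {k} i -> suc i N.< k -> ∀ f a -> V⁺ k f (swp i a) ≈ᵣ -ᵣ V⁺ k (\b -> f (swp i b)) a
 V-anti {k} i h f a with pairs-π k i h
 ... | rest , p , q = rt (DL-↭ p f (swp i a)) (rt (DL-swp i h ((i , suc i) ∷ rest) f a) (rt (Dp-cong (π2 i (i , suc i)) (DL-↭ q f') a)
  (rt (fl (π i i) (π i (suc i)) (DL rest f') (π0 i) (π1 i)) (-‿cong (rs (DL-↭ p f' a))))))
  where
   f' : Vf k
   f' b = f (swp i b)
   π0 : ∀ i -> π i i ≡ suc i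
   π0 zero = refl
   π0 (suc i) = cong suc (π0 i)
   π1 : ∀ i -> π i (suc i) ≡ i
   π1 zero = refl
   π1 (suc i) = cong suc (π1 i)
   fl : ∀ m l g -> m ≡ suc i -> l ≡ i -> Dp (m , l) g a ≈ᵣ -ᵣ Dp (i , suc i) g a
   fl _ _ g refl refl = rt (+-comm _ _) (rt (+-cong rr (rs (-‿involutive _))) (-‿+-comm _ _))


 ∏ : ∀ {k} -> List (ℤ -> C) -> Vf k
 ∏ (ℓ ∷ ℓs) (z ∷ a) = ℓ z *ᵣ ∏ ℓs a
 ∏ _ _ = 1ᵣ

 NonNeg : ∀ {k} -> Vec ℤ k -> Set
 NonNeg [] = ⊤
 NonNeg (z ∷ a) = 0z ≤ z × NonNeg a

 bump-nn : ∀ {k} i (a : Vec ℤ k) -> NonNeg a -> NonNeg (bump i a)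
 bump-nn i [] _ = tt
 bump-nn zero (z ∷ a) (p , q) = Z.≤-trans p (Z.<⇒≤ (lia 1 (\i -> |- i :< i :+ #1) z)) , q
 bump-nn (suc i) (z ∷ a) (p , q) = p , bump-nn i a q

 DL-cong⁺ : ∀ {k} ps {f g : Vf k} -> (∀ a -> NonNeg a -> f a ≈ᵣ g a) -> ∀ a -> NonNeg a -> DL ps f a ≈ᵣ DL ps g a
 DL-cong⁺ [] e = e
 DL-cong⁺ ((i , j) ∷ ps) e a q = +-cong (DL-cong⁺ ps e _ (bump-nn i a q)) (-‿cong (DL-cong⁺ ps e _ (bump-nn j a q)))

 -- `Λ` stands for pairing with the coefficients of a symmetric series. Agreement is asked only on
 -- nonnegative vectors, because `mon` behaves as a monomial only there.
 record SymFun (k : ℕ) : Set where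
  field
   Λ : Vf k -> C
   Λ-cong : ∀ {f g} -> (∀ a -> NonNeg a -> f a ≈ᵣ g a) -> Λ f ≈ᵣ Λ g
   Λ-+ : ∀ f g -> Λ (\a -> f a +ᵣ g a) ≈ᵣ Λ f +ᵣ Λ g
   Λ-* : ∀ r f -> Λ (\a -> r *ᵣ f a) ≈ᵣ r *ᵣ Λ f
   Λ-swp : ∀ i -> suc i N.< k -> ∀ f -> Λ (\a -> f (swp i a)) ≈ᵣ Λ f
 open SymFun public

 h : List C -> ℕ -> C
 h [] zero = 1ᵣ
 h [] (suc d) = 0ᵣ
 h (x ∷ X) zero = 1ᵣ
 h (x ∷ X) (suc d) = h X (suc d) +ᵣ x *ᵣ h (x ∷ X) d

 hz : List C -> ℤ -> C
 hz X (+ d) = h X d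
 hz X -[1+ _ ] = 0ᵣ

 h0 : ∀ X -> h X 0 ≈ᵣ 1ᵣ
 h0 [] = rr
 h0 (x ∷ X) = rr

 hz-∷ : ∀ x X z -> hz (x ∷ X) z ≈ᵣ hz X z +ᵣ x *ᵣ hz (x ∷ X) (z - 1z)
 hz-∷ x X (+ zero) = rs (rt (+-cong (h0 X) (zeroʳ x)) (+-identityʳ 1ᵣ))
 hz-∷ x X (+ suc d) = rr
 hz-∷ x X -[1+ d ] = rs (rt (+-identityˡ _) (zeroʳ x))

 hz-mid : ∀ Y x Z z -> hz (Y ++ x ∷ Z) z ≈ᵣ hz (Y ++ Z) z +ᵣ x *ᵣ hz (Y ++ x ∷ Z) (z - 1z)
 hz-mid [] x Z z = hz-∷ x Z z
 hz-mid (y ∷ Y) x Z (+ zero) = rs (rt (+-cong (h0 (y ∷ Y ++ Z)) (zeroʳ x)) (+-identityʳ 1ᵣ))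
 hz-mid (y ∷ Y) x Z -[1+ d ] = rs (rt (+-identityˡ _) (zeroʳ x))
 hz-mid (y ∷ Y) x Z (+ suc d) = rt (+-cong (hz-mid Y x Z (+ suc d)) (*-cong {y} rr (hz-mid (y ∷ Y) x Z (+ d))))
  (rt (+-cong rr (distribˡ y _ _)) (rt (inter _ _ _ _) (+-cong rr (rt (+-cong rr (rt (rs (*-assoc y x _)) (rt (*-cong (*-comm y x) rr) (*-assoc x y _)))) (rt (rs (distribˡ x _ _)) (*-cong {x} rr (rs (hz-∷ y (Y ++ x ∷ Z) (+ d)))))))))

 -- An entry of a Jacobi-Trudi product: the complete homogeneous polynomial whose degree is the
 -- exponent lowered by c.
 ℓ : List C -> ℕ -> ℤ -> C
 ℓ X c z = hz X (z - + c)

 desc : ℕ -> List C -> List (ℤ -> C)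
 desc zero X = []
 desc (suc c) X = ℓ X c ∷ desc c X

 mon : ∀ {k} -> List C -> Vf k
 mon (x ∷ xs) (z ∷ a) = hz (x ∷ []) z *ᵣ mon xs a
 mon _ _ = 1ᵣ

 *-swap : ∀ x y z -> x *ᵣ (y *ᵣ z) ≈ᵣ y *ᵣ (x *ᵣ z)
 *-swap x y z = rt (rs (*-assoc x y z)) (rt (*-cong (*-comm x y) rr) (*-assoc y x z))

 _⊗_ : ∀ {k} -> (ℤ -> C) -> Vf k -> Vf (suc k)
 (m ⊗ f) (z ∷ a) = m z *ᵣ f a

 DL-++ : ∀ {k} ps qs (f : Vf k) a -> DL (ps ++ qs) f a ≈ᵣ DL ps (DL qs f) a
 DL-++ [] qs f a = rr
 DL-++ (p ∷ ps) qs f = Dp-cong p (DL-++ ps qs f)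

 -*ᵣ : ∀ x y -> -ᵣ (x *ᵣ y) ≈ᵣ x *ᵣ (-ᵣ y)
 -*ᵣ x y = -‿distribʳ-* x y

 DL-tail : ∀ {k} ps m (f : Vf k) z a -> DL (map (\(i , j) -> suc i , suc j) ps) (m ⊗ f) (z ∷ a) ≈ᵣ m z *ᵣ DL ps f a
 DL-tail [] m f z a = rr
 DL-tail ((i , j) ∷ ps) m f z a = rt (+-cong (DL-tail ps m f z _) (rt (-‿cong (DL-tail ps m f z _)) (-*ᵣ _ _))) (rs (distribˡ _ _ _))

 row : ℕ -> List (ℕ × ℕ)
 row k = map (\j -> 0 , suc j) (upTo k)

 us : ℕ -> ℕ -> List ℕ
 us o zero = []
 us o (suc m) = o ∷ us (suc o) m

 upTo-us : ∀ m -> upTo m ≡ us 0 m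
 upTo-us m = k 0 m id (\_ -> refl)
  where
   k : ∀ o m (f : ℕ -> ℕ) -> (∀ j -> f j ≡ o N.+ j) -> List.applyUpTo f m ≡ us o m
   k o zero f h = refl
   k o (suc m) f h = cong2 _∷_ (h 0 & M.+-identityʳ o) (k (suc o) m (f ∘ suc) (\j -> h (suc j) & M.+-suc o j))

 mon-bump : ∀ {k} ys w zs (a : Vec ℤ k) -> NonNeg a -> length ys N.< k -> mon (ys ++ w ∷ zs) (bump (length ys) a) ≈ᵣ w *ᵣ mon (ys ++ w ∷ zs) a
 mon-bump [] w zs (z ∷ a) (p , _) _ = rt (*-cong (pw1 z p) rr) (*-assoc w _ _)
  where
   pw1 : ∀ z -> 0z ≤ z -> hz (w ∷ []) (z + 1z) ≈ᵣ w *ᵣ hz (w ∷ []) z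
   pw1 (+ d) _ = rt (r≡ (cong (h (w ∷ [])) (M.+-comm d 1))) (+-identityˡ _)
   pw1 -[1+ d ] ()
 mon-bump (y ∷ ys) w zs (z ∷ a) (_ , q) (s≤s lt) = rt (*-cong rr (mon-bump ys w zs a q lt)) (*-swap _ w _)

 -- (y0 - yⱼ) turns the functional of X into that of X without xⱼ, as yⱼ is evaluated at xⱼ
 peel : ∀ {k} x ys zs -> length (ys ++ zs) ≡ k -> ∀ z (a : Vec ℤ k) -> 0z ≤ z -> NonNeg a ->
  DL (map (\j -> 0 , suc j) (us (length ys) (length zs))) (ℓ (x ∷ zs) (length zs) ⊗ mon (ys ++ zs)) (z ∷ a) ≈ᵣ hz (x ∷ []) z *ᵣ mon (ys ++ zs) a
 peel x ys [] e z a p q = *-cong (r≡ (cong (hz (x ∷ [])) (+0 z))) rr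
 peel {k} x ys (w ∷ zs) e z a p q =
  rt (DL-↭ (Perm.↭-trans (PermP.∷↭∷ʳ _ _) (Perm.↭-reflexive (sym (L.map-++ _ (us (suc o) (length zs)) [ o ])))) _ (z ∷ a))
  (rt (r≡ (cong (\l -> DL l F (z ∷ a)) (L.map-++ (\j -> 0 , suc j) (us (suc o) (length zs)) [ o ])))
  (rt (DL-++ (map (\j -> 0 , suc j) (us (suc o) (length zs))) [ (0 , suc o) ] F (z ∷ a))
  (rt (DL-cong⁺ (map (\j -> 0 , suc j) (us (suc o) (length zs))) one (z ∷ a) (p , q))
  (subst2 (\l yz -> DL (map (\j -> 0 , suc j) (us l (length zs))) (ℓ (x ∷ zs) (length zs) ⊗ mon yz) (z ∷ a) ≈ᵣ hz (x ∷ []) z *ᵣ mon yz a) (L.length-++ ys & M.+-comm o 1) (L.++-assoc ys [ w ] zs)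
   (peel x (ys ++ [ w ]) zs (cong length (L.++-assoc ys [ w ] zs) & e) z a p q)))))
  where
   o = length ys
   F = ℓ (x ∷ w ∷ zs) (suc (length zs)) ⊗ mon {k} (ys ++ w ∷ zs)
   lt : o N.< k
   lt = subst (o N.<_) (sym (L.length-++ ys) & e) (M.m<m+n o (s≤s z≤n))
   one : ∀ a -> NonNeg a -> Dp (0 , suc o) F a ≈ᵣ (ℓ (x ∷ zs) (length zs) ⊗ mon (ys ++ w ∷ zs)) a
   one (z ∷ a) (p , q) = rt (+-cong (rt (*-cong (rt (r≡ (cong (hz (x ∷ w ∷ zs)) (lia 2 (\z c -> |- z :+ #1 :- (#1 :+ c) := z :- c) z (+ length zs)))) (hz-mid [ x ] w zs (z - + length zs))) rr) (distribʳ _ _ _))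
    (-‿cong (rt (*-cong (r≡ (cong (hz (x ∷ w ∷ zs)) (lia 2 (\z c -> |- z :- (#1 :+ c) := z :- c :- #1) z (+ length zs)))) (mon-bump ys w zs a q lt)) (rt (*-swap _ w _) (rs (*-assoc w _ _))))))
    (rt (+-assoc _ _ _) (rt (+-cong rr (-‿inverseʳ _)) (+-identityʳ _)))

 module _ (tf : ∀ x -> x +ᵣ x ≈ᵣ 0ᵣ -> x ≈ᵣ 0ᵣ) where

  -- an alternant with two equal neighbouring functionals vanishes
  alt-0 : ∀ {k} (S : SymFun k) i -> suc i N.< k -> ∀ f -> (∀ a -> f (swp i a) ≈ᵣ f a) -> Λ S (V⁺ k f) ≈ᵣ 0ᵣ
  alt-0 {k} S i h f e = tf x (rt (+-cong rr neg) (-‿inverseʳ x))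
   where
    x = Λ S (V⁺ k f)
    neg1 : ∀ y -> -ᵣ 1ᵣ *ᵣ y ≈ᵣ -ᵣ y
    neg1 y = rt (rs (-‿distribˡ-* 1ᵣ y)) (-‿cong (*-identityˡ y))
    neg : x ≈ᵣ -ᵣ x
    neg = rt (rs (Λ-swp S i h (V⁺ k f))) (rt (Λ-cong S (\a _ -> rt (V-anti i h f a) (rt (-‿cong (DL-cong (pairs k) e a)) (rs (neg1 _))))) (rt (Λ-* S (-ᵣ 1ᵣ) (V⁺ k f)) (neg1 x)))

  ∏-swp : ∀ {k} p (m : ℤ -> C) q (a : Vec ℤ k) -> ∏ (p ++ m ∷ m ∷ q) (swp (length p) a) ≈ᵣ ∏ (p ++ m ∷ m ∷ q) a
  ∏-swp p m q [] = rr
  ∏-swp [] m q (x ∷ []) = rr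
  ∏-swp [] m q (x ∷ y ∷ a) = *-swap _ _ _
  ∏-swp (l ∷ p) m q (x ∷ a) = *-cong rr (∏-swp p m q a)

  ∏-lin : ∀ {k} p (m m' m'' : ℤ -> C) r q -> (∀ z -> m z ≈ᵣ m' z +ᵣ r *ᵣ m'' z) -> ∀ (a : Vec ℤ k) -> length p N.< k -> ∏ (p ++ m ∷ q) a ≈ᵣ ∏ (p ++ m' ∷ q) a +ᵣ r *ᵣ ∏ (p ++ m'' ∷ q) a
  ∏-lin [] m m' m'' r q e (z ∷ a) _ = rt (*-cong (e z) rr) (rt (distribʳ _ _ _) (+-cong rr (*-assoc r _ _)))
  ∏-lin (l ∷ p) m m' m'' r q e (z ∷ a) (s≤s lt) = rt (*-cong rr (∏-lin p m m' m'' r q e a lt)) (rt (distribˡ _ _ _) (+-cong rr (*-swap _ r _)))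

  reduce : ∀ x X' {k} c p -> length p N.+ suc c ≡ k -> (S : SymFun k) -> Λ S (V⁺ k (∏ (p ++ ℓ (x ∷ X') c ∷ desc c (x ∷ X')))) ≈ᵣ Λ S (V⁺ k (∏ (p ++ ℓ (x ∷ X') c ∷ desc c X')))
  reduce x X' zero p e S = rr
  reduce x X' {k} (suc c) p e S = rt ih
   (rt (Λ-cong S (\a _ -> rt (DL-cong (pairs k) lin a) (DL-+ (pairs k) f1 (\b -> x *ᵣ f2 b) a)))
    (rt (Λ-+ S (V⁺ k f1) (V⁺ k (\b -> x *ᵣ f2 b))) (rt (+-cong rr (rt (Λ-cong S (\a _ -> DL-* (pairs k) x f2 a)) (rt (Λ-* S x (V⁺ k f2)) (rt (*-cong {x} rr (alt-0 S (length p) lt f2 (∏-swp p ℓ1 (desc c X')))) (zeroʳ x))))) (+-identityʳ _))))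
   where
    ℓ1 = ℓ (x ∷ X') (suc c)
    f1 f2 : Vf k
    f1 = ∏ (p ++ ℓ1 ∷ ℓ X' c ∷ desc c X')
    f2 = ∏ (p ++ ℓ1 ∷ ℓ1 ∷ desc c X')
    lt : suc (length p) N.< k
    lt = subst (suc (length p) N.<_) (sym (M.+-suc (length p) (suc c) & cong suc (M.+-suc (length p) c)) & e) (s≤s (s≤s (M.m≤m+n (length p) c)))
    len1 : length (p ++ [ ℓ1 ]) ≡ suc (length p)
    len1 = L.length-++ p & (M.+-comm _ 1)
    ih = subst2 (\u w -> Λ S (V⁺ k (∏ u)) ≈ᵣ Λ S (V⁺ k (∏ w))) (L.++-assoc p [ ℓ1 ] _) (L.++-assoc p [ ℓ1 ] _)
     (reduce x X' c (p ++ [ ℓ1 ]) (cong (N._+ suc c) len1 & sym (M.+-suc (length p) (suc c)) & e) S)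
    ez : ∀ z -> ℓ (x ∷ X') c z ≈ᵣ ℓ X' c z +ᵣ x *ᵣ ℓ1 z
    ez z = rt (hz-∷ x X' (z - + c)) (+-cong rr (*-cong {x} rr (r≡ (cong (hz (x ∷ X')) (lia 2 (\z c -> |- z :- c :- #1 := z :- (#1 :+ c)) z (+ c))))))
    lin : ∀ a -> ∏ (p ++ ℓ1 ∷ ℓ (x ∷ X') c ∷ desc c X') a ≈ᵣ f1 a +ᵣ x *ᵣ f2 a
    lin a = subst2 (\u w -> ∏ u a ≈ᵣ w) (L.++-assoc p [ ℓ1 ] _) (cong2 (\u w -> ∏ u a +ᵣ x *ᵣ ∏ w a) (L.++-assoc p [ ℓ1 ] _) (L.++-assoc p [ ℓ1 ] _))
     (∏-lin (p ++ [ ℓ1 ]) (ℓ (x ∷ X') c) (ℓ X' c) ℓ1 x (desc c X') ez a (subst (N._< k) (sym len1) lt))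

  -- Absorbs the first coordinate and its factors y_0 - y_j into the functional. Symmetry in the
  -- remaining coordinates survives because these factors are permuted among themselves.
  tailFun : ∀ {k} -> SymFun (suc k) -> (ℤ -> C) -> SymFun k
  tailFun {k} S m = record
   { Λ = \φ -> Λ S (DL (row k) (m ⊗ φ))
   ; Λ-cong = \e -> Λ-cong S (\a q -> DL-cong⁺ (row k) (\ { (z ∷ a) (_ , q) -> *-cong rr (e a q) }) a q)
   ; Λ-+ = \f g -> rt (Λ-cong S (\a _ -> rt (DL-cong (row k) (\ { (z ∷ a) -> distribˡ _ _ _ }) a) (DL-+ (row k) (m ⊗ f) (m ⊗ g) a))) (Λ-+ S _ _)
   ; Λ-* = \r f -> rt (Λ-cong S (\a _ -> rt (DL-cong (row k) (\ { (z ∷ a) -> *-swap _ r _ }) a) (DL-* (row k) r (m ⊗ f) a))) (Λ-* S r _)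
   ; Λ-swp = \i lt f -> rt (Λ-cong S (\a _ -> rt (DL-cong (row k) {m ⊗ (\b -> f (swp i b))} {\b -> (m ⊗ f) (swp (suc i) b)} (\ { (z ∷ a) -> rr }) a)
    (rt (DL-↭ (row↭ i lt) (\b -> (m ⊗ f) (swp (suc i) b)) a) (rs (DL-swp (suc i) (s≤s lt) (row k) (m ⊗ f) a))))) (Λ-swp S (suc i) (s≤s lt) (DL (row k) (m ⊗ f))) }
   where
    row↭ : ∀ i -> suc i N.< k -> row k ↭ map (π2 (suc i)) (row k)
    row↭ i lt = Perm.↭-trans (PermP.map⁺ (\j -> 0 , suc j) (Perm.↭-sym (up-π i k lt))) (Perm.↭-reflexive (sym (L.map-∘ (upTo k)) & L.map-∘ (upTo k)))

  -- A Cauchy identity: the left side expresses a symmetric series through products of complete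
  -- homogeneous polynomials, with the Vandermonde product acting. In the induction on variables
  -- `reduce` removes x from all entries but the first, `tailFun` hides the first coordinate, and
  -- `peel` evaluates it.
  straighten : ∀ {k} X -> length X ≡ k -> (S : SymFun k) -> Λ S (V⁺ k (∏ (desc k X))) ≈ᵣ Λ S (mon X)
  straighten [] refl S = Λ-cong S (\ { [] _ -> rr })
  straighten (x ∷ X) refl S = rt (reduce x X k [] refl S)
   (rt (Λ-cong S (\a _ -> rt (DL-cong (pairs (suc k)) {∏ (ℓ0 ∷ desc k X)} {ℓ0 ⊗ ∏ (desc k X)} (\ { (z ∷ a) -> rr }) a) (rt (DL-++ (row k) (map (\(i , j) -> suc i , suc j) (pairs k)) (ℓ0 ⊗ ∏ (desc k X)) a) (DL-cong (row k) {DL (map (\(i , j) -> suc i , suc j) (pairs k)) (ℓ0 ⊗ ∏ (desc k X))} {ℓ0 ⊗ V⁺ k (∏ (desc k X))} (\ { (z ∷ a) -> DL-tail (pairs k) ℓ0 (∏ (desc k X)) z a }) a))))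
   (rt (straighten X refl (tailFun S ℓ0))
    (Λ-cong S (\ { (z ∷ a) (p , q) -> rt (r≡ (cong (\l -> DL (map (\j -> 0 , suc j) l) (ℓ0 ⊗ mon X) (z ∷ a)) (upTo-us k))) (peel x [] X refl z a p q) }))))
   where
    k = length X
    ℓ0 = ℓ (x ∷ X) k

-- Vanishing of alternants

module ZA = Alternant Z.+-*-commutativeRing

AllV : ∀ {k} -> (ℤ -> Set) -> Vec ℤ k -> Set
AllV B [] = ⊤
AllV B (x ∷ a) = B x × AllV B a

AllV-map : ∀ {k} {B B' : ℤ -> Set} -> (∀ x -> B x -> B' x) -> (a : Vec ℤ k) -> AllV B a -> AllV B' a
AllV-map f [] _ = tt
AllV-map f (x ∷ a) (p , q) = f x p , AllV-map f a q

AllV-× : ∀ {k} {B B' : ℤ -> Set} (a : Vec ℤ k) -> AllV B a -> AllV B' a -> AllV (\x -> B x × B' x) a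
AllV-× [] _ _ = tt
AllV-× (x ∷ a) (p , q) (p' , q') = (p , p') , AllV-× a q q'

Sorted Strict : ∀ {k} -> Vec ℤ k -> Set
Sorted [] = ⊤
Sorted (x ∷ a) = AllV (x ≤_) a × Sorted a
Strict [] = ⊤
Strict (x ∷ a) = AllV (x <_) a × Strict a

Clo : ∀ k -> (Vec ℤ k -> Set) -> Set
Clo k Z = ∀ i a -> suc i N.< k -> Z (swp i a) -> Z a

insertV : ∀ {k} (Z : Vec ℤ (suc k) -> Set) -> Clo (suc k) Z -> (B : ℤ -> Set) -> (∀ b -> Sorted b -> AllV B b -> Z b) ->
 ∀ x b -> B x -> AllV B b -> Sorted b -> Z (x ∷ b)
insertV Z c B h x [] p q s = h (x ∷ []) (tt , tt) (p , tt)
insertV Z c B h x (y ∷ b) p (q , qs) (s , ss) = k (x ≤? y)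
 where
  k : Dec (x ≤ y) -> Z (x ∷ y ∷ b)
  k (yes l) = h (x ∷ y ∷ b) ((l , AllV-map (\z -> Z.≤-trans l) b s) , s , ss) (p , q , qs)
  k (no l) = c 0 (x ∷ y ∷ b) (s≤s (s≤s z≤n)) (insertV (\b -> Z (y ∷ b)) (\i a lt -> c (suc i) (y ∷ a) (s≤s lt)) (\z -> B z × y ≤ z)
   (\d sd ad -> h (y ∷ d) (AllV-map (\_ -> snd) d ad , sd) (q , AllV-map (\_ -> fst) d ad)) x b (p , Z.<⇒≤ (Z.≰⇒> l)) (AllV-× b qs s) ss)

-- Insertion sort as an induction principle: a property that passes through adjacent exchanges need
-- only be checked on sorted vectors.
sortV : ∀ {k} (Z : Vec ℤ k -> Set) -> Clo k Z -> (B : ℤ -> Set) -> (∀ b -> Sorted b -> AllV B b -> Z b) -> ∀ a -> AllV B a -> Z a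
sortV Z c B h [] q = h [] tt tt
sortV Z c B h (x ∷ a) (p , q) = sortV (\a -> Z (x ∷ a)) (\i a lt -> c (suc i) (x ∷ a) (s≤s lt)) B (\b s r -> insertV Z c B h x b p r s) a q

strict? : ∀ {k} (a : Vec ℤ k) -> Sorted a -> Strict a ⊎ (Σ ℕ \i -> suc i N.< k × swp i a ≡ a)
strict? [] s = inl tt
strict? (x ∷ []) s = inl (tt , tt)
strict? (x ∷ y ∷ a) ((l , s) , t) with strict? (y ∷ a) t | x ≟ y
... | _ | yes refl = inr (0 , s≤s (s≤s z≤n) , refl)
... | inr (i , lt , e) | no _ = inr (suc i , s≤s lt , cong (x ∷_) e)
... | inl (p , q) | no ne = inl ((lt , AllV-map (\z -> Z.<-trans lt) a p) , p , q)
 where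
  lt = Z.≤∧≢⇒< l ne

sumV : ∀ {k} -> Vec ℤ k -> ℤ
sumV [] = 0z
sumV (x ∷ a) = x + sumV a

sum-bump : ∀ {k} i (a : Vec ℤ k) -> i N.< k -> sumV (bump i a) ≡ sumV a + 1z
sum-bump zero (x ∷ a) _ = l x (sumV a)
 where
  l : ∀ x s -> x + 1z + s ≡ x + s + 1z
  l = ring
sum-bump (suc i) (x ∷ a) (s≤s h) = cong (_+_ x) (sum-bump i a h) & sym (Z.+-assoc x (sumV a) 1z)

pairs-< : ∀ k -> All (\(i , j) -> i N.< k × j N.< k) (pairs k)
pairs-< zero = []
pairs-< (suc k) = AllP.++⁺ (AllP.map⁺ (All.tabulate (\m -> s≤s z≤n , s≤s (∈-upTo⁻ m)))) (AllP.map⁺ (All.map (\(p , q) -> s≤s p , s≤s q) (pairs-< k)))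

DL-sum : ∀ {k} ps -> All (\(i , j) -> i N.< k × j N.< k) ps -> ∀ (f : ZA.Vf k) a -> (∀ b -> sumV b ≡ sumV a + + length ps -> f b ≡ 0z) -> ZA.DL ps f a ≡ 0z
DL-sum [] _ f a h = h a (sym (+0 _))
DL-sum ((i , j) ∷ ps) ((p , q) ∷ r) f a h = cong2 _-_ (DL-sum ps r f _ (\b e -> h b (k i p b e))) (DL-sum ps r f _ (\b e -> h b (k j q b e)))
 where
  k : ∀ i -> i N.< _ -> ∀ b -> sumV b ≡ sumV (bump i a) + + length ps -> sumV b ≡ sumV a + + suc (length ps)
  k i p b e = e & cong (_+ + length ps) (sum-bump i a p) & Z.+-assoc (sumV a) 1z (+ length ps)

-- The extreme case is -(k - 1), ..., -1, 0, whose sum is minus the number of pairs. After all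
-- Vandermonde factors the coordinate sum is therefore nonnegative.
strict-sum : ∀ {k} (a : Vec ℤ k) -> Strict a -> AllV (\x -> - + k < x) a -> - + length (pairs k) ≤ sumV a
strict-sum [] _ _ = Z.≤-refl
strict-sum {suc k} (x ∷ a) (s , t) (p , q) = lia 6 (\x y P k l K -> #0 :- K :< x => #0 :- P =< y => K := #1 :+ k => l := k :+ P => |- #0 :- l =< x :+ y) x (sumV a) (+ length (pairs k)) (+ k) (+ length (pairs (suc k))) (+ suc k)
 (subst (_< x) (sym (0+ (- + suc k))) p) (subst (_≤ sumV a) (sym (0+ (- + length (pairs k)))) ih) refl len |> subst (_≤ x + sumV a) (0+ _)
 where
  _|>_ : {A B : Set} -> A -> (A -> B) -> B
  x |> f = f x
  ih = strict-sum a t (AllV-map (\y xy -> lia 4 (\x y k K -> #0 :- K :< x => K := #1 :+ k => x :< y => |- #0 :- k :< y) x y (+ k) (+ suc k) (subst (_< x) (sym (0+ (- + suc k))) p) refl xy |> subst (_< y) (0+ _)) a s)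
  len : + length (pairs (suc k)) ≡ + k + + length (pairs k)
  len = cong +_ (L.length-++ (map (\j -> 0 , suc j) (upTo k)) & (cong2 N._+_ ((L.length-map _ (upTo k)) & L.length-upTo k) (L.length-map _ (pairs k))))

-- only the factors y0 - yⱼ move the first coordinate
DL-head : ∀ {k} (f g : ZA.Vf (suc k)) x -> (∀ z b -> x ≤ z -> z ≤ x + + k -> f (z ∷ b) ≡ g (z ∷ b)) -> ∀ a -> ZA.V⁺ (suc k) f (x ∷ a) ≡ ZA.V⁺ (suc k) g (x ∷ a)
DL-head {k} f g x h a = ZA.DL-++ (ZA.row k) tl f (x ∷ a) & rw (upTo k) x a (\z b p q -> tail (pairs k) z b (\b -> h z b p (Z.≤-trans q (Z.≤-reflexive (cong (\m -> x + + m) (L.length-upTo k)))))) & sym (ZA.DL-++ (ZA.row k) tl g (x ∷ a))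
 where
  tl = map (\(i , j) -> suc i , suc j) (pairs k)
  tail : ∀ ps z b -> (∀ b -> f (z ∷ b) ≡ g (z ∷ b)) -> ZA.DL (map (\(i , j) -> suc i , suc j) ps) f (z ∷ b) ≡ ZA.DL (map (\(i , j) -> suc i , suc j) ps) g (z ∷ b)
  tail [] z b e = e b
  tail ((i , j) ∷ ps) z b e = cong2 _-_ (tail ps z _ e) (tail ps z _ e)
  rw : ∀ js x a {f g : ZA.Vf (suc k)} -> (∀ z b -> x ≤ z -> z ≤ x + + length js -> f (z ∷ b) ≡ g (z ∷ b)) -> ZA.DL (map (\j -> 0 , suc j) js) f (x ∷ a) ≡ ZA.DL (map (\j -> 0 , suc j) js) g (x ∷ a)
  rw [] x a e = e x a Z.≤-refl (Z.≤-reflexive (sym (+0 x)))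
  rw (j ∷ js) x a e = cong2 _-_
   (rw js (x + 1z) a (\z b p q -> e z b (lia 2 (\x z -> x :+ #1 =< z => |- x =< z) x z p) (lia 3 (\x z l -> z =< x :+ #1 :+ l => |- z =< x :+ (#1 :+ l)) x z (+ length js) q)))
   (rw js x _ (\z b p q -> e z b p (lia 3 (\x z l -> z =< x :+ l => |- z =< x :+ (#1 :+ l)) x z (+ length js) q)))

sh0 : ∀ {k} -> ℤ -> Vec ℤ (suc k) -> Vec ℤ (suc k)
sh0 c (z ∷ a) = z + c ∷ a

DL-sh0 : ∀ {k} ps c (f : ZA.Vf (suc k)) a -> ZA.DL ps (\b -> f (sh0 c b)) a ≡ ZA.DL ps f (sh0 c a)
DL-sh0 [] c f a = refl
DL-sh0 ((i , j) ∷ ps) c f a = cong2 _-_ (e i) (e j)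
 where
  sb : ∀ i a -> sh0 c (bump i a) ≡ bump i (sh0 c a)
  sb zero (z ∷ a) = cong (_∷ a) (lia 2 (\z c -> |- z :+ #1 :+ c := z :+ c :+ #1) z c)
  sb (suc i) (z ∷ a) = refl
  e : ∀ i -> ZA.DL ps (\b -> f (sh0 c b)) (bump i a) ≡ ZA.DL ps f (bump i (sh0 c a))
  e i = DL-sh0 ps c f (bump i a) & cong (ZA.DL ps f) (sb i a)

DL-Σ : ∀ {k} {A : Set} ps (xs : List A) (c : A -> ℤ) (f : A -> ZA.Vf k) a -> ZA.DL ps (\b -> ΣL xs (\x -> c x * f x b)) a ≡ ΣL xs (\x -> c x * ZA.DL ps (f x) a)
DL-Σ ps [] c f a = ZA.DL-cong ps {\_ -> 0z} {\_ -> 0z * 0z} (\_ -> refl) a & ZA.DL-* ps 0z (\_ -> 0z) a & Z.*-zeroˡ (ZA.DL ps (\_ -> 0z) a)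
DL-Σ ps (x ∷ xs) c f a = ZA.DL-+ ps (\b -> c x * f x b) (\b -> ΣL xs (\y -> c y * f y b)) a & (cong2 _+_ (ZA.DL-* ps (c x) (f x) a) (DL-Σ ps xs c f a))

dbl0 : ∀ x -> x ≡ - x -> x ≡ 0z
dbl0 (+ zero) e = refl
dbl0 (+ suc x) ()
dbl0 -[1+ x ] ()

-- Alternants of the operators `H` that vanish at a permutation with a large excess.

module Vanish (n : ℕ) {{nz : NonZero n}} (1<n : 1z < + n) where
 open Total n 1<n public

 Hz : ℤ -> Fn -> Fn
 Hz (+ a) φ = H a φ
 Hz -[1+ _ ] φ = O

 Hz-lin : ∀ z -> Lin (Hz z)
 Hz-lin (+ a) = H-lin a
 Hz-lin -[1+ _ ] = record { lcong = \_ -> ≈r ; ladd = \_ _ -> ≈r ; lscl = \c _ _ _ -> sym (Z.*-zeroʳ c) }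

 Hz-comm : ∀ y z φ -> Hz y (Hz z φ) ≈ Hz z (Hz y φ)
 Hz-comm (+ a) (+ b) φ = HH-comm a b φ
 Hz-comm (+ a) -[1+ _ ] φ = lzero (H-lin a)
 Hz-comm -[1+ _ ] (+ b) φ = ≈s (lzero (H-lin b))
 Hz-comm -[1+ _ ] -[1+ _ ] φ = ≈r

 HzE-comm : ∀ z b φ -> E b (Hz z φ) ≈ Hz z (E b φ)
 HzE-comm (+ a) b φ = ≈s (HE-comm a b φ)
 HzE-comm -[1+ _ ] b φ = lzero (E-lin b)

 -- exponents are negated, so that lowering an exponent is a bump
 Gt : ∀ {k} -> Fn -> Vec ℤ k -> Fn
 Gt φ [] = φ
 Gt φ (z ∷ a) = Hz (- z) (Gt φ a)

 Gt-lin : ∀ {k} (a : Vec ℤ k) -> Lin (\φ -> Gt φ a)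
 Gt-lin [] = Lin-id
 Gt-lin (z ∷ a) = Lin-∘ (Hz-lin (- z)) (Gt-lin a)

 Gt-swp : ∀ {k} i (a : Vec ℤ k) φ -> Gt φ (swp i a) ≈ Gt φ a
 Gt-swp i [] φ = ≈r
 Gt-swp zero (x ∷ []) φ = ≈r
 Gt-swp zero (x ∷ y ∷ a) φ = Hz-comm (- y) (- x) _
 Gt-swp (suc i) (x ∷ a) φ = lcong (Hz-lin (- x)) (Gt-swp i a φ)

 Gt-E : ∀ {k} (a : Vec ℤ k) b φ -> E b (Gt φ a) ≈ Gt (E b φ) a
 Gt-E [] b φ = ≈r
 Gt-E (z ∷ a) b φ = HzE-comm (- z) b _ ⟫ lcong (Hz-lin (- z)) (Gt-E a b φ)

 -- With a nonnegative sum of negated exponents, either some exponent is negative and its operator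
 -- is zero, or all are zero and nothing acts.
 Gt-0 : ∀ {k} (a : Vec ℤ k) φ {v} -> IsAff v -> 0z ≤ sumV a -> φ v ≡ 0z -> Gt φ a v ≡ 0z
 Gt-0 a φ {v} A h e with signs a
  where
   signs : ∀ {k} (a : Vec ℤ k) -> (∀ φ -> Gt φ a ≈ O) ⊎ AllV (_≤ 0z) a
   signs [] = inr tt
   signs (+ suc z ∷ a) = inl (\φ -> ≈r)
   signs (+ zero ∷ a) with signs a
   ... | inl p = inl (\φ -> lO (Hz-lin 0z) (p φ))
   ... | inr p = inr (Z.≤-refl , p)
   signs (-[1+ z ] ∷ a) with signs a
   ... | inl p = inl (\φ -> lO (Hz-lin (+ suc z)) (p φ))
   ... | inr p = inr (ℤ.-≤+ , p)
 ... | inl p = p φ v A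
 ... | inr p = zero' a p h φ v A & e
  where
   sum≤ : ∀ {k} (a : Vec ℤ k) -> AllV (_≤ 0z) a -> sumV a ≤ 0z
   sum≤ [] _ = Z.≤-refl
   sum≤ (z ∷ a) (p , q) = Z.+-mono-≤ p (sum≤ a q)
   zero' : ∀ {k} (a : Vec ℤ k) -> AllV (_≤ 0z) a -> 0z ≤ sumV a -> ∀ φ -> Gt φ a ≈ φ
   zero' [] _ _ φ = ≈r
   zero' (z ∷ a) (p , q) h φ = z0 (lia 2 (\z s -> z =< #0 => s =< #0 => #0 =< z :+ s => |- z := #0) z (sumV a) p (sum≤ a q) h) h
    where
     z0 : ∀ {z} -> z ≡ 0z -> 0z ≤ z + sumV a -> Gt φ (z ∷ a) ≈ φ
     z0 refl h = H0 _ ⟫ zero' a q (subst (0z ≤_) (0+ (sumV a)) h) φ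

 -- The number of terms J is independent of z: terms beyond the true range carry an `H` of negative
 -- index and vanish. This uniformity matters because the Vandermonde factors move the first
 -- coordinate while the expansion is applied.
 Gt-expand : ∀ {k} J -> J N.< n -> ∀ z (a : Vec ℤ k) φ -> - + J ≤ z -> z < 0z -> Gt φ (z ∷ a) ≈ ΣF (upTo J) (\j -> sg j ⋆ Gt (E (suc j) φ) (z + + suc j ∷ a))
 Gt-expand J lt (+ _) a φ _ (ℤ.+<+ ())
 Gt-expand J lt -[1+ m ] a φ h _ = H-expand m (M.≤-<-trans m<J lt) (Gt φ a)
  ⟫ (\v o -> Σ-cong∈ (upTo (suc m)) (\j j∈ -> cong (sg j *_) (lcong (H-lin (m N.∸ j)) (Gt-E a (suc j) φ) v o & cong (\z -> Hz z (Gt (E (suc j) φ) a) v) (sym (ez j (M.≤-pred (∈-upTo⁻ j∈)))))) &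
   ext-sum J m<J (\j -> sg j * Gt (E (suc j) φ) (-[1+ m ] + + suc j ∷ a) v) (\j m<j -> cong (\z -> sg j * Hz z (Gt (E (suc j) φ) a) v) (snd (ez' j m<j)) & Z.*-zeroʳ (sg j)))
  where
   m<J : suc m N.≤ J
   m<J = Z.drop‿+≤+ (Z.neg-cancel-≤ {+ J} {+ suc m} h)
   ez : ∀ j -> j N.≤ m -> - (-[1+ m ] + + suc j) ≡ + (m N.∸ j)
   ez j h = (lia 2 (\m j -> |- #0 :- (#0 :- (#1 :+ m) :+ (#1 :+ j)) := m :- j) (+ m) (+ j) ∣> \e -> sym (0+ _) & e) & Z.m-n≡m⊖n m j & Z.⊖-≥ h
    where
     _∣>_ : {A B : Set} -> A -> (A -> B) -> B
     x ∣> f = f x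
   ez' : ∀ j -> suc m N.≤ j -> Σ ℕ \q -> - (-[1+ m ] + + suc j) ≡ -[1+ q ]
   ez' j h = k (-[1+ m ] + + suc j) (lia 2 (\m j -> #1 :+ m =< j => |- #0 :< #0 :- (#1 :+ m) :+ (#1 :+ j)) (+ m) (+ j) (ℤ.+≤+ h))
    where
     k : ∀ z -> 0z < z -> Σ ℕ \q -> - z ≡ -[1+ q ]
     k (+ suc q) _ = q , refl
     k (+ zero) (ℤ.+<+ ())
   ext-sum : ∀ J -> suc m N.≤ J -> ∀ f -> (∀ j -> suc m N.≤ j -> f j ≡ 0z) -> ΣL (upTo (suc m)) f ≡ ΣL (upTo J) f
   ext-sum J h f z with M.m≤n⇒∃[o]m+o≡n h
   ... | o , refl = sym (+0 _) & cong (_+_ (ΣL (upTo (suc m)) f)) (sym (Σ-0 (List.applyUpTo (suc m N.+_) o) (\j j∈ -> let (i , _ , e) = ∈-applyUpTo⁻ (suc m N.+_) j∈ in z j (subst (suc m N.≤_) (sym e) (M.m≤m+n (suc m) i))))) & sym (Σ-++ (upTo (suc m)) (List.applyUpTo (suc m N.+_) o) f) & cong (\l -> ΣL l f) (sp (suc m) o id)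
    where
     sp : ∀ m o (f : ℕ -> ℕ) -> List.applyUpTo f m ++ List.applyUpTo (\j -> f (m N.+ j)) o ≡ List.applyUpTo f (m N.+ o)
     sp zero o f = refl
     sp (suc m) o f = cong (f 0 ∷_) (sp m o (f ∘ suc))

 module _ {v} (A : IsAff v) {k N' : ℕ} (kN : N' N.+ k ≡ n) (x0 : ℤ) (big : x0 + + N' < ev v x0) where

  Gv : List ℕ -> ZA.Vf k
  Gv bs a = Gt (Er bs) a v

  dup-0 : ∀ bs i a -> suc i N.< k -> swp i a ≡ a -> ZA.V⁺ k (Gv bs) a ≡ 0z
  dup-0 bs i a lt e = dbl0 _ (cong (ZA.V⁺ k (Gv bs)) (sym e) & ZA.V-anti i lt (Gv bs) a & (cong -_ (ZA.DL-cong (pairs k) (\b -> Gt-swp i b (Er bs) v A) a)))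

  clo : ∀ bs -> Clo k (\a -> ZA.V⁺ k (Gv bs) a ≡ 0z)
  clo bs i a lt h = cong (ZA.V⁺ k (Gv bs)) (sym (swp-inv i a)) & ZA.V-anti i lt (Gv bs) (swp i a) & (cong -_ (ZA.DL-cong (pairs k) (\b -> Gt-swp i b (Er bs) v A) (swp i a) & h))

  -- Induction on the number L of operators `E` that may still be spent. Sorting puts the smallest
  -- negated exponent first. If it exceeds -(L - 1 + k), `E 0` is inserted; if it equals that bound,
  -- `Gt-expand` trades it for operators `E` and raises it. At L = 0 `strict-sum` reduces everything
  -- to `Gt-0`, and the N' operators `E` vanish at v by `Er-0`.
  vanish : ∀ L bs -> length bs N.+ L ≡ N' -> ∀ a -> AllV (\x -> - + (L N.+ k) < x) a -> ZA.V⁺ k (Gv bs) a ≡ 0z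
  vanish L bs eL = sortV _ (clo bs) _ (\a s q -> st'' a s q (strict? a s))
   where
    st'' : ∀ a -> Sorted a -> AllV (\x -> - + (L N.+ k) < x) a -> _ -> ZA.V⁺ k (Gv bs) a ≡ 0z
    st'' a s q (inr (i , lt , e)) = dup-0 bs i a lt e
    st'' a s q (inl st1) = lev L eL q
     where
      lev : ∀ L -> length bs N.+ L ≡ N' -> AllV (\x -> - + (L N.+ k) < x) a -> ZA.V⁺ k (Gv bs) a ≡ 0z
      lev zero eL q = DL-sum (pairs k) (pairs-< k) (Gv bs) a (\b e -> Gt-0 b (Er bs) A
       (lia 3 (\s t l -> #0 :- l =< s => t := s :+ l => |- #0 =< t) (sumV a) (sumV b) (+ length (pairs k)) (subst (_≤ sumV a) (sym (0+ _)) (strict-sum a st1 q)) e)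
       (Er-0 bs A x0 (subst (\m -> x0 + + m < ev v x0) (sym (sym (M.+-identityʳ _) & eL)) big)))
      lev (suc L) eL q = hd a st1 q
       where
        eL' : ∀ j -> length (j ∷ bs) N.+ L ≡ N'
        eL' j = sym (M.+-suc (length bs) L) & eL
        J = L N.+ k
        J<n : J N.< n
        J<n = subst (J N.<_) kN (M.+-monoˡ-< k (subst (L N.<_) eL (M.m≤n+m (suc L) (length bs))))
        hd : ∀ a -> Strict a -> AllV (\x -> - + (suc L N.+ k) < x) a -> ZA.V⁺ k (Gv bs) a ≡ 0z
        hd a st1 q = f (all? a)
         where
          all? : ∀ {k} (a : Vec ℤ k) -> Dec (AllV (\x -> - + J < x) a)
          all? [] = yes tt
          all? (x ∷ a) = (- + J <? x) ×-dec all? a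
          f : _ -> ZA.V⁺ k (Gv bs) a ≡ 0z
          f (yes p) = ZA.DL-cong (pairs k) (\b -> sym (lcong (Gt-lin b) (E0 (Er bs)) v A)) a & vanish L (0 ∷ bs) (eL' 0) a p
          f (no np) = g k refl a st1 q np
           where
            g : ∀ k' -> k' ≡ k -> (a : Vec ℤ k') -> Strict a -> AllV (\x -> - + (suc L N.+ k) < x) a -> ¬ AllV (\x -> - + J < x) a -> ZA.V⁺ k' (\b -> Gt (Er bs) b v) a ≡ 0z
            g zero e [] s q np = absurd (np tt)
            -- Here x = -J. The k' factors that involve the first coordinate keep it between -J and
            -- -J + k', which is negative since J ≥ k' + 1; on this range `Gt-expand` is valid.
            g (suc k') refl (x ∷ a) (s , ss) (q , qs) np = (DL-head _ (\b -> ΣL (upTo J) (\j -> sg j * Gt (E (suc j) (Er bs)) (sh0 (+ suc j) b) v)) x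
             (\z b p p' -> Gt-expand J J<n z b (Er bs) (subst (_≤ z) x≡ p) (lia 5 (\x z k J L -> x := #0 :- J => J := L :+ (#1 :+ k) => z =< x :+ k => #0 =< L => |- z :< #0) x z (+ k') (+ J) (+ L) (x≡ & sym (0+ _)) refl p' (ℤ.+≤+ z≤n)) v A) a) &
             DL-Σ (pairs (suc k')) (upTo J) sg (\j b -> Gt (E (suc j) (Er bs)) (sh0 (+ suc j) b) v) (x ∷ a) &
              Σ-0 (upTo J) (\j _ -> cong (sg j *_) (DL-sh0 (pairs (suc k')) (+ suc j) (\b -> Gt (E (suc j) (Er bs)) b v) (x ∷ a) &
               vanish L (suc j ∷ bs) (eL' (suc j)) (x + + suc j ∷ a) (lia 3 (\x J j -> x := #0 :- J => #0 =< j => |- #0 :- J :< x :+ (#1 :+ j)) x (+ J) (+ j) (x≡ & sym (0+ _)) (ℤ.+≤+ z≤n) ∣> subst (_< x + + suc j) (0+ _) , AllV-map (\y xy -> subst (_< y) x≡ xy) a s)) & Z.*-zeroʳ (sg j))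
             where
              _∣>_ : {A B : Set} -> A -> (A -> B) -> B
              x ∣> f = f x
              x≡ : x ≡ - + J
              x≡ = k2 (- + J <? x)
               where
                k2 : Dec (- + J < x) -> x ≡ - + J
                k2 (yes p) = absurd (np (p , AllV-map (\y xy -> Z.<-trans p xy) a s))
                k2 (no p) = lia 4 (\x J I m -> #0 :- I :< x => I := #1 :+ J => x =< m => m := #0 :- J => |- x := m) x (+ J) (+ suc J) (- + J) (subst (_< x) (sym (0+ _)) q) refl (Z.≮⇒≥ p) (sym (0+ _))

-- Polynomials and the ideal

module _ {k : ℕ} where

 Ex' : Set
 Ex' = Vec ℕ k

 infixl 6 _⊞_
 _⊞_ : Ex' -> Ex' -> Ex'
 _⊞_ = Vec.zipWith N._+_

 𝟎 : Ex'
 𝟎 = Vec.replicate k 0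

 -- Polynomials are unsorted lists of terms. Comparing them through their pairings with all
 -- functions of the exponent, as `_≃_` does, makes the ring laws statements about finite sums.
 pr : Poly k -> (Ex' -> ℤ) -> ℤ
 pr P χ = ΣL P (\t -> fst t * χ (snd t))

 pr-cong : ∀ P {χ χ'} -> (∀ e -> χ e ≡ χ' e) -> pr P χ ≡ pr P χ'
 pr-cong P h = Σ-cong P (\t -> cong (fst t *_) (h (snd t)))

 pr-mul : ∀ P Q χ -> pr (mulPoly P Q) χ ≡ pr P (\e -> pr Q (\f -> χ (e ⊞ f)))
 pr-mul P Q χ = (Σ-concatMap _ P _) & Σ-cong P (\t -> (Σ-map _ Q _) & Σ-cong Q (\u' -> Z.*-assoc (fst t) (fst u') _) & (Σ-* (fst t) Q _))

 pr-swap : ∀ P Q (χ : Ex' -> Ex' -> ℤ) -> pr P (\e -> pr Q (χ e)) ≡ pr Q (\f -> pr P (\e -> χ e f))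
 pr-swap P Q χ = Σ-cong P (\t -> sym (Σ-* (fst t) Q _)) & (Σ-swap P Q _) & Σ-cong Q (\u' -> Σ-cong P (\t -> l (fst t) (fst u') (χ (snd t) (snd u'))) & (Σ-* (fst u') P _))
  where
   l : ∀ a b c -> a * (b * c) ≡ b * (a * c)
   l = ring

 infix 4 _≃_
 record _≃_ (P Q : Poly k) : Set where
  constructor mk
  field un : ∀ χ -> pr P χ ≡ pr Q χ
 open _≃_ public

 scl : ℤ -> Poly k -> Poly k
 scl c = map (\t -> c * fst t , snd t)

 pr-scl : ∀ c P χ -> pr (scl c P) χ ≡ c * pr P χ
 pr-scl c P χ = (Σ-map _ P _) & Σ-cong P (\t -> Z.*-assoc c (fst t) _) & (Σ-* c P _)

 mo : Ex' -> Poly k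
 mo e = [ (1z , e) ]

 pr-mo : ∀ e χ -> pr (mo e) χ ≡ χ e
 pr-mo e χ = +0 (1z * χ e) & Z.*-identityˡ (χ e)

 ⊞-comm : ∀ e f -> e ⊞ f ≡ f ⊞ e
 ⊞-comm = VecP.zipWith-comm M.+-comm

 ⊞-assoc : ∀ e f g -> (e ⊞ f) ⊞ g ≡ e ⊞ (f ⊞ g)
 ⊞-assoc = VecP.zipWith-assoc M.+-assoc

 𝟎⊞ : ∀ e -> 𝟎 ⊞ e ≡ e
 𝟎⊞ = VecP.zipWith-identityˡ (\_ -> refl)

 mul-comm : ∀ P Q -> mulPoly P Q ≃ mulPoly Q P
 mul-comm P Q = mk \χ -> pr-mul P Q χ & pr-swap P Q (\e f -> χ (e ⊞ f)) & pr-cong Q (\f -> pr-cong P (\e -> cong χ (⊞-comm e f))) & sym (pr-mul Q P χ)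

 mul-cong : ∀ {P P' Q Q'} -> P ≃ P' -> Q ≃ Q' -> mulPoly P Q ≃ mulPoly P' Q'
 mul-cong {P} {P'} {Q} {Q'} p q = mk \χ -> pr-mul P Q χ & (un p _) & pr-cong P' (\e -> un q _) & sym (pr-mul P' Q' χ)

 PolyRing : CommutativeRing 0ℓ 0ℓ
 PolyRing = record
  { Carrier = Poly k ; _≈_ = _≃_ ; _+_ = _++_ ; _*_ = mulPoly ; -_ = scl -[1+ 0 ] ; 0# = [] ; 1# = mo 𝟎
  ; isCommutativeRing = record
   { isRing = record
    { +-isAbelianGroup = record
     { isGroup = record
      { isMonoid = record
       { isSemigroup = record
        { isMagma = record
         { isEquivalence = record { refl = mk \_ -> refl ; sym = \p -> mk \χ -> sym (un p χ) ; trans = \p q -> mk \χ -> trans (un p χ) (un q χ) }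
         ; ∙-cong = \ {P} {P'} {Q} {Q'} p q -> mk \χ -> trans (Σ-++ P Q _) ((cong2 _+_ (un p χ) (un q χ)) & sym (Σ-++ P' Q' _)) }
        ; assoc = \P Q S -> mk \χ -> cong (\z -> pr z χ) (L.++-assoc P Q S) }
       ; identity = (\_ -> mk \_ -> refl) , (\P -> mk \χ -> cong (\z -> pr z χ) (L.++-identityʳ P)) }
      ; inverse = (\P -> mk \χ -> (Σ-++ (scl -[1+ 0 ] P) P _) & cong (_+ pr P χ) (neg P χ) & Z.+-inverseˡ (pr P χ))
       , (\P -> mk \χ -> (Σ-++ P (scl -[1+ 0 ] P) _) & cong (_+_ (pr P χ)) (neg P χ) & Z.+-inverseʳ (pr P χ))
      ; ⁻¹-cong = \ {P} {Q} p -> mk \χ -> trans (pr-scl -[1+ 0 ] P χ) (cong (-[1+ 0 ] *_) (un p χ) & sym (pr-scl -[1+ 0 ] Q χ)) }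
     ; comm = \P Q -> mk \χ -> trans (Σ-++ P Q _) (Z.+-comm (pr P χ) (pr Q χ) & sym (Σ-++ Q P _)) }
    ; *-cong = mul-cong
    ; *-assoc = \P Q S -> mk \χ -> pr-mul (mulPoly P Q) S χ & (pr-mul P Q _) & pr-cong P (\e -> pr-cong Q (\f -> pr-cong S (\g -> cong χ (⊞-assoc e f g))) & sym (pr-mul Q S (\g -> χ (e ⊞ g)))) & sym (pr-mul P (mulPoly Q S) χ)
    ; *-identity = idˡ , (\P -> mk \χ -> un (mul-comm P (mo 𝟎)) χ & un (idˡ P) χ)
    ; distrib = distˡ , (\P Q S -> mk \χ -> un (mul-comm (Q ++ S) P) χ & un (distˡ P Q S) χ & (Σ-++ (mulPoly P Q) (mulPoly P S) _) & (cong2 _+_ (un (mul-comm P Q) χ) (un (mul-comm P S) χ)) & sym (Σ-++ (mulPoly Q P) (mulPoly S P) _)) }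
   ; *-comm = mul-comm } }
  where
   neg : ∀ P χ -> pr (scl -[1+ 0 ] P) χ ≡ - pr P χ
   neg P χ = (pr-scl -[1+ 0 ] P χ) & Z.-1*i≡-i (pr P χ)
   idˡ : ∀ P -> mulPoly (mo 𝟎) P ≃ P
   idˡ P = mk \χ -> pr-mul (mo 𝟎) P χ & (pr-mo 𝟎 (\e -> pr P (\f -> χ (e ⊞ f)))) & pr-cong P (\f -> cong χ (𝟎⊞ f))
   distˡ : ∀ P Q S -> mulPoly P (Q ++ S) ≃ mulPoly P Q ++ mulPoly P S
   distˡ P Q S = mk \χ -> pr-mul P (Q ++ S) χ & Σ-cong P (\t -> cong (fst t *_) (Σ-++ Q S _) & (Z.*-distribˡ-+ (fst t) _ _)) & (Σ-+ P _ _) & (cong2 _+_ (sym (pr-mul P Q χ)) (sym (pr-mul P S χ))) & sym (Σ-++ (mulPoly P Q) (mulPoly P S) _)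

 _≟E_ : (e f : Ex') -> Dec (e ≡ f)
 _≟E_ = VecP.≡-dec N._≟_

 coeff-pr : ∀ P a -> coeff P a ≡ pr P (\e -> on (e ≟E a) 1z)
 coeff-pr [] a = refl
 coeff-pr ((c , e) ∷ P) a with e ≟E a
 ... | yes _ = cong2 _+_ (sym (Z.*-identityʳ c)) (coeff-pr P a)
 ... | no _ = coeff-pr P a & sym (0+ _) & cong (_+ pr P (\e -> on (e ≟E a) 1z)) (sym (Z.*-zeroʳ c))

 perm : Permutation′ k -> Ex' -> Ex'
 perm σ e = tabulate (\i -> lookup e (σ ⟨$⟩ʳ i))

 -- Symmetry tested against all functions of the exponent, a form that passes easily to products;
 -- indicator functions give back `Symmetric`.
 SymM : Poly k -> Set
 SymM P = ∀ σ χ -> pr P (\e -> χ (perm σ e)) ≡ pr P χ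

 perm-inj : ∀ σ e f -> perm σ e ≡ perm σ f -> e ≡ f
 perm-inj σ e f h = sym (VecP.tabulate∘lookup e) & VecP.tabulate-cong (\i -> cong (lookup e) (sym (inverseʳ σ)) & (sym (VecP.lookup∘tabulate _ (σ ⟨$⟩ˡ i)) & cong (\w -> lookup w (σ ⟨$⟩ˡ i)) h & (VecP.lookup∘tabulate _ (σ ⟨$⟩ˡ i))) & cong (lookup f) (inverseʳ σ)) & VecP.tabulate∘lookup f

 SymM→Symmetric : ∀ {P} -> SymM P -> Symmetric P
 SymM→Symmetric {P} h σ a = coeff-pr P (perm σ a) & sym (h σ (\e -> on (e ≟E perm σ a) 1z)) & pr-cong P (\e -> on-cong (perm σ e ≟E perm σ a) (e ≟E a) (perm-inj σ e a) (cong (perm σ)) (\_ -> refl)) & sym (coeff-pr P a)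

 SymM-≃ : ∀ {P Q} -> P ≃ Q -> SymM P -> SymM Q
 SymM-≃ p h σ χ = sym (un p _) & h σ χ & un p χ

 perm-⊞ : ∀ σ e f -> perm σ (e ⊞ f) ≡ perm σ e ⊞ perm σ f
 perm-⊞ σ e f = VecP.tabulate-cong (\i -> VecP.lookup-zipWith N._+_ (σ ⟨$⟩ʳ i) e f) & sym (VecP.tabulate∘lookup _) & VecP.tabulate-cong (\i -> (VecP.lookup∘tabulate _ i) & sym ((VecP.lookup-zipWith N._+_ i (perm σ e) (perm σ f)) & (cong2 N._+_ (VecP.lookup∘tabulate _ i) (VecP.lookup∘tabulate _ i)))) & (VecP.tabulate∘lookup _)

 SymM-mul : ∀ {P Q} -> SymM P -> SymM Q -> SymM (mulPoly P Q)
 SymM-mul {P} {Q} p q σ χ = (pr-mul P Q _) & pr-cong P (\e -> pr-cong Q (\f -> cong χ (perm-⊞ σ e f)) & q σ (\f -> χ (perm σ e ⊞ f))) & p σ (\e -> pr Q (\f -> χ (e ⊞ f))) & sym (pr-mul P Q χ)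

 SymM-scl : ∀ c {P} -> SymM P -> SymM (scl c P)
 SymM-scl c {P} p σ χ = (pr-scl c P _) & cong (c *_) (p σ χ) & sym (pr-scl c P χ)

 sum-perm : ∀ σ (e : Ex') -> Vec.sum (perm σ e) ≡ Vec.sum e
 sum-perm σ e = Z.+-injective (sm (perm σ e) & (Σ-bij (UP.allFin⁺ k) (UP.allFin⁺ k) (σ ⟨$⟩ʳ_) (σ ⟨$⟩ˡ_) (\i _ -> ∈-allFin _ , inverseˡ σ) (\i _ -> ∈-allFin _ , inverseʳ σ) _ (\i -> + lookup e i) (\i _ -> cong +_ (VecP.lookup∘tabulate _ i))) & sym (sm e))
  where
   sm : ∀ {k} (e : Vec ℕ k) -> + Vec.sum e ≡ ΣL (allFin k) (\i -> + lookup e i)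
   sm [] = refl
   sm {suc k} (x ∷ e) = cong (_+_ (+ x)) (sm e & sym (Σ-map Fin.suc (allFin k) (\i -> + lookup (x ∷ e) i)) & cong (\z -> ΣL z (\i -> + lookup (x ∷ e) i)) (L.map-tabulate id Fin.suc))

comps⁻ : ∀ k d e -> e ∈ comps k d -> Vec.sum e ≡ d
comps⁻ zero zero [] _ = refl
comps⁻ (suc k) d e m with ∈-concat⁻′ (map (\i -> map (i ∷_) (comps k (d N.∸ i))) (upTo (suc d))) m
... | l , e∈ , l∈ with ∈-map⁻ _ l∈
...   | i , i∈ , refl with ∈-map⁻ _ e∈
...     | f , f∈ , refl = cong (i N.+_) (comps⁻ k (d N.∸ i) f f∈) & M.m+[n∸m]≡n (M.≤-pred (∈-upTo⁻ i∈))

comps⁺ : ∀ {k} (e : Vec ℕ k) -> e ∈ comps k (Vec.sum e)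
comps⁺ [] = here refl
comps⁺ {suc k} (x ∷ e) = ∈-concat⁺′ (∈-map⁺ (x ∷_) (subst (\d -> e ∈ comps k d) (sym (M.m+n∸m≡n x (Vec.sum e))) (comps⁺ e))) (∈-map⁺ (\i -> map (i ∷_) (comps k (x N.+ Vec.sum e N.∸ i))) (∈-upTo⁺ (s≤s (M.m≤m+n x (Vec.sum e)))))

comps-unique : ∀ k d -> Unique (comps k d)
comps-unique zero zero = [] ∷ []
comps-unique zero (suc d) = []
comps-unique (suc k) d = cc (upTo (suc d)) (UP.upTo⁺ (suc d))
 where
  cc : ∀ is -> Unique is -> Unique (concatMap (\i -> map (i ∷_) (comps k (d N.∸ i))) is)
  cc [] [] = []
  cc (i ∷ is) (a ∷ u') = UP.++⁺ (UP.map⁺ VecP.∷-injectiveʳ (comps-unique k (d N.∸ i))) (cc is u') dj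
   where
    dj : ∀ {e} -> ¬ (e ∈ map (i ∷_) (comps k (d N.∸ i)) × e ∈ concatMap (\i -> map (i ∷_) (comps k (d N.∸ i))) is)
    dj (p , q) with ∈-map⁻ _ p | ∈-concat⁻′ (map (\i -> map (i ∷_) (comps k (d N.∸ i))) is) q
    ... | f , _ , e1 | l , e∈ , l∈ with ∈-map⁻ _ l∈
    ...   | j , j∈ , refl with ∈-map⁻ _ e∈
    ...     | g , _ , e2 = All.lookup a j∈ (VecP.∷-injectiveˡ (sym e1 & e2))

SymM-h : ∀ k d -> SymM (hPoly k d)
SymM-h k d σ χ = (Σ-map _ (comps k d) _) & (Σ-bij (comps-unique k d) (comps-unique k d) (perm σ) (perm (flipP σ))
 (\e m -> subst (\z -> perm σ e ∈ comps k z) (sum-perm σ e & comps⁻ k d e m) (comps⁺ (perm σ e)) , inv (flipP σ) σ (\i -> inverseʳ σ) e)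
 (\e m -> subst (\z -> perm (flipP σ) e ∈ comps k z) (sum-perm (flipP σ) e & comps⁻ k d e m) (comps⁺ (perm (flipP σ) e)) , inv σ (flipP σ) (\i -> inverseˡ σ) e)
 _ (\e -> 1z * χ e) (\e _ -> refl)) & sym (Σ-map _ (comps k d) _)
 where
  inv : ∀ τ ρ -> (∀ i -> ρ ⟨$⟩ʳ (τ ⟨$⟩ʳ i) ≡ i) -> ∀ (e : Vec ℕ k) -> perm τ (perm ρ e) ≡ e
  inv τ ρ h e = VecP.tabulate-cong (\i -> (VecP.lookup∘tabulate _ (τ ⟨$⟩ʳ i)) & cong (lookup e) (h i)) & VecP.tabulate∘lookup e

-- Complete homogeneous polynomials in the polynomial ring.

module HPoly (K : ℕ) where
 open Alternant (PolyRing {K}) public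

 rep : ℕ -> Vec ℕ K -> Vec ℕ K
 rep zero u' = 𝟎
 rep (suc d) u' = u' ⊞ rep d u'

 lcv : ∀ {m} -> Vec (Vec ℕ K) m -> Vec ℕ m -> Vec ℕ K
 lcv [] [] = 𝟎
 lcv (u' ∷ us') (e ∷ es) = rep e u' ⊞ lcv us' es

 monos : ∀ {m} -> Vec (Vec ℕ K) m -> List (Poly K)
 monos us' = toList (Vec.map mo us')

 comps-0 : ∀ m -> comps m 0 ≡ [ Vec.replicate m 0 ]
 comps-0 zero = refl
 comps-0 (suc m) = (L.++-identityʳ _) & cong (map (0 ∷_)) (comps-0 m)

 lcv-0 : ∀ {m} (us' : Vec (Vec ℕ K) m) -> lcv us' (Vec.replicate m 0) ≡ 𝟎
 lcv-0 [] = refl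
 lcv-0 (u' ∷ us') = (𝟎⊞ _) & lcv-0 us'

 inc : ∀ {m} -> Vec ℕ (suc m) -> Vec ℕ (suc m)
 inc (i ∷ e) = suc i ∷ e

 comps-suc : ∀ m d (g : Vec ℕ (suc m) -> ℤ) -> ΣL (comps (suc m) (suc d)) g ≡ ΣL (comps m (suc d)) (\e -> g (0 ∷ e)) + ΣL (comps (suc m) d) (\e -> g (inc e))
 comps-suc m d g = Σ-concatMap (\i -> map (i ∷_) (comps m (suc d N.∸ i))) (upTo (suc (suc d))) g & (cong2 _+_ (Σ-map (0 ∷_) (comps m (suc d)) g)
  (cong (\z -> ΣL z G) (sym (L.map-upTo suc (suc d))) & Σ-map suc (upTo (suc d)) G & Σ-cong (upTo (suc d)) {g = \i -> ΣL (map (i ∷_) (comps m (d N.∸ i))) (\e -> g (inc e))} (\i -> Σ-map (suc i ∷_) (comps m (d N.∸ i)) g & sym (Σ-map (i ∷_) (comps m (d N.∸ i)) (\e -> g (inc e)))) & sym (Σ-concatMap (\i -> map (i ∷_) (comps m (d N.∸ i))) (upTo (suc d)) (\e -> g (inc e)))))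
  where
   G : ℕ -> ℤ
   G i = ΣL (map (i ∷_) (comps m (suc d N.∸ i))) g

 pr-h : ∀ {m} (us' : Vec (Vec ℕ K) m) d χ -> pr (h (monos us') d) χ ≡ ΣL (comps m d) (\e -> χ (lcv us' e))
 pr-h [] zero χ = cong (_+ 0z) (Z.*-identityˡ (χ 𝟎))
 pr-h [] (suc d) χ = refl
 pr-h {suc m} (u' ∷ us') zero χ = (pr-mo 𝟎 χ) & sym (cong (\z -> ΣL z (\e -> χ (lcv (u' ∷ us') e))) (comps-0 (suc m)) & (+0 _) & cong χ (lcv-0 (u' ∷ us')))
 pr-h {suc m} (u' ∷ us') (suc d) χ = (Σ-++ (h (monos us') (suc d)) _ _) & (cong2 _+_
  (pr-h us' (suc d) χ & Σ-cong (comps m (suc d)) (\e -> cong χ (sym (𝟎⊞ _))))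
  (pr-mul (mo u') (h (monos (u' ∷ us')) d) χ & pr-mo u' (\e -> pr (h (monos (u' ∷ us')) d) (\f -> χ (e ⊞ f))) & pr-h (u' ∷ us') d (\f -> χ (u' ⊞ f)) & Σ-cong (comps (suc m) d) (\ { (i ∷ e) -> cong χ (sym (⊞-assoc u' (rep i u') (lcv us' e))) }))) &
  sym (comps-suc m d (\e -> χ (lcv (u' ∷ us') e)))

 pr-mon : ∀ {m} (us' : Vec (Vec ℕ K) m) e χ -> pr (mon (monos us') (Vec.map +_ e)) χ ≡ χ (lcv us' e)
 pr-mon [] [] χ = pr-mo 𝟎 χ
 pr-mon (u' ∷ us') (i ∷ e) χ = (pr-mul (h (mo u' ∷ []) i) _ χ) & one i (\f -> pr (mon (monos us') (Vec.map +_ e)) (\g -> χ (f ⊞ g))) & pr-mon us' e (\g -> χ (rep i u' ⊞ g))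
  where
   one : ∀ i χ -> pr (h (mo u' ∷ []) i) χ ≡ χ (rep i u')
   one zero χ = pr-mo 𝟎 χ
   one (suc i) χ = pr-mul (mo u') (h (mo u' ∷ []) i) χ & pr-mo u' (\e -> pr (h (mo u' ∷ []) i) (\f -> χ (e ⊞ f))) & one i (\f -> χ (u' ⊞ f))

 pr-DL : ∀ {m} ps (f : Vf m) a χ -> pr (DL ps f a) χ ≡ ZA.DL ps (\b -> pr (f b) χ) a
 pr-DL [] f a χ = refl
 pr-DL ((i , j) ∷ ps) f a χ = (Σ-++ (DL ps f (bump i a)) _ _) & (cong2 _+_ (pr-DL ps f _ χ) ((pr-scl -[1+ 0 ] (DL ps f (bump j a)) χ) & (Z.-1*i≡-i _) & (cong -_ (pr-DL ps f _ χ))))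

 tf : ∀ (P : Poly K) -> P ++ P ≃ [] -> P ≃ []
 tf P p = mk \χ -> lia 1 (\x -> x :+ x := #0 => |- x := #0) (pr P χ) (sym (Σ-++ P P _) & un p χ)

units : ∀ K -> Vec (Vec ℕ K) K
units zero = []
units (suc K) = (1 ∷ 𝟎) ∷ Vec.map (0 ∷_) (units K)

lcv-units : ∀ K e -> HPoly.lcv K (units K) e ≡ e
lcv-units zero [] = refl
lcv-units (suc K) (i ∷ e) = (cong2 _⊞_ (rp' i) (tl (units K) e)) & (cong2 _∷_ (M.+-identityʳ i) ((𝟎⊞ _) & lcv-units K e))
 where
  rp' : ∀ i -> HPoly.rep (suc K) i (1 ∷ 𝟎) ≡ i ∷ 𝟎
  rp' zero = refl
  rp' (suc i) = cong ((1 ∷ 𝟎) ⊞_) (rp' i) & cong (suc i ∷_) (𝟎⊞ 𝟎)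
  r0 : ∀ i (u' : Vec ℕ K) -> HPoly.rep (suc K) i (0 ∷ u') ≡ 0 ∷ HPoly.rep K i u'
  r0 zero u' = refl
  r0 (suc i) u' = cong (_⊞_ (0 ∷ u')) (r0 i u')
  tl : ∀ {m} (us' : Vec (Vec ℕ K) m) e -> HPoly.lcv (suc K) (Vec.map (0 ∷_) us') e ≡ 0 ∷ HPoly.lcv K us' e
  tl [] [] = refl
  tl (u' ∷ us') (i ∷ e) = cong2 _⊞_ (r0 i u') (tl us' e)

-- Membership in the ideal, and summation by parts over boxes of exponents.

InI : (n k : ℕ) -> (Vec ℕ k -> ℤ) -> Set
InI n k φ = Σ (List (ℕ × Poly k)) \W -> All (\dc -> (n N.∸ k N.< fst dc) × Symmetric (snd dc)) W × (∀ a -> φ a ≡ coeff (idealSum W) a)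

module _ {n k : ℕ} where

 II-ext : ∀ {φ ψ} -> (∀ a -> ψ a ≡ φ a) -> InI n k φ -> InI n k ψ
 II-ext h (W , p , e) = W , p , \a -> h a & e a

 II-0 : InI n k (\_ -> 0z)
 II-0 = [] , [] , \a -> refl

 II-+ : ∀ {φ ψ} -> InI n k φ -> InI n k ψ -> InI n k (\a -> φ a + ψ a)
 II-+ (W , p , e) (W' , p' , e') = W ++ W' , AllP.++⁺ p p' , \a -> (cong2 _+_ (e a & coeff-pr (idealSum W) a) (e' a & coeff-pr (idealSum W') a)) &
  sym (Σ-++ (idealSum W) (idealSum W') _) & cong (\z -> pr z (\e -> on (e ≟E a) 1z)) (sym (L.concatMap-++ (\dc -> mulPoly (snd dc) (hPoly k (fst dc))) W W')) & sym (coeff-pr (idealSum (W ++ W')) a)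

 Symmetric-scl : ∀ c {P : Poly k} -> Symmetric P -> Symmetric (scl c P)
 Symmetric-scl c {P} h σ a = cs (perm σ a) & cong (c *_) (h σ a) & sym (cs a)
  where
   cs : ∀ a -> coeff (scl c P) a ≡ c * coeff P a
   cs a = coeff-pr (scl c P) a & (pr-scl c P _) & cong (c *_) (sym (coeff-pr P a))

 II-* : ∀ c {φ} -> InI n k φ -> InI n k (\a -> c * φ a)
 II-* c (W , p , e) = map (\dc -> fst dc , scl c (snd dc)) W , AllP.map⁺ (All.map (\ {dc} (l , s') -> l , Symmetric-scl c {snd dc} s') p) ,
  \a -> cong (c *_) (e a & coeff-pr (idealSum W) a) & (k' W _) & sym (coeff-pr (idealSum (map _ W)) a)
  where
   k' : ∀ W χ -> c * pr (idealSum W) χ ≡ pr (idealSum (map (\dc -> fst dc , scl c (snd dc)) W)) χ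
   k' [] χ = Z.*-zeroʳ c
   k' ((d , P) ∷ W) χ = cong (c *_) (Σ-++ (mulPoly P (hPoly k d)) (idealSum W) _) & (Z.*-distribˡ-+ c _ _) & (cong2 _+_ (cong (c *_) (pr-mul P (hPoly k d) χ) & sym (pr-scl c P _) & sym (pr-mul (scl c P) (hPoly k d) χ)) (k' W χ)) & sym (Σ-++ (mulPoly (scl c P) (hPoly k d)) _ _)

 II-Σ : {A : Set} (xs : List A) {φ : A -> Vec ℕ k -> ℤ} -> (∀ x -> x ∈ xs -> InI n k (φ x)) -> InI n k (\a -> ΣL xs (\x -> φ x a))
 II-Σ [] h = II-0
 II-Σ (x ∷ xs) h = II-+ (h x (here refl)) (II-Σ xs (\y m -> h y (there m)))

unb : ∀ {k} -> ℕ -> Vec ℤ k -> Vec ℤ k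
unb i [] = []
unb zero (x ∷ a) = x - 1z ∷ a
unb (suc i) (x ∷ a) = x ∷ unb i a

negV : ∀ {k} -> Vec ℤ k -> Vec ℤ k
negV = Vec.map (\z -> - z)

negV-inv : ∀ {k} (a : Vec ℤ k) -> negV (negV a) ≡ a
negV-inv [] = refl
negV-inv (x ∷ a) = cong2 _∷_ (Z.neg-involutive x) (negV-inv a)

unb-neg : ∀ {k} i (a : Vec ℤ k) -> unb i (negV a) ≡ negV (bump i a)
unb-neg i [] = refl
unb-neg zero (x ∷ a) = cong (_∷ negV a) (sym (Z.neg-distrib-+ x 1z))
unb-neg (suc i) (x ∷ a) = cong (- x ∷_) (unb-neg i a)

Da : ∀ {k} -> ℕ × ℕ -> ZA.Vf k -> ZA.Vf k
Da (i , j) p a = p (unb i a) - p (unb j a)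

-- The adjoint of `DL` under summation over exponents: `unb` undoes `bump`, and the head of the list
-- now acts first.
DLa : ∀ {k} -> List (ℕ × ℕ) -> ZA.Vf k -> ZA.Vf k
DLa [] p = p
DLa (q ∷ qs) p = DLa qs (Da q p)

DLa-neg : ∀ {k} qs (p : ZA.Vf k) a -> DLa qs p (negV a) ≡ ZA.DL qs (\b -> p (negV b)) a
DLa-neg [] p a = refl
DLa-neg (q@(i , j) ∷ qs) p a = DLa-neg qs (Da q p) a & ZA.DL-cong qs (\b -> cong2 (\x y -> p x - p y) (unb-neg i b) (unb-neg j b)) a &
 sym (ZA.DL-++ qs [ q ] (\b -> p (negV b)) a) & sym (ZA.DL-↭ (PermP.∷↭∷ʳ q qs) (\b -> p (negV b)) a)

boxL : ∀ k -> ℕ -> List (Vec ℤ k)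
boxL zero M = [ [] ]
boxL (suc k) M = concatMap (\z -> map (z ∷_) (boxL k M)) (range 0z M)

Ins : ∀ {k} -> ℕ -> Vec ℤ k -> Set
Ins m = AllV (\z -> 0z ≤ z × z < + m)

box⁺ : ∀ {k} M (a : Vec ℤ k) -> Ins M a -> a ∈ boxL k M
box⁺ M [] _ = here refl
box⁺ M (z ∷ a) ((p , q) , r) = ∈-concat⁺′ (∈-map⁺ (z ∷_) (box⁺ M a r)) (∈-map⁺ (\z -> map (z ∷_) (boxL _ M)) (∈-range⁺ 0z M z p (subst (z <_) (sym (0+ (+ M))) q)))

box⁻ : ∀ {k} M (a : Vec ℤ k) -> a ∈ boxL k M -> Ins M a
box⁻ M [] _ = tt
box⁻ {suc k} M (z ∷ a) m with ∈-concat⁻′ (map (\z -> map (z ∷_) (boxL k M)) (range 0z M)) m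
... | l , e∈ , l∈ with ∈-map⁻ _ l∈
...   | y , y∈ , refl with ∈-map⁻ _ e∈
...     | b , b∈ , refl = (fst r , subst (z <_) (0+ (+ M)) (snd r)) , box⁻ M b b∈
 where
  r = ∈-range⁻ 0z M z y∈

box-unique : ∀ k M -> Unique (boxL k M)
box-unique zero M = [] ∷ []
box-unique (suc k) M = cc (range 0z M) (range-unique 0z M)
 where
  cc : ∀ is -> Unique is -> Unique (concatMap (\z -> map (z ∷_) (boxL k M)) is)
  cc [] [] = []
  cc (i ∷ is) (a ∷ u') = UP.++⁺ (UP.map⁺ VecP.∷-injectiveʳ (box-unique k M)) (cc is u') dj
   where
    dj : ∀ {e} -> ¬ (e ∈ map (i ∷_) (boxL k M) × e ∈ concatMap (\z -> map (z ∷_) (boxL k M)) is)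
    dj (p , q) with ∈-map⁻ _ p | ∈-concat⁻′ (map (\z -> map (z ∷_) (boxL k M)) is) q
    ... | f , _ , e1 | l , e∈ , l∈ with ∈-map⁻ _ l∈
    ...   | j , j∈ , refl with ∈-map⁻ _ e∈
    ...     | g , _ , e2 = All.lookup a j∈ (VecP.∷-injectiveˡ (sym e1 & e2))

Sup : ∀ {k} -> ℕ -> ZA.Vf k -> Set
Sup m p = ∀ a -> ¬ Ins m a -> p a ≡ 0z

range-shift : ∀ M (g : ℤ -> ℤ) -> g (-[1+ 0 ]) ≡ 0z -> g (+ M - 1z) ≡ 0z -> ΣL (range 0z M) g ≡ ΣL (range 0z M) (\z -> g (z - 1z))
range-shift zero g _ _ = refl
range-shift (suc m) g h h' = cong (\z -> ΣL z g) (snoc 0z m) & (Σ-++ (range 0z m) [ 0z + + m ] g) & (cong2 _+_ (sft 0z m) ((+0 _) & cong g (lia 1 (\m -> |- #0 :+ m := #1 :+ m :- #1) (+ m)) & h' & sym h)) & Z.+-comm (ΣL (range 1z m) (\z -> g (z - 1z))) (g -[1+ 0 ])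
 where
  snoc : ∀ a m -> range a (suc m) ≡ range a m ++ [ a + + m ]
  snoc a zero = cong (_∷ []) (sym (+0 a))
  snoc a (suc m) = cong (a ∷_) (snoc (a + 1z) m & cong (\z -> range (a + 1z) m ++ [ z ]) (Z.+-assoc a 1z (+ m)))
  sft : ∀ a m -> ΣL (range a m) g ≡ ΣL (range (a + 1z) m) (\z -> g (z - 1z))
  sft a zero = refl
  sft a (suc m) = cong2 _+_ (cong g (lia 1 (\a -> |- a := a :+ #1 :- #1) a)) (sft (a + 1z) m)

box-Σ : ∀ k M (g : Vec ℤ (suc k) -> ℤ) -> ΣL (boxL (suc k) M) g ≡ ΣL (range 0z M) (\z -> ΣL (boxL k M) (\a -> g (z ∷ a)))
box-Σ k M g = (Σ-concatMap _ (range 0z M) g) & Σ-cong (range 0z M) (\z -> Σ-map (z ∷_) (boxL k M) g)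

-- summation by parts
adj1 : ∀ {k} m M -> m N.< M -> ∀ i -> i N.< k -> (p f : ZA.Vf k) -> Sup m p -> ΣL (boxL k M) (\a -> p a * f (bump i a)) ≡ ΣL (boxL k M) (\a -> p (unb i a) * f a)
adj1 {suc k} m M lt zero _ p f s = (box-Σ k M _) & range-shift M g (z0 -[1+ 0 ] (\ { ((() , _) , _) })) (z0 (+ M - 1z) (\ { ((_ , q) , _) -> lia 2 (\m M -> M :- #1 :< m => m :< M => |- ff) (+ m) (+ M) q (ℤ.+<+ lt) })) &
 Σ-cong (range 0z M) (\z -> Σ-cong (boxL k M) (\a -> cong (\y -> p (z - 1z ∷ a) * f (y ∷ a)) (lia 1 (\z -> |- z :- #1 :+ #1 := z) z))) & sym (box-Σ k M _)
 where
  g : ℤ -> ℤ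
  g z = ΣL (boxL k M) (\a -> p (z ∷ a) * f (z + 1z ∷ a))
  z0 : ∀ z -> (∀ {a} -> ¬ Ins m (z ∷ a)) -> g z ≡ 0z
  z0 z h = Σ-0 (boxL k M) (\a _ -> cong (_* f (z + 1z ∷ a)) (s (z ∷ a) h) & Z.*-zeroˡ (f (z + 1z ∷ a)))
adj1 {suc k} m M lt (suc i) (s≤s h) p f s = (box-Σ k M _) & Σ-cong (range 0z M) (\z -> adj1 m M lt i h (\a -> p (z ∷ a)) (\a -> f (z ∷ a)) (\a na -> s (z ∷ a) (na ∘ snd))) & sym (box-Σ k M _)

Sup-Da : ∀ {k} m q (p : ZA.Vf k) -> Sup m p -> Sup (suc m) (Da q p)
Sup-Da {k} m (i , j) p s a na = cong2 _-_ (s _ (na ∘ up' i a)) (s _ (na ∘ up' j a))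
 where
  wk : ∀ {k} (a : Vec ℤ k) -> Ins m a -> Ins (suc m) a
  wk a = AllV-map (\z (p , q) -> p , Z.<-trans q (ℤ.+<+ (M.n<1+n m))) a
  up' : ∀ {k} i (a : Vec ℤ k) -> Ins m (unb i a) -> Ins (suc m) a
  up' i [] _ = tt
  up' zero (z ∷ a) ((p , q) , r) = (lia 1 (\z -> #0 =< z :- #1 => |- #0 =< z) z p , lia 2 (\z m -> z :- #1 :< m => |- z :< #1 :+ m) z (+ m) q) , wk a r
  up' (suc i) (z ∷ a) ((p , q) , r) = (p , Z.<-trans q (ℤ.+<+ (M.n<1+n m))) , up' i a r

-- Each factor enlarges the support of p by at most one layer, so a box with `length qs` spare
-- layers produces no boundary terms.
adjoint : ∀ {k} qs -> All (\(i , j) -> i N.< k × j N.< k) qs -> ∀ m M -> m N.+ length qs N.≤ M -> (p f : ZA.Vf k) -> Sup m p ->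
 ΣL (boxL k M) (\a -> p a * ZA.DL qs f a) ≡ ΣL (boxL k M) (\a -> DLa qs p a * f a)
adjoint [] _ m M h p f s = refl
adjoint {k} (q@(i , j) ∷ qs) ((hi , hj) ∷ hs) m M h p f s = Σ-cong (boxL k M) (\a -> Z.*-distribˡ-+ (p a) (g (bump i a)) (- g (bump j a))) &
 (Σ-+ (boxL k M) _ _) & (cong2 _+_ (adj1 m M lt i hi p g s) (Σ-cong (boxL k M) (\a -> sym (Z.neg-distribʳ-* (p a) (g (bump j a)))) & (Σ-neg (boxL k M) _) & (cong -_ (adj1 m M lt j hj p g s)))) &
 cong (_+_ (ΣL (boxL k M) (\a -> p (unb i a) * g a))) (sym (Σ-neg (boxL k M) (\a -> p (unb j a) * g a))) & sym (Σ-+ (boxL k M) _ _) & Σ-cong (boxL k M) (\a -> l (p (unb i a)) (p (unb j a)) (g a)) & adjoint qs hs (suc m) M (M.≤-trans (M.≤-reflexive (sym (M.+-suc m (length qs)))) h) (Da q p) f (Sup-Da m q p s)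
 where
  g = ZA.DL qs f
  lt : m N.< M
  lt = M.≤-trans (M.≤-trans (s≤s (M.m≤m+n m (length qs))) (M.≤-reflexive (sym (M.+-suc m (length qs))))) h
  l : ∀ x y z -> x * z + - (y * z) ≡ (x - y) * z
  l = ring

-- A series with too large an excess lies in the ideal.

module Ideal (n : ℕ) {{nz : NonZero n}} (1<n : 1z < + n) where
 open Vanish n 1<n public

 Fr-deg : ∀ as {v} -> IsAff v -> len v ≢ sumN as -> Fr as v ≡ 0z
 Fr-deg as {v} A ne with count as A
 ... | zero , _ , e = sym e
 ... | suc m , (g ∷ _ , _ , h' , _) , _ = absurd (ne (snd (snd (fst (h' g) (here refl)))))

 Gt-nat : ∀ {k} (e : Vec ℕ k) φ -> Gt φ (negV (Vec.map ℤ.+_ e)) ≡ foldr H φ (toList e)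
 Gt-nat [] φ = refl
 Gt-nat (zero ∷ e) φ = cong (H 0) (Gt-nat e φ)
 Gt-nat (suc x ∷ e) φ = cong (H (suc x)) (Gt-nat e φ)

 foldr-Fr : ∀ as -> foldr H δe as ≡ Fr as
 foldr-Fr [] = refl
 foldr-Fr (a ∷ as) = cong (H a) (foldr-Fr as)

 nat? : ∀ {k} (a : Vec ℤ k) -> (Σ (Vec ℕ k) \e -> a ≡ Vec.map ℤ.+_ e) ⊎ (∀ φ -> Gt φ (negV a) ≈ O)
 nat? [] = inl ([] , refl)
 nat? (-[1+ x ] ∷ a) = inr (\φ -> ≈r)
 nat? (+ x ∷ a) with nat? a
 ... | inl (e , refl) = inl (x ∷ e , refl)
 ... | inr p = inr (k' x)
  where
   k' : ∀ x φ -> Gt φ (negV (+ x ∷ a)) ≈ O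
   k' zero φ = lO (H-lin 0) (p φ)
   k' (suc x) φ = lO (H-lin (suc x)) (p φ)

 module _ {v} (A : IsAff v) {k : ℕ} (k≤n : k N.≤ n) (x0 : ℤ) (big : x0 + + (n N.∸ k) < ev v x0) where
  open HPoly k using (SymFun; V⁺; ∏; desc; mon; monos; straighten; hz; h; tf; pr-DL; pr-mon; pr-h; lcv) renaming (_≈ᵣ_ to _≈P_)

  p : ZA.Vf k
  p a = Gt δe (negV a) v

  -- Exponents of total degree len v lie below `m0`; each Vandermonde factor then needs one more
  -- layer.
  m0 M : ℕ
  m0 = suc (len v)
  M = m0 N.+ length (pairs k)

  p-nat : ∀ e -> p (Vec.map ℤ.+_ e) ≡ Fr (toList e) v
  p-nat e = cong-app (Gt-nat e δe) v & cong-app (foldr-Fr (toList e)) v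

  Ins-nat : ∀ {k} (e : Vec ℕ k) m -> sumN (toList e) N.< m -> Ins m (Vec.map ℤ.+_ e)
  Ins-nat [] m _ = tt
  Ins-nat (x ∷ e) m h = (ℤ.+≤+ z≤n , ℤ.+<+ (M.≤-<-trans (M.m≤m+n x _) h)) , Ins-nat e m (M.≤-<-trans (M.m≤n+m _ x) h)

  p-sup : Sup m0 p
  p-sup a na with nat? a
  ... | inr z = z δe v A
  ... | inl (e , refl) = p-nat e & Fr-deg (toList e) A (\eq -> na (Ins-nat e m0 (s≤s (M.≤-reflexive (sym eq)))))

  box = boxL k M

  X0 : List (Poly k)
  X0 = monos (units k)

  -- The series of v as a functional: the sum of p(a) f(a) over the box. Its symmetry is the
  -- commutation of the operators `H`, through `Gt-swp`.
  S : SymFun k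
  S = record
   { Λ = \f -> concatMap (\a -> scl (p a) (f a)) box
   ; Λ-cong = \ {f} {g} h -> mk \χ -> prΛ f χ & Σ-cong∈ box (\a a∈ -> cong (p a *_) (un (h a (nn' a (box⁻ M a a∈))) χ)) & sym (prΛ g χ)
   ; Λ-+ = \f g -> mk \χ -> prΛ (\a -> f a ++ g a) χ & Σ-cong box (\a -> cong (p a *_) (Σ-++ (f a) (g a) _) & Z.*-distribˡ-+ (p a) (pr (f a) χ) (pr (g a) χ)) & (Σ-+ box _ _) & (cong2 _+_ (sym (prΛ f χ)) (sym (prΛ g χ))) & sym (Σ-++ (Λ0 f) (Λ0 g) _)
   ; Λ-* = \r f -> mk \χ -> prΛ (\a -> mulPoly r (f a)) χ & Σ-cong box (\a -> cong (p a *_) (pr-mul r (f a) χ) & sym (Σ-cong r (\t' -> l (fst t') (p a) (pr (f a) (\g -> χ (snd t' ⊞ g)))) & (Σ-* (p a) r _))) &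
    (Σ-swap box r _) & Σ-cong r (\t' -> (Σ-* (fst t') box _) & cong (fst t' *_) (sym (prΛ f (\g -> χ (snd t' ⊞ g))))) & sym (pr-mul r (Λ0 f) χ)
   ; Λ-swp = \i lt f -> mk \χ -> trans (prΛ (\a -> f (swp i a)) χ) (Σ-bij (box-unique k M) (box-unique k M) (swp i) (swp i)
    (\a m -> box⁺ M (swp i a) (Ins-swp i a (box⁻ M a m)) , swp-inv i a) (\a m -> box⁺ M (swp i a) (Ins-swp i a (box⁻ M a m)) , swp-inv i a)
    (\a -> p a * pr (f (swp i a)) χ) (\a -> p a * pr (f a) χ) (\a _ -> cong (_* pr (f (swp i a)) χ) (sym (p-swp i a))) & sym (prΛ f χ)) }
   where
    Λ0 : (Vec ℤ k -> Poly k) -> Poly k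
    Λ0 f = concatMap (\a -> scl (p a) (f a)) box
    prΛ : ∀ f χ -> pr (Λ0 f) χ ≡ ΣL box (\a -> p a * pr (f a) χ)
    prΛ f χ = (Σ-concatMap (\a -> scl (p a) (f a)) box _) & Σ-cong box (\a -> pr-scl (p a) (f a) χ)
    l : ∀ a b c -> a * (b * c) ≡ b * (a * c)
    l = ring
    nn' : ∀ {k} (a : Vec ℤ k) -> Ins M a -> HPoly.NonNeg k a
    nn' [] _ = tt
    nn' (z ∷ a) ((q , _) , r) = q , nn' a r
    Ins-swp : ∀ {k} i (a : Vec ℤ k) -> Ins M a -> Ins M (swp i a)
    Ins-swp i [] _ = tt
    Ins-swp zero (x ∷ []) q = q
    Ins-swp zero (x ∷ y ∷ a) (q , q' , r) = q' , q , r
    Ins-swp (suc i) (x ∷ a) (q , r) = q , Ins-swp i a r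
    neg-swp : ∀ {k} i (a : Vec ℤ k) -> negV (swp i a) ≡ swp i (negV a)
    neg-swp i [] = refl
    neg-swp zero (x ∷ []) = refl
    neg-swp zero (x ∷ y ∷ a) = refl
    neg-swp (suc i) (x ∷ a) = cong (- x ∷_) (neg-swp i a)
    p-swp : ∀ i a -> p (swp i a) ≡ p a
    p-swp i a = cong (\z -> Gt δe z v) (neg-swp i a) & Gt-swp i (negV a) δe v A

  prΛ : ∀ f χ -> pr (SymFun.Λ S f) χ ≡ ΣL box (\a -> p a * pr (f a) χ)
  prΛ f χ = (Σ-concatMap (\a -> scl (p a) (f a)) box _) & Σ-cong box (\a -> pr-scl (p a) (f a) χ)

  q0 : ZA.Vf k
  q0 = DLa (pairs k) p

  -- Negation turns `DLa` into the Vandermonde product on negated exponents, and the bound n = (n -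
  -- k) + k is the range of `vanish` when all n - k operators `E` are still available.
  q-0 : ∀ a -> AllV (_< + n) a -> q0 a ≡ 0z
  q-0 a h' = cong q0 (sym (negV-inv a)) & DLa-neg (pairs k) p (negV a) & ZA.DL-cong (pairs k) (\b -> cong (\z -> Gt δe z v) (negV-inv b)) (negV a) &
   vanish A {k} {n N.∸ k} (M.m∸n+n≡m k≤n) x0 big (n N.∸ k) [] refl (negV a) (ng a h')
   where
    ng : ∀ {j} (a : Vec ℤ j) -> AllV (_< + n) a -> AllV (\x -> - + (n N.∸ k N.+ k) < x) (negV a)
    ng [] _ = tt
    ng (z ∷ a) (q , r) = subst (\w -> - + w < - z) (sym (M.m∸n+n≡m k≤n)) (Z.neg-mono-< q) , ng a r

  lenX : length X0 ≡ k
  lenX = VecP.length-toList (Vec.map mo (units k))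

  h-hPoly : ∀ d -> h X0 d ≃ hPoly k d
  h-hPoly d = mk \χ -> pr-h (units k) d χ & Σ-cong (comps k d) (\e -> cong χ (lcv-units k e) & sym (Z.*-identityˡ (χ e))) & sym (Σ-map (\e -> 1z , e) (comps k d) _)

  SymM-hz : ∀ z -> SymM (hz X0 z)
  SymM-hz (+ d) = SymM-≃ {P = hPoly k d} {h X0 d} (mk \χ -> sym (un (h-hPoly d) χ)) (SymM-h k d)
  SymM-hz -[1+ _ ] σ χ = refl

  SymM-1 : SymM (mo (𝟎 {k}))
  SymM-1 σ χ = (pr-mo 𝟎 (\e -> χ (perm σ e))) & cong χ p0 & sym (pr-mo 𝟎 χ)
   where
    p0 : perm σ (𝟎 {k}) ≡ 𝟎
    p0 = VecP.tabulate-cong (\i -> VecP.lookup-replicate (σ ⟨$⟩ʳ i) 0 & sym (VecP.lookup-replicate i 0)) & (VecP.tabulate∘lookup 𝟎)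

  SymM-∏ : ∀ c {j} (a : Vec ℤ j) -> SymM (∏ (desc c X0) a)
  SymM-∏ (suc c) (z ∷ a) = SymM-mul {P = hz X0 (z - + c)} {∏ (desc c X0) a} (SymM-hz (z - + c)) (SymM-∏ c a)
  SymM-∏ zero a = SymM-1
  SymM-∏ (suc c) [] = SymM-1

  -- An exponent that is at least n and is lowered by at most k - 1 leaves a degree above n - k.
  -- That factor is split off; the product of the others is symmetric and serves as coefficient.
  cofactor : ∀ c -> c N.≤ k -> (a : Vec ℤ c) -> ¬ AllV (_< + n) a -> Σ ℕ \d -> Σ (Poly k) \P -> n N.∸ k N.< d × SymM P × ∏ (desc c X0) a ≃ mulPoly P (hPoly k d)
  cofactor zero _ [] na = absurd (na tt)
  cofactor (suc c) lt (z ∷ a) na = k' (z <? + n)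
   where
    k' : Dec (z < + n) -> _
    k' (yes q) with cofactor c (M.≤-trans (M.n≤1+n c) lt) a (\r -> na (q , r))
    ... | d , P , dl , sP , e = d , mulPoly (hz X0 (z - + c)) P , dl , SymM-mul {P = hz X0 (z - + c)} {P} (SymM-hz (z - + c)) sP ,
     mk \χ -> un (mul-cong {P = hz X0 (z - + c)} {hz X0 (z - + c)} {∏ (desc c X0) a} {mulPoly P (hPoly k d)} (mk \_ -> refl) e) χ & sym (un (CommutativeRing.*-assoc (PolyRing {k}) (hz X0 (z - + c)) P (hPoly k d)) χ)
    k' (no q) = d , ∏ (desc c X0) a , dl , SymM-∏ c a , mk \χ -> un (mul-comm (hz X0 (z - + c)) (∏ (desc c X0) a)) χ & un (mul-cong {P = ∏ (desc c X0) a} {∏ (desc c X0) a} {hz X0 (z - + c)} {hPoly k d} (mk \_ -> refl) (mk \χ -> cong (\w -> pr (hz X0 w) χ) (sym dz) & un (h-hPoly d) χ)) χ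
     where
      d = ℤ.∣ z - + c ∣
      zc : + (n N.∸ k) < z - + c
      zc = lia 5 (\z c n k m -> n =< z => #1 :+ c =< k => m :+ k := n => |- m :< z :- c) z (+ c) (+ n) (+ k) (+ (n N.∸ k)) (Z.≮⇒≥ q) (ℤ.+≤+ lt) (cong +_ (M.m∸n+n≡m k≤n))
      dz : + d ≡ z - + c
      dz = Z.0≤i⇒+∣i∣≡i (Z.≤-trans (ℤ.+≤+ z≤n) (Z.<⇒≤ zc))
      dl : n N.∸ k N.< d
      dl = Z.drop‿+<+ (subst (+ (n N.∸ k) <_) (sym dz) zc)

  all<? : ∀ {j} (a : Vec ℤ j) -> Dec (AllV (_< + n) a)
  all<? [] = yes tt
  all<? (z ∷ a) = (z <? + n) ×-dec all<? a

  term : Vec ℤ k -> List (ℕ × Poly k)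
  term a = k' (all<? a)
   where
    k' : Dec (AllV (_< + n) a) -> List (ℕ × Poly k)
    k' (yes _) = []
    k' (no na) = let (d , P , _) = cofactor k M.≤-refl a na in [ (d , scl (q0 a) P) ]

  term-ok : ∀ a -> All (\dc -> (n N.∸ k N.< fst dc) × Symmetric (snd dc)) (term a) × (∀ χ -> pr (idealSum (term a)) χ ≡ q0 a * pr (∏ (desc k X0) a) χ)
  term-ok a with all<? a
  ... | yes q = [] , \χ -> sym (cong (_* pr (∏ (desc k X0) a) χ) (q-0 a q) & Z.*-zeroˡ (pr (∏ (desc k X0) a) χ))
  ... | no na with cofactor k M.≤-refl a na
  ...   | d , P , dl , sP , e = (dl , SymM→Symmetric {P = scl (q0 a) P} (SymM-scl (q0 a) {P} sP)) ∷ [] ,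
   \χ -> cong (\z -> pr z χ) (L.++-identityʳ (mulPoly (scl (q0 a) P) (hPoly k d))) & pr-mul (scl (q0 a) P) (hPoly k d) χ & (pr-scl (q0 a) P _) & cong (q0 a *_) (sym (pr-mul P (hPoly k d) χ) & sym (un e χ))

  -- `straighten` rewrites the series, `adjoint` moves the Vandermonde product onto the
  -- coefficients, and each term then has coefficient 0 by `q-0` or a generator of the ideal as
  -- factor by `cofactor`.
  Fr-in-ideal : InI n k (\a -> Fr (toList a) v)
  Fr-in-ideal = W , AllP.concat⁺ {xss = map term box} (AllP.map⁺ {xs = box} (All.tabulate (\ {a} _ -> fst (term-ok a)))) , \a -> lhs a & sym (un (straighten tf X0 lenX S) (χ0 a)) & rhs (χ0 a) & sym (coeff-pr (idealSum W) a)
   where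
    W = concatMap term box
    χ0 : Vec ℕ k -> Vec ℕ k -> ℤ
    χ0 a e = on (e ≟E a) 1z
    prW : ∀ bx χ -> pr (idealSum (concatMap term bx)) χ ≡ ΣL bx (\a -> q0 a * pr (∏ (desc k X0) a) χ)
    prW [] χ = refl
    prW (a ∷ bx) χ = cong (\z -> pr z χ) (L.concatMap-++ (\dc -> mulPoly (snd dc) (hPoly k (fst dc))) (term a) (concatMap term bx)) & (Σ-++ (idealSum (term a)) _ _) & (cong2 _+_ (snd (term-ok a) χ) (prW bx χ))
    rhs : ∀ χ -> pr (SymFun.Λ S (V⁺ k (∏ (desc k X0)))) χ ≡ pr (idealSum W) χ
    rhs χ = prΛ (V⁺ k (∏ (desc k X0))) χ & Σ-cong box (\a -> cong (p a *_) (pr-DL (pairs k) (∏ (desc k X0)) a χ)) & adjoint (pairs k) (pairs-< k) m0 M M.≤-refl p (\a -> pr (∏ (desc k X0) a) χ) p-sup & sym (prW box χ)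
    lhs : ∀ a -> Fr (toList a) v ≡ pr (SymFun.Λ S (mon X0)) (χ0 a)
    lhs a = sym (prΛ (mon X0) (χ0 a) & fin (len v N.≟ sumN (toList a)))
     where
      a⁺ = Vec.map ℤ.+_ a
      val' : ∀ e -> pr (mon X0 (Vec.map ℤ.+_ e)) (χ0 a) ≡ χ0 a e
      val' e = pr-mon (units k) e (χ0 a) & cong (χ0 a) (lcv-units k e)
      other : ∀ b -> b ≢ a⁺ -> p b * pr (mon X0 b) (χ0 a) ≡ 0z
      other b ne with nat? b
      ... | inr z = cong (_* pr (mon X0 b) (χ0 a)) (z δe v A) & Z.*-zeroˡ (pr (mon X0 b) (χ0 a))
      ... | inl (e , refl) = cong (p b *_) (val' e & on-no (e ≟E a) (\ { refl -> ne refl }) 1z) & Z.*-zeroʳ (p b)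
      at-a : p a⁺ * pr (mon X0 a⁺) (χ0 a) ≡ Fr (toList a) v
      at-a = (cong2 _*_ (p-nat a) (val' a & on-yes (a ≟E a) refl 1z)) & Z.*-identityʳ (Fr (toList a) v)
      fin : Dec (len v ≡ sumN (toList a)) -> ΣL box (\b -> p b * pr (mon X0 b) (χ0 a)) ≡ Fr (toList a) v
      fin (yes eq) = Σ-one (\b -> p b * pr (mon X0 b) (χ0 a)) (box-unique k M) {a⁺} (box⁺ M a⁺ (Ins-nat a M (M.<-≤-trans (s≤s (M.≤-reflexive (sym eq))) (M.m≤m+n m0 _)))) (\b _ ne -> other b ne) & at-a
      fin (no ne) = Σ-0 box (\b _ -> k' b (VecP.≡-dec _≟_ b a⁺)) & sym (Fr-deg (toList a) A ne)
       where
        k' : ∀ b -> Dec (b ≡ a⁺) -> p b * pr (mon X0 b) (χ0 a) ≡ 0z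
        k' b (no nb) = other b nb
        k' b (yes refl) = at-a & Fr-deg (toList a) A ne

-- Tableaux and horizontal strips

Bits : Set
Bits = List Bool

cc : Bits -> ℕ
cc [] = 0
cc (true ∷ bs) = cc bs
cc (false ∷ bs) = suc (cc bs)

-- true marks a row and false a column of the partition, read from the top
-- of its boundary path; the part of a row is the number of later columns.
shp : Bits -> List ℕ
shp [] = []
shp (true ∷ bs) = cc bs ∷ shp bs
shp (false ∷ bs) = shp bs

-- Runs along the path with the step b in hand. A row step that meets a column step is put down, or
-- it passes the column step and removes one cell. A passed column step is put down at once, so a
-- column loses at most one cell: the cells removed form a horizontal strip.
Rr : Bool -> Bits -> List (ℕ × Bits)
Rr b [] = [ (0 , [ b ]) ]
Rr true (false ∷ bs) = map (\(m , cs) -> m , true ∷ cs) (Rr false bs) ++ map (\(m , cs) -> suc m , false ∷ cs) (Rr true bs)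
Rr b (c ∷ bs) = map (\(m , cs) -> m , b ∷ cs) (Rr c bs)

hd0 : List ℕ -> ℕ
hd0 [] = 0
hd0 (x ∷ _) = x

IL : List ℕ -> List ℕ -> Set
IL [] [] = ⊤
IL (x ∷ xs) (y ∷ ys) = y N.≤ x × hd0 xs N.≤ y × IL xs ys
IL _ _ = ⊥

sumL : List ℕ -> ℕ
sumL [] = 0
sumL (x ∷ xs) = x N.+ sumL xs

hd0≤ : ∀ bs -> hd0 (shp bs) N.≤ cc bs
hd0≤ [] = z≤n
hd0≤ (true ∷ bs) = M.≤-refl
hd0≤ (false ∷ bs) = M.m≤n⇒m≤1+n (hd0≤ bs)

record StripOK (bs : Bits) (p : ℕ × Bits) : Set where
 constructor sok
 field
  il : IL (shp bs) (shp (snd p))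
  size : fst p N.+ sumL (shp (snd p)) ≡ sumL (shp bs)
  cols : cc (snd p) ≡ cc bs
open StripOK

hd0-IL : ∀ xs ys -> IL xs ys -> hd0 ys N.≤ hd0 xs
hd0-IL [] [] _ = z≤n
hd0-IL (x ∷ xs) (y ∷ ys) (p , _) = p

Rr-ok : ∀ b bs p -> p ∈ Rr b bs -> StripOK (b ∷ bs) p
Rr-ok true [] p (here refl) = sok (z≤n , z≤n , tt) refl refl
Rr-ok false [] p (here refl) = sok tt refl refl
Rr-ok true (true ∷ bs) p m with ∈-map⁻ _ m
... | (j , cs) , q , refl = let r = Rr-ok true bs (j , cs) q in sok (M.≤-reflexive (cols r) , M.≤-reflexive (sym (cols r)) , il r)
 (sw j (cc cs) (sumL (shp cs)) & (cong2 N._+_ (cols r) (size r))) (cols r)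
 where
  sw : ∀ j c s -> j N.+ (c N.+ s) ≡ c N.+ (j N.+ s)
  sw = ringN
Rr-ok false (c ∷ bs) p m with ∈-map⁻ _ m
... | (j , cs) , q , refl = let r = Rr-ok c bs (j , cs) q in sok (il r) (size r) (cong suc (cols r))
Rr-ok true (false ∷ bs) p m with ∈-++⁻ (map (\(m , cs) -> m , true ∷ cs) (Rr false bs)) m
... | inl m' with ∈-map⁻ _ m'
...   | (j , cs) , q , refl = let r = Rr-ok false bs (j , cs) q in sok (M.≤-reflexive (cols r) , M.≤-trans (M.m≤n⇒m≤1+n (hd0≤ bs)) (M.≤-reflexive (sym (cols r))) , il r)
 (sw j (cc cs) (sumL (shp cs)) & (cong2 N._+_ (cols r) (size r))) (cols r)
 where
  sw : ∀ j c s -> j N.+ (c N.+ s) ≡ c N.+ (j N.+ s)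
  sw = ringN
Rr-ok true (false ∷ bs) p m | inr m' with ∈-map⁻ _ m'
... | (j , cs) , q , refl with Rr-ok true bs (j , cs) q
...   | r = sok (k (shp cs) (il r)) (cong suc (size r)) (cong suc (cols r))
 where
  k : ∀ ys -> IL (cc bs ∷ shp bs) ys -> IL (suc (cc bs) ∷ shp bs) ys
  k (y ∷ ys) (p , q) = M.m≤n⇒m≤1+n p , q

Rr-complete : ∀ b bs ys -> IL (shp (b ∷ bs)) ys -> Σ (ℕ × Bits) \p -> p ∈ Rr b bs × shp (snd p) ≡ ys
Rr-complete true [] (zero ∷ []) _ = _ , here refl , refl
Rr-complete false [] [] _ = _ , here refl , refl
Rr-complete false (c ∷ bs) ys h with Rr-complete c bs ys h
... | (j , cs) , q , e = (j , false ∷ cs) , ∈-map⁺ (\(m , cs) -> m , false ∷ cs) q , e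
Rr-complete true (true ∷ bs) (y ∷ ys) (p , q , h) with Rr-complete true bs ys h
... | (j , cs) , r , e = (j , true ∷ cs) , ∈-map⁺ (\(m , cs) -> m , true ∷ cs) r , cong2 _∷_ (cols (Rr-ok true bs _ r) & M.≤-antisym q p) e
Rr-complete true (false ∷ bs) (y ∷ ys) (p , q , h) with y N.≟ suc (cc bs)
... | yes refl with Rr-complete false bs ys h
...   | (j , cs) , r , e = (j , true ∷ cs) , ∈-++⁺ˡ (∈-map⁺ (\(m , cs) -> m , true ∷ cs) r) , cong2 _∷_ (cols (Rr-ok false bs _ r)) e
Rr-complete true (false ∷ bs) (y ∷ ys) (p , q , h) | no ne with Rr-complete true bs (y ∷ ys) (M.≤-pred (M.≤∧≢⇒< p ne) , q , h)
... | (j , cs) , r , e = (suc j , false ∷ cs) , ∈-++⁺ʳ (map (\(m , cs) -> m , true ∷ cs) (Rr false bs)) (∈-map⁺ (\(m , cs) -> suc m , false ∷ cs) r) , e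

-- In the branching case the first part tells the branches apart: a row step that is put down keeps
-- all its columns, while one that passes a column step has lost a cell.
Rr-inj : ∀ b bs -> Unique (map (\p -> shp (snd p)) (Rr b bs))
Rr-inj b [] = [] ∷ []
Rr-inj false (c ∷ bs) = subst Unique (L.map-cong (\_ -> refl) (Rr c bs) & L.map-∘ (Rr c bs)) (Rr-inj c bs)
Rr-inj true (true ∷ bs) = uniq-map-∷ (Rr true bs) (Rr-inj true bs)
 where
  uniq-map-∷ : ∀ L -> Unique (map (\p -> shp (snd p)) L) -> Unique (map (\p -> shp (snd p)) (map (\(m , cs) -> m , true ∷ cs) L))
  uniq-map-∷ [] [] = []
  uniq-map-∷ (x ∷ L) (a ∷ u') = AllP.map⁺ (AllP.map⁺ (All.map (\ne e -> ne (L.∷-injectiveʳ e)) (AllP.map⁻ a))) ∷ uniq-map-∷ L u'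
Rr-inj true (false ∷ bs) = subst Unique (sym (L.map-++ sh' (map f (Rr false bs)) (map g (Rr true bs))))
 (UP.++⁺ (um (Rr false bs) (Rr-inj false bs)) (subst Unique (L.map-cong (\_ -> refl) (Rr true bs) & L.map-∘ (Rr true bs)) (Rr-inj true bs)) dj)
 where
  sh' : ℕ × Bits -> List ℕ
  sh' p = shp (snd p)
  f g : ℕ × Bits -> ℕ × Bits
  f (m , cs) = m , true ∷ cs
  g (m , cs) = suc m , false ∷ cs
  um : ∀ L -> Unique (map sh' L) -> Unique (map sh' (map f L))
  um [] [] = []
  um (x ∷ L) (a ∷ u') = AllP.map⁺ (AllP.map⁺ (All.map (\ne e -> ne (L.∷-injectiveʳ e)) (AllP.map⁻ a))) ∷ um L u'
  dj : ∀ {e} -> ¬ (e ∈ map sh' (map f (Rr false bs)) × e ∈ map sh' (map g (Rr true bs)))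
  dj (p , q) with ∈-map⁻ sh' p | ∈-map⁻ sh' q
  ... | _ , p' , e1 | _ , q' , e2 with ∈-map⁻ f p' | ∈-map⁻ g q'
  ...   | (i , cs) , r1 , refl | (j , ds) , r2 , refl = M.<-irrefl refl (M.≤-trans (M.≤-reflexive (sym (cols (Rr-ok false bs _ r1)) & cong hd0 (sym e1 & e2))) (hd0-IL (cc bs ∷ shp bs) (shp ds) (il (Rr-ok true bs _ r2))))

strips : Bits -> List (ℕ × Bits)
strips [] = [ (0 , []) ]
strips (b ∷ bs) = Rr b bs

strips-ok : ∀ bs p -> p ∈ strips bs -> StripOK bs p
strips-ok [] p (here refl) = sok tt refl refl
strips-ok (b ∷ bs) p m = Rr-ok b bs p m

all0? : ∀ xs -> Dec (All (_≡ 0) xs)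
all0? = All.all? (\x -> x N.≟ 0)

-- Counts tableaux by peeling off the cells with the largest entry, which form a horizontal strip.
-- The head of the list is the multiplicity of the largest entry.
KBs : List ℕ -> Bits -> ℤ
KBs [] bs = on (all0? (shp bs)) 1z
KBs (a ∷ as) bs = ΣL (strips bs) (\(m , cs) -> on (a N.≟ m) (KBs as cs))

Tab : Set
Tab = List (List ℕ)

CO : List ℕ -> List ℕ -> Set
CO r r' = ∀ c x y -> r !! c ≡ just x -> r' !! c ≡ just y -> x N.< y

Cols : Tab -> Set
Cols (r ∷ r' ∷ T) = CO r r' × Cols (r' ∷ T)
Cols _ = ⊤

one? : {P : Set} -> Dec P -> ℕ
one? (yes _) = 1
one? (no _) = 0

one?-yes : {P : Set} (d : Dec P) -> P -> one? d ≡ 1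
one?-yes (yes _) _ = refl
one?-yes (no np) p = absurd (np p)

one?-no : {P : Set} (d : Dec P) -> ¬ P -> one? d ≡ 0
one?-no (yes p) np = absurd (np p)
one?-no (no _) _ = refl

cnt : ℕ -> List ℕ -> ℕ
cnt i [] = 0
cnt i (x ∷ xs) = one? (x N.≟ i) N.+ cnt i xs

Inc : List ℕ -> Set
Inc = Linked N._≤_

ext' : ℕ -> List ℕ -> Tab -> Tab
ext' j (l ∷ μ) (r ∷ T) = (r ++ replicate (l N.∸ length r) j) ∷ ext' j μ T
ext' j _ _ = []

lo : ℕ -> List ℕ -> List ℕ
lo j [] = []
lo j (x ∷ xs) with x N.<? j
... | yes _ = x ∷ lo j xs
... | no _ = []

record SS (α : ℕ -> ℕ) (j : ℕ) (μ : List ℕ) (T : Tab) : Set where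
 constructor ssm
 field
  shape : map length T ≡ μ
  rows : All Inc T
  colsT : Cols T
  small : All (All (N._< j)) T
  cont : ∀ i -> i N.< j -> cnt i (concat T) ≡ α i
open SS

cnt-++ : ∀ i xs ys -> cnt i (xs ++ ys) ≡ cnt i xs N.+ cnt i ys
cnt-++ i [] ys = refl
cnt-++ i (x ∷ xs) ys = cong (one? (x N.≟ i) N.+_) (cnt-++ i xs ys) & sym (M.+-assoc (one? (x N.≟ i)) _ _)

cnt-rep : ∀ i m j -> i ≢ j -> cnt i (replicate m j) ≡ 0
cnt-rep i zero j ne = refl
cnt-rep i (suc m) j ne = cong2 N._+_ (one?-no (j N.≟ i) (ne ∘ sym)) (cnt-rep i m j ne)

cnt-rep= : ∀ m j -> cnt j (replicate m j) ≡ m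
cnt-rep= zero j = refl
cnt-rep= (suc m) j = cong2 N._+_ (one?-yes (j N.≟ j) refl) (cnt-rep= m j)

cnt-small : ∀ j xs -> All (N._< j) xs -> cnt j xs ≡ 0
cnt-small j [] _ = refl
cnt-small j (x ∷ xs) (p ∷ ps) = cong2 N._+_ (one?-no (x N.≟ j) (M.<⇒≢ p)) (cnt-small j xs ps)

lo-small : ∀ j xs -> All (N._< j) (lo j xs)
lo-small j [] = []
lo-small j (x ∷ xs) with x N.<? j
... | yes p = p ∷ lo-small j xs
... | no _ = []

lo-ext : ∀ j r m -> All (N._< j) r -> lo j (r ++ replicate m j) ≡ r
lo-ext j [] zero _ = refl
lo-ext j [] (suc m) _ with j N.<? j
... | yes p = absurd (M.<-irrefl refl p)
... | no _ = refl
lo-ext j (x ∷ r) m (p ∷ ps) with x N.<? j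
... | yes _ = cong (x ∷_) (lo-ext j r m ps)
... | no ¬p = absurd (¬p p)

lo-split : ∀ j xs -> Inc xs -> All (N._< suc j) xs -> xs ≡ lo j xs ++ replicate (length xs N.∸ length (lo j xs)) j
lo-split j [] _ _ = refl
lo-split j (x ∷ xs) s (p ∷ ps) with x N.<? j
... | yes _ = cong (x ∷_) (lo-split j xs (Linked.tail s) ps)
... | no np = cong2 _∷_ x≡ (rest x xs x≡ s ps)
 where
  x≡ = M.≤-antisym (M.≤-pred p) (M.≮⇒≥ np)
  rest : ∀ x xs -> x ≡ j -> Inc (x ∷ xs) -> All (N._< suc j) xs -> xs ≡ replicate (length xs) j
  rest x [] e s _ = refl
  rest x (y ∷ ys) refl (h Linked.∷ s) (q ∷ qs) = let e = M.≤-antisym (M.≤-pred q) h in cong2 _∷_ e (rest y ys e s qs)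

lo-len : ∀ j xs -> length (lo j xs) N.≤ length xs
lo-len j [] = z≤n
lo-len j (x ∷ xs) with x N.<? j
... | yes _ = s≤s (lo-len j xs)
... | no _ = z≤n

!!-< : ∀ (xs : List ℕ) c -> c N.< length xs -> Σ ℕ \x -> xs !! c ≡ just x
!!-< (x ∷ xs) zero _ = x , refl
!!-< (x ∷ xs) (suc c) (s≤s h) = !!-< xs c h

<-!! : ∀ (xs : List ℕ) c {x} -> xs !! c ≡ just x -> c N.< length xs
<-!! (x ∷ xs) zero e = s≤s z≤n
<-!! (x ∷ xs) (suc c) e = s≤s (<-!! xs c e)

All-!! : {P : ℕ -> Set} -> ∀ xs c {x} -> All P xs -> xs !! c ≡ just x -> P x
All-!! (x ∷ xs) zero (p ∷ _) refl = p
All-!! (x ∷ xs) (suc c) (_ ∷ ps) e = All-!! xs c ps e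

!!-++ˡ : ∀ (xs ys : List ℕ) c -> c N.< length xs -> (xs ++ ys) !! c ≡ xs !! c
!!-++ˡ (x ∷ xs) ys zero _ = refl
!!-++ˡ (x ∷ xs) ys (suc c) (s≤s h) = !!-++ˡ xs ys c h

lo-reach : ∀ j xs c {x} -> Inc xs -> xs !! c ≡ just x -> x N.< j -> c N.< length (lo j xs)
lo-reach j (x ∷ xs) c s e h with x N.<? j
lo-reach j (x ∷ xs) zero s e h | yes _ = s≤s z≤n
lo-reach j (x ∷ xs) (suc c) s e h | yes _ = s≤s (lo-reach j xs c (Linked.tail s) e h)
... | no np = absurd (np (M.≤-<-trans (mono x xs c s e) h))
 where
  mono : ∀ x xs c {y} -> Inc (x ∷ xs) -> (x ∷ xs) !! c ≡ just y -> x N.≤ y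
  mono x xs zero s refl = M.≤-refl
  mono x (z ∷ xs) (suc c) (h Linked.∷ s) e = M.≤-trans h (mono z xs c s e)

lo-of-!! : ∀ j xs c {x} -> lo j xs !! c ≡ just x -> xs !! c ≡ just x
lo-of-!! j (x ∷ xs) c e with x N.<? j
lo-of-!! j (x ∷ xs) zero e | yes _ = e
lo-of-!! j (x ∷ xs) (suc c) e | yes _ = lo-of-!! j xs c e

lo-Inc : ∀ j xs -> Inc xs -> Inc (lo j xs)
lo-Inc j [] s = Linked.[]
lo-Inc j (x ∷ xs) s with x N.<? j
lo-Inc j (x ∷ []) s | yes _ = Linked.[-]
lo-Inc j (x ∷ y ∷ xs) (h Linked.∷ s) | yes _ with y N.<? j | lo-Inc j (y ∷ xs) s
... | yes _ | s' = h Linked.∷ s'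
... | no _ | _ = Linked.[-]
lo-Inc j (x ∷ xs) s | no _ = Linked.[]

Inc-ext : ∀ j r m -> Inc r -> All (N._< j) r -> Inc (r ++ replicate m j)
Inc-ext j [] zero _ _ = Linked.[]
Inc-ext j [] (suc zero) _ _ = Linked.[-]
Inc-ext j [] (suc (suc m)) _ _ = M.≤-refl Linked.∷ Inc-ext j [] (suc m) Linked.[] []
Inc-ext j (x ∷ []) zero s _ = Linked.[-]
Inc-ext j (x ∷ []) (suc m) s (p ∷ _) = M.<⇒≤ p Linked.∷ Inc-ext j [] (suc m) Linked.[] []
Inc-ext j (x ∷ y ∷ r) m (h Linked.∷ s) (_ ∷ ps) = h Linked.∷ Inc-ext j (y ∷ r) m s ps

Decr : List ℕ -> Set
Decr (x ∷ y ∷ xs) = y N.≤ x × Decr (y ∷ xs)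
Decr _ = ⊤

module _ (α : ℕ -> ℕ) (j : ℕ) where

 ext-cnt : ∀ μ μ' T -> IL μ μ' -> map length T ≡ μ' -> All (All (N._< j)) T -> cnt j (concat (ext' j μ T)) N.+ sumL μ' ≡ sumL μ
 ext-cnt [] [] [] _ _ _ = refl
 ext-cnt (x ∷ μ) (_ ∷ μ') (r ∷ T) (p , _ , h) refl (s ∷ ss) = cong (N._+ (length r N.+ sumL μ')) ((cnt-++ j (r ++ replicate (x N.∸ length r) j) _) & cong (N._+ cnt j (concat (ext' j μ T))) ((cnt-++ j r _) & (cong2 N._+_ (cnt-small j r s) (cnt-rep= (x N.∸ length r) j)))) &
  (inter' (x N.∸ length r) _ (length r) (sumL μ')) & (cong2 N._+_ (M.m∸n+n≡m p) (ext-cnt μ μ' T h refl ss))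
  where
   inter' : ∀ a b c d -> (a N.+ b) N.+ (c N.+ d) ≡ (a N.+ c) N.+ (b N.+ d)
   inter' = ringN

 ext-SS : ∀ μ μ' T -> IL μ μ' -> α j N.+ sumL μ' ≡ sumL μ -> SS α j μ' T -> SS α (suc j) μ (ext' j μ T)
 ext-SS μ μ' T h sz (ssm sh rw cl sm ct) = ssm (shp' μ μ' T h sh) (rws μ μ' T h sh rw sm) (cls μ μ' T h sh cl sm) (sml μ μ' T h sh sm) cnt'
  where
   shp' : ∀ μ μ' T -> IL μ μ' -> map length T ≡ μ' -> map length (ext' j μ T) ≡ μ
   shp' [] [] [] _ _ = refl
   shp' (x ∷ μ) (_ ∷ μ') (r ∷ T) (p , _ , h) refl = cong2 _∷_ (L.length-++ r & cong (length r N.+_) (L.length-replicate _) & M.m+[n∸m]≡n p) (shp' μ μ' T h refl)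
   rws : ∀ μ μ' T -> IL μ μ' -> map length T ≡ μ' -> All Inc T -> All (All (N._< j)) T -> All Inc (ext' j μ T)
   rws [] [] [] _ _ _ _ = []
   rws (x ∷ μ) (_ ∷ μ') (r ∷ T) (_ , _ , h) refl (i ∷ is) (s ∷ ss) = Inc-ext j r _ i s ∷ rws μ μ' T h refl is ss
   sml : ∀ μ μ' T -> IL μ μ' -> map length T ≡ μ' -> All (All (N._< j)) T -> All (All (N._< suc j)) (ext' j μ T)
   sml [] [] [] _ _ _ = []
   sml (x ∷ μ) (_ ∷ μ') (r ∷ T) (_ , _ , h) refl (s ∷ ss) = AllP.++⁺ (All.map M.m≤n⇒m≤1+n s) (AllP.replicate⁺ _ (M.n<1+n j)) ∷ sml μ μ' T h refl ss
   cls : ∀ μ μ' T -> IL μ μ' -> map length T ≡ μ' -> Cols T -> All (All (N._< j)) T -> Cols (ext' j μ T)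
   cls [] [] [] _ _ _ _ = tt
   cls (x ∷ []) (_ ∷ []) (r ∷ []) _ refl _ _ = tt
   cls (x ∷ y ∷ μ) (_ ∷ μ') (r ∷ r' ∷ T) (_ , q , h@(p' , _)) refl (c , cl) (s ∷ s' ∷ ss) = co , cls (y ∷ μ) μ' (r' ∷ T) h refl cl (s' ∷ ss)
    where
     co : CO (r ++ replicate (x N.∸ length r) j) (r' ++ replicate (y N.∸ length r') j)
     co i u' w e e' = k (i N.<? length r')
      where
       i<r : i N.< length r
       i<r = M.<-≤-trans (M.<-≤-trans (<-!! (r' ++ replicate (y N.∸ length r') j) i e') (M.≤-reflexive (L.length-++ r' & cong (length r' N.+_) (L.length-replicate (y N.∸ length r')) & M.m+[n∸m]≡n p'))) q
       er : r !! i ≡ just u'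
       er = sym (!!-++ˡ r _ i i<r) & e
       rep : ∀ r i {w} m -> ¬ i N.< length r -> (r ++ replicate m j) !! i ≡ just w -> w ≡ j
       rep [] zero (suc m) _ refl = refl
       rep [] (suc i) (suc m) h e = rep [] i m (\()) e
       rep (x ∷ r) zero m h e = absurd (h (s≤s z≤n))
       rep (x ∷ r) (suc i) m h e = rep r i m (h ∘ s≤s) e
       k : Dec (i N.< length r') -> u' N.< w
       k (yes l) = c i u' w er (sym (!!-++ˡ r' _ i l) & e')
       k (no l) = subst (u' N.<_) (sym (rep r' i _ l e')) (All-!! r i s er)
   cx : ∀ i μ μ' T -> i ≢ j -> IL μ μ' -> map length T ≡ μ' -> cnt i (concat (ext' j μ T)) ≡ cnt i (concat T)
   cx i [] [] [] _ _ _ = refl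
   cx i (x ∷ μ) (_ ∷ μ') (r ∷ T) ne (_ , _ , h) refl = (cnt-++ i (r ++ replicate (x N.∸ length r) j) _) & (cong2 N._+_ ((cnt-++ i r _) & cong (cnt i r N.+_) (cnt-rep i (x N.∸ length r) j ne) & (M.+-identityʳ _)) (cx i μ μ' T ne h refl)) & sym (cnt-++ i r (concat T))
   cnt' : ∀ i -> i N.< suc j -> cnt i (concat (ext' j μ T)) ≡ α i
   cnt' i lt with i N.≟ j
   ... | yes refl = M.+-cancelʳ-≡ (sumL μ') _ _ (ext-cnt μ μ' T h sh sm & sym sz)
   ... | no ne = cx i μ μ' T ne h sh & ct i (M.≤∧≢⇒< (M.≤-pred lt) ne)

 rs' : Tab -> Tab
 rs' = map (lo j)

 rs-ext : ∀ μ μ' T -> IL μ μ' -> map length T ≡ μ' -> All (All (N._< j)) T -> rs' (ext' j μ T) ≡ T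
 rs-ext [] [] [] _ _ _ = refl
 rs-ext (x ∷ μ) (_ ∷ μ') (r ∷ T) (_ , _ , h) refl (s ∷ ss) = cong2 _∷_ (lo-ext j r _ s) (rs-ext μ μ' T h refl ss)

 ext-rs : ∀ μ T -> map length T ≡ μ -> All Inc T -> All (All (N._< suc j)) T -> ext' j μ (rs' T) ≡ T
 ext-rs _ [] refl _ _ = refl
 ext-rs _ (r ∷ T) refl (i ∷ is) (s ∷ ss) = cong2 _∷_ (sym (lo-split j r i s)) (ext-rs _ T refl is ss)

 -- Suppose a row had fewer entries below j than the next row has cells. Column strictness at the
 -- first place in question would make the upper entry less than j, so it would have been kept.
 rs-IL : ∀ T -> Decr (map length T) -> All Inc T -> Cols T -> All (All (N._< suc j)) T -> IL (map length T) (map length (rs' T))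
 rs-IL [] _ _ _ _ = tt
 rs-IL (r ∷ []) _ _ _ _ = lo-len j r , z≤n , tt
 rs-IL (r ∷ r' ∷ T) (d , ds) (i ∷ is) (c , cl) (s ∷ s' ∷ ss) = lo-len j r , M.≮⇒≥ bad , rs-IL (r' ∷ T) ds is cl (s' ∷ ss)
  where
   bad : ¬ length (lo j r) N.< length r'
   bad lt with !!-< r' (length (lo j r)) lt | !!-< r (length (lo j r)) (M.<-≤-trans lt d)
   ... | y , ey | x , ex = M.<-irrefl refl (lo-reach j r _ i ex (M.<-≤-trans (c _ x y ex ey) (M.≤-pred (All-!! r' _ s' ey))))

 rs-SS : ∀ T -> All Inc T -> Cols T -> (∀ i -> i N.< suc j -> cnt i (concat T) ≡ α i) -> SS α j (map length (rs' T)) (rs' T)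
 rs-SS T rw cl ct = ssm refl (rws T rw) (cls T cl) (sml T) \i lt -> cx i lt T rw & ct i (M.m≤n⇒m≤1+n lt)
  where
   rws : ∀ T -> All Inc T -> All Inc (rs' T)
   rws [] _ = []
   rws (r ∷ T) (i ∷ is) = lo-Inc j r i ∷ rws T is
   sml : ∀ T -> All (All (N._< j)) (rs' T)
   sml [] = []
   sml (r ∷ T) = lo-small j r ∷ sml T
   cls : ∀ T -> Cols T -> Cols (rs' T)
   cls [] _ = tt
   cls (r ∷ []) _ = tt
   cls (r ∷ r' ∷ T) (c , cl) = (\i x y e e' -> c i x y (lo-of-!! j r i e) (lo-of-!! j r' i e')) , cls (r' ∷ T) cl
   cr : ∀ i -> i N.< j -> ∀ r -> Inc r -> cnt i (lo j r) ≡ cnt i r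
   hi : ∀ i x r -> i N.< x -> Inc (x ∷ r) -> cnt i r ≡ 0
   hi i x [] lt _ = refl
   hi i x (y ∷ r) lt (h Linked.∷ s) = cong2 N._+_ (one?-no (y N.≟ i) (\e -> M.<-irrefl (sym e) (M.<-≤-trans lt h))) (hi i y r (M.<-≤-trans lt h) s)
   cr i lt [] _ = refl
   cr i lt (x ∷ r) s with x N.<? j
   ... | yes _ = cong (one? (x N.≟ i) N.+_) (cr i lt r (Linked.tail s))
   ... | no np = let i<x = M.<-≤-trans lt (M.≮⇒≥ np) in sym (cong2 N._+_ (one?-no (x N.≟ i) (\e -> M.<-irrefl (sym e) i<x)) (hi i x r i<x s))
   cx : ∀ i -> i N.< j -> ∀ T -> All Inc T -> cnt i (concat (rs' T)) ≡ cnt i (concat T)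
   cx i lt [] _ = refl
   cx i lt (r ∷ T) (p ∷ ps) = (cnt-++ i (lo j r) _) & (cong2 N._+_ (cr i lt r p) (cx i lt T ps)) & sym (cnt-++ i r _)


-- Empty rows. `lam` retains the zeros of the code, and a tableau must have a row for each of its
-- parts.
zs : ℕ -> List ℕ
zs N = replicate N 0

hd0-zs : ∀ N -> hd0 (zs N) ≡ 0
hd0-zs zero = refl
hd0-zs (suc N) = refl

hd0-pad : ∀ N xs -> hd0 (xs ++ zs N) ≡ hd0 xs
hd0-pad N [] = hd0-zs N
hd0-pad N (x ∷ xs) = refl

IL-pad : ∀ N xs ys -> IL xs ys -> IL (xs ++ zs N) (ys ++ zs N)
IL-pad zero [] [] _ = tt
IL-pad (suc N) [] [] _ = z≤n , M.≤-reflexive (hd0-zs N) , IL-pad N [] [] tt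
IL-pad N (x ∷ xs) (y ∷ ys) (p , q , h) = p , subst (N._≤ y) (sym (hd0-pad N xs)) q , IL-pad N xs ys h

IL-unpad : ∀ N xs w -> IL (xs ++ zs N) w -> Σ (List ℕ) \ys -> IL xs ys × w ≡ ys ++ zs N
IL-unpad zero [] [] _ = [] , tt , refl
IL-unpad (suc N) [] (zero ∷ w) (z≤n , _ , h) with IL-unpad N [] w h
... | [] , _ , e = [] , tt , cong (0 ∷_) e
IL-unpad N (x ∷ xs) (y ∷ w) (p , q , h) with IL-unpad N xs w h
... | ys , i , e = y ∷ ys , (p , subst (N._≤ y) (hd0-pad N xs) q , i) , cong (y ∷_) e

sumL-pad : ∀ N xs -> sumL (xs ++ zs N) ≡ sumL xs
sumL-pad zero [] = refl
sumL-pad (suc N) [] = sumL-pad N []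
sumL-pad N (x ∷ xs) = cong (x N.+_) (sumL-pad N xs)

Decr-cons : ∀ x xs -> hd0 xs N.≤ x -> Decr xs -> Decr (x ∷ xs)
Decr-cons x [] _ _ = tt
Decr-cons x (y ∷ xs) p d = p , d

Decr-shp : ∀ N bs -> Decr (shp bs ++ zs N)
Decr-shp zero [] = tt
Decr-shp (suc N) [] = Decr-cons 0 (zs N) (M.≤-reflexive (hd0-zs N)) (Decr-shp N [])
Decr-shp N (true ∷ bs) = Decr-cons (cc bs) _ (subst (N._≤ cc bs) (sym (hd0-pad N (shp bs))) (hd0≤ bs)) (Decr-shp N bs)
Decr-shp N (false ∷ bs) = Decr-shp N bs

strips-inj : ∀ bs -> Unique (map (\p -> shp (snd p)) (strips bs))
strips-inj [] = [] ∷ []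
strips-inj (b ∷ bs) = Rr-inj b bs

inj-of : {A B : Set} (f : A -> B) (xs : List A) -> Unique (map f xs) -> ∀ {x y} -> x ∈ xs -> y ∈ xs -> f x ≡ f y -> x ≡ y
inj-of f (_ ∷ xs) (a ∷ u') (here refl) (here refl) _ = refl
inj-of f (_ ∷ xs) (a ∷ u') (here refl) (there q) e = absurd (All.lookup a (∈-map⁺ f q) e)
inj-of f (_ ∷ xs) (a ∷ u') (there p) (here refl) e = absurd (All.lookup a (∈-map⁺ f p) (sym e))
inj-of f (_ ∷ xs) (a ∷ u') (there p) (there q) e = inj-of f xs u' p q e

uniq-of : {A B : Set} (f : A -> B) (xs : List A) -> Unique (map f xs) -> Unique xs
uniq-of f [] _ = []
uniq-of f (x ∷ xs) (a ∷ u') = All.map (\ne e -> ne (cong f e)) (AllP.map⁻ a) ∷ uniq-of f xs u'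

strips-complete : ∀ bs ys -> IL (shp bs) ys -> Σ (ℕ × Bits) \p -> p ∈ strips bs × shp (snd p) ≡ ys
strips-complete [] [] _ = _ , here refl , refl
strips-complete (b ∷ bs) ys h = Rr-complete b bs ys h

module _ (α : ℕ -> ℕ) (N : ℕ) where

 alist : ℕ -> List ℕ
 alist zero = []
 alist (suc j) = α j ∷ alist j

 empty : List ℕ -> Tab
 empty = map (\_ -> [])

 -- Deleting the entries j from a tableau with entries at most j leaves a tableau with entries below
 -- j on an interlacing shape, and `ext'` puts them back at the ends of the rows. The interlacing
 -- shapes are those listed by `strips`, each once.
 SS-count : ∀ j bs -> Σ ℕ \m -> HasCard (SS α j (shp bs ++ zs N)) m × + m ≡ KBs (alist j) bs
 SS-count zero bs = k (all0? (shp bs))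
  where
   μ̂ = shp bs ++ zs N
   E0' : ∀ μ -> All (_≡ 0) μ -> SS α 0 μ (empty μ)
   E0' μ z = ssm (sh μ z) (AllP.map⁺ (All.universal (\_ -> Linked.[]) μ)) (cl μ) (AllP.map⁺ (All.universal (\_ -> []) μ)) (\i ())
    where
     sh : ∀ μ -> All (_≡ 0) μ -> map length (empty μ) ≡ μ
     sh [] _ = refl
     sh (_ ∷ μ) (refl ∷ z) = cong (0 ∷_) (sh μ z)
     cl : ∀ μ -> Cols (empty μ)
     cl [] = tt
     cl (x ∷ []) = tt
     cl (x ∷ y ∷ μ) = (\c x y ()) , cl (y ∷ μ)
   T≡ : ∀ T -> All (All (N._< 0)) T -> T ≡ empty (map length T) × All (_≡ 0) (map length T)
   T≡ [] _ = refl , []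
   T≡ ([] ∷ T) (_ ∷ s) = cong ([] ∷_) (fst (T≡ T s)) , refl ∷ snd (T≡ T s)
   T≡ ((_ ∷ _) ∷ T) ((() ∷ _) ∷ s)
   k : (d : Dec (All (_≡ 0) (shp bs))) -> Σ ℕ \m -> HasCard (SS α 0 μ̂) m × + m ≡ on d 1z
   k (yes z) = 1 , ([ empty μ̂ ] , [] ∷ [] , (\T -> (\ { (here refl) -> E0' μ̂ (AllP.++⁺ z (AllP.replicate⁺ N refl)) }) ,
    \s -> here (fst (T≡ T (small s)) & cong empty (shape s))) , refl) , refl
   k (no nz) = 0 , ([] , [] , (\T -> (\()) , \s -> absurd (nz (AllP.++⁻ˡ (shp bs) (subst (All (_≡ 0)) (shape s) (snd (T≡ T (small s))))))) , refl) , refl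
 SS-count (suc j) bs = fst con , hc-bij F' G' fwd bwd (fst (snd con)) , snd (snd con) & Σ-cong L (\p -> snd (snd (SS-count j (snd p)))) & Σ-filter (\p -> α j N.≟ fst p) (strips bs) (\p -> KBs (alist j) (snd p))
  where
   μ̂ = shp bs ++ zs N
   pd : ℕ × Bits -> List ℕ
   pd p = shp (snd p) ++ zs N
   L = filter (\p -> α j N.≟ fst p) (strips bs)
   L⊆ : ∀ {p} -> p ∈ L -> p ∈ strips bs × α j ≡ fst p
   L⊆ = ∈-filter⁻ (\p -> α j N.≟ fst p) {xs = strips bs}
   con = hc-concat L (UP.filter⁺ (\p -> α j N.≟ fst p) (uniq-of (\p -> shp (snd p)) (strips bs) (strips-inj bs))) (\p T -> SS α j (pd p) T)
    (\p -> fst (SS-count j (snd p))) (\p -> fst (snd (SS-count j (snd p)))) (\p T -> pd p , T)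
    (\p p' T T' m m' e -> inj-of (\p -> shp (snd p)) (strips bs) (strips-inj bs) (fst (L⊆ m)) (fst (L⊆ m')) (L.++-cancelʳ (zs N) (shp (snd p)) (shp (snd p')) (cong fst e)) , cong snd e)
   Pr = \(c : List ℕ × Tab) -> Σ (ℕ × Bits) \p -> Σ Tab \T -> p ∈ L × SS α j (pd p) T × c ≡ (pd p , T)
   F' : List ℕ × Tab -> Tab
   F' (_ , T) = ext' j μ̂ T
   G' : Tab -> List ℕ × Tab
   G' T = map length (rs' α j T) , rs' α j T
   fwd : ∀ c -> Pr c -> SS α (suc j) μ̂ (F' c) × G' (F' c) ≡ c
   fwd _ (p , T , m , s , refl) = ext-SS α j μ̂ (pd p) T il' ((cong2 N._+_ (snd (L⊆ m)) (sumL-pad N (shp (snd p)))) & size ok & sym (sumL-pad N (shp bs))) s ,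
    cong2 _,_ (cong (map length) re & shape s) re
    where
     ok = strips-ok bs p (fst (L⊆ m))
     il' = IL-pad N (shp bs) (shp (snd p)) (il ok)
     re = rs-ext α j μ̂ (pd p) T il' (shape s) (small s)
   bwd : ∀ T -> SS α (suc j) μ̂ T -> Pr (G' T) × F' (G' T) ≡ T
   bwd T s = ((p , rs' α j T , ∈-filter⁺ (\p -> α j N.≟ fst p) p∈ (M.+-cancelʳ-≡ (sumL (shp (snd p))) _ _ (sz & sym (size (strips-ok bs p p∈)))) , subst (\μ -> SS α j μ (rs' α j T)) ey r , cong2 _,_ ey refl)) , er
    where
     r = rs-SS α j T (rows s) (colsT s) (cont s)
     er = ext-rs α j μ̂ T (shape s) (rows s) (small s)
     i0 : IL μ̂ (map length (rs' α j T))
     i0 = subst (\μ -> IL μ (map length (rs' α j T))) (shape s) (rs-IL α j T (subst Decr (sym (shape s)) (Decr-shp N bs)) (rows s) (colsT s) (small s))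
     up' = IL-unpad N (shp bs) _ i0
     sc = strips-complete bs (fst up') (fst (snd up'))
     p = fst sc
     p∈ = fst (snd sc)
     ey : map length (rs' α j T) ≡ pd p
     ey = snd (snd up') & cong (_++ zs N) (sym (snd (snd sc)))
     sz : α j N.+ sumL (shp (snd p)) ≡ sumL (shp bs)
     sz = (cong2 N._+_ (sym (cong (cnt j ∘ concat) er & cont s j (M.n<1+n j))) (sym (cong sumL ey & sumL-pad N (shp (snd p))))) & (ext-cnt α j μ̂ (map length (rs' α j T)) (rs' α j T) i0 refl (small r)) & sumL-pad N (shp bs)

-- From tableaux of natural numbers to the tableaux of the statement.

nth : List ℕ -> ℕ -> ℕ
nth [] _ = 0
nth (x ∷ xs) zero = x
nth (x ∷ xs) (suc i) = nth xs i

nth-lookup : ∀ {K} (a : Vec ℕ K) m -> nth (toList a) (toℕ m) ≡ lookup a m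
nth-lookup (x ∷ a) Fin.zero = refl
nth-lookup (x ∷ a) (Fin.suc m) = nth-lookup a m

alist-reverse : ∀ N xs -> alist (nth xs) N (length xs) ≡ reverse xs
alist-reverse N [] = refl
alist-reverse N (x ∷ xs) = sn (length xs) & cong (_++ [ x ]) (alist-reverse N xs) & sym (L.unfold-reverse x xs)
 where
  sn : ∀ j -> alist (nth (x ∷ xs)) N (suc j) ≡ alist (nth xs) N j ++ [ x ]
  sn zero = refl
  sn (suc j) = cong (nth xs j ∷_) (sn j)

module _ (K : ℕ) where

 down : List ℕ -> List (Fin K)
 down [] = []
 down (x ∷ xs) with x N.<? K
 ... | yes p = fromℕ< p ∷ down xs
 ... | no _ = down xs

 down-up : ∀ xs -> down (map toℕ xs) ≡ xs
 down-up [] = refl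
 down-up (x ∷ xs) with toℕ x N.<? K
 ... | yes p = cong2 _∷_ (FinP.fromℕ<-toℕ x p) (down-up xs)
 ... | no np = absurd (np (FinP.toℕ<n x))

 up-down : ∀ xs -> All (N._< K) xs -> map toℕ (down xs) ≡ xs
 up-down [] _ = refl
 up-down (x ∷ xs) (p ∷ ps) with x N.<? K
 ... | yes q = cong2 _∷_ (FinP.toℕ-fromℕ< q) (up-down xs ps)
 ... | no np = absurd (np p)

 upT : List (List (Fin K)) -> Tab
 upT = map (map toℕ)

 ups-down : ∀ T -> All (All (N._< K)) T -> upT (map down T) ≡ T
 ups-down [] _ = refl
 ups-down (r ∷ T) (p ∷ ps) = cong2 _∷_ (up-down r p) (ups-down T ps)

 !!-up : ∀ (xs : List (Fin K)) c {y} -> map toℕ xs !! c ≡ just y -> Σ (Fin K) \x -> xs !! c ≡ just x × toℕ x ≡ y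
 !!-up (x ∷ xs) zero refl = x , refl , refl
 !!-up (x ∷ xs) (suc c) e = !!-up xs c e

 up-!! : ∀ (xs : List (Fin K)) c {x} -> xs !! c ≡ just x -> map toℕ xs !! c ≡ just (toℕ x)
 up-!! (x ∷ xs) zero refl = refl
 up-!! (x ∷ xs) (suc c) e = up-!! xs c e

 ColsF : List (List (Fin K)) -> Set
 ColsF T = ∀ r c x y -> entry T r c ≡ just x -> entry T (suc r) c ≡ just y -> x Fin.< y

 cols-up : ∀ T -> ColsF T -> Cols (upT T)
 cols-up [] h = tt
 cols-up (r ∷ []) h = tt
 cols-up (r ∷ r' ∷ T) h = (\c x y e e' -> let (x' , ex , q) = !!-up r c e ; (y' , ey , q') = !!-up r' c e' in subst2 N._<_ q q' (h 0 c x' y' ex ey)) , cols-up (r' ∷ T) (\r c -> h (suc r) c)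

 up-cols : ∀ T -> Cols (upT T) -> ColsF T
 up-cols (r ∷ []) h zero c x y e ()
 up-cols (r ∷ []) h (suc i) c x y ()
 up-cols (r ∷ r' ∷ T) (h , hs) zero c x y e e' = h c (toℕ x) (toℕ y) (up-!! r c e) (up-!! r' c e')
 up-cols (r ∷ r' ∷ T) (h , hs) (suc i) = up-cols (r' ∷ T) hs i

 cnt-filter : ∀ (m : Fin K) xs -> length (filter (\x -> x Fin.≟ m) xs) ≡ cnt (toℕ m) (map toℕ xs)
 cnt-filter m [] = refl
 cnt-filter m (x ∷ xs) = k (x Fin.≟ m)
  where
   k : Dec (x ≡ m) -> length (filter (\x -> x Fin.≟ m) (x ∷ xs)) ≡ cnt (toℕ m) (map toℕ (x ∷ xs))
   k (yes p) = cong length (L.filter-accept (\x -> x Fin.≟ m) p) & cong suc (cnt-filter m xs) & cong (N._+ cnt (toℕ m) (map toℕ xs)) (sym (one?-yes (toℕ x N.≟ toℕ m) (cong toℕ p)))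
   k (no p) = cong length (L.filter-reject (\x -> x Fin.≟ m) p) & cnt-filter m xs & cong (N._+ cnt (toℕ m) (map toℕ xs)) (sym (one?-no (toℕ x N.≟ toℕ m) (\e -> p (FinP.toℕ-injective e))))

 SS→SSYT : ∀ (a : Vec ℕ K) μ T -> SS (nth (toList a)) K μ (upT T) -> SSYT K μ T × Content K T a
 SS→SSYT a μ T (ssm sh rw cl sm ct) = ((L.map-cong (\r -> sym (L.length-map toℕ r)) T & L.map-∘ T) & sh , All.map LinkedP.map⁻ (AllP.map⁻ rw) , up-cols T cl) ,
  \m -> cnt-filter m (concat T) & cong (cnt (toℕ m)) (sym (L.concat-map T)) & ct (toℕ m) (FinP.toℕ<n m) & nth-lookup a m

 SSYT→SS : ∀ (a : Vec ℕ K) μ T -> SSYT K μ T × Content K T a -> SS (nth (toList a)) K μ (upT T)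
 SSYT→SS a μ T ((sh , rw , cl) , ct) = ssm (sym (L.map-cong (\r -> sym (L.length-map toℕ r)) T & L.map-∘ T) & sh) (AllP.map⁺ (All.map LinkedP.map⁺ rw)) (cols-up T cl)
  (AllP.map⁺ (All.universal (\r -> AllP.map⁺ (All.universal FinP.toℕ<n r)) T))
  \i lt -> cong (cnt i) (L.concat-map T) & subst (\i -> cnt i (map toℕ (concat T)) ≡ nth (toList a) i) (FinP.toℕ-fromℕ< lt)
   (sym (cnt-filter (fromℕ< lt) (concat T)) & ct (fromℕ< lt) & sym (nth-lookup a (fromℕ< lt)))

 Kostka-KBs : ∀ N bs (a : Vec ℕ K) m -> Kostka K (shp bs ++ zs N) a m -> + m ≡ KBs (reverse (toList a)) bs
 Kostka-KBs N bs a m h = (cong +_ (hc-unique h (hc-bij (map down) upT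
  (\T s -> SS→SSYT a _ (map down T) (subst (SS (nth (toList a)) K _) (sym (ups-down T (small s))) s) , ups-down T (small s))
  (\T s -> SSYT→SS a _ T s , sym (L.map-∘ T) & L.map-cong down-up T & L.map-id T) (fst (snd sc))))) &
  snd (snd sc) & cong (\as -> KBs as bs) (cong (alist (nth (toList a)) N) (sym (VecP.length-toList a)) & alist-reverse N (toList a))
  where
   sc = SS-count (nth (toList a)) N K bs

-- Grassmannian permutations

sortDesc-↭ : ∀ n {{_ : NonZero n}} xs -> sortDesc n xs ↭ xs
sortDesc-↭ n [] = Perm.refl
sortDesc-↭ n (x ∷ xs) = Perm.trans (ins (sortDesc n xs)) (Perm.prep x (sortDesc-↭ n xs))
 where
  ins : ∀ ys -> insertDesc n x ys ↭ x ∷ ys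
  ins [] = Perm.refl
  ins (y ∷ ys) with y N.≤? x
  ... | yes _ = Perm.refl
  ... | no _ = Perm.trans (Perm.prep y (ins ys)) (Perm.swap y x Perm.refl)

Desc-List : List ℕ -> Set
Desc-List = Linked N._≥_

sortDesc-sorted : ∀ n {{_ : NonZero n}} xs -> Desc-List (sortDesc n xs)
sortDesc-sorted n [] = Linked.[]
sortDesc-sorted n (x ∷ xs) = ins (sortDesc n xs) (sortDesc-sorted n xs)
 where
  ins : ∀ ys -> Desc-List ys -> Desc-List (insertDesc n x ys)
  ins [] _ = Linked.[-]
  ins (y ∷ ys) s with y N.≤? x
  ... | yes p = p Linked.∷ s
  ins (y ∷ []) s | no p = M.≰⇒≥ p Linked.∷ Linked.[-]
  ins (y ∷ z ∷ ys) (q Linked.∷ s) | no p with z N.≤? x | ins (z ∷ ys) s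
  ... | yes _ | h = M.≰⇒≥ p Linked.∷ h
  ... | no _ | h = q Linked.∷ h

sortDesc-unique : ∀ n {{_ : NonZero n}} xs ys -> xs ↭ ys -> Decr ys -> sortDesc n xs ≡ ys
sortDesc-unique n xs ys p d = Pointwise-≡⇒≡ (↗↭↗⇒≋ (Flip.totalOrder M.≤-totalOrder) (sortDesc-sorted n xs) (dl ys d) (Perm.↭⇒↭ₛ (Perm.trans (sortDesc-↭ n xs) p)))
 where
  dl : ∀ ys -> Decr ys -> Desc-List ys
  dl [] _ = Linked.[]
  dl (y ∷ []) _ = Linked.[-]
  dl (x ∷ y ∷ ys) (p , d) = p Linked.∷ dl (y ∷ ys) d

wgt : (ℕ -> ℤ) -> (Bits -> ℤ) -> ℕ × Bits -> ℤ
wgt c κ p = c (fst p) * κ (snd p)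

cns : Bool -> ℕ × Bits -> ℕ × Bits
cns b p = fst p , b ∷ snd p

cns⁺ : ℕ × Bits -> ℕ × Bits
cns⁺ p = suc (fst p) , false ∷ snd p

isrow : Bool -> ℤ -> Set
isrow true x = x ≤ 0z
isrow false x = 0z < x

Same : ℤ -> ℤ -> Set
Same x y = (x ≤ 0z × y ≤ 0z) ⊎ (0z < x × 0z < y)

module Leaf (n : ℕ) {{nz : NonZero n}} (1<n : 1z < + n) where
 open Ideal n 1<n public

 Eacc : List ℕ -> Fn -> Fn
 Eacc [] χ = χ
 Eacc (a ∷ as) χ = Eacc as (E a χ)

 Eacc-lin : ∀ as -> Lin (Eacc as)
 Eacc-lin [] = Lin-id
 Eacc-lin (a ∷ as) = Lin-∘ (Eacc-lin as) (E-lin a)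

 Eacc-Er : ∀ as bs -> Eacc as (Er bs) ≡ Er (List.foldl (\x y -> y ∷ x) bs as)
 Eacc-Er [] bs = refl
 Eacc-Er (a ∷ as) bs = Eacc-Er as (a ∷ bs)

 δe-inverse : ∀ {v} (A : IsAff v) W -> UW W δe v ≡ UW (reverse W) δe (inverse A)
 δe-inverse {v} A W = UW-on A W δe & on-on d1 e1 1z & on-cong (d1 ×-dec e1) (d2 ×-dec e2) f g {1z} {1z} (\_ -> refl) & sym (on-on d2 e2 1z) & sym (UW-on (inverse-Aff A) (reverse W) δe)
  where
   z = inverse A
   d1 = len (v ·w W) N.+ length W N.≟ len v
   e1 = (v ·w W) ≟P idP n
   d2 = len (z ·w reverse W) N.+ length (reverse W) N.≟ len z
   e2 = (z ·w reverse W) ≟P idP n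
   lens : v ·w W ≡ idP n -> z ·w reverse W ≡ idP n -> (len (v ·w W) N.+ length W ≡ len v -> len (z ·w reverse W) N.+ length (reverse W) ≡ len z) × (len (z ·w reverse W) N.+ length (reverse W) ≡ len z -> len (v ·w W) N.+ length W ≡ len v)
   lens p q = (\h -> eq & h & sym (len-inverse A)) , \h -> sym eq & h & len-inverse A
    where
     eq = cong2 N._+_ (cong len (q & sym p)) (L.length-reverse W)
   fw' : v ·w W ≡ idP n -> z ·w reverse W ≡ idP n
   fw' p = ext _ _ \x -> ev-w z (reverse W) x & ev-inverse A (act (reverse W) x) & (inj A _ _ ((ev-at A _) & sym (ev-id (act (reverse W) x)) & cong (\u' -> ev u' (act (reverse W) x)) (sym p) & (ev-w v W _) & cong (ev v) (act-rev W x))) & sym (ev-id x)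
   bw' : z ·w reverse W ≡ idP n -> v ·w W ≡ idP n
   bw' p = ext _ _ \x -> ev-w v W x & cong (ev v) (sym (eqz x)) & ev-at A x & sym (ev-id x)
    where
     eqz : ∀ x -> at A x ≡ act W x
     eqz x = cong (at A) (sym (rr x)) & sym (ev-inverse A (act (reverse W) (act W x))) & sym (ev-w z (reverse W) (act W x)) & cong (\u' -> ev u' (act W x)) p & ev-id (act W x)
      where
       rr : ∀ x -> act (reverse W) (act W x) ≡ x
       rr x = cong (\w -> act (reverse W) (act w x)) (sym (L.reverse-involutive W)) & act-rev (reverse W) x
   f : (len (v ·w W) N.+ length W ≡ len v) × v ·w W ≡ idP n -> (len (z ·w reverse W) N.+ length (reverse W) ≡ len z) × z ·w reverse W ≡ idP n
   f (h , p) = fst (lens p (fw' p)) h , fw' p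
   g : (len (z ·w reverse W) N.+ length (reverse W) ≡ len z) × z ·w reverse W ≡ idP n -> (len (v ·w W) N.+ length W ≡ len v) × v ·w W ≡ idP n
   g (h , p) = snd (lens (bw' p) p) h , bw' p

 -- Inverting v reverses the order of the factors and the words within them.
 UW-inverse : ∀ as W {v} (A : IsAff v) -> UW W (Fr as) v ≡ Eacc as (UW (reverse W) δe) (inverse A)
 UW-inverse [] W A = δe-inverse A W
 UW-inverse (a ∷ as) W {v} A = sumQ-lin (UW-lin W) (bools n) (\S -> δ a ∥ S ∥ ⋆ UM (cw 0z S) (Fr as)) v A &
  (sumQ-boolsL n _ v) & Σ-cong (boolsL n) (\S -> each (cw 0z S) (δ a ∥ S ∥)) &
  sym (sumQ-boolsL n (\S -> Eacc as (δ a ∥ S ∥ ⋆ UM (rev (cw 0z S)) (UW (reverse W) δe))) z) & sym (sumQ-lin (Eacc-lin as) (bools n) (\S -> δ a ∥ S ∥ ⋆ UM (rev (cw 0z S)) (UW (reverse W) δe)) z zA)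
  where
   z = inverse A
   zA = inverse-Aff A
   each : ∀ x c -> UW W (c ⋆ UM x (Fr as)) v ≡ Eacc as (c ⋆ UM (rev x) (UW (reverse W) δe)) z
   each (inl x) c = lscl (UW-lin W) c (UW x (Fr as)) v A & cong (c *_) (sym (UW-++ W x (Fr as) v A) & UW-inverse as (W ++ x) A &
    lcong (Eacc-lin as) {UW (reverse (W ++ x)) δe} {UW (reverse x) (UW (reverse W) δe)} (\u' o -> cong (\y -> UW y δe u') (L.reverse-++ W x) & UW-++ (reverse x) (reverse W) δe u' o) z zA) &
    sym (lscl (Eacc-lin as) c (UW (reverse x) (UW (reverse W) δe)) z zA)
   each (inr x) c = lO (UW-lin W) {c ⋆ O} (\_ _ -> Z.*-zeroʳ c) v A & sym (lO (Eacc-lin as) {c ⋆ O} (\_ _ -> Z.*-zeroʳ c) z zA)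

 -- Trades `H` at v for `E` at the inverse. For a leaf the inverse is a boundary path written along
 -- positions, and the generators exchange adjacent steps of it.
 Fr-inverse : ∀ as {v} (A : IsAff v) -> Fr as v ≡ Er (reverse as) (inverse A)
 Fr-inverse as A = UW-inverse as [] A & cong (\φ -> φ (inverse A)) (Eacc-Er as [])

 module Block (k : ℕ) where

  lo' hi' : ℤ
  lo' = 1z - + k
  hi' = lo' + N

  -- Inverses of translated leaves. The block 1 - k, ..., n - k is preserved, and within it the
  -- values at most 0 and the positive values each occur in increasing order; so z is determined by
  -- which positions carry values at most 0, that is, by a lattice path.
  record G' (z : Perm n) : Set where
   field
    aff : IsAff z
    blk : ∀ p -> lo' ≤ p -> p < hi' -> lo' ≤ ev z p × ev z p < hi'
    inc : ∀ p q -> lo' ≤ p -> p < q -> q < hi' -> Same (ev z p) (ev z q) -> ev z p < ev z q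
  open G'

  far' : ∀ x y -> lo' ≤ x -> x < hi' -> lo' ≤ y -> y < hi' -> x ≢ y -> ¬ x ~ y
  far' x y a b c d ne with Z.<-cmp x y
  ... | Tri.tri< l _ _ = near x y l (lia 4 (\x y l N -> l =< x => y :< l :+ N => |- y :< x :+ N) x y lo' N a d)
  ... | Tri.tri≈ _ e _ = absurd (ne e)
  ... | Tri.tri> _ _ l = near y x l (lia 4 (\x y l N -> l =< x => y :< l :+ N => |- y :< x :+ N) y x lo' N c b) ∘ sym

  module Swap {z : Perm n} (gz : G' z) (i : ℤ) (li : lo' ≤ i) (ih : i + 1z < hi') where

   y' : Perm n
   y' = z ·s i

   i<h : i < hi'
   i<h = Z.<-trans (i<i+1 i) ih
   l+1 : lo' ≤ i + 1z
   l+1 = Z.≤-trans li (Z.<⇒≤ (i<i+1 i))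

   data Pl (p : ℤ) : Set where
    a1 : p ≡ i -> ev y' p ≡ ev z (i + 1z) -> Pl p
    a2 : p ≡ i + 1z -> ev y' p ≡ ev z i -> Pl p
    a3 : p ≢ i -> p ≢ i + 1z -> ev y' p ≡ ev z p -> Pl p

   see : ∀ p -> lo' ≤ p -> p < hi' -> Pl p
   see p a b with p ≟ i | p ≟ (i + 1z)
   ... | yes refl | _ = a1 refl (ev-sl z i)
   ... | no _ | yes refl = a2 refl (ev-sr z i)
   ... | no h | no h' = a3 h h' (ev-s-o z i p (far' p i a b li i<h h) (far' p (i + 1z) a b l+1 ih h'))

   other : ∀ p -> lo' ≤ p -> p < hi' -> p ≢ i -> p ≢ i + 1z -> ev y' p ≡ ev z p
   other p a b n1 n2 with see p a b
   ... | a1 e _ = absurd (n1 e)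
   ... | a2 e _ = absurd (n2 e)
   ... | a3 _ _ e = e

   module _ (d : Desc i z) where

    -- Two values of the same kind increase, so a descent joins values of different kinds, and the
    -- larger one is positive.
    sides : 0z < ev z i × ev z (i + 1z) ≤ 0z
    sides = c1 (0z <? ev z i) (0z <? ev z (i + 1z))
     where
      no! : ¬ Same (ev z i) (ev z (i + 1z))
      no! s' = Z.<-asym d (inc gz i (i + 1z) li (i<i+1 i) ih s')
      c1 : Dec (0z < ev z i) -> Dec (0z < ev z (i + 1z)) -> 0z < ev z i × ev z (i + 1z) ≤ 0z
      c1 (yes a) (no b) = a , Z.≮⇒≥ b
      c1 (yes a) (yes b) = absurd (no! (inr (a , b)))
      c1 (no a) (yes b) = absurd (a (Z.<-trans b d))
      c1 (no a) (no b) = absurd (no! (inl (Z.≮⇒≥ a , Z.≮⇒≥ b)))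

    swap-G : G' y'
    aff swap-G = s-Aff (aff gz) i
    blk swap-G p a b with see p a b
    ... | a1 _ e = subst (\x -> lo' ≤ x × x < hi') (sym e) (blk gz (i + 1z) l+1 ih)
    ... | a2 _ e = subst (\x -> lo' ≤ x × x < hi') (sym e) (blk gz i li i<h)
    ... | a3 _ _ e = subst (\x -> lo' ≤ x × x < hi') (sym e) (blk gz p a b)
    inc swap-G p q a l b sm = go' (see p a (Z.<-trans l b)) (see q (Z.≤-trans a (Z.<⇒≤ l)) b)
     where
      tr' : ∀ p' q' -> ev y' p ≡ ev z p' -> ev y' q ≡ ev z q' -> lo' ≤ p' -> p' < q' -> q' < hi' -> ev y' p < ev y' q
      tr' p' q' e e' h1 h2 h3 = subst2 _<_ (sym e) (sym e') (inc gz p' q' h1 h2 h3 (subst2 Same e e' sm))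
      go' : Pl p -> Pl q -> ev y' p < ev y' q
      go' (a1 refl e) (a1 refl _) = absurd (Z.<-irrefl refl l)
      go' (a1 refl e) (a2 refl e') = absurd (no! (subst2 Same e e' sm))
       where
        no! : ¬ Same (ev z (i + 1z)) (ev z i)
        no! (inl (_ , h)) = Z.<⇒≱ (fst sides) h
        no! (inr (h , _)) = Z.<⇒≱ h (snd sides)
      go' (a1 refl e) (a3 _ n2 e') = tr' (i + 1z) q e e' l+1 (Z.≤∧≢⇒< (lia 2 (\i q -> i :< q => |- i :+ #1 =< q) i q l) (n2 ∘ sym)) b
      go' (a2 refl e) (a1 refl _) = absurd (Z.<-asym l (i<i+1 i))
      go' (a2 refl e) (a2 refl _) = absurd (Z.<-irrefl refl l)
      go' (a2 refl e) (a3 _ _ e') = tr' i q e e' li (Z.<-trans (i<i+1 i) l) b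
      go' (a3 n1 n2 e) (a1 refl e') = tr' p (i + 1z) e e' a (Z.<-trans l (i<i+1 i)) ih
      go' (a3 n1 n2 e) (a2 refl e') = tr' p i e e' a (Z.≤∧≢⇒< (lia 2 (\p i -> p :< i :+ #1 => |- p =< i) p i l) n1) i<h
      go' (a3 _ _ e) (a3 _ _ e') = tr' p q e e' a l b

  -- Bits are read from the highest position of a segment downwards, and a value at most 0 is a row
  -- step.
  BtR : Perm n -> ℕ -> Bits -> Set
  BtR z zero [] = ⊤
  BtR z (suc m) (b ∷ bs) = isrow b (ev z (lo' + + m)) × BtR z m bs
  BtR z _ _ = ⊥

  BtR-cong : ∀ {z y} m bs -> (∀ p -> lo' ≤ p -> p < lo' + + m -> ev y p ≡ ev z p) -> BtR z m bs -> BtR y m bs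
  BtR-cong zero [] h _ = tt
  BtR-cong (suc m) (b ∷ bs) h (r , t') = subst (isrow b) (sym (h _ (l1 m) (l2 m))) r , BtR-cong m bs (\p a c -> h p a (Z.<-trans c (l2 m))) t'
   where
    l1 : ∀ m -> lo' ≤ lo' + + m
    l1 m = lia 2 (\l m -> #0 =< m => |- l =< l :+ m) lo' (+ m) (ℤ.+≤+ z≤n)
    l2 : ∀ m -> lo' + + m < lo' + + suc m
    l2 m = lia 2 (\l m -> |- l :+ m :< l :+ (#1 :+ m)) lo' (+ m)

  -- A decreasing word is applied from the highest letter down, as `Rr` walks along the path with
  -- the step at i + 1 in hand. Choosing the letter i exchanges the steps at i and i + 1 and is
  -- nonzero only for a row step above a column step. `κ'` is a continuation that collects the steps
  -- already put down.
  strip : ∀ ψ m b bs {z} -> G' z -> m N.< n -> BtR z (suc m) (b ∷ bs) -> (c : ℕ -> ℤ) (κ' : Bits -> ℤ) ->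
   (∀ y cs -> G' y -> (∀ p -> lo' + + suc m ≤ p -> p < hi' -> ev y p ≡ ev z p) -> BtR y (suc m) cs -> ψ y ≡ κ' cs) ->
   sumQ (bools m) (\S -> c ∥ S ∥ ⋆ UW (reverse (I lo' S)) ψ) z ≡ ΣL (Rr b bs) (wgt c κ')
  strip ψ zero b [] {z} gz lt bt c κ' h = cong (c 0 *_) (h z [ b ] gz (\_ _ _ -> refl) bt) & sym (+0 _)
  strip ψ (suc m) b (b2 ∷ bs) {z} gz lt (r , r2 , bt) c κ' h =
   trans (sumQ-rot m (true ∷ false ∷ []) f0 z (aff gz)) (sumQ-ΣF (bools m) (true ∷ false ∷ []) (\w q -> f0 (w ++ [ q ])) z (aff gz) &
    cong2 (\x y -> x + (y + 0z)) tpart fpart & fin b b2 r r2)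
   where
    i = lo' + + m
    f0 : List Bool -> Fn
    f0 S = c ∥ S ∥ ⋆ UW (reverse (I lo' S)) ψ
    i+1 : i + 1z ≡ lo' + + suc m
    i+1 = lia 2 (\l m -> |- l :+ m :+ #1 := l :+ (#1 :+ m)) lo' (+ m)
    li : lo' ≤ i
    li = lia 2 (\l m -> #0 =< m => |- l =< l :+ m) lo' (+ m) (ℤ.+≤+ z≤n)
    ih : i + 1z < hi'
    ih = lia 3 (\l m N -> #1 :+ m :< N => |- l :+ m :+ #1 :< l :+ N) lo' (+ m) N (ℤ.+<+ lt)
    module W = Swap gz i li ih
    lenw : ∀ (w : List Bool) -> length w ≡ length (bools m) -> length w ≡ m
    lenw w e = e & L.length-replicate m
    fpart : sumQ (bools m) (\w -> f0 (w ++ [ false ])) z ≡ ΣL (Rr b2 bs) (wgt c (κ' ∘ (b ∷_)))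
    fpart = sumQ-cong (bools m) {\w -> f0 (w ++ [ false ])} {\w -> c ∥ w ∥ ⋆ UW (reverse (I lo' w)) ψ} (\w _ v _ -> cong2 (\x y -> c x * UW (reverse y) ψ v) ((∥++∥ w [ false ]) & (M.+-identityʳ _)) ((I-++ lo' w [ false ]) & L.++-identityʳ (I lo' w))) z (aff gz) &
     strip ψ m b2 bs gz (M.<-trans (M.n<1+n m) lt) (r2 , bt) c (\cs -> κ' (b ∷ cs))
      (\y cs gy ag bt' -> h y (b ∷ cs) gy (\p a -> ag p (Z.≤-trans (Z.<⇒≤ (l2 (suc m))) a)) (subst (isrow b) (sym (ag _ Z.≤-refl (subst (_< hi') i+1 ih))) r , bt'))
     where
      l2 : ∀ m -> lo' + + m < lo' + + suc m
      l2 m = lia 2 (\l m -> |- l :+ m :< l :+ (#1 :+ m)) lo' (+ m)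
    gT : Fn
    gT = sumQ (bools m) (\w -> c (suc ∥ w ∥) ⋆ UW (reverse (I lo' w)) ψ)
    tpart : sumQ (bools m) (\w -> f0 (w ++ [ true ])) z ≡ U i gT z
    tpart = sumQ-cong (bools m) {\w -> f0 (w ++ [ true ])} {\w -> U i (c (suc ∥ w ∥) ⋆ UW (reverse (I lo' w)) ψ)} (\w e v o -> cong2 (\x y -> c x * UW y ψ v) ((∥++∥ w [ true ]) & (M.+-comm ∥ w ∥ 1))
     (cong reverse ((I-++ lo' w [ true ]) & cong (\x -> I lo' w ++ [ lo' + + x ]) (lenw w e)) & (L.reverse-++ (I lo' w) [ i ])) &
     sym (lscl (Words.Nil.U-lin U-nilp i) (c (suc ∥ w ∥)) (UW (reverse (I lo' w)) ψ) v o)) z (aff gz) &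
     sym (sumQ-lin (Words.Nil.U-lin U-nilp i) (bools m) (\w -> c (suc ∥ w ∥) ⋆ UW (reverse (I lo' w)) ψ) z (aff gz))
    at+ : ev z (i + 1z) ≡ ev z (lo' + + suc m)
    at+ = cong (ev z) i+1
    nod : ¬ Desc i z -> U i gT z ≡ 0z
    nod nd = on-no (ev z (i + 1z) <? ev z i) nd _
    simple : ∀ b b2 -> ¬ Desc i z -> U i gT z + (ΣL (Rr b2 bs) (wgt c (κ' ∘ (b ∷_))) + 0z) ≡ ΣL (map (cns b) (Rr b2 bs)) (wgt c κ')
    simple b b2 nd = cong (_+ (ΣL (Rr b2 bs) (wgt c (κ' ∘ (b ∷_))) + 0z)) (nod nd) & (0+ _) & (+0 _) & sym (Σ-map (cns b) (Rr b2 bs) (wgt c κ'))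
    fin : ∀ b b2 -> isrow b (ev z (lo' + + suc m)) -> isrow b2 (ev z i) -> U i gT z + (ΣL (Rr b2 bs) (wgt c (κ' ∘ (b ∷_))) + 0z) ≡ ΣL (Rr b (b2 ∷ bs)) (wgt c κ')
    fin true true r r2 = simple true true (\d -> Z.<⇒≱ (fst (W.sides d)) r2)
    fin false b2 r r2 = simple false b2 (\d -> Z.<⇒≱ r (subst (_≤ 0z) at+ (snd (W.sides d))))
    fin true false r r2 = cong (_+ (Σf + 0z)) ((on-yes (ev z (i + 1z) <? ev z i) d _) & ihT) & l Σt Σf & sym ((Σ-++ (map (cns true) (Rr false bs)) _ (wgt c κ')) &
     (cong2 _+_ (Σ-map (cns true) (Rr false bs) (wgt c κ')) (Σ-map cns⁺ (Rr true bs) (wgt c κ'))))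
     where
      Σf = ΣL (Rr false bs) (wgt c (κ' ∘ (true ∷_)))
      Σt = ΣL (Rr true bs) (wgt (c ∘ suc) (κ' ∘ (false ∷_)))
      l : ∀ x y -> x + (y + 0z) ≡ y + x
      l = ring
      d : Desc i z
      d = Z.≤-<-trans (subst (_≤ 0z) (sym at+) r) r2
      ihT : gT (z ·s i) ≡ Σt
      ihT = strip ψ m true bs (W.swap-G d) (M.<-trans (M.n<1+n m) lt)
       (subst (_≤ 0z) (sym (ev-sl z i & at+)) r , BtR-cong m bs same bt) (\j -> c (suc j)) (\cs -> κ' (false ∷ cs))
       (\y cs gy ag bt' -> h y (false ∷ cs) gy (\p a b -> ag p (Z.≤-trans (Z.<⇒≤ (l2 (suc m))) a) b & high p a b)
        (subst (0z <_) (sym ((ag _ Z.≤-refl (subst (_< hi') i+1 ih)) & cong (ev (z ·s i)) (sym i+1) & ev-sr z i)) r2 , bt'))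
       where
        l2 : ∀ m -> lo' + + m < lo' + + suc m
        l2 m = lia 2 (\l m -> |- l :+ m :< l :+ (#1 :+ m)) lo' (+ m)
        same : ∀ p -> lo' ≤ p -> p < lo' + + m -> ev (z ·s i) p ≡ ev z p
        same p a b = W.other p a (Z.<-trans b W.i<h) (\e -> Z.<-irrefl e b) (\e -> Z.<-irrefl e (Z.<-trans b (i<i+1 i)))
        high : ∀ p -> lo' + + suc (suc m) ≤ p -> p < hi' -> ev (z ·s i) p ≡ ev z p
        high p a b = W.other p (lia 3 (\l m p -> l :+ (#1 :+ (#1 :+ m)) =< p => #0 =< m => |- l =< p) lo' (+ m) p a (ℤ.+≤+ z≤n)) b (\ { refl -> Z.<⇒≱ (lia 2 (\l m -> |- l :+ m :< l :+ (#1 :+ (#1 :+ m))) lo' (+ m)) a }) (\ { refl -> Z.<⇒≱ (lia 2 (\l m -> |- l :+ m :+ #1 :< l :+ (#1 :+ (#1 :+ m))) lo' (+ m)) a })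

module LeafSum (n : ℕ) {{nz : NonZero n}} (1<n : 1z < + n) where
 open Leaf n 1<n public

 module Block' (k : ℕ) where
  open Block k public
  open G'

  -- The letter across the lower end of the block. Values just below the block are smaller than
  -- those in it, so this is never a descent on `G'`. Cyclic sets based at `r0` vanish if they
  -- contain it, and the others have linear words.
  r0 : ℤ
  r0 = lo' - 1z

  LQ : ℤ -> Set
  LQ i = i ≡ r0 ⊎ (lo' ≤ i × i + 1z < hi')

  ¬Desc-r0 : ∀ {z} -> G' z -> ¬ Desc r0 z
  ¬Desc-r0 {z} gz d = Z.<-asym d (lia 4 (\x y l N -> x :+ N :< l :+ N => l =< y => |- x :< y) (ev z r0) (ev z (r0 + 1z)) lo' N
   (subst (_< hi') (ev-per z r0 1z & cong (_+_ (ev z r0)) 1N) (snd (blk gz (r0 + 1z * N) (lia 3 (\l N M -> #1 :< N => M := N => |- l =< l :- #1 :+ M) lo' N (1z * N) 1<n 1N) (lia 3 (\l N M -> M := N => |- l :- #1 :+ M :< l :+ N) lo' N (1z * N) 1N))))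
   (subst (\x -> lo' ≤ ev z x) (sym (+1-1 lo')) (fst (blk gz lo' Z.≤-refl (lia 2 (\l N -> #1 :< N => |- l :< l :+ N) lo' N 1<n)))))
   where
    1N = Z.*-identityˡ N

  UW-r0 : ∀ ψ w {z} -> G' z -> All LQ w -> r0 ∈ w -> UW w ψ z ≡ 0z
  UW-r0 ψ (i ∷ w) {z} gz (q ∷ qs) m = k' (Desc? i z) q m
   where
    φ' = UW w ψ (z ·s i)
    k' : Dec (Desc i z) -> LQ i -> r0 ∈ i ∷ w -> U i (UW w ψ) z ≡ 0z
    k' (no d) _ _ = on-no (ev z (i + 1z) <? ev z i) d φ'
    k' (yes d) (inl refl) _ = absurd (¬Desc-r0 gz d)
    k' (yes d) (inr (li , ih)) (here refl) = absurd (Z.<⇒≱ (lia 1 (\l -> |- l :- #1 :< l) lo') li)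
    k' (yes d) (inr (li , ih)) (there m') = on-yes (ev z (i + 1z) <? ev z i) d φ' & UW-r0 ψ w (Swap.swap-G gz i li ih d) qs m'

  step1 : ∀ a x S {Q' : ℤ -> Set} -> (∀ i -> a ≤ i -> i < a + + length {A = Bool} (x ∷ S) -> Q' i) -> ∀ i -> a + 1z ≤ i -> i < a + 1z + + length S -> Q' i
  step1 a x S h i p q = h i (Z.≤-trans (Z.<⇒≤ (i<i+1 a)) p) (lia 3 (\a m i -> i :< a :+ #1 :+ m => |- i :< a :+ (#1 :+ m)) a (+ length S) i q)

  I-all : ∀ {Q' : ℤ -> Set} a S -> (∀ i -> a ≤ i -> i < a + + length S -> Q' i) -> All Q' (I a S)
  I-all a [] h = []
  I-all {Q'} a (true ∷ S) h = h a Z.≤-refl (lia 2 (\a m -> #0 =< m => |- a :< a :+ (#1 :+ m)) a (+ length S) (ℤ.+≤+ z≤n)) ∷ I-all (a + 1z) S (step1 a true S {Q'} h)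
  I-all {Q'} a (false ∷ S) h = I-all (a + 1z) S (step1 a false S {Q'} h)

  go-r0 : ∀ ψ a S ks -> (∀ i -> a ≤ i -> i < a + + length S -> LQ i) -> All LQ ks -> r0 ∈ ks -> ∀ {z} -> G' z -> UM (rev (go a S ks)) ψ z ≡ 0z
  go-r0 ψ a [] ks h q m gz = refl
  go-r0 ψ a (true ∷ S) ks h q m gz = go-r0 ψ (a + 1z) S (ks ++ [ a ]) (step1 a true S {LQ} h) (AllP.++⁺ q (h a Z.≤-refl (lia 2 (\a m -> #0 =< m => |- a :< a :+ (#1 :+ m)) a (+ length S) (ℤ.+≤+ z≤n)) ∷ [])) (∈-++⁺ˡ m) gz
  go-r0 ψ a (false ∷ S) ks h q m gz = UW-r0 ψ (reverse (I (a + 1z) S ++ ks)) gz (PermP.All-resp-↭ (Perm.↭-sym (PermP.↭-reverse (I (a + 1z) S ++ ks))) (AllP.++⁺ (I-all (a + 1z) S (step1 a false S {LQ} h)) q)) (AnyP.reverse⁺ (∈-++⁺ʳ (I (a + 1z) S) m))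

  E-strip : ∀ a ψ κ' -> (∀ y cs -> G' y -> BtR y n cs -> ψ y ≡ κ' cs) -> ∀ {z} bs -> G' z -> BtR z n bs -> E a ψ z ≡ ΣL (strips bs) (wgt (δ a) κ')
  E-strip a ψ κ' h {z} bs gz bt = sym (Ec-base (δ a) ψ r0 z (aff gz)) & k' n bs refl bt
   where
    k' : ∀ m bs -> m ≡ n -> BtR z m bs -> sumQ (bools m) (\S -> δ a ∥ S ∥ ⋆ UM (rev (cw r0 S)) ψ) z ≡ ΣL (strips bs) (wgt (δ a) κ')
    k' zero _ e _ = absurd (N.≢-nonZero⁻¹ n (sym e))
    k' (suc m) (b ∷ bs) e bt = cong2 (\x y -> x + (y + 0z)) t0 f0 & (0+ _) & (+0 _)
     where
      m<n : m N.< n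
      m<n = M.≤-reflexive e
      t0 : sumQ (bools m) (\S -> δ a (suc ∥ S ∥) ⋆ UM (rev (go (r0 + 1z) S [ r0 ])) ψ) z ≡ 0z
      t0 = (sumQ-boolsL m _ z) & Σ-0 (boolsL m) (\S S∈ -> cong (δ a (suc ∥ S ∥) *_) (go-r0 ψ (r0 + 1z) S [ r0 ] (\i p q -> inr (subst (_≤ i) (+1-1 lo') p ,
       lia 4 (\l i m N -> i :< l :- #1 :+ #1 :+ m => m :< N => |- i :+ #1 :< l :+ N) lo' i (+ m) N (subst (\x -> i < r0 + 1z + + x) (boolsL-length m S S∈) q) (ℤ.+<+ m<n))) (inl refl ∷ []) (here refl) gz) & Z.*-zeroʳ (δ a (suc ∥ S ∥)))
      f0 : sumQ (bools m) (\S -> δ a ∥ S ∥ ⋆ UW (reverse (I (r0 + 1z) S ++ [])) ψ) z ≡ ΣL (Rr b bs) (wgt (δ a) κ')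
      f0 = sumQ-cong (bools m) {\S -> δ a ∥ S ∥ ⋆ UW (reverse (I (r0 + 1z) S ++ [])) ψ} {\S -> δ a ∥ S ∥ ⋆ UW (reverse (I lo' S)) ψ}
       (\S _ v _ -> cong (\w -> δ a ∥ S ∥ * UW (reverse w) ψ v) ((L.++-identityʳ _) & cong (\x -> I x S) (+1-1 lo'))) z (aff gz) &
       strip ψ m b bs gz m<n bt (δ a) κ' (\y cs gy _ bt' -> h y cs gy (subst (\m -> BtR y m cs) e bt'))

  toBlock : ∀ x -> Σ ℤ \m -> lo' ≤ x + m * N × x + m * N < hi'
  toBlock x with nrm-range (x + + k)
  ... | a , b = κ (x + + k) , lia 3 (\x k m -> #1 =< x :+ k :+ m => |- #1 :- k =< x :+ m) x (+ k) (κ (x + + k) * N) a , lia 4 (\x k m N -> x :+ k :+ m =< N => |- x :+ m :< #1 :- k :+ N) x (+ k) (κ (x + + k) * N) N b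

  cut : ∀ m p -> p < lo' + + suc m -> p ≡ lo' + + m ⊎ p < lo' + + m
  cut m p h with p ≟ (lo' + + m)
  ... | yes e = inl e
  ... | no ne = inr (Z.≤∧≢⇒< (lia 3 (\l m p -> p :< l :+ (#1 :+ m) => |- p =< l :+ m) lo' (+ m) p h) ne)

  l<s : ∀ m -> lo' + + m < lo' + + suc m
  l<s m = lia 2 (\l m -> |- l :+ m :< l :+ (#1 :+ m)) lo' (+ m)

  module _ {z : Perm n} where

   cc-0 : ∀ m bs -> (∀ p -> p < lo' + + m -> ev z p ≤ 0z) -> BtR z m bs -> cc bs ≡ 0
   cc-0 zero [] h _ = refl
   cc-0 (suc m) (true ∷ bs) h (_ , bt) = cc-0 m bs (\p l -> h p (Z.<-trans l (l<s m))) bt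
   cc-0 (suc m) (false ∷ bs) h (r , bt) = absurd (Z.<⇒≱ r (h _ (l<s m)))

   0-cc : ∀ m bs -> cc bs ≡ 0 -> BtR z m bs -> ∀ p -> lo' ≤ p -> p < lo' + + m -> ev z p ≤ 0z
   0-cc zero [] e _ p a b = absurd (Z.<⇒≱ (subst (p <_) (+0 lo') b) a)
   0-cc (suc m) (true ∷ bs) e (r , bt) p a b with cut m p b
   ... | inl refl = r
   ... | inr b' = 0-cc m bs e bt p a b'

   rows-below : ∀ m bs -> All (_≡ 0) (shp bs) -> BtR z m bs -> ∀ p q -> lo' ≤ p -> p < q -> q < lo' + + m -> 0z < ev z p -> ¬ ev z q ≤ 0z
   rows-below zero [] _ _ p q a l b h h' = Z.<⇒≱ (Z.<-trans l (subst (q <_) (+0 lo') b)) a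
   rows-below (suc m) (true ∷ bs) (e ∷ es) (r , bt) p q a l b h h' with cut m q b
   ... | inl refl = Z.<⇒≱ h (0-cc m bs e bt p a l)
   ... | inr b' = rows-below m bs es bt p q a l b' h h'
   rows-below (suc m) (false ∷ bs) es (r , bt) p q a l b h h' with cut m q b
   ... | inl refl = Z.<⇒≱ r h'
   ... | inr b' = rows-below m bs es bt p q a l b' h h'

  id-all0 : ∀ m bs -> BtR (idP n) m bs -> All (_≡ 0) (shp bs)
  id-all0 zero [] _ = []
  id-all0 (suc m) (true ∷ bs) (r , bt) = cc-0 m bs (\p l -> subst (_≤ 0z) (sym (ev-id p)) (Z.<⇒≤ (Z.<-≤-trans l (subst (_≤ 0z) (ev-id (lo' + + m)) r)))) bt ∷ id-all0 m bs bt
  id-all0 (suc m) (false ∷ bs) (r , bt) = id-all0 m bs bt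

  -- Without cells the values at most 0 precede the positive ones, so z is increasing on a block
  -- that it preserves and fixes each of its points.
  all0-id : ∀ {z} bs -> G' z -> BtR z n bs -> All (_≡ 0) (shp bs) -> z ≡ idP n
  all0-id {z} bs gz bt es = ext z (idP n) \x -> let (m , a , b) = toBlock x in
   trans (lia 3 (\e x m -> e :+ m := x :+ m => |- e := x) (ev z x) x (m * N) (sym (ev-per z x m) & fixed (x + m * N) a b)) (sym (ev-id x))
   where
    mono : ∀ p q -> lo' ≤ p -> p < q -> q < hi' -> ev z p < ev z q
    mono p q a l b = k' (ev z p ≤? 0z) (ev z q ≤? 0z)
     where
      k' : Dec (ev z p ≤ 0z) -> Dec (ev z q ≤ 0z) -> ev z p < ev z q
      k' (yes h) (yes h') = inc gz p q a l b (inl (h , h'))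
      k' (yes h) (no h') = Z.≤-<-trans h (Z.≰⇒> h')
      k' (no h) (yes h') = absurd (rows-below n bs es bt p q a l b (Z.≰⇒> h) h')
      k' (no h) (no h') = inc gz p q a l b (inr (Z.≰⇒> h , Z.≰⇒> h'))
    lower : ∀ j p -> p ≡ lo' + + j -> p < hi' -> p ≤ ev z p
    lower zero p e b = let e' = trans e (+0 lo') in Z.≤-trans (Z.≤-reflexive e') (fst (blk gz p (Z.≤-reflexive (sym e')) b))
    lower (suc j) p e b = lia 3 (\x y p -> x :< y => p :- #1 =< x => |- p =< y) (ev z (p - 1z)) (ev z p) p
     (mono (p - 1z) p (subst (lo' ≤_) (sym e1) (lia 2 (\l m -> #0 =< m => |- l =< l :+ m) lo' (+ j) (ℤ.+≤+ z≤n))) p-1 b) (lower j (p - 1z) e1 (Z.<-trans p-1 b))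
     where
      p-1 = lia 1 (\p -> |- p :- #1 :< p) p
      e1 : p - 1z ≡ lo' + + j
      e1 = lia 3 (\p l j -> p := l :+ (#1 :+ j) => |- p :- #1 := l :+ j) p lo' (+ j) e
    upper : ∀ j p -> p + + suc j ≡ hi' -> lo' ≤ p -> ev z p ≤ p
    upper zero p e a = lia 3 (\x p h -> x :< h => p :+ #1 := h => |- x =< p) (ev z p) p hi' (snd (blk gz p a (subst (p <_) e (i<i+1 p)))) e
    upper (suc j) p e a = lia 3 (\x y p -> x :< y => y =< p :+ #1 => |- x =< p) (ev z p) (ev z (p + 1z)) p
     (mono p (p + 1z) a (i<i+1 p) (lia 3 (\p j h -> p :+ (#1 :+ (#1 :+ j)) := h => #0 =< j => |- p :+ #1 :< h) p (+ j) hi' e (ℤ.+≤+ z≤n)))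
     (upper j (p + 1z) (lia 2 (\p j -> |- p :+ #1 :+ (#1 :+ j) := p :+ (#1 :+ (#1 :+ j))) p (+ j) & e) (Z.≤-trans a (Z.<⇒≤ (i<i+1 p))))
    fixed : ∀ p -> lo' ≤ p -> p < hi' -> ev z p ≡ p
    fixed p a b = Z.≤-antisym (upper ℤ.∣ hi' - 1z - p ∣ p (lia 3 (\p d h -> d := h :- #1 :- p => |- p :+ (#1 :+ d) := h) p (+ ℤ.∣ hi' - 1z - p ∣) hi' (Z.0≤i⇒+∣i∣≡i (lia 2 (\p h -> p :< h => |- #0 =< h :- #1 :- p) p hi' b))) a)
     (lower ℤ.∣ p - lo' ∣ p (lia 3 (\p d l -> d := p :- l => |- p := l :+ d) p (+ ℤ.∣ p - lo' ∣) lo' (Z.0≤i⇒+∣i∣≡i (lia 2 (\p l -> l =< p => |- #0 =< p :- l) p lo' a))) b)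

  Er-KBs : ∀ as {z} bs -> G' z -> BtR z n bs -> Er as z ≡ KBs as bs
  Er-KBs [] {z} bs gz bt = on-cong (z ≟P idP n) (all0? (shp bs)) (\ { refl -> id-all0 n bs bt }) (all0-id bs gz bt) {1z} {1z} (\_ -> refl)
  Er-KBs (a ∷ as) {z} bs gz bt = E-strip a (Er as) (KBs as) (\y cs gy b -> Er-KBs as cs gy b) bs gz bt & Σ-cong (strips bs) (\p -> o (a N.≟ fst p) (KBs as (snd p)))
   where
    o : {P : Set} (d : Dec P) -> ∀ x -> on d 1z * x ≡ on d x
    o (yes _) x = Z.*-identityˡ x
    o (no _) x = Z.*-zeroˡ x

  btz : Perm n -> ℕ -> Bits
  btz z zero = []
  btz z (suc m) = ⌊ ev z (lo' + + m) ≤? 0z ⌋ ∷ btz z m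

  BtR-btz : ∀ z m -> BtR z m (btz z m)
  BtR-btz z zero = tt
  BtR-btz z (suc m) = k' (ev z (lo' + + m) ≤? 0z) , BtR-btz z m
   where
    k' : ∀ {x} (d : Dec (x ≤ 0z)) -> isrow ⌊ d ⌋ x
    k' (yes p) = p
    k' (no p) = Z.≰⇒> p

-- The code of a 0-Grassmannian permutation and its partition.

hc-inner : {A : Set} {P : A -> Set} (P? : ∀ x -> Dec (P x)) (xs : List A) -> Unique xs -> HasCard (\x -> x ∈ xs × P x) (length (filter P? xs))
hc-inner P? xs u = filter P? xs , UP.filter⁺ P? u , (\x -> ∈-filter⁻ P? {xs = xs} , \(m , p) -> ∈-filter⁺ P? m p) , refl

keep : Bool -> ℕ -> ℕ
keep true x = x
keep false _ = 0

-- A column step stands for a zero of the code. The appended zeros are therefore as many as the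
-- column steps, and there is one part for every step of the path.
shp-step : ∀ b B {L} -> L ↭ shp B ++ zs (cc B) -> keep b (cc B) ∷ L ↭ shp (b ∷ B) ++ zs (cc (b ∷ B))
shp-step true B p = Perm.prep _ p
shp-step false B p = Perm.trans (Perm.prep 0 p) (Perm.↭-sym (PermP.shift 0 (shp B) (zs (cc B))))

module Shape (n : ℕ) {{nz : NonZero n}} (1<n : 1z < + n) (k : ℕ) where
 open LeafSum n 1<n public
 open Block' k public

 module _ {g : Perm n} (gA : IsAff g) (gB : Bd g) (ge : exceed g ≡ k) (zg : ZeroGrass n g) where

  g-inc : ∀ p q -> 1z ≤ p -> p < q -> q ≤ N -> ev g p < ev g q
  g-inc p q a l b = k' (ev g p <? ev g q)
   where
    k' : Dec (ev g p < ev g q) -> ev g p < ev g q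
    k' (yes h) = h
    k' (no h) = absurd (zg p q (a , l , b , subst2 _<_ (ev≡eval g q) (ev≡eval g p) (Z.≤∧≢⇒< (Z.≮⇒≥ h) (\e -> Z.<-irrefl (sym (inj gA _ _ e)) l))))

  Big : ℤ -> Set
  Big x = N < ev g x

  Big? : ∀ x -> Dec (Big x)
  Big? x = N <? ev g x

  -- The window is increasing, so the values above n occupy a final segment, whose length is their
  -- number.
  threshold : ∀ m -> + m ≤ N -> Σ ℤ \c -> ΣL (range 1z m) (\x -> on (Big? x) 1z) ≡ c × 0z ≤ c × (∀ x -> 1z ≤ x -> x ≤ + m -> (Big x -> + m - c < x) × (+ m - c < x -> Big x))
  threshold zero _ = 0z , refl , Z.≤-refl , \x a b -> absurd (Z.<⇒≱ (Z.<-≤-trans (ℤ.+<+ (s≤s z≤n)) a) b)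
  threshold (suc m) h = k' (Big? (1z + + m)) (threshold m (Z.≤-trans (ℤ.+≤+ (M.n≤1+n m)) h))
   where
    R : ℕ -> Set
    R m = Σ ℤ \c -> ΣL (range 1z m) (\x -> on (Big? x) 1z) ≡ c × 0z ≤ c × (∀ x -> 1z ≤ x -> x ≤ + m -> (Big x -> + m - c < x) × (+ m - c < x -> Big x))
    sn : ΣL (range 1z (suc m)) (\x -> on (Big? x) 1z) ≡ ΣL (range 1z m) (\x -> on (Big? x) 1z) + (on (Big? (1z + + m)) 1z + 0z)
    sn = cong (\l -> ΣL l (\x -> on (Big? x) 1z)) (range-snoc 1z m) & (Σ-++ (range 1z m) [ 1z + + m ] _)
    k' : Dec (Big (1z + + m)) -> R m -> R (suc m)
    k' (yes B') (c , e , c0 , f) = c + 1z , sn & (cong2 _+_ e (cong (_+ 0z) (on-yes (Big? (1z + + m)) B' 1z))) , lia 1 (\c -> #0 =< c => |- #0 =< c :+ #1) c c0 , \x a b -> k2 x a b (x ≟ (1z + + m))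
     where
      k2 : ∀ x -> 1z ≤ x -> x ≤ 1z + + m -> Dec (x ≡ 1z + + m) -> (Big x -> 1z + + m - (c + 1z) < x) × (1z + + m - (c + 1z) < x -> Big x)
      k2 x a b (yes refl) = (\_ -> lia 2 (\c m -> #0 =< c => |- #1 :+ m :- (c :+ #1) :< #1 :+ m) c (+ m) c0) , \_ -> B'
      k2 x a b (no ne) = (\h -> subst (_< x) eq (fst pq h)) , \h -> snd pq (subst (_< x) (sym eq) h)
       where
        pq = f x a (lia 2 (\x m -> x :< #1 :+ m => |- x =< m) x (+ m) (Z.≤∧≢⇒< b ne))
        eq : + m - c ≡ 1z + + m - (c + 1z)
        eq = lia 2 (\c m -> |- m :- c := #1 :+ m :- (c :+ #1)) c (+ m)
    k' (no B') _ = 0z , Σ-0 (range 1z (suc m)) (\x x∈ -> let (a , b) = ∈-range⁻ 1z (suc m) x x∈ in on-no (Big? x) (nb x a (lia 2 (\x m -> x :< #1 :+ (#1 :+ m) => |- x =< #1 :+ m) x (+ m) b)) 1z) , Z.≤-refl ,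
     \x a b -> (\h' -> absurd (nb x a b h')) , \h' -> absurd (Z.<⇒≱ (subst (_< x) (+0 (1z + + m)) h') b)
     where
      nb : ∀ x -> 1z ≤ x -> x ≤ 1z + + m -> ¬ Big x
      nb x a b h' = c2 (x ≟ (1z + + m))
       where
        c2 : Dec (x ≡ 1z + + m) -> ⊥
        c2 (yes refl) = B' h'
        c2 (no ne) = B' (Z.<-trans h' (g-inc x (1z + + m) a (Z.≤∧≢⇒< b ne) h))

  big : ∀ x -> 1z ≤ x -> x ≤ N -> (Big x -> N - + k < x) × (N - + k < x -> Big x)
  big x a b = let (c , e , _ , f) = threshold n Z.≤-refl in subst (\c -> (Big x -> N - c < x) × (N - c < x -> Big x)) (sym e & cnt≡) (f x a b)
   where
    cnt≡ : ΣL (range 1z n) (\x -> on (Big? x) 1z) ≡ + k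
    cnt≡ = (Σ-window _) & Σ-cong (allFin n) (\j -> on-cong (Big? (pos n j)) (N <? lookup g j) (subst (N <_) (ev-lookup g j)) (subst (N <_) (sym (ev-lookup g j))) {1z} {1z} (\_ -> refl)) &
     sym (Σ-filter (\j -> N <? lookup g j) (allFin n) (\_ -> 1z)) & Σ-1 (filter (\j -> N <? lookup g j) (allFin n)) & (cong +_ ge)

  v' : Perm n
  v' = shift n (+ k) g
  vA : IsAff v'
  vA = shift-Aff (+ k) gA
  z' : Perm n
  z' = inverse vA

  g+N : ∀ p -> ev g (p + N) ≡ ev g p + N
  g+N p = cong (\x -> ev g (p + x)) (sym (Z.*-identityˡ N)) & ev-per g p 1z & cong (_+_ (ev g p)) (Z.*-identityˡ N)

  -- The last k positions of the window carry the values above n. Moved down by one period,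
  -- positions and values, they complete the first n - k positions to the block, and all values fall
  -- in 1, ..., n before the translation by -k.
  v-blk : ∀ p -> lo' ≤ p -> p < hi' -> lo' ≤ ev v' p × ev v' p < hi'
  v-blk p a b = subst (\x -> lo' ≤ x × x < hi') (sym (ev-shift (+ k) g p)) (k' (1z ≤? p))
   where
    fin : 1z ≤ ev g p -> ev g p ≤ N -> lo' ≤ ev g p - + k × ev g p - + k < hi'
    fin c d = lia 2 (\x k -> #1 =< x => |- #1 :- k =< x :- k) (ev g p) (+ k) c , lia 3 (\x k N -> x =< N => |- x :- k :< #1 :- k :+ N) (ev g p) (+ k) N d
    k' : Dec (1z ≤ p) -> lo' ≤ ev g p - + k × ev g p - + k < hi'
    k' (yes c) = fin (Z.≤-trans c (fst (gB p))) (Z.≮⇒≥ (\B' -> Z.<⇒≱ (fst (big p c p≤N) B') p≤))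
     where
      p≤ = lia 3 (\p k N -> p :< #1 :- k :+ N => |- p =< N :- k) p (+ k) N b
      p≤N = lia 3 (\p k N -> p =< N :- k => #0 =< k => |- p =< N) p (+ k) N p≤ (ℤ.+≤+ z≤n)
    k' (no c) = fin (lia 3 (\x y N -> N :< y => y := x :+ N => |- #1 =< x) (ev g p) (ev g (p + N)) N (snd (big (p + N) 1≤ ≤N) (lia 3 (\p k N -> #1 :- k =< p => |- N :- k :< p :+ N) p (+ k) N a)) (g+N p))
     (Z.≤-trans (snd (gB p)) ≤N)
     where
      p≤0 : p ≤ 0z
      p≤0 = lia 1 (\p -> p :< #1 => |- p =< #0) p (Z.≰⇒> c)
      ≤N = lia 2 (\p N -> p =< #0 => |- p :+ N =< N) p N p≤0
      k≤N : + k ≤ N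
      k≤N = subst (\k -> + k ≤ N) ge (ℤ.+≤+ (M.≤-trans (L.length-filter (\j -> N <? lookup g j) (allFin n)) (M.≤-reflexive (L.length-tabulate {n = n} id))))
      1≤ = lia 3 (\p k N -> #1 :- k =< p => k =< N => |- #1 =< p :+ N) p (+ k) N a k≤N

  v-inc : ∀ p q -> lo' ≤ p -> p < q -> q < hi' -> Same p q -> ev v' p < ev v' q
  v-inc p q a l b sm = subst2 _<_ (sym (ev-shift (+ k) g p)) (sym (ev-shift (+ k) g q)) (lia 3 (\x y k -> x :< y => |- x :- k :< y :- k) (ev g p) (ev g q) (+ k) (k' sm))
   where
    k' : Same p q -> ev g p < ev g q
    k' (inr (c , d)) = g-inc p q (lia 1 (\p -> #0 :< p => |- #1 =< p) p c) l (lia 3 (\p k N -> p :< #1 :- k :+ N => #0 =< k => |- p =< N) q (+ k) N b (ℤ.+≤+ z≤n))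
    k' (inl (c , d)) = lia 5 (\x y x' y' N -> x' :< y' => x' := x :+ N => y' := y :+ N => |- x :< y) (ev g p) (ev g q) (ev g (p + N)) (ev g (q + N)) N
     (g-inc (p + N) (q + N) (lia 3 (\p k N -> #1 :- k =< p => k =< N => |- #1 =< p :+ N) p (+ k) N a k≤N) (lia 3 (\p q N -> p :< q => |- p :+ N :< q :+ N) p q N l) (lia 2 (\p N -> p =< #0 => |- p :+ N =< N) q N d)) (g+N p) (g+N q)
     where
      k≤N : + k ≤ N
      k≤N = subst (\k -> + k ≤ N) ge (ℤ.+≤+ (M.≤-trans (L.length-filter (\j -> N <? lookup g j) (allFin n)) (M.≤-reflexive (L.length-tabulate {n = n} id))))

  vz : ∀ p -> ev v' (ev z' p) ≡ p
  vz p = cong (ev v') (ev-inverse vA p) & ev-at vA p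

  zv : ∀ p -> ev z' (ev v' p) ≡ p
  zv p = (ev-inverse vA _) & at-ev vA p

  z-G : G' z'
  z-G = record { aff = inverse-Aff vA ; blk = bl ; inc = ic }
   where
    bl : ∀ p -> lo' ≤ p -> p < hi' -> lo' ≤ ev z' p × ev z' p < hi'
    bl p a b = k' (mcase m)
     where
      x = ev z' p
      m = fst (toBlock x)
      c = fst (snd (toBlock x))
      d = snd (snd (toBlock x))
      vx : ev v' (x + m * N) ≡ p + m * N
      vx = ev-per v' x m & cong (_+ m * N) (vz p)
      w = subst (\y -> lo' ≤ y × y < hi') vx (v-blk (x + m * N) c d)
      k' : MC m -> lo' ≤ x × x < hi'
      k' (neg _ h) = absurd (Z.<⇒≱ (lia 4 (\p l M N -> p :< l :+ N => M =< #0 :- N => |- p :+ M :< l) p lo' (m * N) N b (subst (m * N ≤_) (sym (0+ (- N))) h)) (fst w))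
      k' (nul e) = subst (\y -> lo' ≤ y × y < hi') (cong (\m -> x + m * N) e & +0N x) (c , d)
      k' (pos' _ h) = absurd (Z.<⇒≱ (snd w) (lia 4 (\p l M N -> l =< p => N =< M => |- l :+ N =< p :+ M) p lo' (m * N) N a h))
    ic : ∀ p q -> lo' ≤ p -> p < q -> q < hi' -> Same (ev z' p) (ev z' q) -> ev z' p < ev z' q
    ic p q a l b sm = k' (ev z' p <? ev z' q)
     where
      k' : Dec (ev z' p < ev z' q) -> ev z' p < ev z' q
      k' (yes h) = h
      k' (no h) = absurd (Z.<-asym l (subst2 _<_ (vz q) (vz p) (v-inc (ev z' q) (ev z' p) (fst (bl q (Z.≤-trans a (Z.<⇒≤ l)) b)) (Z.≤∧≢⇒< (Z.≮⇒≥ h) (\e -> Z.<-irrefl (sym (vz p) & cong (ev v') (sym e) & vz q) l)) (snd (bl p a (Z.<-trans l b))) (sw sm))))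
       where
        sw : Same (ev z' p) (ev z' q) -> Same (ev z' q) (ev z' p)
        sw (inl (x , y)) = inl (y , x)
        sw (inr (x , y)) = inr (y , x)

  ix : ∀ p -> lo' ≤ p -> lo' + + ℤ.∣ p - lo' ∣ ≡ p
  ix p a = lia 3 (\p d l -> d := p :- l => |- l :+ d := p) p (+ ℤ.∣ p - lo' ∣) lo' (Z.0≤i⇒+∣i∣≡i (lia 2 (\p l -> l =< p => |- #0 =< p :- l) p lo' a))

  lo-cancel : ∀ {x y} -> lo' + + x ≡ lo' + + y -> x ≡ y
  lo-cancel {x} {y} e = Z.+-injective (lia 3 (\l x y -> l :+ x := l :+ y => |- x := y) lo' (+ x) (+ y) e)

  lo-< : ∀ {x y} -> x N.< y -> lo' + + x < lo' + + y
  lo-< {x} {y} h = lia 3 (\l x y -> x :< y => |- l :+ x :< l :+ y) lo' (+ x) (+ y) (ℤ.+<+ h)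

  <-lo : ∀ {x y} -> lo' + + x < lo' + + y -> x N.< y
  <-lo {x} {y} h = Z.drop‿+<+ (lia 3 (\l x y -> l :+ x :< l :+ y => |- x :< y) lo' (+ x) (+ y) h)

  lo≤ : ∀ x -> lo' ≤ lo' + + x
  lo≤ x = lia 2 (\l m -> #0 =< m => |- l =< l :+ m) lo' (+ x) (ℤ.+≤+ z≤n)

  module Idx (F' : ℤ -> ℤ) (h : ∀ p -> lo' ≤ p -> p < hi' -> lo' ≤ F' p × F' p < hi') where

   ixm : ℕ -> ℕ
   ixm x = ℤ.∣ F' (lo' + + x) - lo' ∣

   ixm-eq : ∀ {x} -> x N.< n -> lo' + + ixm x ≡ F' (lo' + + x)
   ixm-eq {x} l = ix _ (fst (h _ (lo≤ x) (lo-< l)))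

   ixm-< : ∀ {x} -> x N.< n -> ixm x N.< n
   ixm-< {x} l = <-lo (subst (_< hi') (sym (ixm-eq l)) (snd (h _ (lo≤ x) (lo-< l))))

  module VI = Idx (ev v') v-blk
  module ZI = Idx (ev z') (G'.blk z-G)

  zv-ix : ∀ {x} -> x N.< n -> ZI.ixm (VI.ixm x) ≡ x
  zv-ix {x} l = lo-cancel (ZI.ixm-eq (VI.ixm-< l) & cong (ev z') (VI.ixm-eq l) & (zv _))

  vz-ix : ∀ {x} -> x N.< n -> VI.ixm (ZI.ixm x) ≡ x
  vz-ix {x} l = lo-cancel (VI.ixm-eq (ZI.ixm-< l) & cong (ev v') (ZI.ixm-eq l) & (vz _))

  row? : ∀ m -> Dec (ev z' (lo' + + m) ≤ 0z)
  row? m = ev z' (lo' + + m) ≤? 0z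

  part : ℕ -> ℕ
  part m = keep ⌊ row? m ⌋ (cc (btz z' m))

  parts : ∀ m -> map part (List.downFrom m) ↭ shp (btz z' m) ++ zs (cc (btz z' m))
  parts zero = Perm.refl
  parts (suc m) = shp-step ⌊ row? m ⌋ (btz z' m) (parts m)

  Cl : ℕ -> ℕ -> Set
  Cl m j = j N.< m × 0z < ev z' (lo' + + j)

  cc-card : ∀ m -> HasCard (Cl m) (cc (btz z' m))
  cc-card zero = [] , [] , (\x -> (\()) , \ { (() , _) }) , refl
  cc-card (suc m) = k' (row? m)
   where
    k' : (d : Dec (ev z' (lo' + + m) ≤ 0z)) -> HasCard (Cl (suc m)) (cc (⌊ d ⌋ ∷ btz z' m))
    k' (yes r) = hc-iff (\j (l , h) -> M.m≤n⇒m≤1+n l , h) (\j (l , h) -> M.≤∧≢⇒< (M.≤-pred l) (\ { refl -> Z.<⇒≱ h r }) , h) (cc-card m)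
    k' (no r) = hc-insert m (\(l , _) -> M.<-irrefl refl l) (M.n<1+n m , Z.≰⇒> r) (\j (l , h) -> M.m≤n⇒m≤1+n l , h) (\j (l , h) -> c2 j l h (j N.≟ m)) (cc-card m)
     where
      c2 : ∀ j -> j N.< suc m -> 0z < ev z' (lo' + + j) -> Dec (j ≡ m) -> j ≡ m ⊎ Cl m j
      c2 j l h (yes e) = inl e
      c2 j l h (no ne) = inr (M.≤∧≢⇒< (M.≤-pred l) ne , h)

  w' : ℕ -> ℤ
  w' i = eval n g (+ i - + k)

  ones : List ℕ
  ones = map suc (upTo n)

  code' : ℕ -> ℕ
  code' i = length (filter (\i' -> (i N.<? i') ×-dec (w' i' <? w' i)) ones)

  w≡ : ∀ x -> w' (suc x) ≡ ev v' (lo' + + x) + + k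
  w≡ x = sym (ev≡eval g _) & cong (ev g) (lia 2 (\x k -> |- #1 :+ x :- k := #1 :- k :+ x) (+ x) (+ k)) &
   lia 2 (\x k -> |- x := x :- k :+ k) (ev g (lo' + + x)) (+ k) & cong (_+ + k) (sym (ev-shift (+ k) g (lo' + + x)))

  w-< : ∀ x y -> w' (suc x) < w' (suc y) -> ev v' (lo' + + x) < ev v' (lo' + + y)
  w-< x y h = lia 3 (\x y k -> x :+ k :< y :+ k => |- x :< y) (ev v' (lo' + + x)) (ev v' (lo' + + y)) (+ k) (subst2 _<_ (w≡ x) (w≡ y) h)

  <-w : ∀ x y -> ev v' (lo' + + x) < ev v' (lo' + + y) -> w' (suc x) < w' (suc y)
  <-w x y h = subst2 _<_ (sym (w≡ x)) (sym (w≡ y)) (lia 3 (\x y k -> x :< y => |- x :+ k :< y :+ k) (ev v' (lo' + + x)) (ev v' (lo' + + y)) (+ k) h)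

  ones⁻ : ∀ {i} -> i ∈ ones -> Σ ℕ \c -> c N.< n × i ≡ suc c
  ones⁻ m with ∈-map⁻ suc m
  ... | c , c∈ , e = c , ∈-upTo⁻ c∈ , e

  -- With x now measured from the lower end of the block: a positive point has no smaller value
  -- after it, since v' increases on positive points. A point at most 0 is a row step at height y,
  -- its image; the later points with smaller value are then the positive ones with image below y,
  -- the column steps that `part` counts.
  code-part : ∀ x -> x N.< n -> code' (suc x) ≡ part (VI.ixm x)
  code-part x x<n = k' (row? y)
   where
    y = VI.ixm x
    zy : ev z' (lo' + + y) ≡ lo' + + x
    zy = cong (ev z') (VI.ixm-eq x<n) & (zv _)
    Pc : ℕ -> Set
    Pc i = i ∈ ones × (suc x N.< i × w' i < w' (suc x))
    hcC : HasCard Pc (code' (suc x))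
    hcC = hc-inner (\i' -> (suc x N.<? i') ×-dec (w' i' <? w' (suc x))) ones (UP.map⁺ M.suc-injective (UP.upTo⁺ n))
    noSame : ∀ c -> c N.< n -> suc x N.< suc c -> w' (suc c) < w' (suc x) -> ¬ Same (lo' + + x) (lo' + + c)
    noSame c c<n l h sm = Z.<-asym (w-< c x h) (v-inc _ _ (lo≤ x) (lo-< (M.≤-pred l)) (lo-< c<n) sm)
    k' : (d : Dec (ev z' (lo' + + y) ≤ 0z)) -> code' (suc x) ≡ keep ⌊ d ⌋ (cc (btz z' y))
    k' (no r) = hc-unique hcC ([] , [] , (\i -> (\()) , \p -> absurd (bad i p)) , refl)
     where
      bad : ∀ i -> ¬ Pc i
      bad i (i∈ , l , h) with ones⁻ i∈
      ... | c , c<n , refl = noSame c c<n l h (inr (x>0 , Z.<-trans x>0 (lo-< (M.≤-pred l))))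
       where
        x>0 = subst (0z <_) zy (Z.≰⇒> r)
    k' (yes r) = hc-unique hcC (hc-bij (\j -> suc (ZI.ixm j)) (\i -> VI.ixm (N.pred i)) fwd bwd (cc-card y))
     where
      x≤0 = subst (_≤ 0z) zy r
      fwd : ∀ j -> Cl y j -> Pc (suc (ZI.ixm j)) × VI.ixm (ZI.ixm j) ≡ j
      fwd j (l , h) = (∈-map⁺ suc (∈-upTo⁺ (ZI.ixm-< j<n)) , s≤s (<-lo (Z.≤-<-trans x≤0 (subst (0z <_) (sym (ZI.ixm-eq j<n)) h))) ,
       <-w (ZI.ixm j) x (subst2 _<_ (sym (cong (ev v') (ZI.ixm-eq j<n) & (vz _))) (VI.ixm-eq x<n) (lo-< l))) , vz-ix j<n
       where
        j<n = M.<-trans l (VI.ixm-< x<n)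
      bwd : ∀ i -> Pc i -> Cl y (VI.ixm (N.pred i)) × suc (ZI.ixm (VI.ixm (N.pred i))) ≡ i
      bwd i (i∈ , l , h) with ones⁻ i∈
      ... | c , c<n , refl = (<-lo (subst2 _<_ (sym (VI.ixm-eq c<n)) (sym (VI.ixm-eq x<n)) (w-< c x h)) , subst (0z <_) (sym (cong (ev z') (VI.ixm-eq c<n) & (zv _))) (Z.≰⇒> (\c≤0 -> noSame c c<n l h (inl (x≤0 , c≤0))))) , cong suc (zv-ix c<n)

  lam-shp : lam n k g ≡ shp (btz z' n) ++ zs (cc (btz z' n))
  lam-shp = sortDesc-unique n (map code' ones) _ (Perm.trans (Perm.↭-reflexive (sym (L.map-∘ (upTo n)) & mc (upTo n) (\x m -> code-part x (∈-upTo⁻ m)) & L.map-∘ (upTo n)))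
   (Perm.trans (PermP.map⁺ part (map-↭ (UP.upTo⁺ n) (UP.downFrom⁺ n) VI.ixm ZI.ixm (\x m -> let l = ∈-upTo⁻ m in ∈-downFrom⁺ (VI.ixm-< l) , zv-ix l) (\x m -> let l = ∈-downFrom⁻ m in ∈-upTo⁺ (ZI.ixm-< l) , vz-ix l))) (parts n))) (Decr-shp _ (btz z' n))
   where
    mc : {f g : ℕ -> ℕ} -> ∀ xs -> (∀ x -> x ∈ xs -> f x ≡ g x) -> map f xs ≡ map g xs
    mc [] h = refl
    mc (x ∷ xs) h = cong2 _∷_ (h x (here refl)) (mc xs (\y m -> h y (there m)))

  leaf-Kostka : ∀ {k'} (a : Vec ℕ k') m -> Kostka k' (lam n k g) a m -> + m ≡ Fr (toList a) v'
  leaf-Kostka {k'} a m h = Kostka-KBs k' (cc bs) bs a m (subst (\μ -> Kostka k' μ a m) lam-shp h) & sym (Er-KBs (reverse (toList a)) bs z-G (BtR-btz z' n)) & sym (Fr-inverse (toList a) vA)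
   where
    bs = btz z' n

-- Children in the tree

module Tree (n : ℕ) {{nz : NonZero n}} (1<n : 1z < + n) (k : ℕ) where
 open Shape n 1<n k public

 win-≁ : ∀ l x y -> l ≤ x -> x < l + N -> l ≤ y -> y < l + N -> x ≢ y -> ¬ x ~ y
 win-≁ l x y a b c d ne = k' (Z.<-cmp x y)
  where
   k' : _ -> ¬ x ~ y
   k' (Tri.tri< h _ _) = near x y h (lia 4 (\x y l N -> l =< x => y :< l :+ N => |- y :< x :+ N) x y l N a d)
   k' (Tri.tri≈ _ e _) = absurd (ne e)
   k' (Tri.tri> _ _ h) = near y x h (lia 4 (\x y l N -> l =< x => y :< l :+ N => |- y :< x :+ N) y x l N c b) ∘ sym

 <1+N : ∀ {x} -> x ≤ N -> x < 1z + N
 <1+N {x} h = lia 2 (\x N -> x =< N => |- x :< #1 :+ N) x N h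

 class-count : ∀ a -> ΣL (range 1z n) (\x -> on (x ~? a) 1z) ≡ 1z
 class-count a = Σ-one (\x -> on (x ~? a) 1z) (range-unique 1z n) {x0} (∈-range⁺ 1z n x0 (fst nr) (<1+N (snd nr)))
  (\y y∈ ne -> let (p , q) = ∈-range⁻ 1z n y y∈ in on-no (y ~? a) (\h -> win-≁ 1z y x0 p q (fst nr) (<1+N (snd nr)) ne (h & sym x~)) 1z) & on-yes (x0 ~? a) x~ 1z
  where
   x0 = a + κ a * N
   nr = nrm-range a
   x~ : x0 ~ a
   x~ = sym (→~ a x0 (κ a) refl)

 -- Each residue class meets the window once. The class of a gains v(b) - v(a) and the class of b
 -- loses as much.
 tot-t : ∀ v a b -> tot (mulT n v a b) ≡ tot v
 tot-t v a b = k' (a ~? b)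
  where
   d = ev v b - ev v a
   k' : Dec (a ~ b) -> tot (mulT n v a b) ≡ tot v
   k' (yes h) = cong tot (ext _ v (\x -> ev-t v a b x & cong (ev v) (t-id h x)))
   k' (no h) = Σ-cong (range 1z n) (\x -> ev-t v a b x & each x (tv a b x)) & (Σ-+ (range 1z n) (ev v) _) &
    cong (_+_ (tot v)) ((Σ-* d (range 1z n) _) & cong (d *_) ((Σ-+ (range 1z n) _ _) & (cong2 _+_ (class-count a) ((Σ-neg (range 1z n) _) & cong (\z -> - z) (class-count b))))) & cong (_+_ (tot v)) (Z.*-zeroʳ d) & +0 (tot v)
    where
     ~a : ∀ a m -> a + m * N ~ a
     ~a a m = sym (→~ a _ m refl)
     l1 : ∀ x y m -> y + m ≡ x + m + (y - x) * (1z + - 0z)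
     l1 = ring
     l2 : ∀ x y m -> x + m ≡ y + m + (y - x) * (0z + - 1z)
     l2 = ring
     l3 : ∀ x y z -> z ≡ z + (y - x) * (0z + - 0z)
     l3 = ring
     each : ∀ x -> TV a b x -> ev v (t a b x) ≡ ev v x + d * (on (x ~? a) 1z + - on (x ~? b) 1z)
     each x (isA m refl) = cong (ev v) (t-a h m) & ev-per v b m & l1 (ev v a) (ev v b) (m * N) &
      cong2 (\p q -> p + d * q) (sym (ev-per v a m)) (cong2 (\p q -> p + - q) (sym (on-yes ((a + m * N) ~? a) (~a a m) 1z)) (sym (on-no ((a + m * N) ~? b) (\e -> h (sym (~a a m) & e)) 1z)))
     each x (isB m refl) = cong (ev v) (t-b h m) & ev-per v a m & l2 (ev v a) (ev v b) (m * N) &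
      cong2 (\p q -> p + d * q) (sym (ev-per v b m)) (cong2 (\p q -> p + - q) (sym (on-no ((b + m * N) ~? a) (\e -> h (sym e & ~a b m)) 1z)) (sym (on-yes ((b + m * N) ~? b) (~a b m) 1z)))
     each x (off p q) = cong (ev v) (t-o p q) & l3 (ev v a) (ev v b) (ev v x) & cong (\z -> ev v x + d * z) (cong2 (\p q -> p + - q) (sym (on-no (x ~? a) p 1z)) (sym (on-no (x ~? b) q 1z)))

 Bd-t : ∀ {f} r j -> ¬ r ~ j -> Bd f -> r ≤ ev f j -> ev f j ≤ r + N -> j ≤ ev f r -> ev f r ≤ j + N -> Bd (mulT n f r j)
 Bd-t {f} r j h bd p q p' q' x = subst (\y -> x ≤ y × y ≤ x + N) (sym (ev-t f r j x)) (k' (tv r j x))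
  where
   shf : ∀ x y m -> x ≤ y -> y ≤ x + N -> x + m ≤ y + m × y + m ≤ x + m + N
   shf x y m a b = lia 3 (\x y m -> x =< y => |- x :+ m =< y :+ m) x y m a , lia 4 (\x y m N -> y =< x :+ N => |- y :+ m =< x :+ m :+ N) x y m N b
   k' : TV r j x -> x ≤ ev f (t r j x) × ev f (t r j x) ≤ x + N
   k' (isA m refl) = subst (\y -> r + m * N ≤ y × y ≤ r + m * N + N) (sym (cong (ev f) (t-a h m) & ev-per f j m)) (shf r (ev f j) (m * N) p q)
   k' (isB m refl) = subst (\y -> j + m * N ≤ y × y ≤ j + m * N + N) (sym (cong (ev f) (t-b h m) & ev-per f r m)) (shf j (ev f r) (m * N) p' q')
   k' (off a b) = subst (\y -> x ≤ y × y ≤ x + N) (cong (ev f) (sym (t-o a b))) (bd x)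

 Bd? : ∀ f -> Bd f ⊎ (Σ ℤ \x -> ev f x < x ⊎ x + N < ev f x)
 Bd? f = k' (All.all? (\x -> (x ≤? ev f x) ×-dec (ev f x ≤? x + N)) (range 1z n))
  where
   k2 : ∀ x -> ¬ (x ≤ ev f x × ev f x ≤ x + N) -> Dec (x ≤ ev f x) -> ev f x < x ⊎ x + N < ev f x
   k2 x h (yes p) = inr (Z.≰⇒> (\q -> h (p , q)))
   k2 x h (no p) = inl (Z.≰⇒> p)
   k' : Dec (All (\x -> x ≤ ev f x × ev f x ≤ x + N) (range 1z n)) -> Bd f ⊎ (Σ ℤ \x -> ev f x < x ⊎ x + N < ev f x)
   k' (yes h) = inl (\x -> let (a , b) = nrm-range x ; (p , q) = All.lookup h (∈-range⁺ 1z n (x + κ x * N) a (<1+N b)) in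
    lia 3 (\x y m -> x :+ m =< y :+ m => |- x =< y) x (ev f x) (κ x * N) (subst (x + κ x * N ≤_) (ev-per f x (κ x)) p) ,
    lia 4 (\x y m N -> y :+ m =< x :+ m :+ N => |- y =< x :+ N) x (ev f x) (κ x * N) N (subst (_≤ x + κ x * N + N) (ev-per f x (κ x)) q))
   k' (no h) = let (x , p) = Any.satisfied (AllP.¬All⇒Any¬ (\x -> (x ≤? ev f x) ×-dec (ev f x ≤? x + N)) (range 1z n) h) in inr (x , k2 x p (x ≤? ev f x))

 last-before : {P : ℤ -> Set} (P? : ∀ x -> Dec (P x)) -> ∀ r d -> (Σ ℤ \i -> r - + d ≤ i × i < r × P i × (∀ x -> i < x -> x < r -> ¬ P x)) ⊎ (∀ x -> r - + d ≤ x -> x < r -> ¬ P x)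
 last-before P? r zero = inr (\x a b _ -> Z.<⇒≱ b (subst (_≤ x) (+0 r) a))
 last-before {P} P? r (suc d) = k' (last-before P? r d) (P? x0)
  where
   x0 = r - + suc d
   dn' : x0 ≤ r - + d
   dn' = lia 2 (\r d -> |- r :- (#1 :+ d) =< r :- d) r (+ d)
   up' : ∀ x -> x0 < x -> r - + d ≤ x
   up' x h = lia 3 (\r d x -> r :- (#1 :+ d) :< x => |- r :- d =< x) r (+ d) x h
   R = (Σ ℤ \i -> x0 ≤ i × i < r × P i × (∀ x -> i < x -> x < r -> ¬ P x)) ⊎ (∀ x -> x0 ≤ x -> x < r -> ¬ P x)
   k' : (Σ ℤ \i -> r - + d ≤ i × i < r × P i × (∀ x -> i < x -> x < r -> ¬ P x)) ⊎ (∀ x -> r - + d ≤ x -> x < r -> ¬ P x) -> Dec (P x0) -> R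
   k' (inl (i , a , b)) _ = inl (i , Z.≤-trans dn' a , b)
   k' (inr h) (yes p) = inl (x0 , Z.≤-refl , lia 2 (\r d -> #0 =< d => |- r :- (#1 :+ d) :< r) r (+ d) (ℤ.+≤+ z≤n) , p , \x l -> h x (up' x l))
   k' (inr h) (no p) = inr (\x a b -> k2 x b (x ≟ x0) a)
    where
     k2 : ∀ x -> x < r -> Dec (x ≡ x0) -> x0 ≤ x -> ¬ P x
     k2 x b (yes refl) _ = p
     k2 x b (no ne) a = h x (up' x (Z.≤∧≢⇒< a (ne ∘ sym))) b

 ev-a : ∀ f r j -> ¬ r ~ j -> ev (mulT n f r j) r ≡ ev f j
 ev-a f r j h = ev-t f r j r & cong (ev f) (t-a0 h)

 ev-b : ∀ f r j -> ¬ r ~ j -> ev (mulT n f r j) j ≡ ev f r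
 ev-b f r j h = ev-t f r j j & cong (ev f) (t-b0 h)

 ev-o : ∀ f r j x -> ¬ x ~ r -> ¬ x ~ j -> ev (mulT n f r j) x ≡ ev f x
 ev-o f r j x h h' = ev-t f r j x & cong (ev f) (t-o h h')

 Cov-sym : ∀ {f} r j -> Cov f r j -> Cov f j r
 Cov-sym {f} r j h = cong len (mulT-sym f j r) & h

 module Node {g : Perm n} (gA : IsAff g) (gB : Bd g) (r s : ℤ) (1≤r : 1z ≤ r) (r<s : r < s) (s≤N : s ≤ N) (gs<gr : ev g s < ev g r)
  (up1 : ∀ p q -> r < p -> p < q -> q ≤ N -> ev g p < ev g q) (up2 : ∀ q -> s < q -> q ≤ N -> ev g r < ev g q) where

  in≁ : ∀ x y -> 1z ≤ x -> x ≤ N -> 1z ≤ y -> y ≤ N -> x ≢ y -> ¬ x ~ y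
  in≁ x y a b c d = win-≁ 1z x y a (<1+N b) c (<1+N d)

  1≤s : 1z ≤ s
  1≤s = Z.≤-trans 1≤r (Z.<⇒≤ r<s)

  r≤N : r ≤ N
  r≤N = Z.≤-trans (Z.<⇒≤ r<s) s≤N

  r≁s : ¬ r ~ s
  r≁s = in≁ r s 1≤r r≤N 1≤s s≤N (\e -> Z.<-irrefl e r<s)

  u0 : Perm n
  u0 = mulT n g r s

  uA : IsAff u0
  uA = t-Aff gA r s

  ur : ev u0 r ≡ ev g s
  ur = ev-a g r s r≁s

  us : ev u0 s ≡ ev g r
  us = ev-b g r s r≁s

  uo : ∀ q -> r < q -> q ≤ N -> q ≢ s -> ev u0 q ≡ ev g q
  uo q a b ne = ev-o g r s q (in≁ q r 1≤q b 1≤r r≤N (\e -> Z.<-irrefl (sym e) a)) (in≁ q s 1≤q b 1≤s s≤N ne)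
   where
    1≤q = Z.≤-trans 1≤r (Z.<⇒≤ a)

  ur<us : ev u0 r < ev u0 s
  ur<us = subst2 _<_ (sym ur) (sym us) gs<gr

  u-up : ∀ p q -> r < p -> p < q -> q ≤ N -> ev u0 p < ev u0 q
  u-up p q a l b = k' (p ≟ s) (q ≟ s)
   where
    k' : Dec (p ≡ s) -> Dec (q ≡ s) -> ev u0 p < ev u0 q
    k' (yes refl) (yes refl) = absurd (Z.<-irrefl refl l)
    k' (yes refl) (no ne) = subst2 _<_ (sym us) (sym (uo q (Z.<-trans a l) b ne)) (up2 q l b)
    k' (no ne) (yes refl) = subst2 _<_ (sym (uo p a (Z.<⇒≤ (Z.<-≤-trans l b)) ne)) (sym us) (Z.<-trans (up1 p q a l b) gs<gr)
    k' (no ne) (no ne') = subst2 _<_ (sym (uo p a (Z.<⇒≤ (Z.<-≤-trans l b)) ne)) (sym (uo q (Z.<-trans a l) b ne')) (up1 p q a l b)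

  us≤ : ∀ q -> s ≤ q -> q ≤ N -> ev u0 s ≤ ev u0 q
  us≤ q a b = k' (s ≟ q)
   where
    k' : Dec (s ≡ q) -> ev u0 s ≤ ev u0 q
    k' (yes refl) = Z.≤-refl
    k' (no ne) = Z.<⇒≤ (u-up s q r<s (Z.≤∧≢⇒< a ne) b)

  s≤gs = fst (gB s)
  gr≤ = snd (gB r)

  uB : Bd u0
  uB = Bd-t r s r≁s gB (Z.≤-trans (Z.<⇒≤ r<s) s≤gs) (Z.<⇒≤ (Z.<-≤-trans gs<gr gr≤)) (Z.≤-trans s≤gs (Z.<⇒≤ gs<gr))
   (Z.≤-trans gr≤ (lia 3 (\r s N -> r :< s => |- r :+ N =< s :+ N) r s N r<s))

  -- By maximality of the inversion, positions strictly between r and s carry values below g(s) =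
  -- u0(r), so none of them is intermediate.
  cov-rs : Cov u0 r s
  cov-rs = cov⁺ uA r s r<s r≁s ur<us (\c a b p _ -> Z.<-asym (subst2 _<_ ur (uo c a (Z.<⇒≤ (Z.<-≤-trans b s≤N)) (\e -> Z.<-irrefl e b)) p) (up1 c s a b s≤N))

  g≡ : mulT n u0 r s ≡ g
  g≡ = mulT-inv g r s

  -- The form in which a child is seen to have a smaller maximal inversion: no inversion starts
  -- after r, and none that starts at r ends at s or later.
  Low : Perm n -> Set
  Low c = (∀ p q -> r < p -> p < q -> q ≤ N -> ev c p < ev c q) × (∀ q -> s ≤ q -> q ≤ N -> ev c r < ev c q)

  -- After r the child differs from u0 only at positions congruent to j, where values go up, so the
  -- order can break only between such a p and some q > p. The translate q' of q by the same period
  -- as from p to j lies between j and r, and there the cover condition forbids a value between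
  -- u0(j) and u0(r).
  low⁺ : ∀ j -> j < r -> ¬ r ~ j -> Cov u0 r j -> Low (mulT n u0 r j)
  low⁺ j j<r h cv = A , \q a b -> subst (_< ev c q) (sym cr) (Z.<-≤-trans (Z.<-trans uj<ur ur<us) (Z.≤-trans (us≤ q a b) (ge q (Z.<-≤-trans r<s a) b (q ~? j))))
   where
    c = mulT n u0 r j
    cv' = cov⁻ uA j r j<r (h ∘ sym) (Cov-sym r j cv)
    uj<ur = fst cv'
    cr = ev-a u0 r j h
    cj = ev-b u0 r j h
    q≁r : ∀ q -> r < q -> q ≤ N -> ¬ q ~ r
    q≁r q a b = in≁ q r (Z.≤-trans 1≤r (Z.<⇒≤ a)) b 1≤r r≤N (\e -> Z.<-irrefl (sym e) a)
    eq : ∀ q -> r < q -> q ≤ N -> ¬ q ~ j -> ev c q ≡ ev u0 q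
    eq q a b h' = ev-o u0 r j q (q≁r q a b) h'
    at~ : ∀ q m -> q ≡ j + m * N -> ev c q ≡ ev u0 r + m * N × ev u0 q ≡ ev u0 j + m * N
    at~ q m refl = ev-per c j m & cong (_+ m * N) cj , ev-per u0 j m
    ge : ∀ q -> r < q -> q ≤ N -> Dec (q ~ j) -> ev u0 q ≤ ev c q
    ge q a b (no h') = Z.≤-reflexive (sym (eq q a b h'))
    ge q a b (yes h') = let (m , e) = ~→ j q (sym h') ; (e1 , e2) = at~ q m e in
     subst2 _≤_ (sym e2) (sym e1) (lia 3 (\x y m -> x :< y => |- x :+ m =< y :+ m) (ev u0 j) (ev u0 r) (m * N) uj<ur)
    A : ∀ p q -> r < p -> p < q -> q ≤ N -> ev c p < ev c q
    A p q a l b = k' (p ~? j)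
     where
      p≤N = Z.<⇒≤ (Z.<-≤-trans l b)
      r<q = Z.<-trans a l
      k' : Dec (p ~ j) -> ev c p < ev c q
      k' (no h') = Z.<-≤-trans (subst (_< ev u0 q) (sym (eq p a p≤N h')) (u-up p q a l b)) (ge q r<q b (q ~? j))
      k' (yes h') = subst2 _<_ (sym e1) (sym cq) (k2 (mcase m))
       where
        m = fst (~→ j p (sym h'))
        e = snd (~→ j p (sym h'))
        e1 = fst (at~ p m e)
        e2 = snd (at~ p m e)
        q≁p : ¬ q ~ p
        q≁p = in≁ q p (Z.≤-trans 1≤r (Z.<⇒≤ r<q)) b (Z.≤-trans 1≤r (Z.<⇒≤ a)) p≤N (\e -> Z.<-irrefl (sym e) l)
        cq = eq q r<q b (\e -> q≁p (e & sym h'))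
        q' = q + (- m) * N
        uq' : ev u0 q' ≡ ev u0 q - m * N
        uq' = ev-per u0 q (- m) & cong (_+_ (ev u0 q)) (sym (Z.neg-distribˡ-* m N))
        q'≡ : q' ≡ q - m * N
        q'≡ = cong (_+_ q) (sym (Z.neg-distribˡ-* m N))
        k2 : MC m -> ev u0 r + m * N < ev u0 q
        k2 (neg _ h2) = absurd (Z.<-asym a (lia 5 (\p j Mu r N -> p := j :+ Mu => Mu =< #0 :- N => j :< r => #1 :< N => |- p :< r) p j (m * N) r N e (subst (m * N ≤_) (sym (0+ (- N))) h2) j<r 1<n))
        k2 (nul h2) = absurd (Z.<-asym a (subst (_< r) (sym (e & cong (\m -> j + m * N) h2 & +0N j)) j<r))
        k2 (pos' _ h2) = lia 4 (\x y z Mu -> x :< y => y := z :- Mu => |- x :+ Mu :< z) (ev u0 r) (ev u0 q') (ev u0 q) (m * N) (Z.≤∧≢⇒< (Z.≮⇒≥ (\lt -> snd cv' q' j<q' q'<r uj< lt)) (\e3 -> q≁r q r<q b ((→~ q q' (- m) refl) & cong (_%ℕ n) (sym (inj uA r q' e3))))) uq'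
         where
          j<q' = subst (j <_) (sym q'≡) (lia 4 (\j q p Mu -> p := j :+ Mu => p :< q => |- j :< q :- Mu) j q p (m * N) e l)
          q'<r = subst (_< r) (sym q'≡) (lia 4 (\q r Mu N -> q =< N => N =< Mu => #1 =< r => |- q :- Mu :< r) q r (m * N) N b h2 1≤r)
          uj< = lia 5 (\x y z w Mu -> x :< y => x := z :+ Mu => w := y :- Mu => |- z :< w) (ev u0 p) (ev u0 q) (ev u0 j) (ev u0 q') (m * N) (u-up p q a l b) e2 uq'

  -- Inside the window only j = s could be a cover to the right, so j > n, while boundedness of the
  -- child gives j < r + n. Hence no window position after r is congruent to j, and the values there
  -- are those of u0.
  low⁻ : ∀ j -> r < j -> ¬ r ~ j -> Cov u0 r j -> j ≢ s -> Bd (mulT n u0 r j) -> Low (mulT n u0 r j)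
  low⁻ j r<j h cv ne bd = (\p q a l b -> subst2 _<_ (sym (eq p a (Z.<⇒≤ (Z.<-≤-trans l b)))) (sym (eq q (Z.<-trans a l) b)) (u-up p q a l b)) ,
   \q a b -> subst2 _<_ (sym cr) (sym (eq q (Z.<-≤-trans r<s a) b)) (Z.≤∧≢⇒< (Z.≮⇒≥ (snd cv' q (Z.<-≤-trans r<s a) (Z.≤-<-trans b j>N) (Z.<-≤-trans ur<us (us≤ q a b)))) (\e -> Z.<-irrefl (sym (inj uA _ _ e)) (Z.≤-<-trans b j>N)))
   where
    c = mulT n u0 r j
    cv' = cov⁻ uA r j r<j h cv
    cr = ev-a u0 r j h
    j>N : N < j
    j>N = Z.≰⇒> (\j≤N -> k' j≤N (Z.<-cmp j s))
     where
      k' : j ≤ N -> _ -> ⊥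
      k' j≤N (Tri.tri< l _ _) = Z.<-asym (fst cv') (subst2 _<_ (sym (uo j r<j j≤N ne)) (sym ur) (up1 j s r<j l s≤N))
      k' j≤N (Tri.tri≈ _ e _) = ne e
      k' j≤N (Tri.tri> _ _ l) = snd cv' s r<s l ur<us (u-up s j r<s l j≤N)
    j<r+N : j < r + N
    j<r+N = Z.≤∧≢⇒< (Z.≤-trans (fst (uB j)) (subst (_≤ r + N) cr (snd (bd r)))) (\e -> h (→~ r j 1z (e & cong (_+_ r) (sym (Z.*-identityˡ N)))))
    eq : ∀ q -> r < q -> q ≤ N -> ev c q ≡ ev u0 q
    eq q a b = ev-o u0 r j q (in≁ q r (Z.≤-trans 1≤r (Z.<⇒≤ a)) b 1≤r r≤N (\e -> Z.<-irrefl (sym e) a))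
     (near q j (Z.≤-<-trans b j>N) (lia 4 (\q j r N -> j :< r :+ N => r :< q => |- j :< q :+ N) q j r N j<r+N a))

  r<ur : r < ev u0 r
  r<ur = subst (r <_) (sym ur) (Z.<-≤-trans r<s s≤gs)

  ur<r+N : ev u0 r < r + N
  ur<r+N = subst (_< r + N) (sym ur) (Z.<-≤-trans gs<gr gr≤)

  Mid : ℤ -> Set
  Mid i = r ≤ ev u0 i × ev u0 i < ev u0 r

  -- Otherwise the values r, …, u(r) - 1 all sit, modulo n, at the u(r) - r - 1
  -- positions strictly between r and u(r).
  mid-exists : ¬ (∀ x -> ev u0 r - N ≤ x -> x < r -> ¬ Mid x)
  mid-exists none = let (i , j , i<j , e) = FinP.pigeonhole (M.n<1+n Mu) f in
   FinP.<⇒≢ i<j (FinP.toℕ-injective (val-inj i j (subst2 _~_ (ev-at uA (Y i)) (ev-at uA (Y j)) (per-~ {ev u0} (ev-per u0) _ _ (sym (Xp~ i) & cong (_%ℕ n) (Xp≡ i j e) & Xp~ j)))))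
   where
    Mu = ℤ.∣ ev u0 r - r - 1z ∣
    M≡ : + Mu ≡ ev u0 r - r - 1z
    M≡ = Z.0≤i⇒+∣i∣≡i (lia 2 (\r y -> r :< y => |- #0 =< y :- r :- #1) r (ev u0 r) r<ur)
    Y : Fin (suc Mu) -> ℤ
    Y i = r + + toℕ i
    Y< : ∀ i -> Y i < ev u0 r
    Y< i = lia 4 (\r i Mu y -> i :< #1 :+ Mu => Mu := y :- r :- #1 => |- r :+ i :< y) r (+ toℕ i) (+ Mu) (ev u0 r) (ℤ.+<+ (FinP.toℕ<n i)) M≡
    r≤Y : ∀ i -> r ≤ Y i
    r≤Y i = lia 2 (\r i -> #0 =< i => |- r =< r :+ i) r (+ toℕ i) (ℤ.+≤+ z≤n)
    val-inj : ∀ i j -> Y i ~ Y j -> toℕ i ≡ toℕ j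
    val-inj i j h = k' (Y i ≟ Y j)
     where
      k' : Dec (Y i ≡ Y j) -> toℕ i ≡ toℕ j
      k' (yes e) = Z.+-injective (lia 3 (\r x y -> r :+ x := r :+ y => |- x := y) r (+ toℕ i) (+ toℕ j) e)
      k' (no ne) = absurd (win-≁ r (Y i) (Y j) (r≤Y i) (Z.<-trans (Y< i) ur<r+N) (r≤Y j) (Z.<-trans (Y< j) ur<r+N) ne h)
    Pos : ℤ -> Set
    Pos x = Σ ℤ \x' -> x' ~ x × r < x' × x' < ev u0 r
    place : ∀ i -> Pos (at uA (Y i))
    place i = k' (r ≤? x) (ev u0 r - N ≤? x)
     where
      x = at uA (Y i)
      ux : ev u0 x ≡ Y i
      ux = ev-at uA (Y i)
      k' : Dec (r ≤ x) -> Dec (ev u0 r - N ≤ x) -> Pos x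
      k' (yes a) _ = x , refl , Z.≤∧≢⇒< a (\e -> Z.<-irrefl (sym ux & cong (ev u0) (sym e)) (Y< i)) , Z.≤-<-trans (subst (x ≤_) ux (fst (uB x))) (Y< i)
      k' (no a) (yes b) = absurd (none x b (Z.≰⇒> a) (subst (r ≤_) (sym ux) (r≤Y i) , subst (_< ev u0 r) (sym ux) (Y< i)))
      k' (no a) (no b) = x + 1z * N , sym (→~ x _ 1z refl) , Z.≤∧≢⇒< (Z.≤-trans (r≤Y i) (subst2 _≤_ ux (cong (_+_ x) (sym 1N)) (snd (uB x)))) (\e -> Z.<⇒≱ (lt e) (r≤Y i)) ,
       lia 4 (\x y Mu N -> x :< y :- N => Mu := N => |- x :+ Mu :< y) x (ev u0 r) (1z * N) N (Z.≰⇒> b) 1N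
       where
        1N = Z.*-identityˡ N
        lt : r ≡ x + 1z * N -> Y i < r
        lt e = lia 5 (\y u r Mu N -> u := y :+ Mu => Mu := N => u :< r :+ N => |- y :< r) (Y i) (ev u0 r) r (1z * N) N (cong (ev u0) e & ev-per u0 x 1z & cong (_+ 1z * N) ux) 1N ur<r+N
    Xp : Fin (suc Mu) -> ℤ
    Xp i = fst (place i)
    Xp~ : ∀ i -> Xp i ~ at uA (Y i)
    Xp~ i = fst (snd (place i))
    r<Xp : ∀ i -> r < Xp i
    r<Xp i = fst (snd (snd (place i)))
    Xp< : ∀ i -> Xp i < ev u0 r
    Xp< i = snd (snd (snd (place i)))
    0≤ : ∀ i -> 0z ≤ Xp i - r - 1z
    0≤ i = lia 2 (\r y -> r :< y => |- #0 =< y :- r :- #1) r (Xp i) (r<Xp i)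
    Xn : ∀ i -> ℤ.∣ Xp i - r - 1z ∣ N.< Mu
    Xn i = Z.drop‿+<+ (subst2 _<_ (sym (Z.0≤i⇒+∣i∣≡i (0≤ i))) (sym M≡) (lia 3 (\x y r -> x :< y => |- x :- r :- #1 :< y :- r :- #1) (Xp i) (ev u0 r) r (Xp< i)))
    f : Fin (suc Mu) -> Fin Mu
    f i = fromℕ< (Xn i)
    Xp≡ : ∀ i j -> f i ≡ f j -> Xp i ≡ Xp j
    Xp≡ i j e = lia 3 (\x y r -> x :- r :- #1 := y :- r :- #1 => |- x := y) (Xp i) (Xp j) r (sym (Z.0≤i⇒+∣i∣≡i (0≤ i)) & (cong +_ (sym (FinP.toℕ-fromℕ< (Xn i)) & cong toℕ e & FinP.toℕ-fromℕ< (Xn j))) & Z.0≤i⇒+∣i∣≡i (0≤ j))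

  -- The last position before r with a value in the range of `Mid` has no intermediate position, so
  -- it gives a cover. Such a child always exists, which keeps a vertex with an inversion from being
  -- childless.
  plus-child : Σ ℤ \i -> i < r × (¬ r ~ i) × Cov u0 r i × Bd (mulT n u0 r i)
  plus-child = k' (last-before (\x -> (r ≤? ev u0 x) ×-dec (ev u0 x <? ev u0 r)) r d)
   where
    d = ℤ.∣ r - (ev u0 r - N) ∣
    d≡ : r - + d ≡ ev u0 r - N
    d≡ = lia 3 (\r d y -> d := r :- y => |- r :- d := y) r (+ d) (ev u0 r - N) (Z.0≤i⇒+∣i∣≡i (lia 3 (\r y N -> y :< r :+ N => |- #0 =< r :- (y :- N)) r (ev u0 r) N ur<r+N))
    k' : _ -> Σ ℤ \i -> i < r × (¬ r ~ i) × Cov u0 r i × Bd (mulT n u0 r i)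
    k' (inr h) = absurd (mid-exists (\x a -> h x (subst (_≤ x) (sym d≡) a)))
    k' (inl (i , a , b , (p , q) , h)) = i , b , ri≁ , Cov-sym i r (cov⁺ uA i r b (ri≁ ∘ sym) q (\c x y z w -> h c x y (Z.≤-trans p (Z.<⇒≤ z) , w))) ,
     Bd-t r i ri≁ uB p (Z.<⇒≤ (Z.<-trans q ur<r+N)) (Z.<⇒≤ (Z.<-trans b r<ur)) (lia 3 (\y i N -> y :- N =< i => |- y =< i :+ N) (ev u0 r) i N (subst (_≤ i) d≡ a))
     where
      ri≁ : ¬ r ~ i
      ri≁ = near i r b (lia 4 (\r i y N -> y :- N =< i => r :< y => |- r :< i :+ N) r i (ev u0 r) N (subst (_≤ i) d≡ a) r<ur) ∘ sym

-- The tree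

sgz : Sign -> ℤ
sgz Sign.+ = 1z
sgz Sign.- = -[1+ 0 ]

sgz-* : ∀ σ τ -> sgz (σ Sign.* τ) ≡ sgz σ * sgz τ
sgz-* Sign.+ Sign.+ = refl
sgz-* Sign.+ Sign.- = refl
sgz-* Sign.- Sign.+ = refl
sgz-* Sign.- Sign.- = refl

◃-sgz : ∀ σ m -> σ ◃ m ≡ sgz σ * + m
◃-sgz Sign.+ m = Z.+◃n≡+n m & sym (Z.*-identityˡ (+ m))
◃-sgz Sign.- m = Z.-◃n≡-n m & sym (Z.-1*i≡-i (+ m))

II-on : ∀ {n k} {P : Set} (d : Dec P) {φ : Vec ℕ k -> ℤ} -> (P -> InI n k φ) -> InI n k (\a -> on d (φ a))
II-on (yes p) h = h p
II-on (no _) h = II-0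

module Final (n : ℕ) {{nz : NonZero n}} (1<n : 1z < + n) (k : ℕ) (k≤n : k N.≤ n) where
 open Tree n 1<n k public

 -- A cover has positive length and so is never the identity, hence D kills `δe`; the operators `H`
 -- preserve this by `D-H`.
 D-Fr : ∀ as r -> D r (Fr as) ≈ O
 D-Fr [] r v A = Σ-0 (covs v r) (\j j∈ -> cong (ori r j *_) (on-no (mulT n v r j ≟P idP n) (\e -> ne e (snd (covs⁻ v r j j∈))) 1z) & Z.*-zeroʳ (ori r j))
  where
   ne : ∀ {x m} -> x ≡ idP n -> len x ≡ suc m -> ⊥
   ne refl e with trans (sym len-id) e
   ... | ()
 D-Fr (a ∷ as) r = D-H D-deriv (Fr as) (D-Fr as) a r

 Fk : Vec ℕ k -> Perm n -> ℤ
 Fk a g = Fr (toList a) (shift n (+ k) g)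

 record OK (g : Perm n) : Set where
  constructor okk
  field
   oA : IsAff g
   oB : Bd g
   oE : exceed g ≡ k
 open OK

 OK→ : ∀ {c} -> OK c -> IsBound n k c
 OK→ {c} (okk A B E) = fromAff A , (\x -> subst (\y -> x ≤ y × y ≤ x + N) (ev≡eval c x) (B x)) , E

 →OK : ∀ {c} -> IsBound n k c -> OK c
 →OK {c} (A , B , E) = okk (toAff A) (\x -> subst (\y -> x ≤ y × y ≤ x + N) (sym (ev≡eval c x)) (B x)) E

 -- Among bounded permutations the window sum determines the number of exceedances.
 exceed-eq : ∀ {c g} -> OK g -> IsAff c -> Bd c -> tot c ≡ tot g -> OK c
 exceed-eq {c} {g} o A B e = okk A B (Z.+-injective (*N-cancel _ _ (lia 5 (\x y t c g -> c := t :+ x => g := t :+ y => c := g => |- x := y) (+ exceed c * N) (+ exceed g * N) tot-id (tot c) (tot g) (exceed-tot A B) (exceed-tot (oA o) (oB o)) e)) & oE o)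

 Bd-dec : ∀ f -> Dec (Bd f)
 Bd-dec f = k' (Bd? f)
  where
   k' : _ -> Dec (Bd f)
   k' (inl b) = yes b
   k' (inr (x , inl h)) = no (\b -> Z.<⇒≱ h (fst (b x)))
   k' (inr (x , inr h)) = no (\b -> Z.<⇒≱ h (snd (b x)))

 -- After translation by -k, c(x) < x becomes v(x) < x - k, out of reach of k factors, and c(x) > x
 -- + n becomes v(x) > x + (n - k), the hypothesis of `Fr-in-ideal`.
 unbounded : ∀ {c} -> IsAff c -> ¬ Bd c -> InI n k (\a -> Fk a c)
 unbounded {c} A nb = k' (Bd? c)
  where
   v = shift n (+ k) c
   k' : _ -> InI n k (\a -> Fk a c)
   k' (inl b) = absurd (nb b)
   k' (inr (x , inl h)) = II-ext (\a -> Fr-0 (toList a) (shift-Aff (+ k) A) x (subst (\m -> ev v x < x - + m) (sym (VecP.length-toList a))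
    (subst (_< x - + k) (sym (ev-shift (+ k) c x)) (lia 3 (\y x k -> y :< x => |- y :- k :< x :- k) (ev c x) x (+ k) h)))) II-0
   k' (inr (x , inr h)) = Fr-in-ideal (shift-Aff (+ k) A) k≤n x (subst2 _<_ (cong (_+_ x) nk) (sym (ev-shift (+ k) c x)) (lia 4 (\y x k N -> x :+ N :< y => |- x :+ (N :- k) :< y :- k) (ev c x) x (+ k) N h))
    where
     nk : N - + k ≡ + (n N.∸ k)
     nk = Z.m-n≡m⊖n n k & Z.⊖-≥ k≤n

 Lf : Sign × Perm n -> Set
 Lf sg = ZeroGrass n (snd sg) × OK (snd sg)

 sF : List (Sign × Perm n) -> Vec ℕ k -> ℤ
 sF L a = ΣL L (\sg -> sgz (fst sg) * Fk a (snd sg))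

 -- Only congruence modulo the ideal is carried along the tree, since dropping an unbounded cover
 -- may change the series itself.
 Res : Perm n -> Set
 Res g = Σ (List (Sign × Perm n)) \L -> LSTree n k g L × All Lf L × InI n k (\a -> Fk a g - sF L a)

 sgd : Sign × Perm n -> List (Sign × Perm n) -> List (Sign × Perm n)
 sgd sc L = map (\th -> (fst sc Sign.* fst th , snd th)) L

 sF-sgd : ∀ sc L a -> sF (sgd sc L) a ≡ sgz (fst sc) * sF L a
 sF-sgd sc L a = (Σ-map _ L _) & Σ-cong L (\th -> cong (_* Fk a (snd th)) (sgz-* (fst sc) (fst th)) & (Z.*-assoc (sgz (fst sc)) _ _)) & (Σ-* (sgz (fst sc)) L _)

 build : ∀ cs -> All (\sc -> Res (snd sc)) cs -> Σ (List (List (Sign × Perm n))) \ls -> Pointwise (\sc L -> LSTree n k (snd sc) L) cs ls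
  × All Lf (concat (zipWith sgd cs ls)) × InI n k (\a -> sF cs a - sF (concat (zipWith sgd cs ls)) a)
 build [] [] = [] , [] , [] , II-0
 build (c ∷ cs) ((L , T , al , i) ∷ rs) with build cs rs
 ... | ls , pw' , al' , i' = L ∷ ls , T ∷ pw' , AllP.++⁺ (AllP.map⁺ al) al' ,
  II-ext (\a -> cong (\z -> sgz (fst c) * Fk a (snd c) + sF cs a - z) ((Σ-++ (sgd c L) _ _) & cong (_+ sF (concat (zipWith sgd cs ls)) a) (sF-sgd c L a)) & (l (sgz (fst c)) (Fk a (snd c)) (sF cs a) (sF L a) _)) (II-+ (II-* (sgz (fst c)) i) i')
  where
   l : ∀ s f x y z -> s * f + x - (s * y + z) ≡ s * (f - y) + (x - z)
   l = ring

 leaf-Res : ∀ {g} -> OK g -> ZeroGrass n g -> Res g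
 leaf-Res {g} o z = [ (Sign.+ , g) ] , leaf z , (z , o) ∷ [] , II-ext (\a -> l (Fk a g)) II-0
  where
   l : ∀ x -> x - (1z * x + 0z) ≡ 0z
   l = ring

 Below : ℤ -> ℤ -> Perm n -> Set
 Below r s g = ∀ r' s' -> Inv1 n g r' s' -> r' < r ⊎ (r' ≡ r × s' ≤ s)

 module Step {g : Perm n} (o : OK g) (r s : ℤ) (iv : Inv1 n g r s) (mx : Below r s g)
  (rec : ∀ c -> OK c -> Below r (s - 1z) c -> Res c) where

  inv : ∀ {c} -> IsAff c -> ∀ p q -> 1z ≤ p -> p < q -> q ≤ N -> ¬ Inv1 n c p q -> ev c p < ev c q
  inv {c} A p q a l b h = k' (ev c p <? ev c q)
   where
    k' : Dec (ev c p < ev c q) -> ev c p < ev c q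
    k' (yes x) = x
    k' (no x) = absurd (h (a , l , b , subst2 _<_ (ev≡eval c q) (ev≡eval c p) (Z.≤∧≢⇒< (Z.≮⇒≥ x) (\e -> Z.<-irrefl (sym (inj A _ _ e)) l))))

  1≤r' = fst iv
  r<s' = fst (snd iv)

  not1 : ∀ p q -> r < p -> ¬ Inv1 n g p q
  not1 p q l i = k' (mx p q i)
   where
    k' : p < r ⊎ (p ≡ r × q ≤ s) -> ⊥
    k' (inl h) = Z.<-asym h l
    k' (inr (e , _)) = Z.<-irrefl (sym e) l
  not2 : ∀ q -> s < q -> ¬ Inv1 n g r q
  not2 q l i = k' (mx r q i)
   where
    k' : r < r ⊎ (r ≡ r × q ≤ s) -> ⊥
    k' (inl h) = Z.<-irrefl refl h
    k' (inr (_ , h)) = Z.<⇒≱ l h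

  open Node (oA o) (oB o) r s 1≤r' r<s' (fst (snd (snd iv))) (subst2 _<_ (sym (ev≡eval g s)) (sym (ev≡eval g r)) (snd (snd (snd iv))))
   (\p q a l b -> inv (oA o) p q (Z.≤-trans 1≤r' (Z.<⇒≤ a)) l b (not1 p q a)) (\q l b -> inv (oA o) r q 1≤r' (Z.<-trans r<s' l) b (not2 q l))

  v0 : Perm n
  v0 = shift n (+ k) u0
  v0A = shift-Aff (+ k) uA

  ch : ℤ -> Perm n
  ch j = mulT n u0 r j

  chA : ∀ j -> IsAff (ch j)
  chA j = t-Aff uA r j

  cov-sh : ∀ j -> (Cov u0 r j -> Cov v0 r j) × (Cov v0 r j -> Cov u0 r j)
  cov-sh j = (\h -> e1 & h & cong suc (sym e2)) , \h -> sym e1 & h & cong suc e2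
   where
    e1 = cong len (sym (mulT-shift (+ k) u0 r j)) & len-shift (+ k) (ch j)
    e2 = len-shift (+ k) u0

  cvs = covs v0 r

  cvs⁻ : ∀ j -> j ∈ cvs -> (¬ r ~ j) × Cov u0 r j
  cvs⁻ j m = let (a , b) = covs⁻ v0 r j m in a , snd (cov-sh j) b

  cvs⁺ : ∀ j -> ¬ r ~ j -> Cov u0 r j -> j ∈ cvs
  cvs⁺ j a b = covs⁺ v0A r j a (fst (cov-sh j) b)

  ch-inj : ∀ i j -> ¬ r ~ i -> ¬ r ~ j -> ch i ≡ ch j -> i ≡ j
  ch-inj i j a b e = inj uA i j (sym (ev-a u0 r i a) & cong (\c -> ev c r) e & ev-a u0 r j b)

  ok? : ∀ j -> Dec (j ≢ s × Bd (ch j))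
  ok? j = ¬? (j ≟ s) ×-dec Bd-dec (ch j)

  bad? : ∀ j -> Dec (j ≢ s × ¬ Bd (ch j))
  bad? j = ¬? (j ≟ s) ×-dec ¬? (Bd-dec (ch j))

  sgd? : ∀ {j} -> Dec (r < j) -> Sign
  sgd? (yes _) = Sign.-
  sgd? (no _) = Sign.+

  sgn : ℤ -> Sign
  sgn j = sgd? {j} (r <? j)

  js = filter ok? cvs

  js⁻ : ∀ {j} -> j ∈ js -> j ∈ cvs × (j ≢ s × Bd (ch j))
  js⁻ = ∈-filter⁻ ok? {xs = cvs}

  mk'' : ℤ -> Sign × Perm n
  mk'' j = sgn j , ch j

  cs : List (Sign × Perm n)
  cs = map mk'' js

  cs-unique : Unique cs
  cs-unique = uniq-map∈ mk'' (UP.filter⁺ ok? (covs-unique v0 r)) (\i j m m' e -> ch-inj i j (fst (cvs⁻ i (fst (js⁻ m)))) (fst (cvs⁻ j (fst (js⁻ m')))) (cong snd e))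

  chOK : ∀ j -> Bd (ch j) -> OK (ch j)
  chOK j b = exceed-eq o (chA j) b (tot-t u0 r j & tot-t g r s)

  cover⁺ : ∀ j -> Cov u0 r j -> Cover n u0 (ch j)
  cover⁺ j h = len u0 , Len-len u0 , subst (Len n (ch j)) h (Len-len (ch j))

  cover⁻ : ∀ j -> Cover n u0 (ch j) -> Cov u0 r j
  cover⁻ j (m , a , b) = sym (Len→len (ch j) b) & cong suc (Len→len u0 a)

  j<r : ∀ j -> ¬ r ~ j -> ¬ r < j -> j < r
  j<r j a b = Z.≤∧≢⇒< (Z.≮⇒≥ b) (\e -> a (cong (_%ℕ n) (sym e)))

  child⁺ : ∀ {j} -> j ∈ js -> Child n k g r s (sgn j) (ch j)
  child⁺ {j} m = k' (r <? j)
   where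
    m1 = cvs⁻ j (fst (js⁻ m))
    m2 = snd (js⁻ m)
    k' : (d : Dec (r < j)) -> Child n k g r s (sgd? {j} d) (ch j)
    k' (yes l) = OK→ (chOK j (snd m2)) , j , l , fst m1 , refl , cover⁺ j (snd m1) , \e -> fst m2 (ch-inj j s (fst m1) r≁s (e & sym g≡))
    k' (no l) = OK→ (chOK j (snd m2)) , j , j<r j (fst m1) l , (fst m1 ∘ sym) , mulT-sym u0 r j , cover⁺ j (snd m1)

  mem : ∀ σ j -> ¬ r ~ j -> Cov u0 r j -> j ≢ s -> Bd (ch j) -> sgn j ≡ σ -> (σ , ch j) ∈ cs
  mem σ j a b ne bd e = subst (\σ -> (σ , ch j) ∈ cs) e (∈-map⁺ mk'' (∈-filter⁺ ok? (cvs⁺ j a b) (ne , bd)))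

  sgn-> : ∀ j -> r < j -> sgn j ≡ Sign.-
  sgn-> j l = k' (r <? j)
   where
    k' : (d : Dec (r < j)) -> sgd? {j} d ≡ Sign.-
    k' (yes _) = refl
    k' (no h) = absurd (h l)

  sgn-< : ∀ j -> j < r -> sgn j ≡ Sign.+
  sgn-< j l = k' (r <? j)
   where
    k' : (d : Dec (r < j)) -> sgd? {j} d ≡ Sign.+
    k' (yes h) = absurd (Z.<-asym h l)
    k' (no _) = refl

  child⁻ : ∀ σ c -> Child n k g r s σ c -> (σ , c) ∈ cs
  child⁻ Sign.+ c (b , i , l , ne , e , cv) = subst (\c -> (Sign.+ , c) ∈ cs) (sym e') (mem Sign.+ i (ne ∘ sym) (cover⁻ i (subst (Cover n u0) e' cv)) (\e -> Z.<-irrefl e (Z.<-trans l r<s')) (subst Bd e' (oB (→OK b))) (sgn-< i l))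
   where
    e' = e & mulT-sym u0 i r
  child⁻ Sign.- c (b , j , l , ne , e , cv , cg) = subst (\c -> (Sign.- , c) ∈ cs) (sym e) (mem Sign.- j ne (cover⁻ j (subst (Cover n u0) e cv)) (\js -> cg (e & cong ch js & g≡)) (subst Bd e (oB (→OK b))) (sgn-> j l))

  low : ∀ j -> j ∈ js -> Low (ch j)
  low j m = k' (r <? j)
   where
    m1 = cvs⁻ j (fst (js⁻ m))
    m2 = snd (js⁻ m)
    k' : Dec (r < j) -> Low (ch j)
    k' (yes l) = low⁻ j l (fst m1) (snd m1) (fst m2) (snd m2)
    k' (no l) = low⁺ j (j<r j (fst m1) l) (fst m1) (snd m1)

  below : ∀ c -> Low c -> Below r (s - 1z) c
  below c (A , B) r' s' (a , l , b , h) = k' (Z.<-cmp r' r) (s ≤? s')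
   where
    h' : ¬ ev c r' < ev c s'
    h' x = Z.<-asym x (subst2 _<_ (sym (ev≡eval c s')) (sym (ev≡eval c r')) h)
    k' : _ -> Dec (s ≤ s') -> r' < r ⊎ (r' ≡ r × s' ≤ s - 1z)
    k' (Tri.tri< x _ _) _ = inl x
    k' (Tri.tri≈ _ refl _) (yes x) = absurd (h' (B s' x b))
    k' (Tri.tri≈ _ e _) (no x) = inr (e , lia 2 (\x y -> x :< y => |- x =< y :- #1) s' s (Z.≰⇒> x))
    k' (Tri.tri> _ _ x) _ = absurd (h' (A r' s' x l b))

  bd' : Σ (List (List (Sign × Perm n))) \ls -> Pointwise (\sc L -> LSTree n k (snd sc) L) cs ls × All Lf (concat (zipWith sgd cs ls)) × InI n k (\a -> sF cs a - sF (concat (zipWith sgd cs ls)) a)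
  bd' = build cs (AllP.map⁺ (All.tabulate (\ {j} m -> rec (ch j) (chOK j (snd (snd (js⁻ m)))) (below (ch j) (low j m)))))

  -- `nodeLeaves` makes a leaf of a vertex with an empty list of children, so a child has to be
  -- exhibited; `plus-child` supplies one.
  nonempty : ∀ ls -> nodeLeaves n g cs ls ≡ concat (zipWith sgd cs ls)
  nonempty ls = k' cs (let (i , l , ne , cv , b) = plus-child in mem Sign.+ i ne cv (\e -> Z.<-irrefl e (Z.<-trans l r<s')) b (sgn-< i l))
   where
    k' : ∀ cs {x} -> x ∈ cs -> nodeLeaves n g cs ls ≡ concat (zipWith sgd cs ls)
    k' (_ ∷ _) _ = refl

  X1 : Vec ℕ k -> ℤ -> ℤ
  X1 a j = sgz (sgn j) * Fk a (ch j)

  badΣ : Vec ℕ k -> ℤ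
  badΣ a = ΣL cvs (\j -> on (bad? j) (X1 a j))

  -- The vanishing of D at `v0`, solved for the term j = s, which is g itself. Covers with j > r
  -- have sign + in D, as g does, so they move to the other side with -, the label of their edges.
  expand : ∀ a -> Fk a g ≡ sF cs a + badΣ a
  expand a = lia 3 (\f x y -> f :- (x :+ y) := #0 => |- f := x :+ y) (Fk a g) (sF cs a) (badΣ a)
   (sym (Σ-cong∈ cvs (\j m -> each j m (j ≟ s) (Bd-dec (ch j))) & (Σ-+ cvs (\j -> on (j ≟ s) (Fk a (ch j))) _) &
    (cong2 _+_ (Σ-at cvs (covs-unique v0 r) s (\j -> Fk a (ch j)) (cvs⁺ s r≁s cov-rs) & cong (Fk a) g≡)
     ((Σ-neg cvs _) & cong (\z -> - z) ((Σ-+ cvs (\j -> on (ok? j) (X1 a j)) _) & cong (_+ badΣ a) (sym (Σ-filter ok? cvs (X1 a)) & sym (Σ-map mk'' js _)))))) &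
    D-Fr (toList a) r v0 v0A)
   where
    φ' = Fr (toList a)
    opp : ∀ j -> ¬ r ~ j -> Dec (r < j) -> ori r j * Fk a (ch j) ≡ - X1 a j
    opp j h (yes l) = cong (_* Fk a (ch j)) (ori-< r j l) & m1 (Fk a (ch j)) & cong (\σ -> - (sgz σ * Fk a (ch j))) (sym (sgn-> j l))
     where
      m1 : ∀ x -> 1z * x ≡ - (-[1+ 0 ] * x)
      m1 = ring
    opp j h (no l) = cong (_* Fk a (ch j)) (ori-> r j (j<r j h l)) & m1 (Fk a (ch j)) & cong (\σ -> - (sgz σ * Fk a (ch j))) (sym (sgn-< j (j<r j h l)))
     where
      m1 : ∀ x -> -[1+ 0 ] * x ≡ - (1z * x)
      m1 = ring
    asm : ∀ j {x y z w} -> on (j ≟ s) (Fk a (ch j)) ≡ x -> on (ok? j) (X1 a j) ≡ y -> on (bad? j) (X1 a j) ≡ z -> w ≡ x + - (y + z) -> w ≡ on (j ≟ s) (Fk a (ch j)) + - (on (ok? j) (X1 a j) + on (bad? j) (X1 a j))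
    asm j refl refl refl e = e
    each : ∀ j -> j ∈ cvs -> Dec (j ≡ s) -> Dec (Bd (ch j)) -> ori r j * φ' (mulT n v0 r j) ≡ on (j ≟ s) (Fk a (ch j)) + - (on (ok? j) (X1 a j) + on (bad? j) (X1 a j))
    each j m (yes refl) _ = asm j (on-yes (j ≟ s) refl _) (on-no (ok? j) (\(h , _) -> h refl) _) (on-no (bad? j) (\(h , _) -> h refl) _)
     ((cong2 _*_ (ori-< r j r<s') (cong φ' (sym (mulT-shift (+ k) u0 r j)))) & (Z.*-identityˡ _) & sym (+0 _))
    each j m (no ne) (yes b) = asm j (on-no (j ≟ s) ne _) (on-yes (ok? j) (ne , b) _) (on-no (bad? j) (\(_ , h) -> h b) _)
     (cong (\c -> ori r j * φ' c) (sym (mulT-shift (+ k) u0 r j)) & opp j (fst (cvs⁻ j m)) (r <? j) & cong (\z -> - z) (sym (+0 (X1 a j))) & sym (0+ _))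
    each j m (no ne) (no b) = asm j (on-no (j ≟ s) ne _) (on-no (ok? j) (\(_ , h) -> b h) _) (on-yes (bad? j) (ne , b) _)
     (cong (\c -> ori r j * φ' c) (sym (mulT-shift (+ k) u0 r j)) & opp j (fst (cvs⁻ j m)) (r <? j) & cong (\z -> - z) (sym (0+ (X1 a j))) & sym (0+ _))

  step-Res : Res g
  step-Res = let (ls , pw' , al , i) = bd' in concat (zipWith sgd cs ls) ,
   node (iv , mx) cs cs-unique (\σ c -> (\m -> let (j , j∈ , e) = ∈-map⁻ mk'' m in subst (\sc -> Child n k g r s (fst sc) (snd sc)) (sym e) (child⁺ j∈)) , child⁻ σ c) ls pw' (sym (nonempty ls)) , al ,
   II-ext (\a -> cong (_- sF (concat (zipWith sgd cs ls)) a) (expand a) & (l (sF cs a) (badΣ a) _)) (II-+ i (II-Σ cvs (\j _ -> II-on (bad? j) (\(_ , nb) -> II-* (sgz (sgn j)) (unbounded (chA j) nb)))))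
   where
    l : ∀ x y z -> x + y - z ≡ (x - z) + y
    l = ring

 -- (R, S) runs down the pairs in lexicographic order; the first one that is an
 -- inversion is the maximal inversion.
 tree : (R S : ℕ) -> ∀ g -> OK g -> Below (+ R) (+ S) g -> Res g
 tree zero S g o h = leaf-Res o (\r s iv -> k' r s (fst iv) (h r s iv))
  where
   k' : ∀ r s -> 1z ≤ r -> r < 0z ⊎ (r ≡ 0z × s ≤ + S) -> ⊥
   k' r s a (inl b) = Z.<⇒≱ (Z.<-trans b (ℤ.+<+ (s≤s z≤n))) a
   k' r s a (inr (refl , _)) = Z.<⇒≱ (ℤ.+<+ (s≤s z≤n)) a
 -- No inversion ends at 0 or below, so the search continues with the previous R and the largest
 -- second entry, n.
 tree (suc R) zero g o h = tree R n g o (\r s iv -> k' r s iv (h r s iv) (r ≟ + R))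
  where
   k' : ∀ r s -> Inv1 n g r s -> r < + suc R ⊎ (r ≡ + suc R × s ≤ 0z) -> Dec (r ≡ + R) -> r < + R ⊎ (r ≡ + R × s ≤ N)
   k' r s iv (inl a) (yes e) = inr (e , fst (snd (snd iv)))
   k' r s iv (inl a) (no ne) = inl (Z.≤∧≢⇒< (lia 2 (\x y -> x :< #1 :+ y => |- x =< y) r (+ R) a) ne)
   k' r s iv (inr (e , b)) _ = absurd (Z.<⇒≱ (lia 2 (\r s -> #1 =< r => r :< s => |- #0 :< s) r s (fst iv) (fst (snd iv))) b)
 tree (suc R) (suc S) g o h = k' ((1z ≤? + suc R) ×-dec ((+ suc R <? + suc S) ×-dec ((+ suc S ≤? N) ×-dec (eval n g (+ suc S) <? eval n g (+ suc R))))) (tree (suc R) S)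
  where
   k' : Dec (Inv1 n g (+ suc R) (+ suc S)) -> (∀ c -> OK c -> Below (+ suc R) (+ S) c -> Res c) -> Res g
   k' (yes iv) rec = Step.step-Res o (+ suc R) (+ suc S) iv h rec
   k' (no ni) rec = rec g o (\r s iv -> k2 r s iv (h r s iv) (s ≟ + suc S))
    where
     k2 : ∀ r s -> Inv1 n g r s -> r < + suc R ⊎ (r ≡ + suc R × s ≤ + suc S) -> Dec (s ≡ + suc S) -> r < + suc R ⊎ (r ≡ + suc R × s ≤ + S)
     k2 r s iv (inl a) _ = inl a
     k2 r s iv (inr (refl , b)) (yes refl) = absurd (ni iv)
     k2 r s iv (inr (e , b)) (no ne) = inr (e , lia 2 (\x y -> x :< #1 :+ y => |- x =< y) s (+ S) (Z.≤∧≢⇒< b ne))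

 Kostka-sum : ∀ (K : List ℕ -> Vec ℕ k -> ℕ) -> (∀ μ a -> Kostka k μ a (K μ a)) -> ∀ L -> All Lf L -> ∀ a -> signedKostkaSum n K L a ≡ sF L a
 Kostka-sum K h [] _ a = refl
 Kostka-sum K h ((σ , g) ∷ L) ((z , o) ∷ al) a = cong2 _+_ ((◃-sgz σ _) & cong (sgz σ *_) (leaf-Kostka (oA o) (oB o) (oE o) z a _ (h (lam n k g) a))) (Kostka-sum K h L al a)

 main-sum : (f : Perm n) -> IsBound n k f ->
  Σ (List (Sign × Perm n)) \L -> LSTree n k f L × All (\sg -> ZeroGrass n (snd sg)) L
  × ((cG : Vec ℕ k -> ℕ) -> (∀ a -> GCoeff n k f a (cG a)) -> (K : List ℕ -> Vec ℕ k -> ℕ) -> (∀ μ a -> Kostka k μ a (K μ a)) ->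
   InI n k (\a -> + cG a - signedKostkaSum n K L a))
 main-sum f b = L , T , All.map fst al , \cG hG K hK -> II-ext (\a -> cong2 _-_ (GCoeff-Fr k (oA o) (exceed-tot (oA o) (oB o) & cong (\e -> tot-id + + e * N) (oE o)) a (cG a) (hG a)) (Kostka-sum K hK L al a)) i
  where
   o = →OK b
   res = tree n n f o (\r s iv -> inl (Z.<-≤-trans (fst (snd iv)) (fst (snd (snd iv)))))
   L = fst res
   T = fst (snd res)
   al = fst (snd (snd res))
   i = snd (snd (snd res))

-- For n = 1 every affine permutation is a translation.

module One where
 open Aff 1

 idP1 : Perm 1
 idP1 = idP 1

 no-inv : ∀ (f : Perm 1) p -> ¬ InvPair 1 f p
 no-inv f (i , j) (_ , _ , l , h) = Z.<-asym (subst2 _<_ (sym (ev≡eval f j)) (sym (ev≡eval f i)) h)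
  (subst (ev f i <_) (sym (cong (ev f) e & ev-per f i (j - i))) (lia 4 (\x i j m -> i :< j => m := j :- i => |- x :< x :+ m) (ev f i) i j ((j - i) * + 1) l (Z.*-identityʳ (j - i))))
  where
   e : j ≡ i + (j - i) * + 1
   e = lia 2 (\i j -> |- j := i :+ (j :- i)) i j & cong (_+_ i) (sym (Z.*-identityʳ (j - i)))

 Len-0 : ∀ (f : Perm 1) -> Len 1 f 0
 Len-0 f = [] , [] , (\p -> (\()) , \h -> absurd (no-inv f p h)) , refl

 fin1 : ∀ (x y : Fin 1) -> x ≡ y
 fin1 Fin.zero Fin.zero = refl

 elem-id : ∀ g -> CycDecElem 1 g -> g ≡ idP1
 elem-id g ([] , _ , e) = sym e
 elem-id g (x ∷ w , (_ , h) , e) = absurd (M.<-irrefl refl (h Fin.zero Fin.zero (fin1 x (nextFin 1 x))))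

 prod-id : ∀ k -> foldr (compose 1) idP1 (toList (Vec.replicate k idP1)) ≡ idP1
 prod-id zero = refl
 prod-id (suc k) = cong (compose 1 idP1) (prod-id k)

 sum-0 : ∀ {k} (a : Vec ℕ k) -> (∀ i -> 0 ≡ lookup a i) -> Vec.sum a ≡ 0
 sum-0 [] h = refl
 sum-0 (x ∷ a) h = cong2 N._+_ (sym (h Fin.zero)) (sum-0 a (h ∘ Fin.suc))

 shift-id : ∀ (f : Perm 1) -> Σ ℤ \m -> shift 1 m f ≡ idP1
 shift-id (x ∷ []) = x - 1z , cong (_∷ []) (l x)
  where
   l : ∀ x -> x - (x - 1z) ≡ 1z
   l = ring

 all-id : ∀ {k} (fs : Vec (Perm 1) k) -> (∀ i -> lookup fs i ≡ idP1) -> fs ≡ Vec.replicate k idP1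
 all-id [] h = refl
 all-id (x ∷ fs) h = cong2 _∷_ (h Fin.zero) (all-id fs (h ∘ Fin.suc))

 -- Both sides count solutions with all exponents zero: only the identity is cyclically decreasing,
 -- and the only tableau is a single empty row.
 counts-agree : ∀ {k} (f : Perm 1) (a : Vec ℕ k) m m' -> GCoeff 1 k f a m -> Kostka k [ 0 ] a m' -> m ≡ m'
 counts-agree {k} f a m m' hG hK = hc-unique hG (hc-bij (\_ -> Vec.replicate k idP1) (\_ -> [] ∷ []) fwd bwd hK)
  where
   fwd : ∀ T -> SSYT k [ 0 ] T × Content k T a -> Fact 1 k f a (Vec.replicate k idP1) × ([] ∷ []) ≡ T
   fwd ([] ∷ []) ((_ , _) , ct) = ((\i -> subst (CycDecElem 1) (sym (VecP.lookup-replicate i idP1)) ([] , ([] , (\())) , refl) , subst2 (Len 1) (sym (VecP.lookup-replicate i idP1)) (ct i) (Len-0 idP1)) ,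
    (fst (shift-id f) , ([] , sym (snd (shift-id f))) , prod-id k & sym (snd (shift-id f))) , subst (Len 1 f) (sym (sum-0 a ct)) (Len-0 f)) , refl
   fwd [] ((() , _) , _)
   fwd ((_ ∷ _) ∷ _) ((() , _) , _)
   fwd (_ ∷ _ ∷ _) ((() , _) , _)
   bwd : ∀ fs -> Fact 1 k f a fs -> (SSYT k [ 0 ] ([] ∷ []) × Content k ([] ∷ []) a) × Vec.replicate k idP1 ≡ fs
   bwd fs (h , _) = ((refl , Linked.[] ∷ [] , (\ { zero c x y () ; (suc r) c x y () })) , (\i -> sym (hc-unique (snd (h i)) (Len-0 (lookup fs i))))) , sym (all-id fs (\i -> elem-id _ (fst (h i))))

theorem3p9 : (n k : ℕ) {{nz : NonZero n}} → k ℕ.≤ n → (f : Perm n) → IsBound n k f →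
 Σ (List (Sign × Perm n)) λ L →
 LSTree n k f L
 × All (λ sg → ZeroGrass n (proj₂ sg)) L
 × ((cG : Vec ℕ k → ℕ) → (∀ a → GCoeff n k f a (cG a)) →
 (K : List ℕ → Vec ℕ k → ℕ) → (∀ μ a → Kostka k μ a (K μ a)) →
 Σ (List (ℕ × Poly k)) λ W →
 All (λ dc → (n ℕ.∸ k ℕ.< proj₁ dc) × Symmetric (proj₂ dc)) W
 × (∀ a → + cG a - signedKostkaSum n K L a ≡ coeff (idealSum W) a))
-- For n = 1 the residues of i and i + 1 coincide and the simple reflections degenerate, so the
-- development under 1 < n does not reach this case. The tree is a single leaf with partition (0).
theorem3p9 1 k k≤n f b = [ (Sign.+ , f) ] , leaf zg , zg ∷ [] , \cG hG K hK -> [] , [] , \a ->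
 trans (cong2 _-_ (cong +_ (One.counts-agree f a _ _ (hG a) (hK [ 0 ] a))) ((+0 _) & Z.+◃n≡+n (K [ 0 ] a))) (Z.i≡j⇒i-j≡0 {+ K [ 0 ] a} refl)
 where
  zg : ZeroGrass 1 f
  zg r s (a , l , h , _) = Z.<⇒≱ (Z.≤-<-trans a l) h
theorem3p9 n@(suc (suc m)) k k≤n f b = Final.main-sum n (ℤ.+<+ (s≤s (s≤s z≤n))) k k≤n f b
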